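{- Let $\lambda$ be a partition of $N$ with $\ell$ parts. Among elements of $M_\lambda$ that are symmetric (invariant under all $s_i\otimes s_i$), those homogeneous of the minimal degree at which nonzero such elements exist form a one-dimensional space spanned by $J_{T_1}$; among elements that are antisymmetric ($P(s_i\otimes s_i)=-P$ for all $i$), those homogeneous of the minimal degree at which nonzero such elements exist form a one-dimensional space spanned by $J'_{T_{\det}}$.
   Context: Partitions in French convention (rows numbered $1,\dots,\ell$ from bottom to top, columns from the left). $T_1$ is the filling of shape $\lambda$ in which every box of row $r$ contains $r-1$; $T_{\det}$ is the filling in which every box of column $c$ contains $c-1$. An RST of shape $\lambda$ is a bijective filling with $1,\dots,N$ strictly decreasing along rows (left to right) and columns (bottom to top); $\mathrm{CT}_\tau[i]=c-r$ if $i$ is in column $c$, row $r$; $\tau_\lambda$ fills the columns left to right, each bottom to top, with $N,\dots,1$. For $v\in\mathbb{N}^N$: $v^+$ decreasing rearrangement; $\sigma_v$ labels positions by $1,\dots,N$ in order of decreasing entries, ties left to right; $vs_i$ swaps entries $i,i+1$; $v\Psi=[v[2],\dots,v[N],v[1]+1]$. $\alpha$ indeterminate; $\zeta_{v,\tau}[i]=\alpha v[i]+\mathrm{CT}_\tau[\sigma_v[i]]$. Graph $G_\lambda$: vertices are pairs $(\tau,v)$ reachable from $(\tau_\lambda,0^N)$ plus $\varnothing$; from $(\tau,v)$: edge $\Psi$ to $(\tau,v\Psi)$; edge $s_i$ to $(\tau,vs_i)$ if $v[i]<v[i+1]$; if $v[i]=v[i+1]$ and $\mathrm{CT}_\tau[\sigma_v[i]]-\mathrm{CT}_\tau[\sigma_v[i]+1]\ge2$,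 edge $s_i$ to $(\tau',v)$, $\tau'$ obtained by interchanging $\sigma_v[i],\sigma_v[i]+1$; if $v[i]=v[i+1]$ and this interchange is not an RST, edge $s_i$ to $\varnothing$. $H_\lambda$: remove the $\Psi$-edges, $\varnothing$ and edges into it. For a filling $T$, $H_T$ is the connected component of $H_\lambda$ formed by the vertices $(\tau,v)$ such that replacing each entry $i$ of $\tau$ by $v^+[i]$ gives $T$. $\mathcal{E}$: equal to $1$ at the vertex of $H_T$ without incoming edge, and for an edge $s_i$ of $H_T$ from $(\tau',v')$ to $(\tau,v)$, $\mathcal{E}_{v,\tau}=\frac{\zeta'[i]-\zeta'[i+1]}{\zeta'[i]-\zeta'[i+1]+1}\mathcal{E}_{v',\tau'}$ with $\zeta'=\zeta_{v',\tau'}$; $\mathcal{F}$: equal to $1$ at that vertex, and $\mathcal{F}_{v,\tau}=-\frac{\zeta[i]-\zeta[i+1]}{\zeta[i]-\zeta[i+1]+1}\mathcal{F}_{v',\tau'}$ with $\zeta=\zeta_{v,\tau}$ (both consistently defined). $J_T=\sum_{(\tau,v)\in H_T}\mathcal{E}_{v,\tau}J_{v,\tau}$, $J'_T=\sum_{(\tau,v)\in H_T}\mathcal{F}_{v,\tau}J_{v,\tau}$. $V_\lambda$: $\mathbb{Q}(\alpha)$-space with basis the RSTs of shape $\lambda$, right action: with $b=1/(\mathrm{CT}_\tau[i]-\mathrm{CT}_\tau[i+1])$, $\tau s_i=b\tau$ if $b=\pm1$; $b\tau+\tau^{(i,i+1)}$ if $0<b\le\frac12$; $b\tau+(1-b^2)\tau^{(i,i+1)}$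 otherwise. $M_\lambda=\mathbb{Q}(\alpha)[x_1,\dots,x_N]\otimes V_\lambda$ graded by degree in $x$, operators on the right, $(f\otimes t)(\omega\otimes\omega)=(f\omega)\otimes(t\omega)$; $P\Psi=x_N\cdot(P(\theta\otimes\theta))$, $\theta=s_1\cdots s_{N-1}$. $J_{v,\tau}$: $J_{0^N,\tau_\lambda}=1\otimes\tau_\lambda$, and along edges from $(\tau,v)$: $s_i$-edge to $w$: $J_w=J_{v,\tau}\big(s_i\otimes s_i+\frac1{\zeta_{v,\tau}[i+1]-\zeta_{v,\tau}[i]}\big)$; $\Psi$-edge: $J_{v\Psi,\tau}=J_{v,\tau}\Psi$ (path-independent). -}

module Defs where

open import Data.Nat as Nat using (ℕ; zero; suc; _∸_; _≤ᵇ_; _<ᵇ_; _≡ᵇ_; _<_; _≤_)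
open import Data.Bool using (Bool; true; false; _∧_; _∨_; not; if_then_else_; T)
open import Data.List using (List; []; _∷_; _++_; map; foldr; foldl; concatMap; filterᵇ;
  length; take; drop; replicate; upTo; head; reverse)
open import Data.Nat.ListAction using (sum)
open import Data.List.Properties using (≡-dec)
open import Data.List.Relation.Unary.All using (All; all?)
open import Data.Maybe using (Maybe; just; nothing)
open import Data.Product using (Σ; _×_; _,_; proj₁; proj₂)
open import Relation.Nullary using (¬_; Dec; yes; no; does)
open import Relation.Binary.PropositionalEquality using (_≡_)
import Data.Integer as Z
open Z using (ℤ; +_)
import Data.Rational as Q
open Q using (ℚ; 0ℚ; 1ℚ)

-- polynomials in α over ℚ: list of coefficients, constant term first
Poly : Set
Poly = List ℚ

addP : Poly → Poly → Poly
addP [] q = q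
addP p [] = p
addP (a ∷ p) (b ∷ q) = (a Q.+ b) ∷ addP p q

scaleP : ℚ → Poly → Poly
scaleP a = map (a Q.*_)

mulP : Poly → Poly → Poly
mulP [] q = []
mulP (a ∷ p) q = addP (scaleP a q) (0ℚ ∷ mulP p q)

negP : Poly → Poly
negP = map (λ a → Q.- a)

IsZeroP : Poly → Set
IsZeroP p = All (_≡ 0ℚ) p

isZeroP? : (p : Poly) → Dec (IsZeroP p)
isZeroP? = all? (Q._≟ 0ℚ)

NZPoly : Set
NZPoly = Σ Poly (λ p → ¬ IsZeroP p)

prodNZ : List NZPoly → Poly
prodNZ = foldr (λ q acc → mulP (proj₁ q) acc) (1ℚ ∷ [])

-- an element of ℚ(α): numerator / (product of nonzero denominators)
record K : Set where
  constructor mkK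
  field
    num : Poly
    den : List NZPoly
open K public

_≈K_ : K → K → Set
x ≈K y = IsZeroP (addP (mulP (num x) (prodNZ (den y))) (negP (mulP (num y) (prodNZ (den x)))))

0K 1K αK : K
0K = mkK [] []
1K = mkK (1ℚ ∷ []) []
αK = mkK (0ℚ ∷ 1ℚ ∷ []) []

fromℚ : ℚ → K
fromℚ q = mkK (q ∷ []) []

fromℤ : ℤ → K
fromℤ z = fromℚ (z Q./ 1)

fromℕ : ℕ → K
fromℕ n = fromℤ (+ n)

_+K_ : K → K → K
x +K y = mkK (addP (mulP (num x) (prodNZ (den y))) (mulP (num y) (prodNZ (den x)))) (den x ++ den y)

_*K_ : K → K → K
x *K y = mkK (mulP (num x) (num y)) (den x ++ den y)

-K_ : K → K
-K x = mkK (negP (num x)) (den x)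

_-K_ : K → K → K
x -K y = x +K (-K y)

-- inverse (with the convention 0⁻¹ = 0; only ever applied to nonzero elements)
invK : K → K
invK x with isZeroP? (num x)
... | yes _ = 0K
... | no nz = mkK (prodNZ (den x)) ((num x , nz) ∷ [])

infixl 6 _+K_ _-K_
infixl 7 _*K_
infix 4 _≈K_

-- list helpers (vectors in ℕ^N are lists of length N, indexed from 1)

idx0 : List ℕ → ℕ → ℕ
idx0 [] _ = 0
idx0 (x ∷ _) zero = x
idx0 (_ ∷ xs) (suc k) = idx0 xs k

at : List ℕ → ℕ → ℕ
at v i = idx0 v (i ∸ 1)

swap0 : {A : Set} → List A → ℕ → List A
swap0 (x ∷ y ∷ xs) zero = y ∷ x ∷ xs
swap0 (x ∷ xs) (suc k) = x ∷ swap0 xs k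
swap0 xs _ = xs

swapV : {A : Set} → List A → ℕ → List A
swapV v i = swap0 v (i ∸ 1)

incAt0 : List ℕ → ℕ → List ℕ
incAt0 [] _ = []
incAt0 (x ∷ xs) zero = suc x ∷ xs
incAt0 (x ∷ xs) (suc k) = x ∷ incAt0 xs k

count : ℕ → List ℕ → ℕ
count r xs = length (filterᵇ (λ y → r ≡ᵇ y) xs)

eqL : List ℕ → List ℕ → Bool
eqL a b = does (≡-dec Nat._≟_ a b)

oneTo : ℕ → List ℕ
oneTo n = map suc (upTo n)

IsPartition : List ℕ → Set
IsPartition lam = All (λ p → 0 < p) lam × Decreasing lam
  where
  Decreasing : List ℕ → Set
  Decreasing [] = ⊤'
    where open import Data.Unit using () renaming (⊤ to ⊤')
  Decreasing (a ∷ []) = ⊤'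
    where open import Data.Unit using () renaming (⊤ to ⊤')
  Decreasing (a ∷ b ∷ xs) = (b ≤ a) × Decreasing (b ∷ xs)

-- Reverse standard tableaux.
-- An RST τ of shape λ (French convention) is encoded by the word
-- w = w₀ w₁ … w_{N-1} where w_k is the (0-based) row index of the entry N - k.
-- (Entries N, N-1, …, 1 are placed successively; the cells containing
-- N, …, N-k+1 always form a partition.)

Word : Set
Word = List ℕ

stepOK : List ℕ → List ℕ → ℕ → Bool
stepOK lam mu r =
  (r <ᵇ length lam) ∧ (idx0 mu r <ᵇ idx0 lam r) ∧
  ((r ≡ᵇ 0) ∨ (idx0 mu r <ᵇ idx0 mu (r ∸ 1)))

validFrom : List ℕ → List ℕ → Word → Bool
validFrom lam mu [] = eqL mu lam
validFrom lam mu (r ∷ w) = stepOK lam mu r ∧ validFrom lam (incAt0 mu r) w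

isRST : List ℕ → Word → Bool
isRST lam w = validFrom lam (replicate (length lam) 0) w

allWords : ℕ → ℕ → List Word
allWords l zero = [] ∷ []
allWords l (suc n) = concatMap (λ r → map (r ∷_) (allWords l n)) (upTo l)

rsts : List ℕ → List Word
rsts lam = filterᵇ (isRST lam) (allWords (length lam) (sum lam))

rowOf : Word → ℕ → ℕ
rowOf w a = suc (idx0 w (length w ∸ a))

colOf : Word → ℕ → ℕ
colOf w a = count (idx0 w (length w ∸ a)) (take (suc (length w ∸ a)) w)

CT : Word → ℕ → ℤ
CT w a = + colOf w a Z.- + rowOf w a

swapEntries : Word → ℕ → Word
swapEntries w a = swap0 w (length w ∸ a ∸ 1)

-- τ_λ : columns filled left to right, each bottom to top, with N, …, 1
tauLam : List ℕ → Word
tauLam lam = concatMap (λ c → filterᵇ (λ r → c ≤ᵇ idx0 lam r) (upTo (length lam)))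
                       (oneTo (idx0 lam 0))

-- the right action of s_i on V_λ : τ s_i as a linear combination of RSTs
actTab : Word → ℕ → List (K × Word)
actTab w i =
  let d = CT w i Z.- CT w (suc i)
      b = invK (fromℤ d)
  in if (Z.∣ d ∣ ≡ᵇ 1) then ((b , w) ∷ [])
     else if (+ 2 Z.≤ᵇ d) then ((b , w) ∷ (1K , swapEntries w i) ∷ [])
     else ((b , w) ∷ ((1K -K (b *K b)) , swapEntries w i) ∷ [])

-- M_λ = ℚ(α)[x₁,…,x_N] ⊗ V_λ, elements as finite formal sums of
-- coef · x^expo ⊗ tab

record Term : Set where
  constructor term
  field
    coef : K
    expo : List ℕ
    tab  : Word
open Term public

M : Set
M = List Term

coeffM : M → List ℕ → Word → K
coeffM P m w = foldr (λ t acc → if (eqL (expo t) m ∧ eqL (tab t) w) then coef t +K acc else acc) 0K P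

_≈M_ : M → M → Set
P ≈M Q = ∀ m w → coeffM P m w ≈K coeffM Q m w
infix 4 _≈M_

InM : List ℕ → M → Set
InM lam P = All (λ t → (length (expo t) ≡ sum lam) × (isRST lam (tab t) ≡ true)) P

Homogeneous : ℕ → M → Set
Homogeneous d P = ∀ m w → ¬ (sum m ≡ d) → coeffM P m w ≈K 0K

scaleM : K → M → M
scaleM c = map (λ t → term (c *K coef t) (expo t) (tab t))

negM : M → M
negM = scaleM (-K 1K)

actS : ℕ → M → M
actS i = concatMap (λ t → map (λ qw → term (coef t *K proj₁ qw) (swapV (expo t) i) (proj₂ qw))
                              (actTab (tab t) i))

Symmetric : ℕ → M → Set
Symmetric N P = ∀ i → 1 ≤ i → i < N → actS i P ≈M P

Antisymmetric : ℕ → M → Set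
Antisymmetric N P = ∀ i → 1 ≤ i → i < N → actS i P ≈M negM P

PsiM : ℕ → M → M
PsiM N P = map (λ t → term (coef t) (incAt0 (expo t) (N ∸ 1)) (tab t))
               (foldl (λ acc j → actS j acc) P (oneTo (N ∸ 1)))

sigma : List ℕ → ℕ → ℕ
sigma v i = suc (length (filterᵇ (λ y → at v i <ᵇ y) v)
                 + count (at v i) (take (i ∸ 1) v))
  where open Nat using (_+_)

insertDesc : ℕ → List ℕ → List ℕ
insertDesc x [] = x ∷ []
insertDesc x (y ∷ ys) = if (y ≤ᵇ x) then x ∷ y ∷ ys else y ∷ insertDesc x ys

vplus : List ℕ → List ℕ
vplus = foldr insertDesc []

vPsi : List ℕ → List ℕ
vPsi [] = []
vPsi (x ∷ xs) = xs ++ (suc x ∷ [])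

zeta : Word → List ℕ → ℕ → K
zeta w v i = αK *K fromℕ (at v i) +K fromℤ (CT w (sigma v i))

-- The graph G_λ (edges to ∅ are irrelevant and omitted)

Key : Set
Key = Word × List ℕ

eqKey : Key → Key → Bool
eqKey (w , v) (w' , v') = eqL w w' ∧ eqL v v'

-- target of the s_i-edge out of (τ,v), if it is a vertex (not ∅)
edge : Key → ℕ → Maybe Key
edge (w , v) i =
  if (at v i <ᵇ at v (suc i)) then just (w , swapV v i)
  else if (at v i ≡ᵇ at v (suc i)) ∧ (+ 2 Z.≤ᵇ (CT w (sigma v i) Z.- CT w (suc (sigma v i))))
       then just (swapEntries w (sigma v i) , v)
       else nothing

edgeTo : Key → ℕ → Key → Bool
edgeTo k i k' with edge k i
... | just k'' = eqKey k'' k'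
... | nothing = false

record Vtx : Set where
  constructor vtx
  field
    vkey : Key
    vJ   : M
open Vtx public

vw : Vtx → Word
vw u = proj₁ (vkey u)
vv : Vtx → List ℕ
vv u = proj₂ (vkey u)

memKey : Key → List Vtx → Bool
memKey k = foldr (λ u b → eqKey (vkey u) k ∨ b) false

Jstep : Vtx → ℕ → M
Jstep u i = actS i (vJ u) ++
            scaleM (invK (zeta (vw u) (vv u) (suc i) -K zeta (vw u) (vv u) i)) (vJ u)

tryAdd : Vtx → List Vtx → ℕ → List Vtx
tryAdd u acc i with edge (vkey u) i
... | nothing = acc
... | just k = if memKey k acc then acc else acc ++ (vtx k (Jstep u i) ∷ [])

closeRound : ℕ → List Vtx → List Vtx
closeRound N vs = foldl (λ acc u → foldl (tryAdd u) acc (oneTo (N ∸ 1))) vs vs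

closeFuel : ℕ → ℕ → List Vtx → List Vtx
closeFuel N zero vs = vs
closeFuel N (suc f) vs = closeFuel N f (closeRound N vs)

-- all vertices (τ,v) of G_λ with |v| = k, together with J_{v,τ}
-- (level k+1 = closure under s_i-edges of the Ψ-image of level k;
--  the fuel bounds the number of candidate vertices at that level)
level : List ℕ → ℕ → List Vtx
level lam zero =
  closeFuel (sum lam) (length (rsts lam))
    (vtx (tauLam lam , replicate (sum lam) 0)
         (term 1K (replicate (sum lam) 0) (tauLam lam) ∷ []) ∷ [])
level lam (suc k) =
  closeFuel (sum lam) (length (rsts lam) Nat.* (suc (suc k) Nat.^ sum lam))
    (map (λ u → vtx (vw u , vPsi (vv u)) (PsiM (sum lam) (vJ u))) (level lam k))

-- a filling of shape λ: entry in row r, column c (both 1-based)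
Filling : Set
Filling = ℕ → ℕ → ℕ

T1 : Filling
T1 r c = r ∸ 1

Tdet : Filling
Tdet r c = c ∸ 1

degFilling : List ℕ → Filling → ℕ
degFilling lam T = sum (concatMap (λ r → map (T r) (oneTo (at lam r))) (oneTo (length lam)))

labelOK : Filling → Key → Bool
labelOK T (w , v) =
  foldr (λ i b → (at (vplus v) i ≡ᵇ T (rowOf w i) (colOf w i)) ∧ b) true (oneTo (length w))

HT : List ℕ → Filling → List Vtx
HT lam T = filterᵇ (λ u → labelOK T (vkey u)) (level lam (degFilling lam T))

anyL : {A : Set} → (A → Bool) → List A → Bool
anyL p = foldr (λ x b → p x ∨ b) false

sourceOf : ℕ → List Vtx → Maybe Vtx
sourceOf N hv =
  foldr (λ s r → if anyL (λ u → anyL (λ i → edgeTo (vkey u) i (vkey s)) (oneTo (N ∸ 1))) hv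
                 then r else just s) nothing hv

-- an edge factor: given the s_i edge from u to t, coefficient(t) = factor · coefficient(u)
Factor : Set
Factor = Vtx → ℕ → Vtx → K

factorE : Factor
factorE u i t = let d = zeta (vw u) (vv u) i -K zeta (vw u) (vv u) (suc i) in d *K invK (d +K 1K)

factorF : Factor
factorF u i t = let d = zeta (vw t) (vv t) i -K zeta (vw t) (vv t) (suc i) in -K (d *K invK (d +K 1K))

lookupVal : Key → List (Vtx × K) → Maybe K
lookupVal k = foldr (λ p r → if eqKey (vkey (proj₁ p)) k then just (proj₂ p) else r) nothing

firstJust : {A : Set} → List (Maybe A) → Maybe A
firstJust [] = nothing
firstJust (just a ∷ _) = just a
firstJust (nothing ∷ xs) = firstJust xs

findVal : ℕ → Factor → List Vtx → List (Vtx × K) → Vtx → Maybe K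
findVal N f hv acc t =
  firstJust (concatMap (λ u → concatMap (λ i →
      fwd u i ∷ bwd u i ∷ []) (oneTo (N ∸ 1))) hv)
  where
  fwd : Vtx → ℕ → Maybe K
  fwd u i with edgeTo (vkey u) i (vkey t) | lookupVal (vkey u) acc
  ... | true | just e = just (f u i t *K e)
  ... | _ | _ = nothing
  bwd : Vtx → ℕ → Maybe K
  bwd u i with edgeTo (vkey t) i (vkey u) | lookupVal (vkey u) acc
  ... | true | just e = just (invK (f t i u) *K e)
  ... | _ | _ = nothing

propRound : ℕ → Factor → List Vtx → List (Vtx × K) → List (Vtx × K)
propRound N f hv acc0 = foldl step acc0 hv
  where
  step : List (Vtx × K) → Vtx → List (Vtx × K)
  step acc t with lookupVal (vkey t) acc
  ... | just _ = acc
  ... | nothing with findVal N f hv acc t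
  ...   | just e = acc ++ ((t , e) ∷ [])
  ...   | nothing = acc

propFuel : ℕ → Factor → List Vtx → ℕ → List (Vtx × K) → List (Vtx × K)
propFuel N f hv zero acc = acc
propFuel N f hv (suc n) acc = propFuel N f hv n (propRound N f hv acc)

coeffs : List ℕ → Factor → Filling → List (Vtx × K)
coeffs lam f T with sourceOf (sum lam) (HT lam T)
... | nothing = []
... | just s = propFuel (sum lam) f (HT lam T) (length (HT lam T)) ((s , 1K) ∷ [])

JTwith : List ℕ → Factor → Filling → M
JTwith lam f T = concatMap (λ p → scaleM (proj₂ p) (vJ (proj₁ p))) (coeffs lam f T)

JT : List ℕ → Filling → M
JT lam T = JTwith lam factorE T

J'T : List ℕ → Filling → M
J'T lam T = JTwith lam factorF T

{-# OPTIONS --safe #-}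
-- An element of M_λ is a family of coefficients f(m, t) indexed by an exponent m ∈ ℕ^N and a tableau t.
-- An invariant (ε = 1) or anti-invariant (ε = −1) f is determined by its values at decreasing m, and at
-- those by the tableaux whose row indices are monotone within every block of equal exponents of m.  For
-- such a tableau the box in row r and column c carries an exponent ≥ T₁ (resp. ≥ T_det), so f vanishes
-- below the degree of T, and in that degree it is determined by the single coefficient whose exponents are T.
--
-- Conversely, J_T is ε-invariant: all vertices of H_T share one tableau τ, and v runs through all
-- rearrangements of T.  Path independence of the J_{v,τ} (the intertwining relations) shows that s_i
-- preserves the span of J_v and J_{v s_i}; the coefficient 𝓔 or 𝓕 is a product over the inversions of v
-- that makes each of these pairs ε-invariant, while for v[i] = v[i+1] the vector J_v itself is ε-invariant
-- since the corresponding boxes are adjacent in τ.  J_T ≠ 0 because at α = ∞ every J_{v,τ} degenerates to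
-- x^v ⊗ t with t ≠ 0, and the coefficients stay regular there, with that of the increasing v equal to 1.
module Submission where

open import Defs
open import Algebra.Bundles using (CommutativeRing; RawRing)
open import Algebra.Structures using (IsCommutativeRing)
open import Algebra.Solver.Ring.AlmostCommutativeRing using (fromCommutativeRing; _-Raw-AlmostCommutative⟶_)
import Algebra.Solver.Ring
import Algebra.Properties.Ring
import Algebra.Properties.Semiring.Mult
open import Data.Nat using (ℕ; zero; suc; _+_; _*_; _∸_; _^_; _≤_; _<_; z≤n; s≤s; _≤ᵇ_; _<ᵇ_; _≡ᵇ_)
import Data.Nat as ℕ
import Data.Nat.Properties as ℕₚ
open import Data.Integer using (ℤ; +_; -[1+_]; _⊖_)
import Data.Integer as ℤ
import Data.Integer.Properties as ℤₚ
open import Data.Rational using (ℚ; 0ℚ; 1ℚ)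
import Data.Rational as ℚ
import Data.Rational.Properties as ℚₚ
import Data.Rational.Unnormalised as ℚᵘ
import Data.Rational.Unnormalised.Properties as ℚᵘₚ
open import Data.List using (List; []; _∷_; _++_; map; foldr; foldl; length; reverse; replicate; take; concatMap; filterᵇ; upTo; applyUpTo; initLast; _∷ʳ′_; _ʳ++_)
open import Data.List.Relation.Unary.All using (All; []; _∷_)
open import Data.Product using (∃; _×_; _,_; proj₁; proj₂; ∃-syntax)
open import Data.Sum using (_⊎_; inj₁; inj₂)
open import Data.Empty using (⊥; ⊥-elim)
open import Data.Maybe using (Maybe; just; nothing)
open import Function using (_∘_; id; _$_)
open import Level using (0ℓ)
open import Relation.Nullary using (¬_; Dec; yes; no)
open import Relation.Binary.PropositionalEquality using (_≡_; _≢_; refl; sym; trans; cong; cong₂; subst; subst₂; module ≡-Reasoning)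
import Relation.Binary.Reasoning.Setoid as SetoidReasoning
open import Data.Bool using (Bool; true; false; _∧_; _∨_; if_then_else_; T)
open import Data.Unit using (⊤; tt)
open import Data.Nat.ListAction using (sum)
import Data.List.Properties as Listₚ
open import Data.Nat.Tactic.RingSolver using (solve-∀)
open import Relation.Binary.Definitions using (Tri; tri<; tri≈; tri>)
open import Data.Nat.Induction using (<-wellFounded)
open import Induction.WellFounded using (Acc; acc)
open import Data.List.Relation.Unary.Any using (Any; here; there)
open import Data.List.Membership.Propositional using (_∈_)
import Data.List.Membership.Propositional.Properties as Memₚ
import Data.List.Relation.Unary.All as All
import Data.List.Relation.Unary.All.Properties as Allₚ
import Data.List.Relation.Unary.Any as Any
open import Data.List.Relation.Unary.AllPairs using (AllPairs; []; _∷_)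
open import Data.List.Relation.Unary.Linked using (Linked; []; [-]; _∷_)
open import Data.List.Relation.Unary.Linked.Properties using (Linked⇒AllPairs)
import Data.List.Relation.Unary.Any.Properties as Anyₚ
import Data.List.Relation.Unary.AllPairs.Properties as AllPairsₚ

-- The vectors J_{v,τ} are produced by a graph search with fuel, so nothing about them holds by
-- construction. The function `J` therefore fixes one path to each (τ, v), and all other edges are
-- compared with it; the inputs are the braid and Yang-Baxter relations and the laws for moving the
-- operators of the edges through Ψ and through Ψ². Separately, the search is shown to return these
-- vectors and to find every vertex that is needed. Degenerate positions (two entries in one row or
-- column, edges to ∅) need no algebra of their own: the off-diagonal coefficient `κ` vanishes there
-- and J at ∅ is set to 0, so the generic identities stay true. The place α = ∞ is chosen because
-- 1/(αn + c) vanishes there for n ≠ 0. An edge between different values then acts to leading order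
-- as a mere s ⊗ s, and the summands of J_T receive different leading monomials. Tableaux are
-- handled as reversed words: the tail of a list then holds the larger entries, whose boxes form a
-- smaller partition, and statements about tableaux become recursions on lists.

-- Ring identities with integer constants

module IntegerSolver {c ℓ} (R : CommutativeRing c ℓ) where
  private
    module R = CommutativeRing R
    open Algebra.Properties.Semiring.Mult R.semiring using (×-homo-+; ×1-homo-*; ×-congˡ) renaming (_×_ to _·_)
    open Algebra.Properties.Ring R.ring using (-‿distribˡ-*; -‿distribʳ-*; -0#≈0#; -‿involutive; -‿+-comm)
    open SetoidReasoning R.setoid

  ⟦_⟧ℤ : ℤ → R.Carrier
  ⟦ + n ⟧ℤ = n · R.1#
  ⟦ -[1+ n ] ⟧ℤ = R.- (suc n · R.1#)

  private
    cancel-suc : ∀ a b → (R.1# R.+ a) R.+ (R.- (R.1# R.+ b)) R.≈ a R.+ (R.- b)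
    cancel-suc a b = begin
      (R.1# R.+ a) R.+ (R.- (R.1# R.+ b)) ≈⟨ R.+-cong (R.+-comm _ _) (R.sym (-‿+-comm _ _)) ⟩
      (a R.+ R.1#) R.+ ((R.- R.1#) R.+ (R.- b)) ≈⟨ R.+-assoc _ _ _ ⟩
      a R.+ (R.1# R.+ ((R.- R.1#) R.+ (R.- b))) ≈⟨ R.+-congˡ (R.sym (R.+-assoc _ _ _)) ⟩
      a R.+ ((R.1# R.+ (R.- R.1#)) R.+ (R.- b)) ≈⟨ R.+-congˡ (R.+-congʳ (R.-‿inverseʳ _)) ⟩
      a R.+ (R.0# R.+ (R.- b)) ≈⟨ R.+-congˡ (R.+-identityˡ _) ⟩
      a R.+ (R.- b) ∎

    ⊖-homo : ∀ m n → ⟦ m ⊖ n ⟧ℤ R.≈ (m · R.1#) R.+ (R.- (n · R.1#))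
    ⊖-homo zero zero = R.sym (R.-‿inverseʳ _)
    ⊖-homo zero (suc n) = R.sym (R.+-identityˡ _)
    ⊖-homo (suc m) zero = R.sym (R.trans (R.+-congˡ -0#≈0#) (R.+-identityʳ _))
    ⊖-homo (suc m) (suc n) rewrite ℤₚ.[1+m]⊖[1+n]≡m⊖n m n =
      R.trans (⊖-homo m n) (R.sym (cancel-suc _ _))

    +-hom : ∀ x y → ⟦ x ℤ.+ y ⟧ℤ R.≈ ⟦ x ⟧ℤ R.+ ⟦ y ⟧ℤ
    +-hom (+ m) (+ n) = ×-homo-+ R.1# m n
    +-hom (+ m) -[1+ n ] = ⊖-homo m (suc n)
    +-hom -[1+ m ] (+ n) = R.trans (⊖-homo n (suc m)) (R.+-comm _ _)
    +-hom -[1+ m ] -[1+ n ] = R.trans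
      (R.-‿cong (R.trans (×-congˡ {x = R.1#} (cong suc (sym (ℕₚ.+-suc m n)))) (×-homo-+ R.1# (suc m) (suc n))))
      (R.sym (-‿+-comm _ _))

    neg-hom : ∀ x → ⟦ ℤ.- x ⟧ℤ R.≈ R.- ⟦ x ⟧ℤ
    neg-hom (+ zero) = R.sym -0#≈0#
    neg-hom (+ suc n) = R.refl
    neg-hom -[1+ n ] = R.sym (-‿involutive _)

    *-hom⁺ : ∀ x n → ⟦ x ℤ.* + n ⟧ℤ R.≈ ⟦ x ⟧ℤ R.* ⟦ + n ⟧ℤ
    *-hom⁺ (+ m) n rewrite sym (ℤₚ.pos-* m n) = ×1-homo-* m n
    *-hom⁺ -[1+ m ] n = R.trans (R.reflexive (cong ⟦_⟧ℤ (sym (ℤₚ.neg-distribˡ-* (+ suc m) (+ n)))))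
      (R.trans (neg-hom (+ suc m ℤ.* + n)) (R.trans (R.-‿cong (*-hom⁺ (+ suc m) n)) (-‿distribˡ-* _ _)))

    *-hom : ∀ x y → ⟦ x ℤ.* y ⟧ℤ R.≈ ⟦ x ⟧ℤ R.* ⟦ y ⟧ℤ
    *-hom x (+ n) = *-hom⁺ x n
    *-hom x -[1+ n ] = R.trans (R.reflexive (cong ⟦_⟧ℤ (sym (ℤₚ.neg-distribʳ-* x (+ suc n)))))
      (R.trans (neg-hom (x ℤ.* + suc n)) (R.trans (R.-‿cong (*-hom⁺ x (suc n))) (-‿distribʳ-* _ _)))

    ℤ-raw : RawRing 0ℓ 0ℓ
    ℤ-raw = CommutativeRing.rawRing ℤₚ.+-*-commutativeRing

    morphism : ℤ-raw -Raw-AlmostCommutative⟶ fromCommutativeRing R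
    morphism = record
      { ⟦_⟧ = ⟦_⟧ℤ ; +-homo = +-hom ; *-homo = *-hom ; -‿homo = neg-hom
      ; 0-homo = R.refl ; 1-homo = R.+-identityʳ _ }

    dec : ∀ x y → Maybe (⟦ x ⟧ℤ R.≈ ⟦ y ⟧ℤ)
    dec x y with x ℤ.≟ y
    ... | yes refl = just R.refl
    ... | no _ = nothing

  open Algebra.Solver.Ring ℤ-raw (fromCommutativeRing R) morphism dec public
    using (solve; _:=_; _:+_; _:*_; :-_; _:-_; con)

module ℚSolver = IntegerSolver ℚₚ.+-*-commutativeRing

-- Polynomials over ℚ, compared coefficientwise

cf : Poly → ℕ → ℚ
cf [] n = 0ℚ
cf (a ∷ p) zero = a
cf (a ∷ p) (suc n) = cf p n

infix 4 _≈P_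
-- Lists that differ by trailing zeros denote the same polynomial, so propositional equality is too
-- fine. The record form lets `p` and `q` be inferred from a proof.
record _≈P_ (p q : Poly) : Set where
  constructor coefwise
  field at-cf : ∀ n → cf p n ≡ cf q n
open _≈P_ public

≈P-refl : ∀ {p} → p ≈P p
≈P-refl = coefwise λ _ → refl

≈P-sym : ∀ {p q} → p ≈P q → q ≈P p
≈P-sym e = coefwise λ n → sym (at-cf e n)

≈P-trans : ∀ {p q r} → p ≈P q → q ≈P r → p ≈P r
≈P-trans e f = coefwise λ n → trans (at-cf e n) (at-cf f n)

cf-addP : ∀ p q n → cf (addP p q) n ≡ cf p n ℚ.+ cf q n
cf-addP [] q n = sym (ℚₚ.+-identityˡ _)
cf-addP (a ∷ p) [] n = sym (ℚₚ.+-identityʳ _)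
cf-addP (a ∷ p) (b ∷ q) zero = refl
cf-addP (a ∷ p) (b ∷ q) (suc n) = cf-addP p q n

cf-scaleP : ∀ a p n → cf (scaleP a p) n ≡ a ℚ.* cf p n
cf-scaleP a [] n = sym (ℚₚ.*-zeroʳ a)
cf-scaleP a (b ∷ p) zero = refl
cf-scaleP a (b ∷ p) (suc n) = cf-scaleP a p n

cf-negP : ∀ p n → cf (negP p) n ≡ ℚ.- cf p n
cf-negP [] n = refl
cf-negP (b ∷ p) zero = refl
cf-negP (b ∷ p) (suc n) = cf-negP p n

cf-mulP-∷ : ∀ a p q n → cf (mulP (a ∷ p) q) n ≡ a ℚ.* cf q n ℚ.+ cf (0ℚ ∷ mulP p q) n
cf-mulP-∷ a p q n = trans (cf-addP (scaleP a q) (0ℚ ∷ mulP p q) n) (cong (ℚ._+ _) (cf-scaleP a q n))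

zero⇒cf : ∀ {p} → IsZeroP p → ∀ n → cf p n ≡ 0ℚ
zero⇒cf [] n = refl
zero⇒cf (e ∷ z) zero = e
zero⇒cf (e ∷ z) (suc n) = zero⇒cf z n

cf⇒zero : ∀ p → (∀ n → cf p n ≡ 0ℚ) → IsZeroP p
cf⇒zero [] h = []
cf⇒zero (a ∷ p) h = h 0 ∷ cf⇒zero p (h ∘ suc)

diff-zero : ∀ {a b} → a ℚ.+ (ℚ.- b) ≡ 0ℚ → a ≡ b
diff-zero {a} {b} h = begin
  a ≡⟨ ℚSolver.solve 2 (λ a b → a ℚSolver.:= (a ℚSolver.:+ (ℚSolver.:- b)) ℚSolver.:+ b) refl a b ⟩
  (a ℚ.+ (ℚ.- b)) ℚ.+ b ≡⟨ cong (ℚ._+ b) h ⟩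
  0ℚ ℚ.+ b ≡⟨ ℚₚ.+-identityˡ b ⟩
  b ∎ where open ≡-Reasoning

sub-zero⇒≈P : ∀ p q → IsZeroP (addP p (negP q)) → p ≈P q
sub-zero⇒≈P p q z = coefwise λ n → diff-zero (trans (sym (trans (cf-addP p (negP q) n) (cong (cf p n ℚ.+_) (cf-negP q n)))) (zero⇒cf z n))

≈P⇒sub-zero : ∀ {p q} → p ≈P q → IsZeroP (addP p (negP q))
≈P⇒sub-zero {p} {q} e = cf⇒zero _ λ n → trans (cf-addP p (negP q) n)
  (trans (cong₂ ℚ._+_ (at-cf e n) (cf-negP q n)) (ℚₚ.+-inverseʳ (cf q n)))

addP-cong : ∀ {p p' q q'} → p ≈P p' → q ≈P q' → addP p q ≈P addP p' q'
addP-cong {p} {p'} {q} {q'} e f = coefwise λ n →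
  trans (cf-addP p q n) (trans (cong₂ ℚ._+_ (at-cf e n) (at-cf f n)) (sym (cf-addP p' q' n)))

negP-cong : ∀ {p q} → p ≈P q → negP p ≈P negP q
negP-cong {p} {q} e = coefwise λ n → trans (cf-negP p n) (trans (cong (ℚ.-_) (at-cf e n)) (sym (cf-negP q n)))

shift-cong : ∀ {p q} → p ≈P q → (0ℚ ∷ p) ≈P (0ℚ ∷ q)
shift-cong e = coefwise λ { zero → refl ; (suc n) → at-cf e n }

mulP-congˡ : ∀ p {q q'} → q ≈P q' → mulP p q ≈P mulP p q'
mulP-congˡ [] e = ≈P-refl
mulP-congˡ (a ∷ p) {q} {q'} e = coefwise λ n → trans (cf-mulP-∷ a p q n)
  (trans (cong₂ ℚ._+_ (cong (a ℚ.*_) (at-cf e n)) (at-cf (shift-cong (mulP-congˡ p e)) n)) (sym (cf-mulP-∷ a p q' n)))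

mulP-[]ʳ : ∀ p → mulP p [] ≈P []
mulP-[]ʳ [] = ≈P-refl
mulP-[]ʳ (a ∷ p) = coefwise λ { zero → refl ; (suc n) → at-cf (mulP-[]ʳ p) n }

-- `mulP` recurses on its left factor. This is the mirrored recursion on the right factor; with it
-- commutativity is a plain induction.
mulP-∷ʳ : ∀ p b q → mulP p (b ∷ q) ≈P addP (scaleP b p) (0ℚ ∷ mulP p q)
mulP-∷ʳ [] b q = coefwise λ { zero → refl ; (suc n) → refl }
mulP-∷ʳ (a ∷ p) b q = coefwise λ
  { zero → cong (ℚ._+ 0ℚ) (ℚₚ.*-comm a b)
  ; (suc n) → let open ≡-Reasoning in begin
      cf (addP (scaleP a q) (mulP p (b ∷ q))) n ≡⟨ cf-addP (scaleP a q) _ n ⟩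
      cf (scaleP a q) n ℚ.+ cf (mulP p (b ∷ q)) n ≡⟨ cong (cf (scaleP a q) n ℚ.+_) (trans (at-cf (mulP-∷ʳ p b q) n) (cf-addP (scaleP b p) _ n)) ⟩
      cf (scaleP a q) n ℚ.+ (cf (scaleP b p) n ℚ.+ cf (0ℚ ∷ mulP p q) n)
        ≡⟨ ℚSolver.solve 3 (λ x y z → x ℚSolver.:+ (y ℚSolver.:+ z) ℚSolver.:= y ℚSolver.:+ (x ℚSolver.:+ z)) refl (cf (scaleP a q) n) (cf (scaleP b p) n) (cf (0ℚ ∷ mulP p q) n) ⟩
      cf (scaleP b p) n ℚ.+ (cf (scaleP a q) n ℚ.+ cf (0ℚ ∷ mulP p q) n) ≡⟨ cong (cf (scaleP b p) n ℚ.+_) (sym (cf-addP (scaleP a q) _ n)) ⟩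
      cf (scaleP b p) n ℚ.+ cf (mulP (a ∷ p) q) n ≡⟨ sym (cf-addP (scaleP b p) _ n) ⟩
      cf (addP (scaleP b p) (mulP (a ∷ p) q)) n ∎ }

mulP-comm : ∀ p q → mulP p q ≈P mulP q p
mulP-comm [] q = ≈P-sym (mulP-[]ʳ q)
mulP-comm (a ∷ p) q = ≈P-trans (addP-cong {scaleP a q} ≈P-refl (shift-cong (mulP-comm p q))) (≈P-sym (mulP-∷ʳ q a p))

mulP-cong : ∀ {p p' q q'} → p ≈P p' → q ≈P q' → mulP p q ≈P mulP p' q'
mulP-cong {p} {p'} {q} {q'} e f = ≈P-trans (mulP-congˡ p f) (≈P-trans (mulP-comm p q') (≈P-trans (mulP-congˡ q' e) (mulP-comm q' p')))

mulP-distribˡ : ∀ p q r → mulP p (addP q r) ≈P addP (mulP p q) (mulP p r)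
mulP-distribˡ [] q r = ≈P-refl
mulP-distribˡ (a ∷ p) q r = coefwise λ n → let open ≡-Reasoning in begin
    cf (mulP (a ∷ p) (addP q r)) n ≡⟨ cf-mulP-∷ a p (addP q r) n ⟩
    a ℚ.* cf (addP q r) n ℚ.+ cf (0ℚ ∷ mulP p (addP q r)) n
      ≡⟨ cong₂ ℚ._+_ (cong (a ℚ.*_) (cf-addP q r n)) (sh n) ⟩
    a ℚ.* (cf q n ℚ.+ cf r n) ℚ.+ (cf (0ℚ ∷ mulP p q) n ℚ.+ cf (0ℚ ∷ mulP p r) n)
      ≡⟨ ℚSolver.solve 5 (λ a q r x y → a ℚSolver.:* (q ℚSolver.:+ r) ℚSolver.:+ (x ℚSolver.:+ y) ℚSolver.:= (a ℚSolver.:* q ℚSolver.:+ x) ℚSolver.:+ (a ℚSolver.:* r ℚSolver.:+ y)) refl a (cf q n) (cf r n) (cf (0ℚ ∷ mulP p q) n) (cf (0ℚ ∷ mulP p r) n) ⟩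
    (a ℚ.* cf q n ℚ.+ cf (0ℚ ∷ mulP p q) n) ℚ.+ (a ℚ.* cf r n ℚ.+ cf (0ℚ ∷ mulP p r) n)
      ≡⟨ sym (cong₂ ℚ._+_ (cf-mulP-∷ a p q n) (cf-mulP-∷ a p r n)) ⟩
    cf (mulP (a ∷ p) q) n ℚ.+ cf (mulP (a ∷ p) r) n ≡⟨ sym (cf-addP (mulP (a ∷ p) q) _ n) ⟩
    cf (addP (mulP (a ∷ p) q) (mulP (a ∷ p) r)) n ∎
  where
  sh : ∀ n → cf (0ℚ ∷ mulP p (addP q r)) n ≡ cf (0ℚ ∷ mulP p q) n ℚ.+ cf (0ℚ ∷ mulP p r) n
  sh zero = refl
  sh (suc n) = trans (at-cf (mulP-distribˡ p q r) n) (cf-addP (mulP p q) _ n)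

mulP-distribʳ : ∀ p q r → mulP (addP q r) p ≈P addP (mulP q p) (mulP r p)
mulP-distribʳ p q r = ≈P-trans (mulP-comm (addP q r) p) (≈P-trans (mulP-distribˡ p q r) (addP-cong (mulP-comm p q) (mulP-comm p r)))

mulP-scaleˡ : ∀ a q r → mulP (scaleP a q) r ≈P scaleP a (mulP q r)
mulP-scaleˡ a [] r = ≈P-refl
mulP-scaleˡ a (b ∷ q) r = coefwise λ n → let open ≡-Reasoning in begin
    cf (mulP (scaleP a (b ∷ q)) r) n ≡⟨ cf-mulP-∷ (a ℚ.* b) (scaleP a q) r n ⟩
    (a ℚ.* b) ℚ.* cf r n ℚ.+ cf (0ℚ ∷ mulP (scaleP a q) r) n ≡⟨ cong₂ ℚ._+_ (ℚₚ.*-assoc a b (cf r n)) (sh n) ⟩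
    a ℚ.* (b ℚ.* cf r n) ℚ.+ a ℚ.* cf (0ℚ ∷ mulP q r) n ≡⟨ sym (ℚₚ.*-distribˡ-+ a _ _) ⟩
    a ℚ.* (b ℚ.* cf r n ℚ.+ cf (0ℚ ∷ mulP q r) n) ≡⟨ cong (a ℚ.*_) (sym (cf-mulP-∷ b q r n)) ⟩
    a ℚ.* cf (mulP (b ∷ q) r) n ≡⟨ sym (cf-scaleP a (mulP (b ∷ q) r) n) ⟩
    cf (scaleP a (mulP (b ∷ q) r)) n ∎
  where
  sh : ∀ n → cf (0ℚ ∷ mulP (scaleP a q) r) n ≡ a ℚ.* cf (0ℚ ∷ mulP q r) n
  sh zero = sym (ℚₚ.*-zeroʳ a)
  sh (suc n) = trans (at-cf (mulP-scaleˡ a q r) n) (cf-scaleP a (mulP q r) n)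

mulP-shiftˡ : ∀ p q → mulP (0ℚ ∷ p) q ≈P (0ℚ ∷ mulP p q)
mulP-shiftˡ p q = coefwise λ n → trans (cf-mulP-∷ 0ℚ p q n) (trans (cong (ℚ._+ cf (0ℚ ∷ mulP p q) n) (ℚₚ.*-zeroˡ (cf q n))) (ℚₚ.+-identityˡ (cf (0ℚ ∷ mulP p q) n)))

mulP-assoc : ∀ p q r → mulP (mulP p q) r ≈P mulP p (mulP q r)
mulP-assoc [] q r = ≈P-refl
mulP-assoc (a ∷ p) q r = ≈P-trans (mulP-distribʳ r (scaleP a q) (0ℚ ∷ mulP p q))
  (addP-cong (mulP-scaleˡ a q r) (≈P-trans (mulP-shiftˡ (mulP p q) r) (shift-cong (mulP-assoc p q r))))

onePoly : Poly
onePoly = 1ℚ ∷ []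

mulP-identityˡ : ∀ p → mulP onePoly p ≈P p
mulP-identityˡ p = coefwise λ n → trans (cf-mulP-∷ 1ℚ [] p n) (trans (cong₂ ℚ._+_ (ℚₚ.*-identityˡ (cf p n)) (z n)) (ℚₚ.+-identityʳ _))
  where
  z : ∀ n → cf (0ℚ ∷ []) n ≡ 0ℚ
  z zero = refl
  z (suc n) = refl

mulP-identityʳ : ∀ p → mulP p onePoly ≈P p
mulP-identityʳ p = ≈P-trans (mulP-comm p onePoly) (mulP-identityˡ p)

addP-assoc : ∀ p q r → addP (addP p q) r ≈P addP p (addP q r)
addP-assoc p q r = coefwise λ n → trans (cf-addP (addP p q) r n) (trans (cong (ℚ._+ cf r n) (cf-addP p q n))
  (trans (ℚₚ.+-assoc (cf p n) _ _) (sym (trans (cf-addP p (addP q r) n) (cong (cf p n ℚ.+_) (cf-addP q r n))))))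

addP-comm : ∀ p q → addP p q ≈P addP q p
addP-comm p q = coefwise λ n → trans (cf-addP p q n) (trans (ℚₚ.+-comm (cf p n) _) (sym (cf-addP q p n)))

addP-[]ʳ : ∀ p → addP p [] ≈P p
addP-[]ʳ p = ≈P-trans (addP-comm p []) ≈P-refl

addP-negʳ : ∀ p → addP p (negP p) ≈P []
addP-negʳ p = coefwise λ n → trans (cf-addP p (negP p) n) (trans (cong (cf p n ℚ.+_) (cf-negP p n)) (ℚₚ.+-inverseʳ (cf p n)))

polyRing : CommutativeRing 0ℓ 0ℓ
polyRing = record
  { Carrier = Poly ; _≈_ = _≈P_ ; _+_ = addP ; _*_ = mulP ; -_ = negP ; 0# = [] ; 1# = onePoly
  ; isCommutativeRing = record
    { isRing = record
      { +-isAbelianGroup = record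
        { isGroup = record
          { isMonoid = record
            { isSemigroup = record
              { isMagma = record
                { isEquivalence = record { refl = ≈P-refl ; sym = ≈P-sym ; trans = ≈P-trans }
                ; ∙-cong = addP-cong }
              ; assoc = addP-assoc }
            ; identity = (λ p → ≈P-refl) , addP-[]ʳ }
          ; inverse = (λ p → ≈P-trans (addP-comm (negP p) p) (addP-negʳ p)) , addP-negʳ
          ; ⁻¹-cong = negP-cong }
        ; comm = addP-comm }
      ; *-cong = mulP-cong
      ; *-assoc = mulP-assoc
      ; *-identity = mulP-identityˡ , mulP-identityʳ
      ; distrib = mulP-distribˡ , mulP-distribʳ }
    ; *-comm = mulP-comm } }

-- Degrees of polynomials and cancellation

Below : Poly → ℕ → Set
Below p n = ∀ m → n ≤ m → cf p m ≡ 0ℚ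

HasDeg : Poly → ℕ → Set
HasDeg p n = cf p n ≢ 0ℚ × Below p (suc n)

degree : ∀ p → ¬ IsZeroP p → ∃ (HasDeg p)
degree [] nz = ⊥-elim (nz [])
degree (a ∷ p) nz with isZeroP? p
... | yes z = 0 , (λ e → nz (e ∷ z)) , λ { (suc m) _ → zero⇒cf z m }
... | no nz' with degree p nz'
... | n , c , b = suc n , c , λ { (suc m) (s≤s le) → b m le }

-- The bounds are asymmetric on purpose: degree at most m times degree less than n has degree less
-- than m + n. This one form serves both the exact degree of a product and the products of regular
-- with small elements at α = ∞.
Below-mulP : ∀ {p q m n} → Below p (suc m) → Below q n → Below (mulP p q) (m + n)
Below-mulP {[]} bp bq k le = refl
Below-mulP {a ∷ p} {q} {zero} {n} bp bq k le = trans (cf-mulP-∷ a p q k)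
  (trans (cong₂ ℚ._+_ (trans (cong (a ℚ.*_) (bq k le)) (ℚₚ.*-zeroʳ a)) (z k)) refl)
  where
  z : ∀ k → cf (0ℚ ∷ mulP p q) k ≡ 0ℚ
  z zero = refl
  z (suc k) = at-cf (mulP-cong {p} {[]} {q} {q} (coefwise λ i → bp (suc i) (s≤s z≤n)) ≈P-refl) k
Below-mulP {a ∷ p} {q} {suc m} {n} bp bq (suc k) (s≤s le) = trans (cf-mulP-∷ a p q (suc k))
  (trans (cong₂ ℚ._+_ (trans (cong (a ℚ.*_) (bq (suc k) (ℕₚ.≤-trans (ℕₚ.m≤n+m n m) (ℕₚ.≤-trans le (ℕₚ.n≤1+n k))))) (ℚₚ.*-zeroʳ a))
    (Below-mulP {p} {q} {m} {n} (λ i l → bp (suc i) (s≤s l)) bq k le)) refl)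

cf-mulP-top : ∀ p q m n → Below p (suc m) → Below q (suc n) → cf (mulP p q) (m + n) ≡ cf p m ℚ.* cf q n
cf-mulP-top [] q m n bp bq = sym (ℚₚ.*-zeroˡ (cf q n))
cf-mulP-top (a ∷ p) q zero n bp bq = trans (cf-mulP-∷ a p q n) (trans (cong (a ℚ.* cf q n ℚ.+_) (z n)) (ℚₚ.+-identityʳ _))
  where
  z : ∀ k → cf (0ℚ ∷ mulP p q) k ≡ 0ℚ
  z zero = refl
  z (suc k) = at-cf (mulP-cong {p} {[]} {q} {q} (coefwise λ i → bp (suc i) (s≤s z≤n)) ≈P-refl) k
cf-mulP-top (a ∷ p) q (suc m) n bp bq = trans (cf-mulP-∷ a p q (suc m + n))
  (trans (cong₂ ℚ._+_ (trans (cong (a ℚ.*_) (bq (suc (m + n)) (s≤s (ℕₚ.m≤n+m n m)))) (ℚₚ.*-zeroʳ a))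
     (cf-mulP-top p q m n (λ i l → bp (suc i) (s≤s l)) bq)) (ℚₚ.+-identityˡ _))

ℚ-domain : ∀ {a b} → a ≢ 0ℚ → b ≢ 0ℚ → a ℚ.* b ≢ 0ℚ
ℚ-domain {a} {b} na nb e = nb (begin
  b ≡⟨ sym (ℚₚ.*-identityˡ b) ⟩
  1ℚ ℚ.* b ≡⟨ cong (ℚ._* b) (sym (ℚₚ.*-inverseˡ a)) ⟩
  ((ℚ.1/ a) ℚ.* a) ℚ.* b ≡⟨ ℚₚ.*-assoc (ℚ.1/ a) a b ⟩
  (ℚ.1/ a) ℚ.* (a ℚ.* b) ≡⟨ cong ((ℚ.1/ a) ℚ.*_) e ⟩
  (ℚ.1/ a) ℚ.* 0ℚ ≡⟨ ℚₚ.*-zeroʳ (ℚ.1/ a) ⟩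
  0ℚ ∎)
  where
  open ≡-Reasoning
  instance
    nz : ℚ.NonZero a
    nz = ℚ.≢-nonZero na

HasDeg-mulP : ∀ p q {m n} → HasDeg p m → HasDeg q n → HasDeg (mulP p q) (m + n)
HasDeg-mulP p q {m} {n} (cp , bp) (cq , bq) =
  (λ e → ℚ-domain cp cq (trans (sym (cf-mulP-top p q m n bp bq)) e)) ,
  subst (Below (mulP p q)) (ℕₚ.+-suc m n) (Below-mulP {p} {q} bp bq)

HasDeg-nonzero : ∀ p {n} → HasDeg p n → ¬ IsZeroP p
HasDeg-nonzero p (c , _) z = c (zero⇒cf z _)

degNZ : NZPoly → ℕ
degNZ (p , nz) = proj₁ (degree p nz)

degDen : List NZPoly → ℕ
degDen [] = 0
degDen (q ∷ qs) = degNZ q + degDen qs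

HasDeg-prodNZ : ∀ qs → HasDeg (prodNZ qs) (degDen qs)
HasDeg-prodNZ [] = (λ ()) , λ { (suc m) _ → refl }
HasDeg-prodNZ ((p , nz) ∷ qs) = HasDeg-mulP p (prodNZ qs) (proj₂ (degree p nz)) (HasDeg-prodNZ qs)

prodNZ-++ : ∀ xs ys → prodNZ (xs ++ ys) ≈P mulP (prodNZ xs) (prodNZ ys)
prodNZ-++ [] ys = ≈P-sym (mulP-identityˡ (prodNZ ys))
prodNZ-++ (x ∷ xs) ys = ≈P-trans (mulP-congˡ (proj₁ x) (prodNZ-++ xs ys)) (≈P-sym (mulP-assoc (proj₁ x) (prodNZ xs) (prodNZ ys)))

degDen-++ : ∀ xs ys → degDen (xs ++ ys) ≡ degDen xs + degDen ys
degDen-++ [] ys = refl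
degDen-++ (x ∷ xs) ys = trans (cong (degNZ x ℕ.+_) (degDen-++ xs ys)) (sym (ℕₚ.+-assoc (degNZ x) _ _))

-- If p - q were nonzero it would have a degree, and so would its product with `r`, which is zero.
mulP-cancelʳ : ∀ {p q n} r → HasDeg r n → mulP p r ≈P mulP q r → p ≈P q
mulP-cancelʳ {p} {q} r dr e with isZeroP? (addP p (negP q))
... | yes z = sub-zero⇒≈P p q z
... | no nz = ⊥-elim (HasDeg-nonzero (mulP (addP p (negP q)) r) (HasDeg-mulP (addP p (negP q)) r (proj₂ (degree _ nz)) dr) (cf⇒zero _ (at-cf z)))
  where
  open IntegerSolver polyRing
  z : mulP (addP p (negP q)) r ≈P []
  z = ≈P-trans (solve 3 (λ p q r → (p :+ :- q) :* r := p :* r :+ :- (q :* r)) ≈P-refl p q r)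
        (≈P-trans (addP-cong e ≈P-refl) (addP-negʳ (mulP q r)))

-- The field ℚ(α); its operations are opaque so that they never unfold in later arguments

den* : K → Poly
den* x = prodNZ (den x)

-- Sums and products concatenate lists of denominators, so a denominator is the expected product
-- only up to `≈P`. `Rep` hides this and leaves pure polynomial identities for the solver.
record Rep (x : K) (n d : Poly) : Set where
  constructor rep
  field
    num≈ : num x ≈P n
    den≈ : den* x ≈P d
open Rep public

module PS = IntegerSolver polyRing

rep-self : ∀ x → Rep x (num x) (den* x)
rep-self x = rep ≈P-refl ≈P-refl

rep-+ : ∀ {x y n d m e} → Rep x n d → Rep y m e → Rep (x +K y) (addP (mulP n e) (mulP m d)) (mulP d e)
rep-+ {x} {y} r s = rep (addP-cong (mulP-cong (num≈ r) (den≈ s)) (mulP-cong (num≈ s) (den≈ r)))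
  (≈P-trans (prodNZ-++ (den x) (den y)) (mulP-cong (den≈ r) (den≈ s)))

rep-* : ∀ {x y n d m e} → Rep x n d → Rep y m e → Rep (x *K y) (mulP n m) (mulP d e)
rep-* {x} {y} r s = rep (mulP-cong (num≈ r) (num≈ s)) (≈P-trans (prodNZ-++ (den x) (den y)) (mulP-cong (den≈ r) (den≈ s)))

rep-neg : ∀ {x n d} → Rep x n d → Rep (-K x) (negP n) d
rep-neg r = rep (negP-cong (num≈ r)) (den≈ r)

rep-≈ : ∀ {x y n d m e} → Rep x n d → Rep y m e → mulP n e ≈P mulP m d → x ≈K y
rep-≈ r s h = ≈P⇒sub-zero (≈P-trans (mulP-cong (num≈ r) (den≈ s)) (≈P-trans h (≈P-sym (mulP-cong (num≈ s) (den≈ r)))))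

≈-rep : ∀ x y → x ≈K y → mulP (num x) (den* y) ≈P mulP (num y) (den* x)
≈-rep x y h = sub-zero⇒≈P _ _ h

infix 4 _≈_ _≉_
infixl 6 _⊕_ _⊖ᶠ_
infixl 7 _⊛_
infix 8 ⊝_

opaque
  _≈_ : K → K → Set
  _≈_ = _≈K_

  _⊕_ _⊛_ : K → K → K
  _⊕_ = _+K_
  _⊛_ = _*K_

  ⊝_ inv : K → K
  ⊝_ = -K_
  inv = invK

  0f 1f αf : K
  0f = 0K
  1f = 1K
  αf = αK

  fromZ : ℤ → K
  fromZ = fromℤ

_≉_ : K → K → Set
x ≉ y = ¬ (x ≈ y)

_⊖ᶠ_ : K → K → K
x ⊖ᶠ y = x ⊕ ⊝ y

opaque
  unfolding _≈_ _⊕_ _⊛_ ⊝_ inv 0f 1f αf fromZ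

  ≈-refl : ∀ {x} → x ≈ x
  ≈-refl {x} = rep-≈ {x} {x} (rep-self x) (rep-self x) ≈P-refl

  ≈-sym : ∀ {x y} → x ≈ y → y ≈ x
  ≈-sym {x} {y} h = rep-≈ {y} {x} (rep-self y) (rep-self x) (≈P-sym (≈-rep x y h))

  -- Equality by cross-multiplication is transitive only because the middle denominator, a product
  -- of nonzero polynomials, can be cancelled.
  ≈-trans : ∀ {x y z} → x ≈ y → y ≈ z → x ≈ z
  ≈-trans {x} {y} {z} h k = rep-≈ {x} {z} (rep-self x) (rep-self z)
    (mulP-cancelʳ (den* y) (HasDeg-prodNZ (den y)) (begin
      mulP (mulP (num x) (den* z)) (den* y) ≈⟨ PS.solve 3 (λ a b c → (a PS.:* b) PS.:* c PS.:= (a PS.:* c) PS.:* b) ≈P-refl (num x) (den* z) (den* y) ⟩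
      mulP (mulP (num x) (den* y)) (den* z) ≈⟨ mulP-cong (≈-rep x y h) ≈P-refl ⟩
      mulP (mulP (num y) (den* x)) (den* z) ≈⟨ PS.solve 3 (λ a b c → (a PS.:* b) PS.:* c PS.:= (a PS.:* c) PS.:* b) ≈P-refl (num y) (den* x) (den* z) ⟩
      mulP (mulP (num y) (den* z)) (den* x) ≈⟨ mulP-cong (≈-rep y z k) ≈P-refl ⟩
      mulP (mulP (num z) (den* y)) (den* x) ≈⟨ PS.solve 3 (λ a b c → (a PS.:* b) PS.:* c PS.:= (a PS.:* c) PS.:* b) ≈P-refl (num z) (den* y) (den* x) ⟩
      mulP (mulP (num z) (den* x)) (den* y) ∎))
    where open SetoidReasoning (CommutativeRing.setoid polyRing)

  ⊕-cong : ∀ {x x' y y'} → x ≈ x' → y ≈ y' → x ⊕ y ≈ x' ⊕ y'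
  ⊕-cong {x} {x'} {y} {y'} h k = rep-≈ {x +K y} {x' +K y'} (rep-+ (rep-self x) (rep-self y)) (rep-+ (rep-self x') (rep-self y')) (begin
      mulP (addP (mulP (num x) (den* y)) (mulP (num y) (den* x))) (mulP (den* x') (den* y'))
        ≈⟨ PS.solve 6 (λ n d m e d' e' → (n PS.:* e PS.:+ m PS.:* d) PS.:* (d' PS.:* e') PS.:= (n PS.:* d') PS.:* (e PS.:* e') PS.:+ (m PS.:* e') PS.:* (d PS.:* d')) ≈P-refl (num x) (den* x) (num y) (den* y) (den* x') (den* y') ⟩
      addP (mulP (mulP (num x) (den* x')) (mulP (den* y) (den* y'))) (mulP (mulP (num y) (den* y')) (mulP (den* x) (den* x')))
        ≈⟨ addP-cong (mulP-cong (≈-rep x x' h) ≈P-refl) (mulP-cong (≈-rep y y' k) ≈P-refl) ⟩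
      addP (mulP (mulP (num x') (den* x)) (mulP (den* y) (den* y'))) (mulP (mulP (num y') (den* y)) (mulP (den* x) (den* x')))
        ≈⟨ PS.solve 6 (λ n d m e d' e' → (n PS.:* d') PS.:* (e' PS.:* e) PS.:+ (m PS.:* e') PS.:* (d' PS.:* d) PS.:= (n PS.:* e PS.:+ m PS.:* d) PS.:* (d' PS.:* e')) ≈P-refl (num x') (den* x') (num y') (den* y') (den* x) (den* y) ⟩
      mulP (addP (mulP (num x') (den* y')) (mulP (num y') (den* x'))) (mulP (den* x) (den* y)) ∎)
    where open SetoidReasoning (CommutativeRing.setoid polyRing)

  ⊛-cong : ∀ {x x' y y'} → x ≈ x' → y ≈ y' → x ⊛ y ≈ x' ⊛ y'
  ⊛-cong {x} {x'} {y} {y'} h k = rep-≈ {x *K y} {x' *K y'} (rep-* (rep-self x) (rep-self y)) (rep-* (rep-self x') (rep-self y')) (begin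
      mulP (mulP (num x) (num y)) (mulP (den* x') (den* y'))
        ≈⟨ PS.solve 4 (λ a b c d → (a PS.:* b) PS.:* (c PS.:* d) PS.:= (a PS.:* c) PS.:* (b PS.:* d)) ≈P-refl (num x) (num y) (den* x') (den* y') ⟩
      mulP (mulP (num x) (den* x')) (mulP (num y) (den* y')) ≈⟨ mulP-cong (≈-rep x x' h) (≈-rep y y' k) ⟩
      mulP (mulP (num x') (den* x)) (mulP (num y') (den* y))
        ≈⟨ PS.solve 4 (λ a b c d → (a PS.:* b) PS.:* (c PS.:* d) PS.:= (a PS.:* c) PS.:* (b PS.:* d)) ≈P-refl (num x') (den* x) (num y') (den* y) ⟩
      mulP (mulP (num x') (num y')) (mulP (den* x) (den* y)) ∎)
    where open SetoidReasoning (CommutativeRing.setoid polyRing)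

  ⊝-cong : ∀ {x x'} → x ≈ x' → ⊝ x ≈ ⊝ x'
  ⊝-cong {x} {x'} h = rep-≈ { -K x} { -K x'} (rep-neg (rep-self x)) (rep-neg (rep-self x'))
    (≈P-trans (PS.solve 2 (λ a b → (PS.:- a) PS.:* b PS.:= PS.:- (a PS.:* b)) ≈P-refl (num x) (den* x'))
    (≈P-trans (negP-cong (≈-rep x x' h)) (PS.solve 2 (λ a b → PS.:- (a PS.:* b) PS.:= (PS.:- a) PS.:* b) ≈P-refl (num x') (den* x))))

  K-isCommutativeRing : IsCommutativeRing _≈_ _⊕_ _⊛_ ⊝_ 0f 1f
  K-isCommutativeRing = record
    { isRing = record
      { +-isAbelianGroup = record
        { isGroup = record
          { isMonoid = record
            { isSemigroup = record
              { isMagma = record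
                { isEquivalence = record { refl = λ {x} → ≈-refl {x} ; sym = λ {x} {y} → ≈-sym {x} {y} ; trans = λ {x} {y} {z} → ≈-trans {x} {y} {z} }
                ; ∙-cong = λ {x} {x'} {y} {y'} → ⊕-cong {x} {x'} {y} {y'} }
              ; assoc = λ x y z → rep-≈ {(x +K y) +K z} {x +K (y +K z)} (rep-+ (rep-+ (rs x) (rs y)) (rs z)) (rep-+ (rs x) (rep-+ (rs y) (rs z)))
                  (PS.solve 6 (λ a d b e c f → ((a PS.:* e PS.:+ b PS.:* d) PS.:* f PS.:+ c PS.:* (d PS.:* e)) PS.:* (d PS.:* (e PS.:* f)) PS.:= (a PS.:* (e PS.:* f) PS.:+ (b PS.:* f PS.:+ c PS.:* e) PS.:* d) PS.:* ((d PS.:* e) PS.:* f)) ≈P-refl (num x) (den* x) (num y) (den* y) (num z) (den* z)) }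
            ; identity = idˡ , λ x → ≈-trans {x +K 0K} {0K +K x} {x} (cm x 0K) (idˡ x) }
          ; inverse = (λ x → ≈-trans {(-K x) +K x} {x +K (-K x)} {0K} (cm (-K x) x) (invʳ x)) , invʳ
          ; ⁻¹-cong = λ {x} {x'} → ⊝-cong {x} {x'} }
        ; comm = cm }
      ; *-cong = λ {x} {x'} {y} {y'} → ⊛-cong {x} {x'} {y} {y'}
      ; *-assoc = λ x y z → rep-≈ {(x *K y) *K z} {x *K (y *K z)} (rep-* (rep-* (rs x) (rs y)) (rs z)) (rep-* (rs x) (rep-* (rs y) (rs z)))
                  (PS.solve 6 (λ a d b e c f → ((a PS.:* b) PS.:* c) PS.:* (d PS.:* (e PS.:* f)) PS.:= (a PS.:* (b PS.:* c)) PS.:* ((d PS.:* e) PS.:* f)) ≈P-refl (num x) (den* x) (num y) (den* y) (num z) (den* z))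
      ; *-identity = (λ x → rep-≈ {1K *K x} {x} (rep-* (rs 1K) (rs x)) (rs x) (≈P-trans (mulP-cong (mulP-identityˡ (num x)) ≈P-refl) (mulP-congˡ (num x) (≈P-sym (mulP-identityˡ (den* x))))))
                   , (λ x → rep-≈ {x *K 1K} {x} (rep-* (rs x) (rs 1K)) (rs x) (≈P-trans (mulP-cong (mulP-identityʳ (num x)) ≈P-refl) (mulP-congˡ (num x) (≈P-sym (mulP-identityʳ (den* x))))))
      ; distrib = dˡ , λ x y z → ≈-trans {(y +K z) *K x} {x *K (y +K z)} {(y *K x) +K (z *K x)} (mc (y +K z) x)
            (≈-trans {x *K (y +K z)} {(x *K y) +K (x *K z)} {(y *K x) +K (z *K x)} (dˡ x y z) (⊕-cong {x *K y} {y *K x} {x *K z} {z *K x} (mc x y) (mc x z))) }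
    ; *-comm = mc }
    where
    rs : ∀ x → Rep x (num x) (den* x)
    rs = rep-self
    cm : ∀ x y → (x +K y) ≈K (y +K x)
    cm x y = rep-≈ {x +K y} {y +K x} (rep-+ (rs x) (rs y)) (rep-+ (rs y) (rs x))
      (PS.solve 4 (λ a d b e → (a PS.:* e PS.:+ b PS.:* d) PS.:* (e PS.:* d) PS.:= (b PS.:* d PS.:+ a PS.:* e) PS.:* (d PS.:* e)) ≈P-refl (num x) (den* x) (num y) (den* y))
    mc : ∀ x y → (x *K y) ≈K (y *K x)
    mc x y = rep-≈ {x *K y} {y *K x} (rep-* (rs x) (rs y)) (rep-* (rs y) (rs x))
      (PS.solve 4 (λ a d b e → (a PS.:* b) PS.:* (e PS.:* d) PS.:= (b PS.:* a) PS.:* (d PS.:* e)) ≈P-refl (num x) (den* x) (num y) (den* y))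
    idˡ : ∀ x → (0K +K x) ≈K x
    idˡ x = rep-≈ {0K +K x} {x} (rep ≈P-refl (den≈ (rep-+ (rs 0K) (rs x)))) (rs x)
      (≈P-trans (mulP-cong (mulP-identityʳ (num x)) ≈P-refl) (mulP-congˡ (num x) (≈P-sym (mulP-identityˡ (den* x)))))
    invʳ : ∀ x → (x +K (-K x)) ≈K 0K
    invʳ x = rep-≈ {x +K (-K x)} {0K} (rep-+ (rs x) (rep-neg (rs x))) (rep ≈P-refl ≈P-refl)
      (PS.solve 3 (λ a d o → (a PS.:* d PS.:+ (PS.:- a) PS.:* d) PS.:* o PS.:= PS.con (ℤ.+ 0) PS.:* (d PS.:* d)) ≈P-refl (num x) (den* x) onePoly)
    dˡ : ∀ x y z → (x *K (y +K z)) ≈K ((x *K y) +K (x *K z))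
    dˡ x y z = rep-≈ {x *K (y +K z)} {(x *K y) +K (x *K z)} (rep-* (rs x) (rep-+ (rs y) (rs z))) (rep-+ (rep-* (rs x) (rs y)) (rep-* (rs x) (rs z)))
      (PS.solve 6 (λ a d b e c f → (a PS.:* (b PS.:* f PS.:+ c PS.:* e)) PS.:* ((d PS.:* e) PS.:* (d PS.:* f)) PS.:= ((a PS.:* b) PS.:* (d PS.:* f) PS.:+ (a PS.:* c) PS.:* (d PS.:* e)) PS.:* (d PS.:* (e PS.:* f))) ≈P-refl (num x) (den* x) (num y) (den* y) (num z) (den* z))

kRing : CommutativeRing 0ℓ 0ℓ
kRing = record { isCommutativeRing = K-isCommutativeRing }

module KS = IntegerSolver kRing
module KRing = CommutativeRing kRing
open Algebra.Properties.Ring KRing.ring using (-0#≈0#)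

≡⇒≈ : ∀ {x y} → x ≡ y → x ≈ y
≡⇒≈ refl = ≈-refl

⊕-congˡ : ∀ {x y z} → y ≈ z → x ⊕ y ≈ x ⊕ z
⊕-congˡ = KRing.+-congˡ

⊕-congʳ : ∀ {x y z} → y ≈ z → y ⊕ x ≈ z ⊕ x
⊕-congʳ = KRing.+-congʳ

⊛-congˡ : ∀ {x y z} → y ≈ z → x ⊛ y ≈ x ⊛ z
⊛-congˡ = KRing.*-congˡ

⊛-congʳ : ∀ {x y z} → y ≈ z → y ⊛ x ≈ z ⊛ x
⊛-congʳ = KRing.*-congʳ

⊖ᶠ-cong : ∀ {x x' y y'} → x ≈ x' → y ≈ y' → x ⊖ᶠ y ≈ x' ⊖ᶠ y'
⊖ᶠ-cong e f = ⊕-cong e (⊝-cong f)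

⊖ᶠ-zero⇒≈ : ∀ {x y} → x ⊖ᶠ y ≈ 0f → x ≈ y
⊖ᶠ-zero⇒≈ {x} {y} h = begin
  x ≈⟨ KS.solve 2 (λ x y → x KS.:= (x KS.:+ KS.:- y) KS.:+ y) ≈-refl x y ⟩
  (x ⊖ᶠ y) ⊕ y ≈⟨ ⊕-congʳ h ⟩
  0f ⊕ y ≈⟨ KRing.+-identityˡ y ⟩
  y ∎ where open SetoidReasoning KRing.setoid

≈⇒⊖ᶠ-zero : ∀ {x y} → x ≈ y → x ⊖ᶠ y ≈ 0f
≈⇒⊖ᶠ-zero {x} {y} h = ≈-trans (⊕-congʳ h) (KRing.-‿inverseʳ y)

⊝-zero : ∀ {x} → x ≈ 0f → ⊝ x ≈ 0f
⊝-zero h = ≈-trans (⊝-cong h) -0#≈0#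

⊛-zeroˡ : ∀ {x y} → x ≈ 0f → x ⊛ y ≈ 0f
⊛-zeroˡ {x} {y} h = ≈-trans (⊛-congʳ h) (KRing.zeroˡ y)

⊛-zeroʳ : ∀ {x y} → y ≈ 0f → x ⊛ y ≈ 0f
⊛-zeroʳ {x} {y} h = ≈-trans (⊛-congˡ h) (KRing.zeroʳ x)

⊕-zero : ∀ {x y} → x ≈ 0f → y ≈ 0f → x ⊕ y ≈ 0f
⊕-zero h k = ≈-trans (⊕-cong h k) (KRing.+-identityˡ 0f)

-- Integers in ℚ(α), inverses, and orders at α = ∞

ℚ-proj : ∀ z → ℚ.toℚᵘ (z ℚ./ 1) ℚᵘ.≃ ℚᵘ.mkℚᵘ z 0
ℚ-proj z = ℚₚ.toℚᵘ-fromℚᵘ (ℚᵘ.mkℚᵘ z 0)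

/1-homo-+ : ∀ a b → (a ℤ.+ b) ℚ./ 1 ≡ a ℚ./ 1 ℚ.+ b ℚ./ 1
/1-homo-+ a b = ℚₚ.toℚᵘ-injective (ℚᵘₚ.≃-trans (ℚ-proj (a ℤ.+ b))
  (ℚᵘₚ.≃-trans (ℚᵘ.*≡* (cong (ℤ._* (ℤ.+ 1)) (sym (cong₂ ℤ._+_ (ℤₚ.*-identityʳ a) (ℤₚ.*-identityʳ b)))))
  (ℚᵘₚ.≃-trans (ℚᵘₚ.+-cong (ℚᵘₚ.≃-sym (ℚ-proj a)) (ℚᵘₚ.≃-sym (ℚ-proj b)))
    (ℚᵘₚ.≃-sym (ℚₚ.toℚᵘ-homo-+ (a ℚ./ 1) (b ℚ./ 1))))))

/1-injective : ∀ {a b} → a ℚ./ 1 ≡ b ℚ./ 1 → a ≡ b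
/1-injective {a} {b} e with ℚᵘₚ.≃-trans (ℚᵘₚ.≃-sym (ℚ-proj a)) (ℚᵘₚ.≃-trans (ℚᵘₚ.≃-reflexive (cong ℚ.toℚᵘ e)) (ℚ-proj b))
... | ℚᵘ.*≡* h = trans (sym (ℤₚ.*-identityʳ a)) (trans h (ℤₚ.*-identityʳ b))

1ℚ≢0ℚ : 1ℚ ≢ 0ℚ
1ℚ≢0ℚ ()

opaque
  unfolding _≈_ _⊕_ _⊛_ ⊝_ inv 0f 1f αf fromZ

  ≈K⇒≈ : ∀ {x y} → x ≈K y → x ≈ y
  ≈K⇒≈ h = h

  ≈⇒≈K : ∀ {x y} → x ≈ y → x ≈K y
  ≈⇒≈K h = h

  ⊕-def : ∀ x y → x +K y ≡ x ⊕ y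
  ⊕-def x y = refl

  ⊛-def : ∀ x y → x *K y ≡ x ⊛ y
  ⊛-def x y = refl

  ⊝-def : ∀ x → -K x ≡ ⊝ x
  ⊝-def x = refl

  inv-def : ∀ x → invK x ≡ inv x
  inv-def x = refl

  0f-def : 0K ≡ 0f
  0f-def = refl

  1f-def : 1K ≡ 1f
  1f-def = refl

  αf-def : αK ≡ αf
  αf-def = refl

  fromZ-def : ∀ z → fromℤ z ≡ fromZ z
  fromZ-def z = refl

  ≈0⇒num : ∀ {x} → x ≈ 0f → IsZeroP (num x)
  ≈0⇒num {x} h = cf⇒zero (num x) (λ n → trans (sym (at-cf (mulP-identityʳ (num x)) n)) (at-cf (≈-rep x 0K h) n))

  num⇒≈0 : ∀ {x} → IsZeroP (num x) → x ≈ 0f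
  num⇒≈0 {x} z = rep-≈ {x} {0K} {[]} {den* x} {[]} {onePoly} (rep (coefwise (zero⇒cf z)) (≈P-refl {den* x})) (rep-self 0K) ≈P-refl

  _≈0? : ∀ x → Dec (x ≈ 0f)
  x ≈0? with isZeroP? (num x)
  ... | yes z = yes (num⇒≈0 {x} z)
  ... | no nz = no (λ e → nz (≈0⇒num {x} e))

  inv-right : ∀ {x} → x ≉ 0f → x ⊛ inv x ≈ 1f
  inv-right {x} nz with isZeroP? (num x)
  ... | yes z = ⊥-elim (nz (num⇒≈0 {x} z))
  ... | no nz' = rep-≈ {x *K y} {1K} (rep-* (rep-self x) (rep-self y)) (rep-self 1K)
      (≈P-trans (mulP-identityʳ (mulP (num x) (den* x))) (≈P-trans (mulP-comm (num x) (den* x))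
        (≈P-trans (mulP-congˡ (den* x) (≈P-sym (mulP-identityʳ (num x)))) (≈P-sym (mulP-identityˡ (mulP (den* x) (mulP (num x) onePoly)))))))
    where
    y : K
    y = mkK (prodNZ (den x)) ((num x , nz') ∷ [])

  inv-zero : ∀ {x} → x ≈ 0f → inv x ≈ 0f
  inv-zero {x} e with isZeroP? (num x)
  ... | yes z = ≈-refl {0K}
  ... | no nz = ⊥-elim (nz (≈0⇒num {x} e))

  1≉0 : 1f ≉ 0f
  1≉0 h = 1ℚ≢0ℚ (zero⇒cf (≈0⇒num {1K} h) 0)

  fromZ-+ : ∀ a b → fromZ (a ℤ.+ b) ≈ fromZ a ⊕ fromZ b
  fromZ-+ a b = rep-≈ {fromℤ (a ℤ.+ b)} {fromℤ a +K fromℤ b} (rep-self _) (rep-+ (rep-self (fromℤ a)) (rep-self (fromℤ b)))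
    (≈P-trans (mulP-congˡ (num (fromℤ (a ℤ.+ b))) (mulP-identityʳ onePoly)) (mulP-cong {num (fromℤ (a ℤ.+ b))} {addP (mulP (num (fromℤ a)) onePoly) (mulP (num (fromℤ b)) onePoly)} {onePoly} {onePoly}
      (≈P-trans hom (addP-cong (≈P-sym (mulP-identityʳ (num (fromℤ a)))) (≈P-sym (mulP-identityʳ (num (fromℤ b)))))) ≈P-refl))
    where
    hom : num (fromℤ (a ℤ.+ b)) ≈P addP (num (fromℤ a)) (num (fromℤ b))
    hom = coefwise λ { zero → /1-homo-+ a b ; (suc n) → refl }

  fromZ-0 : fromZ (ℤ.+ 0) ≈ 0f
  fromZ-0 = num⇒≈0 {fromℤ (ℤ.+ 0)} (refl ∷ [])

  fromZ-1 : fromZ (ℤ.+ 1) ≈ 1f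
  fromZ-1 = rep-≈ {fromℤ (ℤ.+ 1)} {1K} (rep-self _) (rep-self _) ≈P-refl

  fromZ≈0 : ∀ {a} → fromZ a ≈ 0f → a ≡ ℤ.+ 0
  fromZ≈0 {a} h = /1-injective {a} {ℤ.+ 0} (zero⇒cf (≈0⇒num {fromℤ a} h) 0)

  -- Order of vanishing at α = ∞: Val 0 are the elements of positive order, Val 1 the regular ones

  Val : ℕ → K → Set
  Val k x = Below (num x) (k + degDen (den x))

  -- Fractions are not reduced, so the order is read off one representative. The numerator of `y`
  -- times the denominator of `x` has a nonzero top coefficient; as it equals the numerator of `x`
  -- times the denominator of `y`, its degree bounds that of the numerator of `y`.
  Val-resp : ∀ {k x y} → x ≈ y → Val k x → Val k y
  Val-resp {k} {x} {y} e v with isZeroP? (num y)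
  ... | yes z = λ m _ → zero⇒cf z m
  ... | no nz with degree (num y) nz
  ... | n , c , b = λ m le → b m (ℕₚ.≤-trans small le)
    where
    bx : Below (mulP (den* y) (num x)) (degDen (den y) + (k + degDen (den x)))
    bx = Below-mulP {den* y} {num x} (proj₂ (HasDeg-prodNZ (den y))) v
    top : cf (mulP (den* y) (num x)) (n + degDen (den x)) ≢ 0ℚ
    top e0 = proj₁ (HasDeg-mulP (num y) (den* x) (c , b) (HasDeg-prodNZ (den x)))
      (trans (sym (at-cf (≈-rep x y e) (n + degDen (den x)))) (trans (at-cf (mulP-comm (num x) (den* y)) (n + degDen (den x))) e0))
    small : suc n ≤ k + degDen (den y)
    small with ℕₚ.≤-total (k + degDen (den y)) n
    ... | inj₁ le = ⊥-elim (top (bx _ (subst (ℕ._≤ n + degDen (den x))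
            (trans (ℕₚ.+-assoc k _ _) (trans (cong (k ℕ.+_) (ℕₚ.+-comm (degDen (den y)) _)) (trans (sym (ℕₚ.+-assoc k _ _)) (ℕₚ.+-comm _ (degDen (den y))))))
            (ℕₚ.+-monoˡ-≤ (degDen (den x)) le))))
    ... | inj₂ ge with ℕₚ.m≤n⇒m<n∨m≡n ge
    ... | inj₁ lt = lt
    ... | inj₂ refl = ⊥-elim (top (bx _ (ℕₚ.≤-reflexive
            (trans (ℕₚ.+-comm (degDen (den y)) _) (trans (ℕₚ.+-assoc k _ _) (trans (cong (k ℕ.+_) (ℕₚ.+-comm (degDen (den x)) _)) (sym (ℕₚ.+-assoc k _ _))))))))

  Val-⊕ : ∀ {k x y} → Val k x → Val k y → Val k (x ⊕ y)
  Val-⊕ {k} {x} {y} vx vy m le = trans (cf-addP (mulP (num x) (den* y)) (mulP (num y) (den* x)) m)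
    (cong₂ ℚ._+_
      (trans (at-cf (mulP-comm (num x) (den* y)) m) (Below-mulP {den* y} {num x} (proj₂ (HasDeg-prodNZ (den y))) vx m
        (subst (ℕ._≤ m) (trans (cong (k ℕ.+_) (trans (degDen-++ (den x) (den y)) (ℕₚ.+-comm (degDen (den x)) _))) (swp k (degDen (den y)) _)) le)))
      (trans (at-cf (mulP-comm (num y) (den* x)) m) (Below-mulP {den* x} {num y} (proj₂ (HasDeg-prodNZ (den x))) vy m
        (subst (ℕ._≤ m) (trans (cong (k ℕ.+_) (degDen-++ (den x) (den y))) (swp k (degDen (den x)) _)) le))))
    where
    swp : ∀ a b c → a + (b + c) ≡ b + (a + c)
    swp a b c = trans (sym (ℕₚ.+-assoc a b c)) (trans (cong (ℕ._+ c) (ℕₚ.+-comm a b)) (ℕₚ.+-assoc b a c))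

  Val-⊛ : ∀ {k x y} → Val 1 x → Val k y → Val k (x ⊛ y)
  Val-⊛ {k} {x} {y} vx vy m le = Below-mulP {num x} {num y} vx vy m
    (subst (ℕ._≤ m) (trans (cong (k ℕ.+_) (degDen-++ (den x) (den y))) (swp k (degDen (den x)) _)) le)
    where
    swp : ∀ a b c → a + (b + c) ≡ b + (a + c)
    swp a b c = trans (sym (ℕₚ.+-assoc a b c)) (trans (cong (ℕ._+ c) (ℕₚ.+-comm a b)) (ℕₚ.+-assoc b a c))

  Val-⊝ : ∀ {k x} → Val k x → Val k (⊝ x)
  Val-⊝ {k} {x} v m le = trans (cf-negP (num x) m) (cong (ℚ.-_) (v m le))

  Val-0 : ∀ {k} → Val k 0f
  Val-0 m le = refl

  Val-weaken : ∀ {x} → Val 0 x → Val 1 x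
  Val-weaken v m le = v m (ℕₚ.≤-trans (ℕₚ.n≤1+n _) le)

  Val-1 : Val 1 1f
  Val-1 (suc m) le = refl

  ¬Val0-1 : ¬ Val 0 1f
  ¬Val0-1 v with v 0 z≤n
  ... | ()

  Val-inv-fromZ : ∀ z → Val 1 (inv (fromZ z))
  Val-inv-fromZ z with isZeroP? (num (fromℤ z))
  ... | yes _ = λ m le → refl
  ... | no nz = λ { (suc m) le → refl }

  -- The linear form αn + c, the shape of a difference of two entries of ζ: n is the difference of
  -- the values of v and c that of the contents.
  lin : ℤ → ℤ → K
  lin n c = αf ⊛ fromZ n ⊕ fromZ c

  private
    lin-cf1 : ∀ n c → cf (num (lin n c)) 1 ≡ n ℚ./ 1
    lin-cf1 n c = trans (cf-addP (mulP (mulP (num αK) (num (fromℤ n))) onePoly) (mulP (num (fromℤ c)) onePoly) 1)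
      (trans (cong₂ ℚ._+_ (trans (at-cf (mulP-identityʳ (mulP (num αK) (num (fromℤ n)))) 1)
         (trans (at-cf (mulP-shiftˡ onePoly (num (fromℤ n))) 1) (at-cf (mulP-identityˡ (num (fromℤ n))) 0)))
         (at-cf (mulP-identityʳ (num (fromℤ c))) 1)) (ℚₚ.+-identityʳ (n ℚ./ 1)))

  lin-cf1-nonzero : ∀ {n} c → n ≢ ℤ.+ 0 → cf (num (lin n c)) 1 ≢ 0ℚ
  lin-cf1-nonzero {n} c nz e = nz (/1-injective {n} {ℤ.+ 0} (trans (sym (lin-cf1 n c)) e))

  lin≉0 : ∀ {n} c → n ≢ ℤ.+ 0 → lin n c ≉ 0f
  lin≉0 {n} c nz e = lin-cf1-nonzero c nz (zero⇒cf (≈0⇒num {lin n c} e) 1)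

  -- The inverse has numerator 1 and a denominator of degree at least 1, because the coefficient of
  -- α is n.
  Val-inv-lin : ∀ {n} c → n ≢ ℤ.+ 0 → Val 0 (inv (lin n c))
  Val-inv-lin {n} c nz with isZeroP? (num (lin n c))
  ... | yes z = λ m _ → refl
  ... | no nz' = λ { zero le → ⊥-elim (ℕₚ.<⇒≱ pos (subst (ℕ._≤ 0) (ℕₚ.+-identityʳ _) le)) ; (suc m) le → refl }
    where
    pos : 1 ≤ degNZ (num (lin n c) , nz')
    pos with degree (num (lin n c)) nz'
    ... | zero , _ , b = ⊥-elim (lin-cf1-nonzero c nz (b 1 (s≤s z≤n)))
    ... | suc k , _ = s≤s z≤n

  lin-def : ∀ n c → lin n c ≡ αf ⊛ fromZ n ⊕ fromZ c
  lin-def n c = refl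

inv-left : ∀ {x} → x ≉ 0f → inv x ⊛ x ≈ 1f
inv-left nz = ≈-trans (KRing.*-comm _ _) (inv-right nz)

⊛-cancelˡ : ∀ {x y} → x ≉ 0f → x ⊛ y ≈ 0f → y ≈ 0f
⊛-cancelˡ {x} {y} nz h = begin
  y ≈⟨ ≈-sym (KRing.*-identityˡ y) ⟩
  1f ⊛ y ≈⟨ ⊛-congʳ (≈-sym (inv-left nz)) ⟩
  (inv x ⊛ x) ⊛ y ≈⟨ KRing.*-assoc _ _ _ ⟩
  inv x ⊛ (x ⊛ y) ≈⟨ ⊛-zeroʳ h ⟩
  0f ∎ where open SetoidReasoning KRing.setoid

⊛-nonzero : ∀ {x y} → x ≉ 0f → y ≉ 0f → x ⊛ y ≉ 0f
⊛-nonzero nx ny h = ny (⊛-cancelˡ nx h)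

inv-unique : ∀ {x y} → x ⊛ y ≈ 1f → y ≈ inv x
inv-unique {x} {y} h = begin
  y ≈⟨ ≈-sym (KRing.*-identityˡ y) ⟩
  1f ⊛ y ≈⟨ ⊛-congʳ (≈-sym (inv-left nz)) ⟩
  (inv x ⊛ x) ⊛ y ≈⟨ KRing.*-assoc _ _ _ ⟩
  inv x ⊛ (x ⊛ y) ≈⟨ ⊛-congˡ h ⟩
  inv x ⊛ 1f ≈⟨ KRing.*-identityʳ _ ⟩
  inv x ∎
  where
  open SetoidReasoning KRing.setoid
  nz : x ≉ 0f
  nz e = 1≉0 (≈-trans (≈-sym h) (⊛-zeroˡ e))

inv-cong : ∀ {x y} → x ≈ y → inv x ≈ inv y
inv-cong {x} {y} e with x ≈0?
... | yes z = ≈-trans (inv-zero z) (≈-sym (inv-zero (≈-trans (≈-sym e) z)))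
... | no nz = inv-unique (≈-trans (⊛-congʳ (≈-sym e)) (inv-right nz))

inv-nonzero : ∀ {x} → x ≉ 0f → inv x ≉ 0f
inv-nonzero nz e = 1≉0 (≈-trans (≈-sym (inv-right nz)) (⊛-zeroʳ e))

inv-⊝ : ∀ {x} → x ≉ 0f → inv (⊝ x) ≈ ⊝ inv x
inv-⊝ {x} nz = ≈-sym (inv-unique (≈-trans (KS.solve 2 (λ x y → (KS.:- x) KS.:* (KS.:- y) KS.:= x KS.:* y) ≈-refl x (inv x)) (inv-right nz)))

-- 1/(a+b) · (1/a + 1/b) = 1/a · 1/b, the only identity behind the braid and Yang–Baxter relations
inv-sum : ∀ {a b} → a ≉ 0f → b ≉ 0f → a ⊕ b ≉ 0f → inv (a ⊕ b) ⊛ (inv a ⊕ inv b) ≈ inv a ⊛ inv b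
inv-sum {a} {b} na nb nc = begin
  C ⊛ (A ⊕ B) ≈⟨ ⊛-congˡ (⊕-cong (≈-sym (≈-trans (⊛-congˡ (inv-right nb)) (KRing.*-identityʳ A))) (≈-sym (≈-trans (⊛-congˡ (inv-right na)) (KRing.*-identityʳ B)))) ⟩
  C ⊛ (A ⊛ (b ⊛ B) ⊕ B ⊛ (a ⊛ A)) ≈⟨ KS.solve 5 (λ A B C a b → C KS.:* (A KS.:* (b KS.:* B) KS.:+ B KS.:* (a KS.:* A)) KS.:= ((a KS.:+ b) KS.:* C) KS.:* (A KS.:* B)) ≈-refl A B C a b ⟩
  ((a ⊕ b) ⊛ C) ⊛ (A ⊛ B) ≈⟨ ⊛-congʳ (inv-right nc) ⟩
  1f ⊛ (A ⊛ B) ≈⟨ KRing.*-identityˡ _ ⟩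
  A ⊛ B ∎
  where
  open SetoidReasoning KRing.setoid
  A B C : K
  A = inv a
  B = inv b
  C = inv (a ⊕ b)

fromZ-neg : ∀ a → fromZ (ℤ.- a) ≈ ⊝ fromZ a
fromZ-neg a = begin
  fromZ (ℤ.- a) ≈⟨ KS.solve 2 (λ x y → x KS.:= (x KS.:+ y) KS.:+ KS.:- y) ≈-refl (fromZ (ℤ.- a)) (fromZ a) ⟩
  (fromZ (ℤ.- a) ⊕ fromZ a) ⊕ ⊝ fromZ a ≈⟨ ⊕-congʳ (≈-trans (≈-sym (fromZ-+ (ℤ.- a) a)) (≈-trans (≡⇒≈ (cong fromZ (ℤₚ.+-inverseˡ a))) fromZ-0)) ⟩
  0f ⊕ ⊝ fromZ a ≈⟨ KRing.+-identityˡ _ ⟩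
  ⊝ fromZ a ∎ where open SetoidReasoning KRing.setoid

fromZ-sub : ∀ a b → fromZ (a ℤ.- b) ≈ fromZ a ⊖ᶠ fromZ b
fromZ-sub a b = ≈-trans (fromZ-+ a (ℤ.- b)) (⊕-congˡ (fromZ-neg b))

fromZ≉0 : ∀ {a} → a ≢ ℤ.+ 0 → fromZ a ≉ 0f
fromZ≉0 nz e = nz (fromZ≈0 e)

2≉0 : 1f ⊕ 1f ≉ 0f
2≉0 e with fromZ≈0 (≈-trans (fromZ-+ (ℤ.+ 1) (ℤ.+ 1)) (≈-trans (⊕-cong fromZ-1 fromZ-1) e))
... | ()

-- Counting letters and exchanging neighbours in lists

≡ᵇ-refl : ∀ x → (x ≡ᵇ x) ≡ true
≡ᵇ-refl zero = refl
≡ᵇ-refl (suc x) = ≡ᵇ-refl x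

≡ᵇ-≢ : ∀ {x y} → x ≢ y → (x ≡ᵇ y) ≡ false
≡ᵇ-≢ {zero} {zero} n = ⊥-elim (n refl)
≡ᵇ-≢ {zero} {suc y} n = refl
≡ᵇ-≢ {suc x} {zero} n = refl
≡ᵇ-≢ {suc x} {suc y} n = ≡ᵇ-≢ (n ∘ cong suc)

count-same : ∀ x r → count x (x ∷ r) ≡ suc (count x r)
count-same x r rewrite ≡ᵇ-refl x = refl

count-diff : ∀ {x y} r → x ≢ y → count x (y ∷ r) ≡ count x r
count-diff r n rewrite ≡ᵇ-≢ n = refl

count-∷ : ∀ x y r → count x (y ∷ r) ≡ count x (y ∷ []) + count x r
count-∷ x y r with x ≡ᵇ y
... | true = refl
... | false = refl

count-++ : ∀ x u r → count x (u ++ r) ≡ count x u + count x r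
count-++ x [] r = refl
count-++ x (y ∷ u) r = trans (count-∷ x y (u ++ r)) (trans (cong (count x (y ∷ []) ℕ.+_) (count-++ x u r))
  (trans (sym (ℕₚ.+-assoc (count x (y ∷ [])) _ _)) (cong (ℕ._+ count x r) (sym (count-∷ x y u)))))

count-≤-∷ : ∀ x y r → count x r ≤ count x (y ∷ r)
count-≤-∷ x y r rewrite count-∷ x y r = ℕₚ.m≤n+m _ (count x (y ∷ []))

count-swap : ∀ c x y r → count c (x ∷ y ∷ r) ≡ count c (y ∷ x ∷ r)
count-swap c x y r rewrite count-∷ c x (y ∷ r) | count-∷ c y r | count-∷ c y (x ∷ r) | count-∷ c x r =
  trans (sym (ℕₚ.+-assoc (count c (x ∷ [])) _ _)) (trans (cong (ℕ._+ count c r) (ℕₚ.+-comm (count c (x ∷ [])) _)) (ℕₚ.+-assoc (count c (y ∷ [])) _ _))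

count-++-cong : ∀ c u {r r'} → count c r ≡ count c r' → count c (u ++ r) ≡ count c (u ++ r')
count-++-cong c u {r} {r'} e = trans (count-++ c u r) (trans (cong (count c u ℕ.+_) e) (sym (count-++ c u r')))

count-swap0 : ∀ c r q → count c (swap0 r q) ≡ count c r
count-swap0 c [] q = refl
count-swap0 c (x ∷ []) zero = refl
count-swap0 c (x ∷ y ∷ r) zero = count-swap c y x r
count-swap0 c (x ∷ []) (suc zero) = refl
count-swap0 c (x ∷ []) (suc (suc q)) = refl
count-swap0 c (x ∷ r@(_ ∷ _)) (suc q) = count-++-cong c (x ∷ []) (count-swap0 c r q)

swap0-split : ∀ {A : Set} (u : List A) x y r → swap0 (u ++ x ∷ y ∷ r) (length u) ≡ u ++ y ∷ x ∷ r
swap0-split [] x y r = refl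
swap0-split (a ∷ []) x y r = refl
swap0-split (a ∷ b ∷ u) x y r = cong (a ∷_) (swap0-split (b ∷ u) x y r)

swap0-∷ : ∀ {A : Set} (x : A) r q → swap0 (x ∷ r) (suc q) ≡ x ∷ swap0 r q
swap0-∷ x [] zero = refl
swap0-∷ x [] (suc q) = refl
swap0-∷ x (y ∷ r) q = refl

length-swap0 : ∀ {A : Set} (r : List A) q → length (swap0 r q) ≡ length r
length-swap0 [] q = refl
length-swap0 (x ∷ []) zero = refl
length-swap0 (x ∷ y ∷ r) zero = refl
length-swap0 (x ∷ r) (suc q) = trans (cong length (swap0-∷ x r q)) (cong suc (length-swap0 r q))

swap0-invol : ∀ {A : Set} (r : List A) q → swap0 (swap0 r q) q ≡ r
swap0-invol [] q = refl
swap0-invol (x ∷ []) zero = refl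
swap0-invol (x ∷ y ∷ r) zero = refl
swap0-invol (x ∷ r) (suc q) = trans (cong (λ s → swap0 s (suc q)) (swap0-∷ x r q))
  (trans (swap0-∷ x (swap0 r q) q) (cong (x ∷_) (swap0-invol r q)))

swap0-comm : ∀ {A : Set} (r : List A) p q → suc (suc p) ≤ q → swap0 (swap0 r p) q ≡ swap0 (swap0 r q) p
swap0-comm [] p q le = refl
swap0-comm (x ∷ []) zero (suc (suc q)) le = refl
swap0-comm (x ∷ y ∷ r) zero (suc (suc q)) le = trans (swap0-∷ y (x ∷ r) (suc q)) (trans (cong (y ∷_) (swap0-∷ x r q))
  (sym (cong (λ s → swap0 s zero) (trans (swap0-∷ x (y ∷ r) (suc q)) (cong (x ∷_) (swap0-∷ y r q))))))
swap0-comm (x ∷ []) zero (suc zero) (s≤s ())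
swap0-comm (x ∷ y ∷ r) zero (suc zero) (s≤s ())
swap0-comm (x ∷ r) (suc p) (suc q) (s≤s le) = trans (cong (λ s → swap0 s (suc q)) (swap0-∷ x r p))
  (trans (swap0-∷ x (swap0 r p) q) (trans (cong (x ∷_) (swap0-comm r p q le))
  (sym (trans (cong (λ s → swap0 s (suc p)) (swap0-∷ x r q)) (swap0-∷ x (swap0 r q) p)))))

swap0-braid : ∀ {A : Set} (r : List A) p → suc (suc p) < length r →
  swap0 (swap0 (swap0 r p) (suc p)) p ≡ swap0 (swap0 (swap0 r (suc p)) p) (suc p)
swap0-braid (x ∷ y ∷ z ∷ r) zero lt = refl
swap0-braid (x ∷ r) (suc p) (s≤s lt)
  rewrite swap0-∷ x r p | swap0-∷ x r (suc p) | swap0-∷ x (swap0 r p) (suc p) | swap0-∷ x (swap0 r (suc p)) p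
        | swap0-∷ x (swap0 (swap0 r p) (suc p)) p | swap0-∷ x (swap0 (swap0 r (suc p)) p) (suc p) = cong (x ∷_) (swap0-braid r p lt)
swap0-braid (x ∷ []) zero (s≤s ())
swap0-braid (x ∷ y ∷ []) zero (s≤s (s≤s ()))

split₂ : ∀ {A : Set} (t : List A) p → suc p < length t → ∃[ u ] ∃[ x ] ∃[ y ] ∃[ r ] (t ≡ u ++ x ∷ y ∷ r × length u ≡ p)
split₂ (x ∷ y ∷ r) zero lt = [] , x , y , r , refl , refl
split₂ (x ∷ r) (suc p) (s≤s lt) with split₂ r p lt
... | u , a , b , s , refl , refl = x ∷ u , a , b , s , refl , refl
split₂ (x ∷ []) zero (s≤s ())

split₁ : ∀ {A : Set} (t : List A) p → p < length t → ∃[ u ] ∃[ x ] ∃[ r ] (t ≡ u ++ x ∷ r × length u ≡ p)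
split₁ (x ∷ r) zero lt = [] , x , r , refl , refl
split₁ (x ∷ r) (suc p) (s≤s lt) with split₁ r p lt
... | u , a , s , refl , refl = x ∷ u , a , s , refl , refl

-- Reversed words: position p of t = reverse w holds the row of the entry p + 1.

-- The content of the box added in row `x` to the boxes of `r`: `count x r` is its 0-based column,
-- and the two shifts from 1-based numbering cancel.
ctAt : ℕ → List ℕ → ℤ
ctAt x r = ℤ.+ count x r ℤ.- ℤ.+ x

ct : List ℕ → ℕ → ℤ
ct [] p = ℤ.+ 0
ct (x ∷ r) zero = ctAt x r
ct (x ∷ r) (suc p) = ct r p

-- The axial distance between the entries p + 1 and p + 2, that is 1/b for the coefficient b of the
-- action of s_{p+1}.
dd : ℕ → List ℕ → ℤ
dd p t = ct t p ℤ.- ct t (suc p)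

ct-split : ∀ u x r → ct (u ++ x ∷ r) (length u) ≡ ctAt x r
ct-split [] x r = refl
ct-split (_ ∷ u) x r = ct-split u x r

ct-split′ : ∀ u x y r → ct (u ++ x ∷ y ∷ r) (suc (length u)) ≡ ctAt y r
ct-split′ [] x y r = refl
ct-split′ (_ ∷ u) x y r = ct-split′ u x y r

ct-swap-far : ∀ t p q → suc p ≤ q ⊎ suc (suc q) ≤ p → ct (swap0 t q) p ≡ ct t p
ct-swap-far [] p q h = refl
ct-swap-far (x ∷ []) p zero h = refl
ct-swap-far (x ∷ y ∷ r) (suc (suc p)) zero h = refl
ct-swap-far (x ∷ y ∷ r) zero zero (inj₁ ())
ct-swap-far (x ∷ y ∷ r) zero zero (inj₂ ())
ct-swap-far (x ∷ y ∷ r) (suc zero) zero (inj₁ ())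
ct-swap-far (x ∷ y ∷ r) (suc zero) zero (inj₂ (s≤s ()))
ct-swap-far (x ∷ r) zero (suc q) h rewrite swap0-∷ x r q = cong (λ c → ℤ.+ c ℤ.- ℤ.+ x) (count-swap0 x r q)
ct-swap-far (x ∷ r) (suc p) (suc q) h rewrite swap0-∷ x r q = ct-swap-far r p q (pred h)
  where
  pred : suc (suc p) ≤ suc q ⊎ suc (suc (suc q)) ≤ suc p → suc p ≤ q ⊎ suc (suc q) ≤ p
  pred (inj₁ (s≤s l)) = inj₁ l
  pred (inj₂ (s≤s l)) = inj₂ l

dd-swap-far : ∀ t p q → suc (suc p) ≤ q ⊎ suc (suc q) ≤ p → dd p (swap0 t q) ≡ dd p t
dd-swap-far t p q (inj₁ h) = cong₂ ℤ._-_ (ct-swap-far t p q (inj₁ (ℕₚ.≤-trans (ℕₚ.n≤1+n _) h))) (ct-swap-far t (suc p) q (inj₁ h))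
dd-swap-far t p q (inj₂ h) = cong₂ ℤ._-_ (ct-swap-far t p q (inj₂ h)) (ct-swap-far t (suc p) q (inj₂ (ℕₚ.≤-trans h (ℕₚ.n≤1+n _))))

-- The condition that a box may be added at the end of row `x`: the row below must be longer.
Step : List ℕ → ℕ → Set
Step r zero = ⊤
Step r (suc x) = count (suc x) r < count x r

-- Lattice (ballot) words read from the end: the letter counts of every suffix form a partition.
-- Since a suffix of a reversed word holds the largest entries, this says that rows and columns
-- decrease.
Lat : ℕ → List ℕ → Set
Lat l [] = ⊤
Lat l (x ∷ r) = x < l × Step r x × Lat l r

count-mono-suc : ∀ {l} r → Lat l r → ∀ x → count (suc x) r ≤ count x r
count-mono-suc [] _ x = z≤n
count-mono-suc (y ∷ r) (_ , st , lt) x with suc x ℕ.≟ y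
... | yes refl = subst₂ _≤_ (sym (count-same (suc x) r)) (sym (count-diff r (ℕₚ.<⇒≢ (ℕₚ.n<1+n x)))) st
... | no ne = subst (ℕ._≤ count x (y ∷ r)) (sym (count-diff r ne)) (ℕₚ.≤-trans (count-mono-suc r lt x) (count-≤-∷ x y r))

count-mono : ∀ {l} r → Lat l r → ∀ {x y} → x ≤ y → count y r ≤ count x r
count-mono r lt {x} {y} le = go (ℕₚ.≤⇒≤′ le)
  where
  go : ∀ {y} → x ℕ.≤′ y → count y r ≤ count x r
  go ℕ.≤′-refl = ℕₚ.≤-refl
  go (ℕ.≤′-step s) = ℕₚ.≤-trans (count-mono-suc r lt _) (go s)

Step-count : ∀ {l} r → Lat l r → ∀ {x y} → x < y → Step r y → count y r < count x r
Step-count r lt {x} {suc y} (s≤s le) st = ℕₚ.<-≤-trans st (count-mono r lt le)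

Lat-≤ : ∀ {r r' x} → count x r ≡ count x r' → (∀ {z} → suc z ≡ x → count z r ≤ count z r') → Step r x → Step r' x
Lat-≤ {x = zero} e h st = tt
Lat-≤ {x = suc x} e h st = ℕₚ.≤-trans (subst (ℕ._< _) e st) (h refl)

Lat-++ : ∀ {l r r'} u → (∀ c → count c r ≡ count c r') → Lat l r' → Lat l (u ++ r) → Lat l (u ++ r')
Lat-++ [] e lt _ = lt
Lat-++ (x ∷ u) e lt (b , st , lt') = b , Lat-≤ {x = x} (count-++-cong x u (e x)) (λ {z} _ → ℕₚ.≤-reflexive (count-++-cong z u (e z))) st , Lat-++ u e lt lt'

Lat-drop : ∀ {l r} u → Lat l (u ++ r) → Lat l r
Lat-drop [] lt = lt
Lat-drop (x ∷ u) (_ , _ , lt) = Lat-drop u lt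

diff-⊖ : ∀ a x b y → (ℤ.+ a ℤ.- ℤ.+ x) ℤ.- (ℤ.+ b ℤ.- ℤ.+ y) ≡ (a + y) ⊖ (b + x)
diff-⊖ a x b y = begin
  (ℤ.+ a ℤ.- ℤ.+ x) ℤ.- (ℤ.+ b ℤ.- ℤ.+ y)
    ≡⟨ ℤ-lin (ℤ.+ a) (ℤ.+ x) (ℤ.+ b) (ℤ.+ y) ⟩
  (ℤ.+ a ℤ.+ ℤ.+ y) ℤ.- (ℤ.+ b ℤ.+ ℤ.+ x) ≡⟨ ℤₚ.m-n≡m⊖n (a + y) (b + x) ⟩
  (a + y) ⊖ (b + x) ∎
  where
  open ≡-Reasoning
  module IS = IntegerSolver ℤₚ.+-*-commutativeRing
  ℤ-lin : ∀ a x b y → (a ℤ.- x) ℤ.- (b ℤ.- y) ≡ (a ℤ.+ y) ℤ.- (b ℤ.+ x)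
  ℤ-lin = IS.solve 4 (λ a x b y → (a IS.:- x) IS.:- (b IS.:- y) IS.:= (a IS.:+ y) IS.:- (b IS.:+ x)) refl

⊖-pos : ∀ n k → (n + k) ⊖ n ≡ ℤ.+ k
⊖-pos n k = trans (ℤₚ.⊖-≥ (ℕₚ.m≤m+n n k)) (cong ℤ.+_ (ℕₚ.m+n∸m≡n n k))

⊖-neg : ∀ n k → n ⊖ (n + k) ≡ ℤ.- (ℤ.+ k)
⊖-neg n k = trans (ℤₚ.⊖-≤ (ℕₚ.m≤m+n n k)) (cong (λ z → ℤ.- (ℤ.+ z)) (ℕₚ.m+n∸m≡n n k))

gap : ∀ {a b} → a ≤ b → ∃[ k ] b ≡ a + k
gap {a} {b} le = b ∸ a , sym (ℕₚ.m+[n∸m]≡n le)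

-- The four relative positions of two consecutive entries, the later one lying in row x
data Adj (l x y : ℕ) (r : List ℕ) : Set where
  row  : x ≡ y → ctAt x (y ∷ r) ℤ.- ctAt y r ≡ ℤ.+ 1 → Adj l x y r
  col  : x ≡ suc y → count x r ≡ count y r → ctAt x (y ∷ r) ℤ.- ctAt y r ≡ -[1+ 0 ] → Adj l x y r
  fall : ∀ k → x < y → ctAt x (y ∷ r) ℤ.- ctAt y r ≡ ℤ.+ (suc (suc k)) → Lat l (y ∷ x ∷ r) → Adj l x y r
  rise : ∀ k → y < x → ctAt x (y ∷ r) ℤ.- ctAt y r ≡ -[1+ suc k ] → Lat l (y ∷ x ∷ r) → Adj l x y r

ctAt-diff : ∀ {x y} r → x ≢ y → ctAt x (y ∷ r) ≡ ctAt x r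
ctAt-diff {x} r n = cong (λ c → ℤ.+ c ℤ.- ℤ.+ x) (count-diff r n)

-- The axial distance is a row gap plus a column gap, and the lattice condition gives the two gaps
-- weakly the same sign. So it is 1 or -1 only for neighbours in a row or column; in all other cases
-- the boxes do not block each other and the exchanged word is again a lattice word.
adj : ∀ l x y r → Lat l (x ∷ y ∷ r) → Adj l x y r
adj l x y r (xl , sx , yl , sy , lt) with ℕₚ.<-cmp x y
... | tri≈ _ refl _ = row refl (trans (diff-⊖ (count x (x ∷ r)) x (count x r) x)
      (trans (cong (λ c → (c + x) ⊖ (count x r + x)) (count-same x r)) (trans (cong (ℤ._⊖ (count x r + x)) (ℕₚ.+-comm 1 (count x r + x))) (⊖-pos (count x r + x) 1))))
... | tri< x<y x≢y _ with gap (Step-count r lt x<y sy) | gap x<y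
... | k , e | j , e' = fall (k + j) x<y (trans (cong (ℤ._- ctAt y r) (ctAt-diff r x≢y)) (trans (diff-⊖ (count x r) x (count y r) y)
       (trans (cong (ℤ._⊖ (count y r + x)) (trans (cong₂ _+_ e e') (arith (count y r) k x j))) (⊖-pos (count y r + x) _))))
       (yl , Lat-≤ {r} {x ∷ r} {y} (sym (count-diff r (x≢y ∘ sym))) (λ {z} _ → count-≤-∷ z x r) sy
       , xl , Lat-≤ {y ∷ r} {r} {x} (count-diff r x≢y) (λ {z} z≡ → ℕₚ.≤-reflexive (count-diff r (λ z≡y → ℕₚ.<⇒≱ x<y (subst (_≤ x) z≡y (subst (z ≤_) z≡ (ℕₚ.n≤1+n z)))))) sx , lt)
  where
  arith : ∀ b k x j → suc b + k + (suc x + j) ≡ (b + x) + suc (suc (k + j))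
  arith = solve-∀
adj l (suc x) y r (xl , sx , yl , sy , lt) | tri> _ x≢y (s≤s y≤x) with y ℕ.≟ x | suc (count (suc x) r) ℕ.≤? count y r
... | yes refl | no nle = col refl eq (trans (cong (ℤ._- ctAt y r) (ctAt-diff r x≢y)) (trans (diff-⊖ (count (suc x) r) (suc x) (count y r) y)
       (trans (cong (λ c → (c + x) ⊖ (count x r + suc x)) eq) (trans (cong ((count x r + x) ℤ.⊖_) (trans (ℕₚ.+-suc (count x r) x) (ℕₚ.+-comm 1 _))) (⊖-neg (count x r + x) 1)))))
  where
  eq : count (suc x) r ≡ count x r
  eq = ℕₚ.≤-antisym (count-mono-suc r lt x) (ℕₚ.≤-pred (ℕₚ.≰⇒> nle))
... | yes refl | yes le with gap le
... | k , e = rise k (ℕₚ.n<1+n x) (trans (cong (ℤ._- ctAt y r) (ctAt-diff r x≢y)) (trans (diff-⊖ (count (suc x) r) (suc x) (count y r) y)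
       (trans (cong ((count (suc x) r + x) ℤ.⊖_) (trans (cong (ℕ._+ suc x) e) (arith (count (suc x) r) k x))) (⊖-neg (count (suc x) r + x) _))))
       (yl , Lat-≤ {r} {suc x ∷ r} {y} (sym (count-diff r (x≢y ∘ sym))) (λ {z} _ → count-≤-∷ z (suc x) r) sy , xl , le , lt)
  where
  arith : ∀ c k x → suc c + k + suc x ≡ (c + x) + suc (suc k)
  arith = solve-∀
adj l (suc x) y r (xl , sx , yl , sy , lt) | tri> _ x≢y (s≤s y≤x) | no y≢x | _ with gap (ℕₚ.≤∧≢⇒< y≤x y≢x) | gap (count-mono r lt y≤x′)
  where
  y≤x′ : y ≤ suc x
  y≤x′ = ℕₚ.≤-trans y≤x (ℕₚ.n≤1+n x)
... | j , e' | k , e = rise (k + j) (s≤s y≤x) (trans (cong (ℤ._- ctAt y r) (ctAt-diff r x≢y)) (trans (diff-⊖ (count (suc x) r) (suc x) (count y r) y)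
       (trans (cong ((count (suc x) r + y) ℤ.⊖_) (trans (cong₂ _+_ e (cong suc e')) (arith (count (suc x) r) k y j))) (⊖-neg (count (suc x) r + y) _))))
       (yl , Lat-≤ {r} {suc x ∷ r} {y} (sym (count-diff r (x≢y ∘ sym))) (λ {z} _ → count-≤-∷ z (suc x) r) sy
       , xl , subst₂ _<_ (count-diff r x≢y) (count-diff r (y≢x ∘ sym)) sx , lt)
  where
  arith : ∀ c k y j → (c + k) + suc (suc y + j) ≡ (c + y) + suc (suc (k + j))
  arith = solve-∀

ctAt-cross : ∀ a x b y → ℤ.+ a ℤ.- ℤ.+ x ≡ ℤ.+ b ℤ.- ℤ.+ y → a + y ≡ b + x
ctAt-cross a x b y e = ℤₚ.+-injective (begin
  ℤ.+ a ℤ.+ ℤ.+ y ≡⟨ IS.solve 3 (λ a x y → a IS.:+ y IS.:= (a IS.:- x) IS.:+ (x IS.:+ y)) refl (ℤ.+ a) (ℤ.+ x) (ℤ.+ y) ⟩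
  (ℤ.+ a ℤ.- ℤ.+ x) ℤ.+ (ℤ.+ x ℤ.+ ℤ.+ y) ≡⟨ cong (ℤ._+ (ℤ.+ x ℤ.+ ℤ.+ y)) e ⟩
  (ℤ.+ b ℤ.- ℤ.+ y) ℤ.+ (ℤ.+ x ℤ.+ ℤ.+ y) ≡⟨ IS.solve 3 (λ b x y → (b IS.:- y) IS.:+ (x IS.:+ y) IS.:= b IS.:+ x) refl (ℤ.+ b) (ℤ.+ x) (ℤ.+ y) ⟩
  ℤ.+ b ℤ.+ ℤ.+ x ∎)
  where
  open ≡-Reasoning
  module IS = IntegerSolver ℤₚ.+-*-commutativeRing

-- Between two boxes on one diagonal at least two others have to be filled, so entries at distance
-- two have different contents. This keeps the third denominator of the braid relation nonzero.
ctAt-distinct₃ : ∀ l x y z r → Lat l (x ∷ y ∷ z ∷ r) → ctAt x (y ∷ z ∷ r) ≢ ctAt z r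
ctAt-distinct₃ l x y z r (xl , sx , yl , sy , zl , sz , lt) e = go (ℕₚ.<-cmp x z)
  where
  cross : count x (y ∷ z ∷ r) + z ≡ count z r + x
  cross = ctAt-cross (count x (y ∷ z ∷ r)) x (count z r) z e
  go : Tri (x < z) (x ≡ z) (z < x) → ⊥
  go (tri≈ _ refl _) = ℕₚ.<⇒≢ (ℕₚ.<-≤-trans (ℕₚ.≤-reflexive (sym (count-same x r))) (count-≤-∷ x y (x ∷ r)))
    (sym (ℕₚ.+-cancelʳ-≡ x _ _ cross))
  go (tri< x<z _ _) = ℕₚ.<⇒≢ (ℕₚ.+-mono-≤-< (ℕₚ.≤-trans (count-mono r lt (ℕₚ.<⇒≤ x<z)) (ℕₚ.≤-trans (count-≤-∷ x z r) (count-≤-∷ x y (z ∷ r)))) x<z) (sym cross)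
  go (tri> _ x≢z z<x) = ℕₚ.<⇒≢ (ℕₚ.+-mono-≤-< bound z<x) cross
    where
    bound : count x (y ∷ z ∷ r) ≤ count z r
    bound with x ℕ.≟ y
    ... | no x≢y = subst (ℕ._≤ count z r) (sym (trans (count-diff (z ∷ r) x≢y) (count-diff r x≢z))) (count-mono r lt (ℕₚ.<⇒≤ z<x))
    ... | yes refl = below x z<x x≢z sx sy
      where
      below : ∀ x → z < x → x ≢ z → Step (x ∷ z ∷ r) x → Step (z ∷ r) x → count x (x ∷ z ∷ r) ≤ count z r
      below (suc x) z<x x≢z sx sy with x ℕ.≟ z
      ... | yes refl = ℕₚ.≤-pred (subst (count (suc x) (suc x ∷ x ∷ r) ℕ.<_) (trans (count-diff {x} {suc x} (x ∷ r) (λ ())) (count-same x r)) sx)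
      ... | no x≢z′ = ℕₚ.<⇒≤ (ℕₚ.<-≤-trans (subst (count (suc x) (suc x ∷ z ∷ r) ℕ.<_) (trans (count-diff {x} {suc x} (z ∷ r) (λ ())) (count-diff r x≢z′)) sx)
              (count-mono r lt (ℕₚ.≤-pred z<x)))

record Valid (lam t : List ℕ) : Set where
  constructor valid
  field
    lattice : Lat (length lam) t
    shape   : ∀ x → x < length lam → count x t ≡ idx0 lam x
    size    : length t ≡ sum lam
open Valid public

data Place (lam : List ℕ) (p : ℕ) (t : List ℕ) : Set where
  same-row    : dd p t ≡ ℤ.+ 1 → Place lam p t
  same-col    : dd p t ≡ -[1+ 0 ] → Place lam p t
  exchange    : ∀ k → dd p t ≡ ℤ.+ (suc (suc k)) ⊎ dd p t ≡ -[1+ suc k ] → Valid lam (swap0 t p) →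
                ct (swap0 t p) p ≡ ct t (suc p) → ct (swap0 t p) (suc p) ≡ ct t p → Place lam p t

swap-valid : ∀ {lam} u x y r → Valid lam (u ++ x ∷ y ∷ r) → Lat (length lam) (y ∷ x ∷ r) → Valid lam (u ++ y ∷ x ∷ r)
swap-valid {lam} u x y r v lt = valid (Lat-++ u (λ c → count-swap c x y r) lt (lattice v))
  (λ c lt → trans (count-++-cong c u (count-swap c y x r)) (shape v c lt))
  (trans (trans (Listₚ.length-++ u) (sym (Listₚ.length-++ u))) (size v))

ct-exchange : ∀ u {x y} r → x ≢ y → (ct (u ++ y ∷ x ∷ r) (length u) ≡ ct (u ++ x ∷ y ∷ r) (suc (length u)))
                                 × (ct (u ++ y ∷ x ∷ r) (suc (length u)) ≡ ct (u ++ x ∷ y ∷ r) (length u))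
ct-exchange u {x} {y} r ne =
  trans (ct-split u y (x ∷ r)) (trans (ctAt-diff r (ne ∘ sym)) (sym (ct-split′ u x y r))) ,
  trans (ct-split′ u y x r) (sym (trans (ct-split u x (y ∷ r)) (ctAt-diff r ne)))

dd-split : ∀ u x y r → dd (length u) (u ++ x ∷ y ∷ r) ≡ ctAt x (y ∷ r) ℤ.- ctAt y r
dd-split u x y r = cong₂ ℤ._-_ (ct-split u x (y ∷ r)) (ct-split′ u x y r)

place : ∀ {lam t p} → Valid lam t → suc p < length t → Place lam p t
place {lam} {t} {p} v lt with split₂ t p lt
... | u , x , y , r , refl , refl with adj (length lam) x y r (Lat-drop u (lattice v))
... | row _ e = same-row (trans (dd-split u x y r) e)
... | col _ _ e = same-col (trans (dd-split u x y r) e)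
... | fall k x<y e lt' = let (c , c') = ct-exchange u r (ℕₚ.<⇒≢ x<y) in
      exchange k (inj₁ (trans (dd-split u x y r) e)) (subst (Valid lam) (sym (swap0-split u x y r)) (swap-valid u x y r v lt'))
        (trans (cong (λ s → ct s (length u)) (swap0-split u x y r)) c) (trans (cong (λ s → ct s (suc (length u))) (swap0-split u x y r)) c')
... | rise k y<x e lt' = let (c , c') = ct-exchange u r (ℕₚ.<⇒≢ y<x ∘ sym) in
      exchange k (inj₂ (trans (dd-split u x y r) e)) (subst (Valid lam) (sym (swap0-split u x y r)) (swap-valid u x y r v lt'))
        (trans (cong (λ s → ct s (length u)) (swap0-split u x y r)) c) (trans (cong (λ s → ct s (suc (length u))) (swap0-split u x y r)) c')

ct-distinct₂ : ∀ {lam t p} → Valid lam t → suc p < length t → ct t p ≢ ct t (suc p)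
ct-distinct₂ {lam} {t} {p} v lt e with place v lt
... | same-row d = contr (trans (sym d) (ℤₚ.i≡j⇒i-j≡0 e)) where
  contr : ℤ.+ 1 ≡ ℤ.+ 0 → ⊥
  contr ()
... | same-col d = contr (trans (sym d) (ℤₚ.i≡j⇒i-j≡0 e)) where
  contr : -[1+ 0 ] ≡ ℤ.+ 0 → ⊥
  contr ()
... | exchange k (inj₁ d) _ _ _ = contr (trans (sym d) (ℤₚ.i≡j⇒i-j≡0 e)) where
  contr : ℤ.+ suc (suc k) ≡ ℤ.+ 0 → ⊥
  contr ()
... | exchange k (inj₂ d) _ _ _ = contr (trans (sym d) (ℤₚ.i≡j⇒i-j≡0 e)) where
  contr : -[1+ suc k ] ≡ ℤ.+ 0 → ⊥
  contr ()

ct-distinct₃ : ∀ {lam t p} → Valid lam t → suc (suc p) < length t → ct t p ≢ ct t (suc (suc p))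
ct-distinct₃ {lam} {t} {p} v lt e with split₂ t p (ℕₚ.≤-trans (ℕₚ.n≤1+n _) lt)
... | u , x , y , [] , refl , refl = ℕₚ.<⇒≱ lt (ℕₚ.≤-reflexive (trans (Listₚ.length-++ u) (ℕₚ.+-comm (length u) 2)))
... | u , x , y , z ∷ r , refl , refl = ctAt-distinct₃ (length lam) x y z r (Lat-drop u (lattice v))
      (trans (sym (ct-split u x (y ∷ z ∷ r))) (trans e (third u)))
  where
  third : ∀ u → ct (u ++ x ∷ y ∷ z ∷ r) (suc (suc (length u))) ≡ ctAt z r
  third [] = refl
  third (_ ∷ u) = third u

β : ℤ → K
β d = inv (fromZ d)

-- The coefficient of a tableau t in the image of its exchange t′, as a function of the axial
-- distance d of t. Acting on coefficients transposes the matrix, so the rule is applied to t′,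
-- whose distance is -d: it contributes 1 for d ≤ -2, 1 - b² for d ≥ 2, and nothing for d = 1 or -1.
κ : ℤ → K
κ -[1+ suc n ] = 1f
κ -[1+ zero ] = 0f
κ (ℤ.+ suc zero) = 0f
κ d = 1f ⊖ᶠ β d ⊛ β d

β-neg : ∀ {d} → d ≢ ℤ.+ 0 → β (ℤ.- d) ≈ ⊝ β d
β-neg {d} nz = ≈-trans (inv-cong (fromZ-neg d)) (inv-⊝ (fromZ≉0 nz))

β-1 : β (ℤ.+ 1) ≈ 1f
β-1 = ≈-sym (inv-unique (≈-trans (KRing.*-identityʳ _) fromZ-1))

β--1 : β -[1+ 0 ] ≈ ⊝ 1f
β--1 = ≈-trans (β-neg {ℤ.+ 1} (λ ())) (⊝-cong β-1)

κ-1 : 1f ⊖ᶠ β (ℤ.+ 1) ⊛ β (ℤ.+ 1) ≈ 0f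
κ-1 = ≈⇒⊖ᶠ-zero (≈-sym (≈-trans (⊛-cong β-1 β-1) (KRing.*-identityʳ 1f)))

β-sq-neg : ∀ {d} → d ≢ ℤ.+ 0 → β (ℤ.- d) ⊛ β (ℤ.- d) ≈ β d ⊛ β d
β-sq-neg {d} nz = ≈-trans (⊛-cong (β-neg nz) (β-neg nz)) (KS.solve 1 (λ b → (KS.:- b) KS.:* (KS.:- b) KS.:= b KS.:* b) ≈-refl (β d))

κ-product : ∀ d → d ≢ ℤ.+ 0 → κ d ⊛ κ (ℤ.- d) ≈ 1f ⊖ᶠ β d ⊛ β d
κ-product (ℤ.+ zero) nz = ⊥-elim (nz refl)
κ-product (ℤ.+ suc zero) nz = ≈-trans (KRing.zeroˡ _) (≈-sym κ-1)
κ-product (ℤ.+ suc (suc n)) nz = KRing.*-identityʳ _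
κ-product -[1+ zero ] nz = ≈-trans (KRing.zeroˡ _) (≈-sym (≈-trans (⊖ᶠ-cong ≈-refl (β-sq-neg {ℤ.+ 1} (λ ()))) κ-1))
κ-product -[1+ suc n ] nz = ≈-trans (KRing.*-identityˡ _) (⊖ᶠ-cong ≈-refl (β-sq-neg { -[1+ suc n ]} nz))

-- The action of the symmetric group on V_λ

module Operators (lam : List ℕ) where

  N : ℕ
  N = sum lam

  -- The exchanged word need not be a tableau, but then `κ` is 0. So an equation multiplied by `κ`
  -- has to be shown only when the exchange is valid, with the two contents swapped.
  κ-cong : ∀ {t p x y} → Valid lam t → suc p < N →
    (Valid lam (swap0 t p) → ct (swap0 t p) p ≡ ct t (suc p) → ct (swap0 t p) (suc p) ≡ ct t p → x ≈ y) →
    κ (dd p t) ⊛ x ≈ κ (dd p t) ⊛ y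
  κ-cong {t} {p} v lt h with place {p = p} v (subst (suc p ℕ.<_) (sym (size v)) lt)
  ... | same-row d rewrite d = ≈-trans (KRing.zeroˡ _) (≈-sym (KRing.zeroˡ _))
  ... | same-col d rewrite d = ≈-trans (KRing.zeroˡ _) (≈-sym (KRing.zeroˡ _))
  ... | exchange k _ v' c c' = ⊛-congˡ (h v' c c')

  dd≢0 : ∀ {t p} → Valid lam t → suc p < N → dd p t ≢ ℤ.+ 0
  dd≢0 {t} {p} v lt e = ct-distinct₂ v (subst (suc p ℕ.<_) (sym (size v)) lt) (ℤₚ.i-j≡0⇒i≡j (ct t p) (ct t (suc p)) e)

  -- The right action of s_{p+1} on coefficients: the coefficient of `t` in the image collects
  -- contributions from `t` and from its exchange. Positions are 0-based, so `p` stands for s_{p+1}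
  -- here and in `T̂` and `S`.
  U : ℕ → (List ℕ → K) → List ℕ → K
  U p g t = β (dd p t) ⊛ g t ⊕ κ (dd p t) ⊛ g (swap0 t p)

  infix 4 _≐ᵥ_
  _≐ᵥ_ : (List ℕ → K) → (List ℕ → K) → Set
  g ≐ᵥ h = ∀ {t} → Valid lam t → g t ≈ h t

  U-cong : ∀ {p g h} → suc p < N → g ≐ᵥ h → U p g ≐ᵥ U p h
  U-cong lt e v = ⊕-cong (⊛-congˡ (e v)) (κ-cong v lt (λ v' _ _ → e v'))

  neg-sub : ∀ a b → ℤ.- (a ℤ.- b) ≡ b ℤ.- a
  neg-sub = IS.solve 2 (λ a b → IS.:- (a IS.:- b) IS.:= b IS.:- a) refl
    where module IS = IntegerSolver ℤₚ.+-*-commutativeRing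

  dd-exchange : ∀ {t p} → ct (swap0 t p) p ≡ ct t (suc p) → ct (swap0 t p) (suc p) ≡ ct t p → dd p (swap0 t p) ≡ ℤ.- dd p t
  dd-exchange {t} {p} c c' = trans (cong₂ ℤ._-_ c c') (sym (neg-sub (ct t p) (ct t (suc p))))

  U-invol : ∀ {p} g → suc p < N → U p (U p g) ≐ᵥ g
  U-invol {p} g lt {t} v = begin
    b ⊛ (b ⊛ g t ⊕ k ⊛ g t') ⊕ k ⊛ U p g t'
      ≈⟨ ⊕-congˡ (κ-cong v lt λ v' c c' → ⊕-cong (⊛-congʳ (≈-trans (≡⇒≈ (cong β (dd-exchange {t} {p} c c'))) (β-neg (dd≢0 v lt))))
           (⊛-cong (≡⇒≈ (cong κ (dd-exchange {t} {p} c c'))) (≡⇒≈ (cong g (swap0-invol t p))))) ⟩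
    b ⊛ (b ⊛ g t ⊕ k ⊛ g t') ⊕ k ⊛ ((⊝ b) ⊛ g t' ⊕ k' ⊛ g t)
      ≈⟨ KS.solve 5 (λ b k k' x y → b KS.:* (b KS.:* x KS.:+ k KS.:* y) KS.:+ k KS.:* ((KS.:- b) KS.:* y KS.:+ k' KS.:* x) KS.:= (b KS.:* b KS.:+ k KS.:* k') KS.:* x) ≈-refl b k k' (g t) (g t') ⟩
    (b ⊛ b ⊕ k ⊛ k') ⊛ g t ≈⟨ ⊛-congʳ (⊕-congˡ (κ-product (dd p t) (dd≢0 v lt))) ⟩
    (b ⊛ b ⊕ (1f ⊖ᶠ b ⊛ b)) ⊛ g t ≈⟨ KS.solve 3 (λ b o x → (b KS.:* b KS.:+ (o KS.:- b KS.:* b)) KS.:* x KS.:= o KS.:* x) ≈-refl b 1f (g t) ⟩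
    1f ⊛ g t ≈⟨ KRing.*-identityˡ _ ⟩
    g t ∎
    where
    open SetoidReasoning KRing.setoid
    t' : List ℕ
    t' = swap0 t p
    b k k' : K
    b = β (dd p t)
    k = κ (dd p t)
    k' = κ (ℤ.- dd p t)

  U-comm : ∀ {p q} g → suc (suc p) ≤ q → suc q < N → U p (U q g) ≐ᵥ U q (U p g)
  U-comm {p} {q} g far lt {t} v rewrite dd-swap-far t q p (inj₂ far) | dd-swap-far t p q (inj₁ far) | swap0-comm t p q far =
    KS.solve 8 (λ b k c j x y z w → b KS.:* (c KS.:* x KS.:+ j KS.:* y) KS.:+ k KS.:* (c KS.:* z KS.:+ j KS.:* w)
                 KS.:= c KS.:* (b KS.:* x KS.:+ k KS.:* z) KS.:+ j KS.:* (b KS.:* y KS.:+ k KS.:* w)) ≈-refl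
      (β (dd p t)) (κ (dd p t)) (β (dd q t)) (κ (dd q t)) (g t) (g (swap0 t q)) (g (swap0 t p)) (g (swap0 (swap0 t q) p))

  -- The fᵢ are the coefficients at the six orders of three entries. The difference of the two sides
  -- lies in the ideal generated by the three hypotheses; the solver call exhibits the combination.
  braid-identity : ∀ A B C x x' y y' z f₁ f₂ f₃ f₄ f₅ f₆ → C ⊛ (A ⊕ B) ≈ A ⊛ B → x ⊛ x' ≈ 1f ⊖ᶠ A ⊛ A → y ⊛ y' ≈ 1f ⊖ᶠ B ⊛ B →
    A ⊛ (B ⊛ (A ⊛ f₁ ⊕ x ⊛ f₂) ⊕ y ⊛ (C ⊛ f₃ ⊕ z ⊛ f₅)) ⊕ x ⊛ (C ⊛ ((⊝ A) ⊛ f₂ ⊕ x' ⊛ f₁) ⊕ z ⊛ (B ⊛ f₄ ⊕ y ⊛ f₆)) ≈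
    B ⊛ (A ⊛ (B ⊛ f₁ ⊕ y ⊛ f₃) ⊕ x ⊛ (C ⊛ f₂ ⊕ z ⊛ f₄)) ⊕ y ⊛ (C ⊛ ((⊝ B) ⊛ f₃ ⊕ y' ⊛ f₁) ⊕ z ⊛ (A ⊛ f₅ ⊕ x ⊛ f₆))
  braid-identity A B C x x' y y' z f₁ f₂ f₃ f₄ f₅ f₆ hC hx hy = ⊖ᶠ-zero⇒≈ (≈-trans
    (KS.solve 15 (λ A B C x x' y y' z f₁ f₂ f₃ f₄ f₅ f₆ o →
      (A KS.:* (B KS.:* (A KS.:* f₁ KS.:+ x KS.:* f₂) KS.:+ y KS.:* (C KS.:* f₃ KS.:+ z KS.:* f₅)) KS.:+ x KS.:* (C KS.:* ((KS.:- A) KS.:* f₂ KS.:+ x' KS.:* f₁) KS.:+ z KS.:* (B KS.:* f₄ KS.:+ y KS.:* f₆)))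
      KS.:- (B KS.:* (A KS.:* (B KS.:* f₁ KS.:+ y KS.:* f₃) KS.:+ x KS.:* (C KS.:* f₂ KS.:+ z KS.:* f₄)) KS.:+ y KS.:* (C KS.:* ((KS.:- B) KS.:* f₃ KS.:+ y' KS.:* f₁) KS.:+ z KS.:* (A KS.:* f₅ KS.:+ x KS.:* f₆)))
      KS.:= (x KS.:* x' KS.:- (o KS.:- A KS.:* A)) KS.:* (C KS.:* f₁) KS.:+ ((y KS.:* y' KS.:- (o KS.:- B KS.:* B)) KS.:* (KS.:- (C KS.:* f₁))
         KS.:+ (C KS.:* (A KS.:+ B) KS.:- A KS.:* B) KS.:* (KS.:- ((A KS.:- B) KS.:* f₁ KS.:+ x KS.:* f₂ KS.:- y KS.:* f₃))))
      ≈-refl A B C x x' y y' z f₁ f₂ f₃ f₄ f₅ f₆ 1f)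
    (⊕-zero (⊛-zeroˡ (≈⇒⊖ᶠ-zero hx)) (⊕-zero (⊛-zeroˡ (≈⇒⊖ᶠ-zero hy)) (⊛-zeroˡ (≈⇒⊖ᶠ-zero hC)))))

  -- With contents a, b, c at three consecutive entries, all axial distances that occur are a - b, b
  -- - c, a - c up to sign. `κ-cong` rewrites the distances of the exchanged words, and where an
  -- exchange is not a tableau the term carries the factor 0.
  U-braid : ∀ {p} g → suc (suc p) < N → U p (U (suc p) (U p g)) ≐ᵥ U (suc p) (U p (U (suc p) g))
  U-braid {p} g lt {t} v = begin
    A ⊛ (B ⊛ U p g t ⊕ y ⊛ U p g t₂) ⊕ x ⊛ U q (U p g) t₁
      ≈⟨ ⊕-cong (⊛-congˡ (⊕-congˡ (κ-cong v lt λ v₂ c₂ c₂' → ⊕-cong (⊛-congʳ (≡⇒≈ (cong β (e-ac₂ c₂)))) (⊛-congʳ (≡⇒≈ (cong κ (e-ac₂ c₂)))))))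
           (κ-cong v lt' λ v₁ c₁ c₁' → ⊕-cong (⊛-cong (≡⇒≈ (cong β (e-ac₁ c₁'))) (⊕-cong (⊛-congʳ (≈-trans (≡⇒≈ (cong β (dd-exchange {t} {p} c₁ c₁'))) (β-neg (dd≢0 v lt')))) (⊛-cong (≡⇒≈ (cong κ (dd-exchange {t} {p} c₁ c₁'))) (≡⇒≈ (cong g (swap0-invol t p))))))
             (≈-trans (κ-cong {x = U p g t₁₂} {y = B ⊛ g t₁₂ ⊕ y ⊛ g (swap0 t₁₂ p)} v₁ lt λ v₁₂ d₁ d₁' → ⊕-cong (⊛-congʳ (≡⇒≈ (cong β (e-bc c₁ d₁)))) (⊛-congʳ (≡⇒≈ (cong κ (e-bc c₁ d₁)))))
               (⊛-congʳ (≡⇒≈ (cong κ (e-ac₁ c₁')))))) ⟩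
    A ⊛ (B ⊛ (A ⊛ g t ⊕ x ⊛ g t₁) ⊕ y ⊛ (C ⊛ g t₂ ⊕ z ⊛ g t₂₁)) ⊕ x ⊛ (C ⊛ ((⊝ A) ⊛ g t₁ ⊕ x' ⊛ g t) ⊕ z ⊛ (B ⊛ g t₁₂ ⊕ y ⊛ g (swap0 t₁₂ p)))
      ≈⟨ braid-identity A B C x x' y y' z (g t) (g t₁) (g t₂) (g t₁₂) (g t₂₁) (g (swap0 t₁₂ p)) hC (κ-product _ (dd≢0 v lt')) (κ-product _ (dd≢0 v lt)) ⟩
    B ⊛ (A ⊛ (B ⊛ g t ⊕ y ⊛ g t₂) ⊕ x ⊛ (C ⊛ g t₁ ⊕ z ⊛ g t₁₂)) ⊕ y ⊛ (C ⊛ ((⊝ B) ⊛ g t₂ ⊕ y' ⊛ g t) ⊕ z ⊛ (A ⊛ g t₂₁ ⊕ x ⊛ g (swap0 t₁₂ p)))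
      ≈⟨ ≈-sym (⊕-cong (⊛-congˡ (⊕-congˡ (κ-cong v lt' λ v₁ c₁ c₁' → ⊕-cong (⊛-congʳ (≡⇒≈ (cong β (e-ac₁ c₁')))) (⊛-congʳ (≡⇒≈ (cong κ (e-ac₁ c₁')))))))
           (κ-cong v lt λ v₂ c₂ c₂' → ⊕-cong (⊛-cong (≡⇒≈ (cong β (e-ac₂ c₂))) (⊕-cong (⊛-congʳ (≈-trans (≡⇒≈ (cong β (dd-exchange {t} {q} c₂ c₂'))) (β-neg (dd≢0 v lt)))) (⊛-cong (≡⇒≈ (cong κ (dd-exchange {t} {q} c₂ c₂'))) (≡⇒≈ (cong g (swap0-invol t q))))))
             (≈-trans (κ-cong {x = U q g t₂₁} {y = A ⊛ g t₂₁ ⊕ x ⊛ g (swap0 t₁₂ p)} v₂ lt' λ v₂₁ d₁ d₁' → ⊕-cong (⊛-congʳ (≡⇒≈ (cong β (e-ab c₂' d₁')))) (⊛-cong (≡⇒≈ (cong κ (e-ab c₂' d₁'))) (≡⇒≈ (cong g (sym (swap0-braid t p (subst (suc q ℕ.<_) (sym (size v)) lt)))))))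
               (⊛-congʳ (≡⇒≈ (cong κ (e-ac₂ c₂))))))) ⟩
    B ⊛ (A ⊛ U q g t ⊕ x ⊛ U q g t₁) ⊕ y ⊛ U p (U q g) t₂ ∎
    where
    open SetoidReasoning KRing.setoid
    q : ℕ
    q = suc p
    lt' : suc p < N
    lt' = ℕₚ.≤-trans (ℕₚ.n≤1+n _) lt
    t₁ t₂ t₁₂ t₂₁ : List ℕ
    t₁ = swap0 t p
    t₂ = swap0 t q
    t₁₂ = swap0 t₁ q
    t₂₁ = swap0 t₂ p
    a b c : ℤ
    a = ct t p
    b = ct t q
    c = ct t (suc q)
    A B C x x' y y' z : K
    A = β (dd p t)
    B = β (dd q t)
    C = β (a ℤ.- c)
    x = κ (dd p t)
    x' = κ (ℤ.- dd p t)
    y = κ (dd q t)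
    y' = κ (ℤ.- dd q t)
    z = κ (a ℤ.- c)
    e-ac₁ : ct t₁ q ≡ a → dd q t₁ ≡ a ℤ.- c
    e-ac₁ e = cong₂ ℤ._-_ e (ct-swap-far t (suc q) p (inj₂ ℕₚ.≤-refl))
    e-ac₂ : ct t₂ q ≡ c → dd p t₂ ≡ a ℤ.- c
    e-ac₂ e = cong₂ ℤ._-_ (ct-swap-far t p q (inj₁ ℕₚ.≤-refl)) e
    e-bc : ct t₁ p ≡ b → ct t₁₂ q ≡ ct t₁ (suc q) → dd p t₁₂ ≡ dd q t
    e-bc e e' = cong₂ ℤ._-_ (trans (ct-swap-far t₁ p q (inj₁ ℕₚ.≤-refl)) e) (trans e' (ct-swap-far t (suc q) p (inj₂ ℕₚ.≤-refl)))
    e-ab : ct t₂ (suc q) ≡ b → ct t₂₁ q ≡ ct t₂ p → dd q t₂₁ ≡ dd p t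
    e-ab e e' = cong₂ ℤ._-_ (trans e' (ct-swap-far t p q (inj₁ ℕₚ.≤-refl))) (trans (ct-swap-far t₂ (suc q) p (inj₂ ℕₚ.≤-refl)) e)
    sum-eq : fromZ (a ℤ.- c) ≈ fromZ (dd p t) ⊕ fromZ (dd q t)
    sum-eq = ≈-trans (≡⇒≈ (cong fromZ (IS.solve 3 (λ a b c → a IS.:- c IS.:= (a IS.:- b) IS.:+ (b IS.:- c)) refl a b c))) (fromZ-+ _ _)
      where module IS = IntegerSolver ℤₚ.+-*-commutativeRing
    hC : C ⊛ (A ⊕ B) ≈ A ⊛ B
    hC = ≈-trans (⊛-congʳ (inv-cong sum-eq)) (inv-sum (fromZ≉0 (dd≢0 v lt')) (fromZ≉0 (dd≢0 v lt))
      (λ e → fromZ≉0 (λ e' → ct-distinct₃ v (subst (suc (suc p) ℕ.<_) (sym (size v)) lt) (ℤₚ.i-j≡0⇒i≡j a c e')) (≈-trans sum-eq e)))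

-- Multiplication by a variable, seen on exponents

-- The coefficient of x_{j+1} f at an exponent is that of f at the exponent lowered at position `j`.
-- The result `nothing` marks monomials not divisible by x_{j+1}.
decAt : List ℕ → ℕ → Maybe (List ℕ)
decAt [] j = nothing
decAt (zero ∷ m) zero = nothing
decAt (suc x ∷ m) zero = just (x ∷ m)
decAt (x ∷ m) (suc j) with decAt m j
... | just m' = just (x ∷ m')
... | nothing = nothing

mapMaybe : {A B : Set} → (A → B) → Maybe A → Maybe B
mapMaybe f (just x) = just (f x)
mapMaybe f nothing = nothing

decAt-∷ : ∀ x m j → decAt (x ∷ m) (suc j) ≡ mapMaybe (x ∷_) (decAt m j)
decAt-∷ zero m j with decAt m j
... | just _ = refl
... | nothing = refl
decAt-∷ (suc x) m j with decAt m j
... | just _ = refl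
... | nothing = refl

mapMaybe-∘ : {A B C : Set} (f : B → C) (g : A → B) (x : Maybe A) → mapMaybe f (mapMaybe g x) ≡ mapMaybe (f ∘ g) x
mapMaybe-∘ f g (just _) = refl
mapMaybe-∘ f g nothing = refl

mapMaybe-cong : {A B : Set} {f g : A → B} → (∀ x → f x ≡ g x) → ∀ x → mapMaybe f x ≡ mapMaybe g x
mapMaybe-cong h (just x) = cong just (h x)
mapMaybe-cong h nothing = refl

decAt-length : ∀ m j {m'} → decAt m j ≡ just m' → length m' ≡ length m
decAt-length (suc x ∷ m) zero refl = refl
decAt-length (x ∷ m) (suc j) e rewrite decAt-∷ x m j with decAt m j in eq
decAt-length (x ∷ m) (suc j) refl | just m' = cong suc (decAt-length m j eq)

decAt-swap-far : ∀ m p j → suc p < j → decAt (swap0 m p) j ≡ mapMaybe (λ m' → swap0 m' p) (decAt m j)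
decAt-swap-far [] p j lt = refl
decAt-swap-far (x ∷ []) zero (suc (suc j)) lt rewrite decAt-∷ x [] (suc j) = refl
decAt-swap-far (x ∷ y ∷ m) zero (suc (suc j)) lt
  rewrite decAt-∷ y (x ∷ m) (suc j) | decAt-∷ x m j | decAt-∷ x (y ∷ m) (suc j) | decAt-∷ y m j with decAt m j
... | just _ = refl
... | nothing = refl
decAt-swap-far (x ∷ []) zero (suc zero) (s≤s ())
decAt-swap-far (x ∷ y ∷ m) zero (suc zero) (s≤s ())
decAt-swap-far (x ∷ m) (suc p) (suc j) (s≤s lt) rewrite swap0-∷ x m p | decAt-∷ x (swap0 m p) j | decAt-∷ x m j | decAt-swap-far m p j lt =
  trans (mapMaybe-∘ (x ∷_) (λ m' → swap0 m' p) (decAt m j))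
    (trans (mapMaybe-cong (λ m' → sym (swap0-∷ x m' p)) (decAt m j)) (sym (mapMaybe-∘ (λ m' → swap0 m' (suc p)) (x ∷_) (decAt m j))))

decAt-swap-right : ∀ m p → suc p < length m → decAt (swap0 m p) (suc p) ≡ mapMaybe (λ m' → swap0 m' p) (decAt m p)
decAt-swap-right (zero ∷ y ∷ m) zero lt = decAt-∷ y (zero ∷ m) 0
decAt-swap-right (suc x ∷ y ∷ m) zero lt = decAt-∷ y (suc x ∷ m) 0
decAt-swap-right (x ∷ []) zero (s≤s ())
decAt-swap-right (x ∷ m) (suc p) (s≤s lt) rewrite swap0-∷ x m p | decAt-∷ x (swap0 m p) (suc p) | decAt-∷ x m p | decAt-swap-right m p lt =
  trans (mapMaybe-∘ (x ∷_) (λ m' → swap0 m' p) (decAt m p))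
    (trans (mapMaybe-cong (λ m' → sym (swap0-∷ x m' p)) (decAt m p)) (sym (mapMaybe-∘ (λ m' → swap0 m' (suc p)) (x ∷_) (decAt m p))))

decAt-swap-left : ∀ m p → suc p < length m → decAt (swap0 m p) p ≡ mapMaybe (λ m' → swap0 m' p) (decAt m (suc p))
decAt-swap-left (x ∷ zero ∷ m) zero lt rewrite decAt-∷ x (zero ∷ m) 0 = refl
decAt-swap-left (x ∷ suc y ∷ m) zero lt rewrite decAt-∷ x (suc y ∷ m) 0 = refl
decAt-swap-left (x ∷ []) zero (s≤s ())
decAt-swap-left (x ∷ m) (suc p) (s≤s lt) rewrite swap0-∷ x m p | decAt-∷ x (swap0 m p) p | decAt-∷ x m (suc p) | decAt-swap-left m p lt =
  trans (mapMaybe-∘ (x ∷_) (λ m' → swap0 m' p) (decAt m (suc p)))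
    (trans (mapMaybe-cong (λ m' → sym (swap0-∷ x m' p)) (decAt m (suc p))) (sym (mapMaybe-∘ (λ m' → swap0 m' (suc p)) (x ∷_) (decAt m (suc p)))))

bindMaybe : {A B : Set} → Maybe A → (A → Maybe B) → Maybe B
bindMaybe (just x) f = f x
bindMaybe nothing f = nothing

decAt-comm : ∀ m i j → i ≢ j → bindMaybe (decAt m i) (λ m' → decAt m' j) ≡ bindMaybe (decAt m j) (λ m' → decAt m' i)
decAt-comm [] i j ne = refl
decAt-comm m zero zero ne = ⊥-elim (ne refl)
decAt-comm (zero ∷ m) zero (suc j) ne with decAt m j
... | just _ = refl
... | nothing = refl
decAt-comm (suc x ∷ m) zero (suc j) ne rewrite decAt-∷ x m j with decAt m j
... | just _ = refl
... | nothing = refl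
decAt-comm (zero ∷ m) (suc i) zero ne with decAt m i
... | just _ = refl
... | nothing = refl
decAt-comm (suc x ∷ m) (suc i) zero ne rewrite decAt-∷ x m i with decAt m i
... | just _ = refl
... | nothing = refl
decAt-comm (x ∷ m) (suc i) (suc j) ne rewrite decAt-∷ x m i | decAt-∷ x m j = trans (bind-∷ (decAt m i) j) (trans (cong (mapMaybe (x ∷_)) (decAt-comm m i j (ne ∘ cong suc))) (sym (bind-∷ (decAt m j) i)))
  where
  bind-∷ : ∀ M k → bindMaybe (mapMaybe (x ∷_) M) (λ m' → decAt m' (suc k)) ≡ mapMaybe (x ∷_) (bindMaybe M (λ m' → decAt m' k))
  bind-∷ (just m') k = decAt-∷ x m' k
  bind-∷ nothing k = refl

-- The operators s ⊗ s, their Yang-Baxter form, and Ψ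

module Polynomials (lam : List ℕ) where
  open Operators lam public

  Fun : Set
  Fun = List ℕ → List ℕ → K

  record OfLen (m : List ℕ) : Set where
    constructor ofLen
    field getLen : length m ≡ N
  open OfLen public

  infix 4 _≐_
  -- Only exponents of length N and words of tableaux are compared. A `Fun` also has values at other
  -- arguments, and these carry no meaning.
  record _≐_ (f g : Fun) : Set where
    constructor pointwise
    field on : ∀ {m t} → OfLen m → Valid lam t → f m t ≈ g m t
  open _≐_ public

  ≐-refl : ∀ {f} → f ≐ f
  ≐-refl = pointwise λ _ _ → ≈-refl

  ≐-sym : ∀ {f g} → f ≐ g → g ≐ f
  ≐-sym e = pointwise λ l v → ≈-sym (on e l v)

  ≐-trans : ∀ {f g h} → f ≐ g → g ≐ h → f ≐ h
  ≐-trans e e' = pointwise λ l v → ≈-trans (on e l v) (on e' l v)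

  ≡⇒≐ : ∀ {f g} → f ≡ g → f ≐ g
  ≡⇒≐ refl = ≐-refl

  infixl 6 _⊞_
  infixr 7 _·_

  _⊞_ : Fun → Fun → Fun
  (f ⊞ g) m t = f m t ⊕ g m t

  _·_ : K → Fun → Fun
  (c · f) m t = c ⊛ f m t

  𝟎 : Fun
  𝟎 m t = 0f

  ⊞-cong : ∀ {f f' g g'} → f ≐ f' → g ≐ g' → f ⊞ g ≐ f' ⊞ g'
  ⊞-cong e e' = pointwise λ l v → ⊕-cong (on e l v) (on e' l v)

  ·-cong : ∀ {c c' f f'} → c ≈ c' → f ≐ f' → c · f ≐ c' · f'
  ·-cong e e' = pointwise λ l v → ⊛-cong e (on e' l v)

  T̂ : ℕ → Fun → Fun
  T̂ p f m t = U p (f (swap0 m p)) t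

  T-cong : ∀ {p f g} → suc p < N → f ≐ g → T̂ p f ≐ T̂ p g
  T-cong {p} lt e = pointwise λ {m} l v → U-cong lt (λ v' → on e (ofLen (trans (length-swap0 m p) (getLen l))) v') v

  T-linear : ∀ p f c g → T̂ p (f ⊞ c · g) ≐ T̂ p f ⊞ c · T̂ p g
  T-linear p f c g = pointwise λ {m} {t} l v → KS.solve 7 (λ b k x y c z w → b KS.:* (x KS.:+ c KS.:* y) KS.:+ k KS.:* (z KS.:+ c KS.:* w)
      KS.:= (b KS.:* x KS.:+ k KS.:* z) KS.:+ c KS.:* (b KS.:* y KS.:+ k KS.:* w)) ≈-refl
      (β (dd p t)) (κ (dd p t)) (f (swap0 m p) t) (g (swap0 m p) t) c (f (swap0 m p) (swap0 t p)) (g (swap0 m p) (swap0 t p))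

  T-zero : ∀ p → T̂ p 𝟎 ≐ 𝟎
  T-zero p = pointwise λ l v → ⊕-zero (KRing.zeroʳ _) (KRing.zeroʳ _)

  T-invol : ∀ {p} f → suc p < N → T̂ p (T̂ p f) ≐ f
  T-invol {p} f lt = pointwise λ {m} {t} l v → ≈-trans (U-invol (f (swap0 (swap0 m p) p)) lt v) (≡⇒≈ (cong (λ m' → f m' t) (swap0-invol m p)))

  T-comm : ∀ {p q} f → suc (suc p) ≤ q → suc q < N → T̂ p (T̂ q f) ≐ T̂ q (T̂ p f)
  T-comm {p} {q} f far lt = pointwise λ {m} {t} l v → ≈-trans (U-comm (f (swap0 (swap0 m p) q)) far lt v)
    (≡⇒≈ (cong (λ m' → U q (U p (f m')) t) (swap0-comm m p q far)))

  T-braid : ∀ {p} f → suc (suc p) < N → T̂ p (T̂ (suc p) (T̂ p f)) ≐ T̂ (suc p) (T̂ p (T̂ (suc p) f))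
  T-braid {p} f lt = pointwise λ {m} {t} l v → ≈-trans (U-braid (f (swap0 (swap0 (swap0 m p) (suc p)) p)) lt v)
    (≡⇒≈ (cong (λ m' → U (suc p) (U p (U (suc p) (f m'))) t) (swap0-braid m p (subst (suc (suc p) ℕ.<_) (sym (getLen l)) lt))))

  -- The operator s ⊗ s + δ of an s-edge, where δ is the inverse of a difference of two entries of
  -- ζ.
  S : ℕ → K → Fun → Fun
  S p δ f = T̂ p f ⊞ δ · f

  S-cong : ∀ {p δ δ' f f'} → suc p < N → δ ≈ δ' → f ≐ f' → S p δ f ≐ S p δ' f'
  S-cong lt e e' = ⊞-cong (T-cong lt e') (·-cong e e')

  S-zero : ∀ p δ → S p δ 𝟎 ≐ 𝟎
  S-zero p δ = pointwise λ l v → ⊕-zero (on (T-zero p) l v) (KRing.zeroʳ δ)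

  T-S : ∀ p q δ f → T̂ p (S q δ f) ≐ T̂ p (T̂ q f) ⊞ δ · T̂ p f
  T-S p q δ f = T-linear p (T̂ q f) δ f

  S-comm : ∀ {p q} δ ε f → suc (suc p) ≤ q → suc q < N → S p δ (S q ε f) ≐ S q ε (S p δ f)
  S-comm {p} {q} δ ε f far lt = pointwise λ {m} {t} l v → ≈-trans (⊕-congʳ (≈-trans (on (T-S p q ε f) l v) (⊕-congʳ (on (T-comm f far lt) l v))))
    (≈-trans (KS.solve 6 (λ x y z w d e → (x KS.:+ e KS.:* y) KS.:+ d KS.:* (z KS.:+ e KS.:* w) KS.:= (x KS.:+ d KS.:* z) KS.:+ e KS.:* (y KS.:+ d KS.:* w)) ≈-refl
      (T̂ q (T̂ p f) m t) (T̂ p f m t) (T̂ q f m t) (f m t) δ ε)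
    (⊕-congʳ (≈-sym (on (T-S q p δ f) l v))))

  S-expand : ∀ {p q} A B C f → suc p < N → suc q < N → S p B (S q C (S p A f)) ≐
    ((T̂ p (T̂ q (T̂ p f)) ⊞ A · T̂ p (T̂ q f)) ⊞ C · (f ⊞ A · T̂ p f)) ⊞ B · ((T̂ q (T̂ p f) ⊞ A · T̂ q f) ⊞ C · (T̂ p f ⊞ A · f))
  S-expand {p} {q} A B C f ltp ltq = ⊞-cong
    (≐-trans (T-S p q C (S p A f)) (⊞-cong (≐-trans (T-cong ltp (T-S q p A f)) (T-linear p (T̂ q (T̂ p f)) A (T̂ q f)))
      (·-cong ≈-refl (≐-trans (T-S p p A f) (⊞-cong (T-invol f ltp) ≐-refl)))))
    (·-cong ≈-refl (⊞-cong (T-S q p A f) ≐-refl))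

  -- Yang-Baxter relation. After expansion and the braid relation the two sides differ by (C(A + B)
  -- - AB)(s_p - s_{p+1}), and the hypothesis is what 1/a, 1/b and 1/(a + b) satisfy.
  S-YB : ∀ {p} A B C f → suc (suc p) < N → C ⊛ (A ⊕ B) ≈ A ⊛ B →
    S p B (S (suc p) C (S p A f)) ≐ S (suc p) A (S p C (S (suc p) B f))
  S-YB {p} A B C f lt h = ≐-trans (S-expand A B C f lt' lt) (≐-trans (pointwise λ {m} {t} l v →
      ≈-trans (⊕-congʳ (⊕-congʳ (⊕-congʳ (on (T-braid f lt) l v))))
       (⊖ᶠ-zero⇒≈ (≈-trans (KS.solve 9 (λ A B C x pq qp a b f →
         (((x KS.:+ A KS.:* pq) KS.:+ C KS.:* (f KS.:+ A KS.:* a)) KS.:+ B KS.:* ((qp KS.:+ A KS.:* b) KS.:+ C KS.:* (a KS.:+ A KS.:* f)))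
         KS.:- (((x KS.:+ B KS.:* qp) KS.:+ C KS.:* (f KS.:+ B KS.:* b)) KS.:+ A KS.:* ((pq KS.:+ B KS.:* a) KS.:+ C KS.:* (b KS.:+ B KS.:* f)))
         KS.:= (C KS.:* (A KS.:+ B) KS.:- A KS.:* B) KS.:* (a KS.:- b)) ≈-refl A B C
           (T̂ q (T̂ p (T̂ q f)) m t) (T̂ p (T̂ q f) m t) (T̂ q (T̂ p f) m t) (T̂ p f m t) (T̂ q f m t) (f m t))
       (⊛-zeroˡ (≈⇒⊖ᶠ-zero h)))))
    (≐-sym (S-expand B A C f lt lt')))
    where
    q : ℕ
    q = suc p
    lt' : suc p < N
    lt' = ℕₚ.≤-trans (ℕₚ.n≤1+n _) lt

  orZero : Maybe K → K
  orZero (just x) = x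
  orZero nothing = 0f

  X : ℕ → Fun → Fun
  X j f m t = orZero (mapMaybe (λ m' → f m' t) (decAt m j))

  X-cong : ∀ {j f g} → f ≐ g → X j f ≐ X j g
  X-cong {j} {f} {g} e = pointwise go
    where
    go : ∀ {m t} → OfLen m → Valid lam t → X j f m t ≈ X j g m t
    go {m} l v with decAt m j in eq
    ... | just m' = on e (ofLen (trans (decAt-length m j eq) (getLen l))) v
    ... | nothing = ≈-refl

  X-linear : ∀ j f c g → X j (f ⊞ c · g) ≐ X j f ⊞ c · X j g
  X-linear j f c g = pointwise go
    where
    go : ∀ {m t} → OfLen m → Valid lam t → X j (f ⊞ c · g) m t ≈ (X j f ⊞ c · X j g) m t
    go {m} l v with decAt m j
    ... | just m' = ≈-refl
    ... | nothing = ≈-sym (⊕-zero ≈-refl (KRing.zeroʳ c))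

  X-zero : ∀ j → X j 𝟎 ≐ 𝟎
  X-zero j = pointwise go
    where
    go : ∀ {m t} → OfLen m → Valid lam t → X j 𝟎 m t ≈ 0f
    go {m} l v with decAt m j
    ... | just m' = ≈-refl
    ... | nothing = ≈-refl

  X-comm : ∀ i j f → i ≢ j → X i (X j f) ≐ X j (X i f)
  X-comm i j f ne = pointwise λ {m} {t} l v → ≡⇒≈ (trans (go i j m t) (trans (cong (λ M → orZero (mapMaybe (λ m' → f m' t) M)) (decAt-comm m i j ne)) (sym (go j i m t))))
    where
    go : ∀ i j m t → X i (X j f) m t ≡ orZero (mapMaybe (λ m' → f m' t) (bindMaybe (decAt m i) (λ m' → decAt m' j)))
    go i j m t with decAt m i
    ... | just _ = refl
    ... | nothing = refl

  TX : ∀ p i j f → (∀ m → OfLen m → decAt (swap0 m p) j ≡ mapMaybe (λ m' → swap0 m' p) (decAt m i)) → T̂ p (X j f) ≐ X i (T̂ p f)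
  TX p i j f h = pointwise go
    where
    go : ∀ {m t} → OfLen m → Valid lam t → T̂ p (X j f) m t ≈ X i (T̂ p f) m t
    go {m} l v rewrite h m l with decAt m i
    ... | just _ = ≈-refl
    ... | nothing = ⊕-zero (KRing.zeroʳ _) (KRing.zeroʳ _)

  TX-far : ∀ {p j} f → suc p < j → T̂ p (X j f) ≐ X j (T̂ p f)
  TX-far {p} {j} f lt = TX p j j f λ m _ → decAt-swap-far m p j lt

  TX-right : ∀ {p} f → suc p < N → T̂ p (X (suc p) f) ≐ X p (T̂ p f)
  TX-right {p} f lt = TX p p (suc p) f λ m l → decAt-swap-right m p (subst (suc p ℕ.<_) (sym (getLen l)) lt)

  TX-left : ∀ {p} f → suc p < N → T̂ p (X p f) ≐ X (suc p) (T̂ p f)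
  TX-left {p} f lt = TX p (suc p) p f λ m l → decAt-swap-left m p (subst (suc p ℕ.<_) (sym (getLen l)) lt)

  θ : ℕ → Fun → Fun
  θ zero f = f
  θ (suc n) f = T̂ n (θ n f)

  θ-cong : ∀ n {f g} → n < N → f ≐ g → θ n f ≐ θ n g
  θ-cong zero lt e = e
  θ-cong (suc n) lt e = T-cong lt (θ-cong n (ℕₚ.<-trans (ℕₚ.n<1+n n) lt) e)

  θ-linear : ∀ n f c g → n < N → θ n (f ⊞ c · g) ≐ θ n f ⊞ c · θ n g
  θ-linear zero f c g lt = ≐-refl
  θ-linear (suc n) f c g lt = ≐-trans (T-cong lt (θ-linear n f c g (ℕₚ.<-trans (ℕₚ.n<1+n n) lt))) (T-linear n (θ n f) c (θ n g))

  θ-zero : ∀ n → n < N → θ n 𝟎 ≐ 𝟎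
  θ-zero zero lt = ≐-refl
  θ-zero (suc n) lt = ≐-trans (T-cong lt (θ-zero n (ℕₚ.<-trans (ℕₚ.n<1+n n) lt))) (T-zero n)

  θ-T-far : ∀ n q f → n < q → suc q < N → θ n (T̂ q f) ≐ T̂ q (θ n f)
  θ-T-far zero q f lt lt' = ≐-refl
  θ-T-far (suc n) q f lt lt' = ≐-trans (T-cong (ℕₚ.<-trans lt (ℕₚ.<-trans (ℕₚ.n<1+n q) lt')) (θ-T-far n q f (ℕₚ.<-trans (ℕₚ.n<1+n n) lt) lt')) (T-comm (θ n f) lt lt')

  -- Conjugation by the cycle s_1 ⋯ s_n shifts the generators by one: a single braid move at the
  -- place where the factors meet, and commutation past all later factors.
  T-θ : ∀ n p f → suc p < n → n < N → T̂ p (θ n f) ≐ θ n (T̂ (suc p) f)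
  T-θ (suc n) p f (s≤s lt) nN with ℕₚ.m≤n⇒m<n∨m≡n lt
  ... | inj₁ p+1<n = ≐-trans (T-comm (θ n f) p+1<n nN) (T-cong nN (T-θ n p f p+1<n (ℕₚ.<-trans (ℕₚ.n<1+n n) nN)))
  ... | inj₂ refl = ≐-trans (T-braid (θ p f) nN) (T-cong nN (T-cong (ℕₚ.<-trans (ℕₚ.n<1+n _) nN) (≐-sym (θ-T-far p (suc p) f ℕₚ.≤-refl nN))))

  -- The cycle without its first factor, s_2 ⋯ s_{n+1}; it lets s_1 be split off from the cycle `θ`.
  θ' : ℕ → Fun → Fun
  θ' zero f = f
  θ' (suc n) f = T̂ (suc n) (θ' n f)

  θ'-cong : ∀ n {f g} → suc n < N → f ≐ g → θ' n f ≐ θ' n g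
  θ'-cong zero lt e = e
  θ'-cong (suc n) lt e = T-cong lt (θ'-cong n (ℕₚ.<-trans (ℕₚ.n<1+n _) lt) e)

  θ-last : ∀ n f → suc n < N → θ (suc n) f ≐ θ' n (T̂ 0 f)
  θ-last zero f lt = ≐-refl
  θ-last (suc n) f lt = T-cong lt (θ-last n f (ℕₚ.<-trans (ℕₚ.n<1+n _) lt))

  θ-θ : ∀ k n f → k < n → n < N → θ k (θ n f) ≐ θ n (θ' k f)
  θ-θ zero n f lt nN = ≐-refl
  θ-θ (suc k) n f lt nN = ≐-trans (T-cong (ℕₚ.<-trans lt nN) (θ-θ k n f (ℕₚ.<-trans (ℕₚ.n<1+n k) lt) nN)) (T-θ n k (θ' k f) lt nN)

  θ-X : ∀ n j f → n < j → θ n (X j f) ≐ X j (θ n f) ⊎ ¬ (n < N)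
  θ-X n j f lt with n ℕ.<? N
  ... | no h = inj₂ h
  ... | yes h = inj₁ (go n lt h)
    where
    go : ∀ n → n < j → n < N → θ n (X j f) ≐ X j (θ n f)
    go zero lt h = ≐-refl
    go (suc n) lt h = ≐-trans (T-cong h (go n (ℕₚ.<-trans (ℕₚ.n<1+n n) lt) (ℕₚ.<-trans (ℕₚ.n<1+n n) h))) (TX-far (θ n f) lt)

  Ψ : Fun → Fun
  Ψ f = X (N ∸ 1) (θ (N ∸ 1) f)

  module _ {n : ℕ} (eqN : N ≡ suc n) where
    private
      n<N : n < N
      n<N = subst (n ℕ.<_) (sym eqN) (ℕₚ.n<1+n n)
      N-1 : N ∸ 1 ≡ n
      N-1 = cong (_∸ 1) eqN

    Ψ-unfold : ∀ f → Ψ f ≡ X n (θ n f)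
    Ψ-unfold f = cong (λ k → X k (θ k f)) N-1

    Ψ-cong : ∀ {f g} → f ≐ g → Ψ f ≐ Ψ g
    Ψ-cong {f} {g} e = ≐-trans (≡⇒≐ (Ψ-unfold f)) (≐-trans (X-cong (θ-cong n n<N e)) (≡⇒≐ (sym (Ψ-unfold g))))

    Ψ-linear : ∀ f c g → Ψ (f ⊞ c · g) ≐ Ψ f ⊞ c · Ψ g
    Ψ-linear f c g = ≐-trans (≡⇒≐ (Ψ-unfold (f ⊞ c · g))) (≐-trans (X-cong (θ-linear n f c g n<N)) (≐-trans (X-linear n _ c _)
      (⊞-cong (≡⇒≐ (sym (Ψ-unfold f))) (·-cong ≈-refl (≡⇒≐ (sym (Ψ-unfold g)))))))

    Ψ-zero : Ψ 𝟎 ≐ 𝟎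
    Ψ-zero = ≐-trans (≡⇒≐ (Ψ-unfold 𝟎)) $ ≐-trans (X-cong (θ-zero n n<N)) (X-zero n)

    Ψ-T : ∀ p f → suc p < n → T̂ p (Ψ f) ≐ Ψ (T̂ (suc p) f)
    Ψ-T p f lt = ≐-trans (T-cong (ℕₚ.<-trans lt n<N) (≡⇒≐ (Ψ-unfold f))) (≐-trans (TX-far (θ n f) lt)
      (≐-trans (X-cong (T-θ n p f lt n<N)) (≡⇒≐ (sym (Ψ-unfold (T̂ (suc p) f))))))

    Ψ-S : ∀ p δ f → suc p < n → S p δ (Ψ f) ≐ Ψ (S (suc p) δ f)
    Ψ-S p δ f lt = ≐-trans (⊞-cong (Ψ-T p f lt) ≐-refl) (≐-sym (Ψ-linear _ δ f))

  module _ {n : ℕ} (eqN : N ≡ suc (suc n)) where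
    private
      n<N : suc n < N
      n<N = subst (suc n ℕ.<_) (sym eqN) (ℕₚ.n<1+n (suc n))
      n<N' : n < N
      n<N' = ℕₚ.<-trans (ℕₚ.n<1+n n) n<N
      un : ∀ f → Ψ f ≡ X (suc n) (θ (suc n) f)
      un = Ψ-unfold eqN

      θX : ∀ f → θ (suc n) (X (suc n) f) ≐ X n (θ (suc n) f)
      θX f with θ-X n (suc n) f (ℕₚ.n<1+n n)
      ... | inj₁ e = ≐-trans (T-cong n<N e) (TX-right (θ n f) n<N)
      ... | inj₂ h = ⊥-elim (h n<N')

      ΨΨ-form : ∀ f → Ψ (Ψ f) ≐ X (suc n) (X n (θ (suc n) (θ (suc n) f)))
      ΨΨ-form f = ≐-trans (≡⇒≐ (trans (un (Ψ f)) (cong (λ g → X (suc n) (θ (suc n) g)) (un f)))) (X-cong (θX (θ (suc n) f)))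

      θθ : ∀ f → T̂ n (θ (suc n) (θ (suc n) f)) ≐ θ (suc n) (θ (suc n) (T̂ 0 f))
      θθ f = ≐-trans (T-invol (θ n (θ (suc n) f)) n<N) (≐-trans (θ-θ n (suc n) f (ℕₚ.n<1+n n) n<N)
        (θ-cong (suc n) n<N (≐-sym (≐-trans (θ-last n (T̂ 0 f) n<N) (θ'-cong n n<N (T-invol f (subst (1 ℕ.<_) (sym eqN) (s≤s (s≤s z≤n)))))))))

    -- One Ψ turns every s_{p+1} except s_1 into its predecessor; s_1 acts on a pair that one Ψ
    -- would tear apart. Two applications carry the first two positions together to the last two. In
    -- the cycles, s_{N-1} cancels the last factor of the outer one, and s_1 comes out of the inner
    -- one by conjugation.
    ΨΨ-T : ∀ f → T̂ n (Ψ (Ψ f)) ≐ Ψ (Ψ (T̂ 0 f))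
    ΨΨ-T f = ≐-trans (T-cong n<N (ΨΨ-form f)) (≐-trans (TX-right _ n<N) (≐-trans (X-cong (TX-left _ n<N))
      (≐-trans (X-comm n (suc n) _ (ℕₚ.<⇒≢ (ℕₚ.n<1+n n))) (≐-trans (X-cong (X-cong (θθ f))) (≐-sym (ΨΨ-form (T̂ 0 f)))))))

    ΨΨ-S : ∀ δ f → S n δ (Ψ (Ψ f)) ≐ Ψ (Ψ (S 0 δ f))
    ΨΨ-S δ f = ≐-trans (⊞-cong (ΨΨ-T f) ≐-refl) (≐-sym (≐-trans (Ψ-cong eqN (Ψ-linear eqN _ δ f)) (Ψ-linear eqN _ δ _)))

-- Entries of a labelled composition: the value v[i] paired with the (0-based) rank σ_v[i] − 1

Ent : Set
Ent = ℕ × ℕ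

vals : List Ent → List ℕ
vals = map proj₁

ind : Bool → ℕ
ind true = 1
ind false = 0

gtc gec : ℕ → List ℕ → ℕ
gtc x [] = 0
gtc x (y ∷ ys) = ind (x <ᵇ y) + gtc x ys
gec x [] = 0
gec x (y ∷ ys) = ind (x ≤ᵇ y) + gec x ys

-- `pre` holds the values to the left. The larger entries on either side and the equal ones to the
-- left are counted, which is σ_v minus one with ties numbered from left to right.
LabOK : List ℕ → List Ent → Set
LabOK pre [] = ⊤
LabOK pre ((x , q) ∷ V) = q ≡ gec x pre + gtc x (vals V) × LabOK (x ∷ pre) V

gtc-++ : ∀ x u r → gtc x (u ++ r) ≡ gtc x u + gtc x r
gtc-++ x [] r = refl
gtc-++ x (y ∷ u) r = trans (cong (ind (x <ᵇ y) ℕ.+_) (gtc-++ x u r)) (sym (ℕₚ.+-assoc (ind (x <ᵇ y)) _ _))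

exch : ∀ a b c → a + (b + c) ≡ b + (a + c)
exch a b c = trans (sym (ℕₚ.+-assoc a b c)) (trans (cong (ℕ._+ c) (ℕₚ.+-comm a b)) (ℕₚ.+-assoc b a c))

gtc-swap : ∀ c u x y r → gtc c (u ++ x ∷ y ∷ r) ≡ gtc c (u ++ y ∷ x ∷ r)
gtc-swap c u x y r = trans (gtc-++ c u _) (trans (cong (gtc c u ℕ.+_) (exch (ind (c <ᵇ x)) (ind (c <ᵇ y)) (gtc c r))) (sym (gtc-++ c u _)))

gec-zero : ∀ xs → gec 0 xs ≡ length xs
gec-zero [] = refl
gec-zero (x ∷ xs) = cong suc (gec-zero xs)

gec-suc : ∀ x ys → gec (suc x) ys ≡ gtc x ys
gec-suc x [] = refl
gec-suc x (y ∷ ys) = cong (ind (x <ᵇ y) ℕ.+_) (gec-suc x ys)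

≤ᵇ-suc : ∀ y x → (y ≤ᵇ x) ≡ (y <ᵇ suc x)
≤ᵇ-suc zero x = refl
≤ᵇ-suc (suc y) x = refl

<ᵇ-true : ∀ {x y} → x < y → (x <ᵇ y) ≡ true
<ᵇ-true {zero} (s≤s _) = refl
<ᵇ-true {suc x} (s≤s lt) = <ᵇ-true {x} lt

<ᵇ-false : ∀ {x y} → y ≤ x → (x <ᵇ y) ≡ false
<ᵇ-false {x} {zero} _ = refl
<ᵇ-false {suc x} {suc y} (s≤s le) = <ᵇ-false {x} le

≤ᵇ-true : ∀ {x y} → x ≤ y → (x ≤ᵇ y) ≡ true
≤ᵇ-true {x} {y} le = trans (≤ᵇ-suc x y) (<ᵇ-true (s≤s le))

≤ᵇ-false : ∀ {x y} → y < x → (x ≤ᵇ y) ≡ false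
≤ᵇ-false {x} {y} lt = trans (≤ᵇ-suc x y) (<ᵇ-false lt)

<ᵇ⇒< : ∀ {x y} → (x <ᵇ y) ≡ true → x < y
<ᵇ⇒< {x} {y} e = ℕₚ.<ᵇ⇒< x y (subst T (sym e) tt)

≢⇒≤ᵇ≡<ᵇ : ∀ {x y} → x ≢ y → (x ≤ᵇ y) ≡ (x <ᵇ y)
≢⇒≤ᵇ≡<ᵇ {x} {y} ne with ℕₚ.<-cmp x y
... | tri< lt _ _ = trans (≤ᵇ-true (ℕₚ.<⇒≤ lt)) (sym (<ᵇ-true lt))
... | tri≈ _ e _ = ⊥-elim (ne e)
... | tri> _ _ gt = trans (≤ᵇ-false gt) (sym (<ᵇ-false (ℕₚ.<⇒≤ gt)))

ind-mono : ∀ x y → ind (x <ᵇ y) ≤ ind (x ≤ᵇ y)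
ind-mono x y with x <ᵇ y in e
... | true rewrite ≤ᵇ-true (ℕₚ.<⇒≤ (<ᵇ⇒< {x} {y} e)) = ℕₚ.≤-refl
... | false = z≤n

gtc≤gec : ∀ x ys → gtc x ys ≤ gec x ys
gtc≤gec x [] = z≤n
gtc≤gec x (y ∷ ys) = ℕₚ.+-mono-≤ (ind-mono x y) (gtc≤gec x ys)

gec≤gtc : ∀ {x y} → x < y → ∀ ys → gec y ys ≤ gtc x ys
gec≤gtc lt [] = z≤n
gec≤gtc {x} {y} lt (z ∷ ys) = ℕₚ.+-mono-≤ h (gec≤gtc lt ys)
  where
  h : ind (y ≤ᵇ z) ≤ ind (x <ᵇ z)
  h with y ℕ.≤? z
  ... | yes le rewrite ≤ᵇ-true le | <ᵇ-true (ℕₚ.<-≤-trans lt le) = ℕₚ.≤-refl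
  ... | no nle rewrite ≤ᵇ-false (ℕₚ.≰⇒> nle) = z≤n

gec≤length : ∀ x ys → gec x ys ≤ length ys
gec≤length x [] = z≤n
gec≤length x (y ∷ ys) with x ≤ᵇ y
... | true = s≤s (gec≤length x ys)
... | false = ℕₚ.m≤n⇒m≤1+n (gec≤length x ys)

LabOK-pre : ∀ {pre pre'} V → (∀ x → gec x pre ≡ gec x pre') → LabOK pre V → LabOK pre' V
LabOK-pre [] h _ = tt
LabOK-pre ((x , q) ∷ V) h (e , rest) = trans e (cong (ℕ._+ gtc x (vals V)) (h x)) , LabOK-pre V (λ z → cong (ind (z ≤ᵇ x) ℕ.+_) (h z)) rest

vals-++ : ∀ u r → vals (u ++ r) ≡ vals u ++ vals r
vals-++ u r = Listₚ.map-++ proj₁ u r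

-- Exchanging different values changes no rank. Hence an entry carries its rank along, and with it
-- its value of ζ.
LabOK-swap : ∀ {pre} u {y q z q'} r → y ≢ z → LabOK pre (u ++ (y , q) ∷ (z , q') ∷ r) → LabOK pre (u ++ (z , q') ∷ (y , q) ∷ r)
LabOK-swap {pre} [] {y} {q} {z} {q'} r ne (e , e' , rest) =
  trans e' (trans (cong (λ b → ind b + gec z pre + gtc z (vals r)) (≢⇒≤ᵇ≡<ᵇ (ne ∘ sym))) (trans (ℕₚ.+-assoc (ind (z <ᵇ y)) _ _) (exch (ind (z <ᵇ y)) (gec z pre) _))) ,
  trans e (trans (exch (gec y pre) (ind (y <ᵇ z)) _) (trans (sym (ℕₚ.+-assoc (ind (y <ᵇ z)) _ _)) (cong (λ b → ind b + gec y pre + gtc y (vals r)) (sym (≢⇒≤ᵇ≡<ᵇ ne))))) ,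
  LabOK-pre r (λ x → exch (ind (x ≤ᵇ z)) (ind (x ≤ᵇ y)) (gec x pre)) rest
LabOK-swap {pre} ((x , q₀) ∷ u) {y} {q} {z} {q'} r ne (e , rest) =
  trans e (cong (gec x pre ℕ.+_) (trans (cong (gtc x) (vals-++ u _)) (trans (gtc-swap x (vals u) y z (vals r)) (sym (cong (gtc x) (vals-++ u _)))))) ,
  LabOK-swap u r ne rest

LabOK-drop : ∀ {pre} u {V} → LabOK pre (u ++ V) → ∃[ pre' ] (LabOK pre' V)
LabOK-drop {pre} [] h = pre , h
LabOK-drop ((x , _) ∷ u) (_ , h) = LabOK-drop u h

LabOK-equal : ∀ {pre y q q'} r → LabOK pre ((y , q) ∷ (y , q') ∷ r) → q' ≡ suc q
LabOK-equal {pre} {y} r (e , e' , _) = trans e' (trans (cong (λ b → ind b + gec y pre + gtc y (vals r)) (≤ᵇ-true (ℕₚ.≤-refl {y})))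
  (cong suc (sym (trans e (cong (λ b → gec y pre + (ind b + gtc y (vals r))) (<ᵇ-false (ℕₚ.≤-refl {y})))))))

IsZ : Ent → Set
IsZ e = proj₁ e ≡ 0

Zeros : List Ent → Set
Zeros = All IsZ

gtc-zeros : ∀ {V} → Zeros V → gtc 0 (vals V) ≡ 0
gtc-zeros [] = refl
gtc-zeros (refl ∷ z) = gtc-zeros z

LabOK-zeros : ∀ {pre} u {q} r → Zeros r → LabOK pre (u ++ (0 , q) ∷ r) → q ≡ length pre + length u
LabOK-zeros {pre} [] r z (e , _) = trans e (cong₂ _+_ (gec-zero pre) (gtc-zeros z))
LabOK-zeros {pre} (_ ∷ u) r z (_ , h) = trans (LabOK-zeros u r z h) (sym (ℕₚ.+-suc (length pre) (length u)))

gtc-snoc : ∀ y xs x → gtc y (xs ++ suc x ∷ []) ≡ ind (y ≤ᵇ x) + gtc y xs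
gtc-snoc y xs x = trans (gtc-++ y xs _) (trans (ℕₚ.+-comm (gtc y xs) _) (cong (ℕ._+ gtc y xs) (trans (ℕₚ.+-identityʳ _) (cong ind (sym (≤ᵇ-suc y x))))))

LabOK-unsnoc : ∀ {pre} W {x q} → LabOK pre (W ++ (suc x , q) ∷ []) → LabOK (x ∷ pre) W × q ≡ gtc x pre + gtc x (vals W)
LabOK-unsnoc {pre} [] {x} (e , _) = tt , trans e (cong (ℕ._+ 0) (gec-suc x pre))
LabOK-unsnoc {pre} ((y , q₀) ∷ W) {x} {q} (e , h) =
  let (h' , e') = LabOK-unsnoc W h in
  (trans e (trans (cong (gec y pre ℕ.+_) (trans (cong (gtc y) (vals-++ W _)) (gtc-snoc y (vals W) x))) (trans (exch (gec y pre) (ind (y ≤ᵇ x)) _) (sym (ℕₚ.+-assoc (ind (y ≤ᵇ x)) _ _)))) ,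
   LabOK-pre W (λ z → exch (ind (z ≤ᵇ x)) (ind (z ≤ᵇ y)) (gec z pre)) h') ,
  trans e' (trans (ℕₚ.+-assoc (ind (x <ᵇ y)) _ _) (exch (ind (x <ᵇ y)) (gtc x pre) _))

-- The value `x` at the front precedes all its equals, and `suc x` at the end follows all its
-- equals; in both places the rank is the number of other entries exceeding `x`. So Ψ keeps all
-- ranks too.
LabOK-unΨ : ∀ W {x q} → LabOK [] (W ++ (suc x , q) ∷ []) → LabOK [] ((x , q) ∷ W)
LabOK-unΨ W h = let (h' , e) = LabOK-unsnoc W h in e , h'

LabOK-range : ∀ {pre} V → LabOK pre V → All (λ e → (gec (proj₁ e) pre + gtc (proj₁ e) (vals V) ≤ proj₂ e) × (proj₂ e < gec (proj₁ e) pre + gec (proj₁ e) (vals V))) V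
LabOK-range [] _ = []
LabOK-range {pre} ((x , q) ∷ V) (e , h) =
  (ℕₚ.≤-reflexive (trans (cong (λ b → gec x pre + (ind b + gtc x (vals V))) (<ᵇ-false (ℕₚ.≤-refl {x}))) (sym e)) ,
   ℕₚ.≤-trans (s≤s (ℕₚ.≤-trans (ℕₚ.≤-reflexive e) (ℕₚ.+-monoʳ-≤ (gec x pre) (gtc≤gec x (vals V)))))
     (ℕₚ.≤-reflexive (trans (sym (ℕₚ.+-suc (gec x pre) _)) (cong (λ b → gec x pre + (ind b + gec x (vals V))) (sym (≤ᵇ-true (ℕₚ.≤-refl {x}))))))) ∷
  All.map (λ {e'} (lo , hi) →
    (ℕₚ.≤-trans (ℕₚ.≤-trans (ℕₚ.+-monoʳ-≤ (gec (proj₁ e') pre) (ℕₚ.+-monoˡ-≤ _ (ind-mono (proj₁ e') x))) (ℕₚ.≤-reflexive (trans (exch (gec (proj₁ e') pre) (ind (proj₁ e' ≤ᵇ x)) _) (sym (ℕₚ.+-assoc (ind (proj₁ e' ≤ᵇ x)) _ _))))) lo) ,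
    (ℕₚ.≤-trans hi (ℕₚ.≤-reflexive (trans (ℕₚ.+-assoc (ind (proj₁ e' ≤ᵇ x)) _ _) (exch (ind (proj₁ e' ≤ᵇ x)) (gec (proj₁ e') pre) _))))) (LabOK-range V h)

Apart : Ent → Ent → Set
Apart e e' = proj₂ e ≢ proj₂ e'

-- Ranks of different values lie in disjoint intervals, and ranks of equal values increase to the
-- right.
LabOK-apart : ∀ {pre} V → LabOK pre V → AllPairs Apart V
LabOK-apart [] _ = []
LabOK-apart {pre} ((x , q) ∷ V) (e , h) = All.map (λ {e'} b → ne e' b) (LabOK-range V h) ∷ LabOK-apart V h
  where
  ne : ∀ (e' : Ent) → (gec (proj₁ e') (x ∷ pre) + gtc (proj₁ e') (vals V) ≤ proj₂ e') × (proj₂ e' < gec (proj₁ e') (x ∷ pre) + gec (proj₁ e') (vals V)) → q ≢ proj₂ e'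
  ne (y , q') (lo , hi) with ℕₚ.<-cmp y x
  ... | tri≈ _ refl _ = ℕₚ.<⇒≢ (ℕₚ.≤-trans (ℕₚ.≤-reflexive (trans (cong suc e) (cong (λ b → ind b + gec x pre + gtc x (vals V)) (sym (≤ᵇ-true (ℕₚ.≤-refl {x})))))) lo)
  ... | tri< lt _ _ = ℕₚ.<⇒≢ (ℕₚ.≤-trans (s≤s (ℕₚ.≤-trans (ℕₚ.≤-reflexive e) (ℕₚ.+-mono-≤ (ℕₚ.≤-trans (gec≤gtc lt pre) (gtc≤gec y pre)) (ℕₚ.≤-trans (gtc≤gec x (vals V)) (gec≤gtc lt (vals V))))))
          (ℕₚ.≤-trans (ℕₚ.≤-reflexive (cong (λ b → ind b + gec y pre + gtc y (vals V)) (sym (≤ᵇ-true (ℕₚ.<⇒≤ lt))))) lo))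
  ... | tri> _ _ gt = ℕₚ.<⇒≢ (ℕₚ.≤-trans hi (ℕₚ.≤-trans (ℕₚ.≤-reflexive (cong (λ b → ind b + gec y pre + gec y (vals V)) (≤ᵇ-false gt)))
          (ℕₚ.≤-trans (ℕₚ.+-mono-≤ (ℕₚ.≤-trans (gec≤gtc gt pre) (gtc≤gec x pre)) (gec≤gtc gt (vals V))) (ℕₚ.≤-reflexive (sym e))))) ∘ sym

apart-from : ∀ {A : Set} {R : A → A → Set} u {e s} → AllPairs R (u ++ e ∷ s) → ∀ {g} → g ∈ s → R e g
apart-from [] (h ∷ _) m = All.lookup h m
apart-from (_ ∷ u) (_ ∷ h) m = apart-from u h m

-- Cuts at the last nonzero entry and returns it with its value already lowered by one, as it is
-- before the Ψ that creates it.
splitz : List Ent → Maybe (List Ent × Ent × List Ent)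
splitz-step : Ent → List Ent → Maybe (List Ent × Ent × List Ent) → Maybe (List Ent × Ent × List Ent)
splitz [] = nothing
splitz (e ∷ V) = splitz-step e V (splitz V)
splitz-step e V (just (w , x , r)) = just (e ∷ w , x , r)
splitz-step (zero , q) V nothing = nothing
splitz-step (suc x , q) V nothing = just ([] , (x , q) , V)

splitz-zeros : ∀ {V} → Zeros V → splitz V ≡ nothing
splitz-zeros [] = refl
splitz-zeros (refl ∷ z) rewrite splitz-zeros z = refl

splitz-++ : ∀ w {x q r} → Zeros r → splitz (w ++ (suc x , q) ∷ r) ≡ just (w , (x , q) , r)
splitz-++ [] z rewrite splitz-zeros z = refl
splitz-++ (e ∷ w) z = cong (splitz-step e _) (splitz-++ w z)

data SplitZ : List Ent → Set where
  zeros : ∀ {V} → Zeros V → SplitZ V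
  last  : ∀ w x q {r} → Zeros r → SplitZ (w ++ (suc x , q) ∷ r)

splitZ : ∀ V → SplitZ V
splitZ [] = zeros []
splitZ (e ∷ V) with splitZ V
splitZ (e ∷ _) | last w x q z = last (e ∷ w) x q z
splitZ ((zero , q) ∷ V) | zeros z = zeros (refl ∷ z)
splitZ ((suc x , q) ∷ V) | zeros z = last [] x q z

total : List Ent → ℕ
total V = sum (vals V)

total-++ : ∀ u r → total (u ++ r) ≡ total u + total r
total-++ [] r = refl
total-++ ((x , _) ∷ u) r = trans (cong (x ℕ.+_) (total-++ u r)) (sym (ℕₚ.+-assoc x _ _))

total-swap : ∀ u e e' r → total (u ++ e ∷ e' ∷ r) ≡ total (u ++ e' ∷ e ∷ r)
total-swap u e e' r = trans (total-++ u _) (trans (cong (total u ℕ.+_) (exch (proj₁ e) (proj₁ e') _)) (sym (total-++ u _)))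

total-Ψ : ∀ W x q → total (W ++ (suc x , q) ∷ []) ≡ suc (total ((x , q) ∷ W))
total-Ψ W x q = trans (total-++ W _) (trans (ℕₚ.+-comm (total W) _) (cong (λ z → suc z + total W) (ℕₚ.+-identityʳ x)))

gapK : K → K → K
gapK z z' = inv (z' ⊖ᶠ z)

gapK-YB : ∀ {z₁ z₂ z₃} → z₂ ⊖ᶠ z₁ ≉ 0f → z₃ ⊖ᶠ z₂ ≉ 0f → z₃ ⊖ᶠ z₁ ≉ 0f → gapK z₁ z₃ ⊛ (gapK z₁ z₂ ⊕ gapK z₂ z₃) ≈ gapK z₁ z₂ ⊛ gapK z₂ z₃
gapK-YB {z₁} {z₂} {z₃} n₁ n₂ n₃ = ≈-trans (⊛-congʳ (inv-cong e)) (inv-sum n₁ n₂ (λ h → n₃ (≈-trans e h)))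
  where
  e : z₃ ⊖ᶠ z₁ ≈ (z₂ ⊖ᶠ z₁) ⊕ (z₃ ⊖ᶠ z₂)
  e = KS.solve 3 (λ a b c → c KS.:- a KS.:= (b KS.:- a) KS.:+ (c KS.:- b)) ≈-refl z₁ z₂ z₃

zE : List ℕ → Ent → K
zE t (x , q) = αf ⊛ fromZ (ℤ.+ x) ⊕ fromZ (ct t q)

zE-diff : ∀ t x q y q' → zE t (y , q') ⊖ᶠ zE t (x , q) ≈ αf ⊛ fromZ (ℤ.+ y ℤ.- ℤ.+ x) ⊕ fromZ (ct t q' ℤ.- ct t q)
zE-diff t x q y q' = ≈-trans (KS.solve 5 (λ a y c x d → (a KS.:* y KS.:+ c) KS.:- (a KS.:* x KS.:+ d) KS.:= a KS.:* (y KS.:- x) KS.:+ (c KS.:- d)) ≈-refl αf (fromZ (ℤ.+ y)) (fromZ (ct t q')) (fromZ (ℤ.+ x)) (fromZ (ct t q)))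
  (≈-sym (⊕-cong (⊛-congˡ (fromZ-sub (ℤ.+ y) (ℤ.+ x))) (fromZ-sub (ct t q') (ct t q))))

zE-apart-val : ∀ t {x y} q q' → x ≢ y → zE t (y , q') ⊖ᶠ zE t (x , q) ≉ 0f
zE-apart-val t {x} {y} q q' ne h = lin≉0 {ℤ.+ y ℤ.- ℤ.+ x} (ct t q' ℤ.- ct t q) (λ e → ne (sym (ℤₚ.+-injective (ℤₚ.i-j≡0⇒i≡j (ℤ.+ y) (ℤ.+ x) e))))
  (≈-trans (≡⇒≈ (lin-def _ _)) (≈-trans (≈-sym (zE-diff t x q y q')) h))

zE-diff-same : ∀ t x q q' → zE t (x , q') ⊖ᶠ zE t (x , q) ≈ fromZ (ct t q' ℤ.- ct t q)
zE-diff-same t x q q' = ≈-trans (KS.solve 4 (λ a x c d → (a KS.:* x KS.:+ c) KS.:- (a KS.:* x KS.:+ d) KS.:= (c KS.:- d)) ≈-refl αf (fromZ (ℤ.+ x)) (fromZ (ct t q')) (fromZ (ct t q)))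
  (≈-sym (fromZ-sub (ct t q') (ct t q)))

-- Two steps Ψ add α to both values of ζ, so the parameter of the operator is the same before and
-- after.
zE-diff-suc : ∀ t x q y q' → zE t (suc y , q') ⊖ᶠ zE t (suc x , q) ≈ zE t (y , q') ⊖ᶠ zE t (x , q)
zE-diff-suc t x q y q' = ≈-trans (zE-diff t (suc x) q (suc y) q') (≈-trans (≡⇒≈ (cong (λ z → αf ⊛ fromZ z ⊕ fromZ (ct t q' ℤ.- ct t q)) e)) (≈-sym (zE-diff t x q y q')))
  where
  e : ℤ.+ suc y ℤ.- ℤ.+ suc x ≡ ℤ.+ y ℤ.- ℤ.+ x
  e = trans (ℤₚ.m-n≡m⊖n (suc y) (suc x)) (trans (ℤₚ.[1+m]⊖[1+n]≡m⊖n y x) (sym (ℤₚ.m-n≡m⊖n y x)))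

eqL-refl : ∀ a → eqL a a ≡ true
eqL-refl a with Listₚ.≡-dec ℕ._≟_ a a
... | yes _ = refl
... | no h = ⊥-elim (h refl)

eqL-≢ : ∀ {a b} → a ≢ b → eqL a b ≡ false
eqL-≢ {a} {b} ne with Listₚ.≡-dec ℕ._≟_ a b
... | yes e = ⊥-elim (ne e)
... | no _ = refl

eqL⇒≡ : ∀ {a b} → eqL a b ≡ true → a ≡ b
eqL⇒≡ {a} {b} h with Listₚ.≡-dec ℕ._≟_ a b
... | yes e = e
eqL⇒≡ () | no _

swap0-replicate : ∀ {A : Set} n p (x : A) → swap0 (replicate n x) p ≡ replicate n x
swap0-replicate zero p x = refl
swap0-replicate (suc zero) zero x = refl
swap0-replicate (suc (suc n)) zero x = refl
swap0-replicate (suc n) (suc p) x = trans (swap0-∷ x (replicate n x) p) (cong (x ∷_) (swap0-replicate n p x))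

-- The vectors J_{v,τ} along a chosen path, and the edges of G_λ

module Graph (lam : List ℕ) where
  open Polynomials lam public

  base : List ℕ → Fun
  base t m s = if eqL m (replicate N 0) ∧ eqL s t then 1f else 0f

  -- J k t V is J_{v,τ} for the composition underlying V, of degree k: the last nonzero entry
  -- is obtained by Ψ and then moved to the left past the zeros that follow it.
  J : ℕ → List ℕ → List Ent → Fun
  Jsplit : ℕ → List ℕ → Maybe (List Ent × Ent × List Ent) → Fun
  Jmove : ℕ → List ℕ → List Ent → Ent → List Ent → Fun
  J zero t V = base t
  J (suc k) t V = Jsplit k t (splitz V)
  Jsplit k t nothing = base t
  Jsplit k t (just (w , e , r)) = Jmove k t w e r
  Jmove k t w e [] = Ψ (J k t (e ∷ w))
  Jmove k t w (x , q) (e₀ ∷ r) = S (length w) (gapK (zE t e₀) (zE t (suc x , q))) (Jmove k t (w ++ e₀ ∷ []) (x , q) r)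

  J-zeros : ∀ k t {V} → Zeros V → J k t V ≡ base t
  J-zeros zero t z = refl
  J-zeros (suc k) t z = cong (Jsplit k t) (splitz-zeros z)

  J-Ψ : ∀ k t W x q → J (suc k) t (W ++ (suc x , q) ∷ []) ≡ Ψ (J k t ((x , q) ∷ W))
  J-Ψ k t W x q = cong (Jsplit k t) (splitz-++ W [])

  J-move : ∀ k t w x q e₀ r → Zeros (e₀ ∷ r) → J (suc k) t (w ++ (suc x , q) ∷ e₀ ∷ r) ≡
    S (length w) (gapK (zE t e₀) (zE t (suc x , q))) (J (suc k) t (w ++ e₀ ∷ (suc x , q) ∷ r))
  J-move k t w x q e₀ r (z₀ ∷ z) = trans (cong (Jsplit k t) (splitz-++ w (z₀ ∷ z)))
    (cong (S (length w) _) (sym (trans (cong (J (suc k) t) (sym (Listₚ.++-assoc w (e₀ ∷ []) ((suc x , q) ∷ r)))) (cong (Jsplit k t) (splitz-++ (w ++ e₀ ∷ []) z)))))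

  -- The end of an s-edge at two equal entries of ranks `q` and `suc q`: another tableau, or ∅
  -- written as `nothing`. At axial distance -2 or less there is no edge.
  data Target (t : List ℕ) (q : ℕ) : Maybe (List ℕ) → Set where
    flip : ∀ k → suc q < N → dd q t ≡ ℤ.+ (suc (suc k)) → Valid lam (swap0 t q) →
           ct (swap0 t q) q ≡ ct t (suc q) → ct (swap0 t q) (suc q) ≡ ct t q → Target t q (just (swap0 t q))
    null : suc q < N → dd q t ≡ ℤ.+ 1 ⊎ dd q t ≡ -[1+ 0 ] → Target t q nothing

  -- An s_i-edge out of a vertex whose entries at i, i+1 are e, e'; at the target they are f, f'
  data Edge (t : List ℕ) : Ent → Ent → Maybe (List ℕ) → Ent → Ent → Set where
    up  : ∀ {y q z q'} → y < z → Edge t (y , q) (z , q') (just t) (z , q') (y , q)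
    tie : ∀ {y q T} → Target t q T → Edge t (y , q) (y , suc q) T (y , q) (y , suc q)

  -- J at ∅ is zero, so an edge into ∅ becomes a relation of the same form as any other edge.
  J? : ℕ → Maybe (List ℕ) → List Ent → Fun
  J? k (just t) V = J k t V
  J? k nothing V = 𝟎

  Target-dd : ∀ {t q T} → Target t q T → dd q t ≢ ℤ.+ 0
  Target-dd (flip k _ e _ _ _) h with trans (sym e) h
  ... | ()
  Target-dd (null _ (inj₁ e)) h with trans (sym e) h
  ... | ()
  Target-dd (null _ (inj₂ e)) h with trans (sym e) h
  ... | ()

  edge-z≉ : ∀ {t e e' T f f'} → Edge t e e' T f f' → zE t e' ⊖ᶠ zE t e ≉ 0f
  edge-z≉ {t} (up lt) = zE-apart-val t _ _ (ℕₚ.<⇒≢ lt)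
  edge-z≉ {t} (tie {y} {q} tg) h = fromZ≉0 (λ e → Target-dd tg (ℤₚ.i≡j⇒i-j≡0 (sym (ℤₚ.i-j≡0⇒i≡j (ct t (suc q)) (ct t q) e))))
    (≈-trans (≈-sym (zE-diff-same t y q (suc q))) h)

  edge-z₁ : ∀ {t e e' t' f f'} → Edge t e e' (just t') f f' → zE t' f ≡ zE t e'
  edge-z₁ (up _) = refl
  edge-z₁ (tie {y} (flip k _ _ _ c c')) = cong (λ z → αf ⊛ fromZ (ℤ.+ y) ⊕ fromZ z) c

  edge-z₂ : ∀ {t e e' t' f f'} → Edge t e e' (just t') f f' → zE t' f' ≡ zE t e
  edge-z₂ (up _) = refl
  edge-z₂ (tie {y} (flip k _ _ _ c c')) = cong (λ z → αf ⊛ fromZ (ℤ.+ y) ⊕ fromZ z) c'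

  edge-z₀ : ∀ {t e e' t' f f'} → Edge t e e' (just t') f f' → ∀ {g} → Apart e g → Apart e' g → zE t' g ≡ zE t g
  edge-z₀ (up _) _ _ = refl
  edge-z₀ {t} (tie {y} {q} (flip k _ _ _ c c')) {x , g} ne ne' = cong (λ z → αf ⊛ fromZ (ℤ.+ x) ⊕ fromZ z) (ct-swap-far t g q far)
    where
    far : suc g ≤ q ⊎ suc (suc q) ≤ g
    far with ℕₚ.<-cmp g q
    ... | tri< lt _ _ = inj₁ lt
    ... | tri≈ _ e _ = ⊥-elim (ne (sym e))
    ... | tri> _ _ gt = inj₂ (ℕₚ.≤∧≢⇒< gt ne')

  J?-move : ∀ k T w x q e₀ r {z₀ z} → Zeros (e₀ ∷ r) → (∀ {t'} → T ≡ just t' → zE t' e₀ ≡ z₀ × zE t' (suc x , q) ≡ z) →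
    J? (suc k) T (w ++ (suc x , q) ∷ e₀ ∷ r) ≐ S (length w) (gapK z₀ z) (J? (suc k) T (w ++ e₀ ∷ (suc x , q) ∷ r))
  J?-move k (just t') w x q e₀ r zs h with h refl
  ... | refl , refl = ≡⇒≐ (J-move k t' w x q e₀ r zs)
  J?-move k nothing w x q e₀ r zs h = ≐-sym (S-zero _ _)

  J?-Ψ : ∀ {n} → N ≡ suc n → ∀ k T W x q → J? (suc k) T (W ++ (suc x , q) ∷ []) ≐ Ψ (J? k T ((x , q) ∷ W))
  J?-Ψ eqN k (just t) W x q = ≡⇒≐ (J-Ψ k t W x q)
  J?-Ψ eqN k nothing W x q = ≐-sym (Ψ-zero eqN)

  J?-cong : ∀ k T {V V'} → V ≡ V' → J? k T V ≐ J? k T V'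
  J?-cong k T refl = ≐-refl

  record WF (V : List Ent) : Set where
    constructor wf
    field
      len : length V ≡ N
      lab : LabOK [] V
  open WF public

  wf-swap : ∀ u {y q z q'} r → y ≢ z → WF (u ++ (y , q) ∷ (z , q') ∷ r) → WF (u ++ (z , q') ∷ (y , q) ∷ r)
  wf-swap u r ne w = wf (trans (trans (Listₚ.length-++ u) (sym (Listₚ.length-++ u))) (len w)) (LabOK-swap u r ne (lab w))

  wf-unΨ : ∀ W {x q} → WF (W ++ (suc x , q) ∷ []) → WF ((x , q) ∷ W)
  wf-unΨ W w = wf (trans (sym (trans (Listₚ.length-++ W) (ℕₚ.+-comm (length W) 1))) (len w)) (LabOK-unΨ W (lab w))

  Intertwines : ℕ → List ℕ → List Ent → Ent → Ent → List Ent → Maybe (List ℕ) → Ent → Ent → Set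
  Intertwines k t u e e' r T f f' = S (length u) (gapK (zE t e) (zE t e')) (J k t (u ++ e ∷ e' ∷ r)) ≐ J? k T (u ++ f ∷ f' ∷ r)

  base-1 : ∀ t {m} → m ≡ replicate N 0 → base t m t ≡ 1f
  base-1 t refl rewrite eqL-refl (replicate N 0) | eqL-refl t = refl

  base-m : ∀ t {m} s → m ≢ replicate N 0 → base t m s ≡ 0f
  base-m t s ne rewrite eqL-≢ ne = refl

  base-s : ∀ t m {s} → s ≢ t → base t m s ≡ 0f
  base-s t m ne with eqL m (replicate N 0)
  ... | true rewrite eqL-≢ ne = refl
  ... | false = refl

  swap-zero : ∀ {m q} → swap0 m q ≡ replicate N 0 → m ≡ replicate N 0
  swap-zero {m} {q} e = trans (sym (swap0-invol m q)) (trans (cong (λ z → swap0 z q) e) (swap0-replicate N q 0))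

  κ-null : ∀ {d} → d ≡ ℤ.+ 1 ⊎ d ≡ -[1+ 0 ] → κ d ≡ 0f
  κ-null (inj₁ refl) = refl
  κ-null (inj₂ refl) = refl

  gapK-dd : ∀ t q y → dd q t ≢ ℤ.+ 0 → gapK (zE t (y , q)) (zE t (y , suc q)) ≈ ⊝ β (dd q t)
  gapK-dd t q y nz = ≈-trans (inv-cong (≈-trans (zE-diff-same t y q (suc q)) (≈-trans (≡⇒≈ (cong fromZ (sym (neg-sub (ct t q) (ct t (suc q)))))) (fromZ-neg (dd q t))))) (inv-⊝ (fromZ≉0 nz))

  -- In degree 0 the relation is the rule for τ s_i itself. The parameter is -b and removes the
  -- diagonal term; what remains is the exchanged tableau with coefficient 1, or nothing if the two
  -- entries are neighbours in a row or column.
  base-edge : ∀ {t q T} y → Target t q T → ∀ {k V} → Zeros V → S q (gapK (zE t (y , q)) (zE t (y , suc q))) (base t) ≐ J? k T V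
  base-edge {t} {q} {T} y tg {k} {V} zs = pointwise go
    where
    δ : K
    δ = gapK (zE t (y , q)) (zE t (y , suc q))
    cancel : β (dd q t) ⊛ 1f ⊕ 0f ⊕ δ ⊛ 1f ≈ 0f
    cancel = ≈-trans (⊕-congˡ (⊛-congʳ (gapK-dd t q y (Target-dd tg)))) (≈-trans (⊕-congʳ (KRing.+-identityʳ _))
      (KS.solve 2 (λ b o → b KS.:* o KS.:+ (KS.:- b) KS.:* o KS.:= KS.con (ℤ.+ 0)) ≈-refl (β (dd q t)) 1f))
    target-m : ∀ {T} → Target t q T → ∀ {m s} → m ≢ replicate N 0 → J? k T V m s ≈ 0f
    target-m (flip j _ _ _ _ _) {m} {s} ne = ≡⇒≈ (trans (cong (λ f → f m s) (J-zeros k (swap0 t q) zs)) (base-m (swap0 t q) s ne))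
    target-m (null _ _) ne = ≈-refl
    at-t : ∀ {T} → Target t q T → ∀ {m} → m ≡ replicate N 0 → (κ (dd q t) ⊛ base t (swap0 m q) (swap0 t q) ≈ 0f) × (J? k T V m t ≈ 0f)
    at-t (flip j lt e v c c') {m} em = ⊛-zeroʳ (≡⇒≈ (base-s t (swap0 m q) ne)) , ≡⇒≈ (trans (cong (λ f → f m t) (J-zeros k (swap0 t q) zs)) (base-s (swap0 t q) m (ne ∘ sym)))
      where
      ne : swap0 t q ≢ t
      ne h with trans (sym e) (ℤₚ.i≡j⇒i-j≡0 (trans (sym (cong (λ z → ct z q) h)) c))
      ... | ()
    at-t (null lt e) em = ⊛-zeroˡ (≡⇒≈ (κ-null e)) , ≈-refl
    at-t' : ∀ {T} → Target t q T → ∀ {m} → m ≡ replicate N 0 → Valid lam (swap0 t q) → swap0 t q ≢ t → κ (dd q (swap0 t q)) ≈ J? k T V m (swap0 t q)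
    at-t' (flip j lt e v c c') {m} em v' ne = ≈-trans (≡⇒≈ (cong κ (trans (dd-exchange {t} {q} c c') (cong (ℤ.-_) e))))
       (≡⇒≈ (sym (trans (cong (λ f → f m (swap0 t q)) (J-zeros k (swap0 t q) zs)) (base-1 (swap0 t q) em))))
    at-t' (null lt e) em v' ne with place {p = q} v' (subst (suc q ℕ.<_) (sym (size v')) lt)
    ... | same-row d = ≡⇒≈ (κ-null (inj₁ d))
    ... | same-col d = ≡⇒≈ (κ-null (inj₂ d))
    ... | exchange j d _ c c' = ⊥-elim (clash e (subst (λ s → dd q s ≡ ℤ.- dd q (swap0 t q)) (swap0-invol t q) (dd-exchange {swap0 t q} {q} c c')) d)
      where
      clash : ∀ {a b} → a ≡ ℤ.+ 1 ⊎ a ≡ -[1+ 0 ] → a ≡ ℤ.- b → b ≡ ℤ.+ (suc (suc j)) ⊎ b ≡ -[1+ suc j ] → ⊥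
      clash (inj₁ refl) () (inj₁ refl)
      clash (inj₁ refl) () (inj₂ refl)
      clash (inj₂ refl) () (inj₁ refl)
      clash (inj₂ refl) () (inj₂ refl)
    off : ∀ {T} → Target t q T → ∀ m {s} → s ≢ swap0 t q → J? k T V m s ≈ 0f
    off (flip j _ _ _ _ _) m {s} ne = ≡⇒≈ (trans (cong (λ f → f m s) (J-zeros k (swap0 t q) zs)) (base-s (swap0 t q) m ne))
    off (null _ _) m ne = ≈-refl
    cases : ∀ {m s} → Valid lam s → Dec (m ≡ replicate N 0) → Dec (s ≡ t) → Dec (s ≡ swap0 t q) → S q δ (base t) m s ≈ J? k T V m s
    cases {m} {s} v (no ne) _ _ = ≈-trans (⊕-zero (⊕-zero (⊛-zeroʳ (≡⇒≈ (base-m t s (ne ∘ swap-zero)))) (⊛-zeroʳ (≡⇒≈ (base-m t (swap0 s q) (ne ∘ swap-zero))))) (⊛-zeroʳ (≡⇒≈ (base-m t s ne))))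
                   (≈-sym (target-m tg ne))
    cases {m} {s} v (yes em) (yes refl) _ = ≈-trans (⊕-cong (⊕-cong (⊛-congˡ (≡⇒≈ (base-1 t em'))) (proj₁ (at-t tg em))) (⊛-congˡ (≡⇒≈ (base-1 t em)))) (≈-trans cancel (≈-sym (proj₂ (at-t tg em))))
      where
      em' : swap0 m q ≡ replicate N 0
      em' = trans (cong (λ z → swap0 z q) em) (swap0-replicate N q 0)
    cases {m} {s} v (yes em) (no s≢t) (no s≢t') = ≈-trans (⊕-zero (⊕-zero (⊛-zeroʳ (≡⇒≈ (base-s t (swap0 m q) s≢t))) (⊛-zeroʳ (≡⇒≈ (base-s t (swap0 m q) {swap0 s q} (λ h → s≢t' (trans (sym (swap0-invol s q)) (cong (λ z → swap0 z q) h)))))))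
                        (⊛-zeroʳ (≡⇒≈ (base-s t m s≢t)))) (≈-sym (off tg m s≢t'))
    cases {m} {s} v (yes em) (no s≢t) (yes refl) = ≈-trans (⊕-cong (⊕-cong (⊛-zeroʳ (≡⇒≈ (base-s t (swap0 m q) s≢t))) (⊛-congˡ (≡⇒≈ (trans (cong (base t (swap0 m q)) (swap0-invol t q)) (base-1 t (trans (cong (λ z → swap0 z q) em) (swap0-replicate N q 0)))))))
                        (⊛-zeroʳ (≡⇒≈ (base-s t m s≢t)))) (≈-trans (≈-trans (KRing.+-identityʳ _) (≈-trans (KRing.+-identityˡ _) (KRing.*-identityʳ _))) (at-t' tg em v s≢t))
    go : ∀ {m s} → OfLen m → Valid lam s → S q δ (base t) m s ≈ J? k T V m s
    go {m} {s} l v = cases v (Listₚ.≡-dec ℕ._≟_ m (replicate N 0)) (Listₚ.≡-dec ℕ._≟_ s t) (Listₚ.≡-dec ℕ._≟_ s (swap0 t q))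

-- Path independence

module Intertwining (lam : List ℕ) where
  open Graph lam public

  private
    length-mid : ∀ u (e e' f f' : Ent) r → length (u ++ e ∷ e' ∷ r) ≡ length (u ++ f ∷ f' ∷ r)
    length-mid u e e' f f' r = trans (Listₚ.length-++ u) (sym (Listₚ.length-++ u))

    length-snoc : ∀ (u : List Ent) e → length (u ++ e ∷ []) ≡ suc (length u)
    length-snoc u e = trans (Listₚ.length-++ u) (ℕₚ.+-comm (length u) 1)

    pos< : ∀ (u : List Ent) e e' r → length (u ++ e ∷ e' ∷ r) ≡ N → suc (length u) < N
    pos< u e e' r l = subst (suc (length u) ℕ.<_) l (subst (suc (length u) ℕ.<_) (sym (Listₚ.length-++ u))
      (subst (suc (suc (length u)) ℕ.≤_) (trans (cong suc (sym (ℕₚ.+-suc (length u) (length r)))) (sym (ℕₚ.+-suc (length u) (suc (length r))))) (s≤s (s≤s (ℕₚ.m≤m+n _ _)))))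

    assoc₂ : ∀ (u : List Ent) e e' r s → u ++ e ∷ e' ∷ (r ++ s) ≡ (u ++ e ∷ e' ∷ r) ++ s
    assoc₂ u e e' r s = sym (Listₚ.++-assoc u (e ∷ e' ∷ r) s)

    assoc₁ : ∀ (u : List Ent) e s → u ++ e ∷ s ≡ (u ++ e ∷ []) ++ s
    assoc₁ u e s = sym (Listₚ.++-assoc u (e ∷ []) s)

  -- If the list ends with a nonzero entry behind the pair, both sides are Ψ-images, and the
  -- relation is the one of degree one lower with the pair shifted one place to the right.
  Ψ-step : ∀ k t u e e' r x q {T f f'} → length (u ++ e ∷ e' ∷ (r ++ (suc x , q) ∷ [])) ≡ N →
    Intertwines k t ((x , q) ∷ u) e e' r T f f' → Intertwines (suc k) t u e e' (r ++ (suc x , q) ∷ []) T f f'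
  Ψ-step k t u e e' r x q {T} {f} {f'} l ih =
    ≐-trans (S-cong (pos< u e e' _ l) ≈-refl (≡⇒≐ (trans (cong (J (suc k) t) (assoc₂ u e e' r _)) (J-Ψ k t W x q))))
    (≐-trans (Ψ-S eqN (length u) g (J k t ((x , q) ∷ W)) small)
    (≐-trans (Ψ-cong eqN ih)
    (≐-trans (≐-sym (J?-Ψ eqN k T (u ++ f ∷ f' ∷ r) x q)) (J?-cong (suc k) T (sym (assoc₂ u f f' r _))))))
    where
    W : List Ent
    W = u ++ e ∷ e' ∷ r
    g : K
    g = gapK (zE t e) (zE t e')
    eqN : N ≡ suc (length W)
    eqN = trans (sym l) (trans (cong length (assoc₂ u e e' r _)) (length-snoc W _))
    small : suc (length u) < length W
    small = subst (suc (length u) ℕ.<_) (sym (Listₚ.length-++ u)) (subst (suc (suc (length u)) ℕ.≤_) (trans (cong suc (sym (ℕₚ.+-suc (length u) (length r)))) (sym (ℕₚ.+-suc (length u) (suc (length r))))) (s≤s (s≤s (ℕₚ.m≤m+n _ _))))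

  -- A pair of nonzero entries at the very end consists of the first two entries two Ψ-steps
  -- earlier, so `ΨΨ-S` lowers the degree by two.
  ΨΨ-step : ∀ k t u y q x q' {T a b a' b'} → length (u ++ (suc y , q) ∷ (suc x , q') ∷ []) ≡ N →
    Intertwines k t [] (y , q) (x , q') u T (a , b) (a' , b') →
    Intertwines (suc (suc k)) t u (suc y , q) (suc x , q') [] T (suc a , b) (suc a' , b')
  ΨΨ-step k t u y q x q' {T} {a} {b} {a'} {b'} l ih =
    ≐-trans (S-cong (pos< u _ _ _ l) (inv-cong (zE-diff-suc t y q x q')) (≐-trans (≡⇒≐ (trans (cong (J (suc (suc k)) t) (assoc₁ u _ _)) (J-Ψ (suc k) t (u ++ _ ∷ []) x q'))) (Ψ-cong eqN (≡⇒≐ (J-Ψ k t ((x , q') ∷ u) y q)))))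
    (≐-trans (ΨΨ-S eqN _ (J k t ((y , q) ∷ (x , q') ∷ u)))
    (≐-trans (Ψ-cong eqN (Ψ-cong eqN ih))
    (≐-sym (≐-trans (J?-cong (suc (suc k)) T (assoc₁ u _ _)) (≐-trans (J?-Ψ eqN (suc k) T (u ++ _ ∷ []) a' b') (Ψ-cong eqN (J?-Ψ eqN k T ((a' , b') ∷ u) a b)))))))
    where
    eqN : N ≡ suc (suc (length u))
    eqN = trans (sym l) (trans (Listₚ.length-++ u) (ℕₚ.+-comm (length u) 2))

  commute-right : ∀ k t u e e' r x q e₀ r₀ {T f f'} → length (u ++ e ∷ e' ∷ (r ++ (suc x , q) ∷ e₀ ∷ r₀)) ≡ N → Zeros (e₀ ∷ r₀) →
    (∀ {t'} → T ≡ just t' → zE t' e₀ ≡ zE t e₀ × zE t' (suc x , q) ≡ zE t (suc x , q)) →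
    Intertwines (suc k) t u e e' (r ++ e₀ ∷ (suc x , q) ∷ r₀) T f f' →
    Intertwines (suc k) t u e e' (r ++ (suc x , q) ∷ e₀ ∷ r₀) T f f'
  commute-right k t u e e' r x q e₀ r₀ {T} {f} {f'} l zs hz ih =
    ≐-trans (S-cong (pos< u e e' _ l) ≈-refl (≡⇒≐ (trans (cong (J (suc k) t) (assoc₂ u e e' r _)) (trans (J-move k t W x q e₀ r₀ zs) (cong (S (length W) h) (cong (J (suc k) t) (sym (assoc₂ u e e' r _))))))))
    (≐-trans (S-comm g h _ far lt)
    (≐-trans (S-cong lt ≈-refl ih)
    (≐-sym (≐-trans (J?-cong (suc k) T (assoc₂ u f f' r _)) (≐-trans (J?-move k T (u ++ f ∷ f' ∷ r) x q e₀ r₀ zs hz)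
      (≐-trans (≡⇒≐ (cong (λ n → S n h (J? (suc k) T ((u ++ f ∷ f' ∷ r) ++ e₀ ∷ (suc x , q) ∷ r₀))) (length-mid u f f' e e' r)))
        (S-cong lt ≈-refl (J?-cong (suc k) T (sym (assoc₂ u f f' r _))))))))))
    where
    W : List Ent
    W = u ++ e ∷ e' ∷ r
    g h : K
    g = gapK (zE t e) (zE t e')
    h = gapK (zE t e₀) (zE t (suc x , q))
    lt : suc (length W) < N
    lt = pos< W (suc x , q) e₀ r₀ (trans (cong length (sym (assoc₂ u e e' r _))) l)
    far : suc (suc (length u)) ≤ length W
    far = subst (suc (suc (length u)) ℕ.≤_) (trans (trans (cong suc (sym (ℕₚ.+-suc (length u) (length r)))) (sym (ℕₚ.+-suc (length u) (suc (length r))))) (sym (Listₚ.length-++ u))) (s≤s (s≤s (ℕₚ.m≤m+n _ _)))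

  commute-left : ∀ k t u x q e₀ u₀ e e' r {T f f'} → length ((u ++ (suc x , q) ∷ e₀ ∷ u₀) ++ e ∷ e' ∷ r) ≡ N →
    Zeros (e₀ ∷ u₀ ++ e ∷ e' ∷ r) → Zeros (e₀ ∷ u₀ ++ f ∷ f' ∷ r) →
    (∀ {t'} → T ≡ just t' → zE t' e₀ ≡ zE t e₀ × zE t' (suc x , q) ≡ zE t (suc x , q)) →
    Intertwines (suc k) t (u ++ e₀ ∷ (suc x , q) ∷ u₀) e e' r T f f' →
    Intertwines (suc k) t (u ++ (suc x , q) ∷ e₀ ∷ u₀) e e' r T f f'
  commute-left k t u x q e₀ u₀ e e' r {T} {f} {f'} l zs zs' hz ih =
    ≐-trans (S-cong lt ≈-refl (≡⇒≐ (trans (cong (J (suc k) t) (Listₚ.++-assoc u _ _)) (trans (J-move k t u x q e₀ (u₀ ++ e ∷ e' ∷ r) zs) (cong (S (length u) h) (cong (J (suc k) t) (sym (Listₚ.++-assoc u _ _))))))))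
    (≐-trans (≐-sym (S-comm h g _ far lt))
    (≐-trans (S-cong lt₀ ≈-refl (≐-trans (≡⇒≐ (cong (λ n → S n g (J (suc k) t ((u ++ e₀ ∷ (suc x , q) ∷ u₀) ++ e ∷ e' ∷ r))) (length-mid u _ _ _ _ u₀))) ih))
    (≐-sym (≐-trans (J?-cong (suc k) T (Listₚ.++-assoc u _ _)) (≐-trans (J?-move k T u x q e₀ (u₀ ++ f ∷ f' ∷ r) zs' hz)
      (S-cong lt₀ ≈-refl (J?-cong (suc k) T (sym (Listₚ.++-assoc u _ _)))))))))
    where
    g h : K
    g = gapK (zE t e) (zE t e')
    h = gapK (zE t e₀) (zE t (suc x , q))
    lt : suc (length (u ++ (suc x , q) ∷ e₀ ∷ u₀)) < N
    lt = pos< (u ++ (suc x , q) ∷ e₀ ∷ u₀) e e' r l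
    far : suc (suc (length u)) ≤ length (u ++ (suc x , q) ∷ e₀ ∷ u₀)
    far = subst (suc (suc (length u)) ℕ.≤_) (trans (trans (cong suc (sym (ℕₚ.+-suc (length u) (length u₀)))) (sym (ℕₚ.+-suc (length u) (suc (length u₀))))) (sym (Listₚ.length-++ u))) (s≤s (s≤s (ℕₚ.m≤m+n _ _)))
    lt₀ : suc (length u) < N
    lt₀ = ℕₚ.<-trans (ℕₚ.≤-trans far (ℕₚ.n≤1+n _)) lt

  -- Two nonzero entries followed by a zero: both can be obtained by moving left past this zero, and
  -- the Yang-Baxter relation lets the edge be taken before the moves, where fewer zeros trail.
  braid-right : ∀ k t u y q x q' e₀ r {T a b a' b'} → length (u ++ (suc y , q) ∷ (suc x , q') ∷ e₀ ∷ r) ≡ N → Zeros (e₀ ∷ r) →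
    Edge t (suc y , q) (suc x , q') T (suc a , b) (suc a' , b') →
    (∀ {t'} → T ≡ just t' → zE t' e₀ ≡ zE t e₀) →
    Intertwines (suc k) t u e₀ (suc y , q) ((suc x , q') ∷ r) (just t) (suc y , q) e₀ →
    Intertwines (suc k) t (u ++ e₀ ∷ []) (suc y , q) (suc x , q') r T (suc a , b) (suc a' , b') →
    S (length u) (gapK (zE t e₀) (zE t (suc x , q'))) (J? (suc k) T (u ++ e₀ ∷ (suc a , b) ∷ (suc a' , b') ∷ r)) ≐ J? (suc k) T (u ++ (suc a , b) ∷ e₀ ∷ (suc a' , b') ∷ r) →
    Intertwines (suc k) t u (suc y , q) (suc x , q') (e₀ ∷ r) T (suc a , b) (suc a' , b')
  braid-right k t u y q x q' (zero , q₀) r {T} {a} {b} {a'} {b'} l zs@(refl ∷ _) ed hz ih₁ ih₂ ih₃ =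
    ≐-trans (S-cong lt₀ ≈-refl (≐-trans (≡⇒≐ (trans (cong (J (suc k) t) (assoc₁ u Y _)) (trans (J-move k t (u ++ Y ∷ []) x q' e₀ r zs) (cong₂ (λ n V → S n C (J (suc k) t V)) (length-snoc u Y) (sym (assoc₁ u Y _))))))
      (S-cong lt ≈-refl (≐-sym ih₁))))
    (≐-trans (S-YB A B C J₀ lt (gapK-YB (zE-apart-val t {0} {suc y} q₀ q (λ ())) (edge-z≉ ed) (zE-apart-val t {0} {suc x} q₀ q' (λ ()))))
    (≐-trans (S-cong lt ≈-refl (S-cong lt₀ ≈-refl (≐-trans (≡⇒≐ (sym (cong₂ (λ n V → S n B (J (suc k) t V)) (length-snoc u e₀) (sym (assoc₁ u e₀ _))))) (≐-trans ih₂ (J?-cong (suc k) T (sym (assoc₁ u e₀ _)))))))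
    (≐-trans (S-cong lt ≈-refl ih₃)
    (≐-sym (≐-trans (J?-cong (suc k) T (assoc₁ u F _)) (≐-trans (J?-move k T (u ++ F ∷ []) a' b' e₀ r zs (λ { refl → hz refl , edge-z₂ ed }))
       (≡⇒≐ (cong₂ (λ n V → S n A (J? (suc k) T V)) (length-snoc u F) (sym (assoc₁ u F _))))))))))
    where
    e₀ Y X' F : Ent
    e₀ = zero , q₀
    Y = suc y , q
    X' = suc x , q'
    F = suc a , b
    A B C : K
    A = gapK (zE t e₀) (zE t Y)
    B = gapK (zE t Y) (zE t X')
    C = gapK (zE t e₀) (zE t X')
    J₀ : Fun
    J₀ = J (suc k) t (u ++ e₀ ∷ Y ∷ X' ∷ r)
    lt₀ : suc (length u) < N
    lt₀ = pos< u _ _ _ l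
    lt : suc (suc (length u)) < N
    lt = subst (λ n → suc n ℕ.< N) (length-snoc u Y) (pos< (u ++ Y ∷ []) X' e₀ r (trans (cong length (sym (assoc₁ u Y _))) l))

  -- The nonzero entry stands directly before a tie of two zeros. It came from behind both, and the
  -- Yang-Baxter relation moves the tie to the time before it passed.
  braid-left : ∀ k t u x q e e' r {T f f'} → length ((u ++ (suc x , q) ∷ []) ++ e ∷ e' ∷ r) ≡ N → Zeros (e ∷ e' ∷ r) → Zeros (f ∷ f' ∷ r) →
    Edge t e e' T f f' → (∀ {t'} → T ≡ just t' → zE t' (suc x , q) ≡ zE t (suc x , q)) →
    Intertwines (suc k) t u e e' ((suc x , q) ∷ r) T f f' →
    Intertwines (suc k) t (u ++ (suc x , q) ∷ []) e e' r T f f'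
  braid-left k t u x q (zero , q₁) (zero , q₂) r {T} {f} {f'} l zs@(refl ∷ zs₁@(refl ∷ zs₂)) zs'@(_ ∷ zs₁') ed hz ih =
    ≐-trans (≡⇒≐ (cong₂ (λ n V → S n A (J (suc k) t V)) (length-snoc u X') (sym (assoc₁ u X' _))))
    (≐-trans (S-cong lt ≈-refl (≡⇒≐ (trans (J-move k t u x q e (e' ∷ r) zs) (cong (S (length u) C) (trans (cong (J (suc k) t) (assoc₁ u e _)) (trans (J-move k t (u ++ e ∷ []) x q e' r zs₁) (cong₂ (λ n V → S n B (J (suc k) t V)) (length-snoc u e) (sym (assoc₁ u e _)))))))))
    (≐-trans (≐-sym (S-YB A B C J₀ lt (gapK-YB (edge-z≉ ed) (zE-apart-val t {0} {suc x} q₂ q (λ ())) (zE-apart-val t {0} {suc x} q₁ q (λ ())))))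
    (≐-trans (S-cong lt₀ ≈-refl (S-cong lt ≈-refl ih))
    (≐-trans (S-cong lt₀ ≈-refl (≐-sym (≐-trans (J?-cong (suc k) T (assoc₁ u f _)) (≐-trans (J?-move k T (u ++ f ∷ []) x q f' r zs₁' (λ { refl → edge-z₂ ed , hz refl }))
        (≡⇒≐ (cong₂ (λ n V → S n C (J? (suc k) T V)) (length-snoc u f) (sym (assoc₁ u f _))))))))
    (≐-sym (≐-trans (J?-cong (suc k) T (sym (assoc₁ u X' _))) (J?-move k T u x q f (f' ∷ r) zs' (λ { refl → edge-z₁ ed , hz refl }))))))))
    where
    e e' X' : Ent
    e = zero , q₁
    e' = zero , q₂
    X' = suc x , q
    A B C : K
    A = gapK (zE t e) (zE t e')
    B = gapK (zE t e') (zE t X')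
    C = gapK (zE t e) (zE t X')
    J₀ : Fun
    J₀ = J (suc k) t (u ++ e ∷ e' ∷ X' ∷ r)
    lt : suc (suc (length u)) < N
    lt = subst (λ n → suc n ℕ.< N) (length-snoc u X') (pos< (u ++ X' ∷ []) e e' r l)
    lt₀ : suc (length u) < N
    lt₀ = ℕₚ.<-trans (ℕₚ.n<1+n _) lt

  tzM : Maybe (List Ent × Ent × List Ent) → ℕ
  tzM nothing = 0
  tzM (just (_ , _ , r)) = length r

  tz : List Ent → ℕ
  tz V = tzM (splitz V)

  tz-split : ∀ {V} w x q {r} → V ≡ w ++ (suc x , q) ∷ r → Zeros r → tz V ≡ length r
  tz-split w x q refl z = cong tzM (splitz-++ w z)

  total-∈ : ∀ {V x q} → (suc x , q) ∈ V → total V ≢ 0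
  total-∈ (here refl) ()
  total-∈ {e ∷ V} (there m) h = total-∈ m (ℕₚ.m+n≡0⇒n≡0 (proj₁ e) h)

  ∈-mid : ∀ {A : Set} (u : List A) {x r} → x ∈ u ++ x ∷ r
  ∈-mid u = Memₚ.∈-++⁺ʳ u (here refl)

  apart-from₂ : ∀ {A : Set} {R : A → A → Set} u {e e' s} → AllPairs R (u ++ e ∷ e' ∷ s) → ∀ {g} → g ∈ s → R e' g
  apart-from₂ [] (_ ∷ h ∷ _) m = All.lookup h m
  apart-from₂ (_ ∷ u) (_ ∷ h) m = apart-from₂ u h m

  wf-subst : ∀ {V V'} → V ≡ V' → WF V → WF V'
  wf-subst refl w = w

  edge-wf : ∀ {t e e' T f f'} → Edge t e e' T f f' → ∀ u r → WF (u ++ e ∷ e' ∷ r) → WF (u ++ f ∷ f' ∷ r)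
  edge-wf (up lt) u r w = wf-swap u r (ℕₚ.<⇒≢ lt) w
  edge-wf (tie _) u r w = w

  edge-total : ∀ {t e e' T f f'} → Edge t e e' T f f' → ∀ u r → total (u ++ f ∷ f' ∷ r) ≡ total (u ++ e ∷ e' ∷ r)
  edge-total {e = e} {e'} (up lt) u r = total-swap u e' e r
  edge-total (tie _) u r = refl

  private
    edge-suc : ∀ {t y q x q' T f f'} → Edge t (suc y , q) (suc x , q') T f f' →
      ∃[ a ] ∃[ b ] ∃[ a' ] ∃[ b' ] (f ≡ (suc a , b) × f' ≡ (suc a' , b') × Edge t (y , q) (x , q') T (a , b) (a' , b'))
    edge-suc (up (s≤s lt)) = _ , _ , _ , _ , refl , refl , up lt
    edge-suc (tie tg) = _ , _ , _ , _ , refl , refl , tie tg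

    ne-IsZ : ∀ {e₀ : Ent} {x} → IsZ e₀ → proj₁ e₀ ≢ suc x
    ne-IsZ refl ()

    total-ΨΨ : ∀ u y q x q' → total (u ++ (suc y , q) ∷ (suc x , q') ∷ []) ≡ suc (suc (total ((y , q) ∷ (x , q') ∷ u)))
    total-ΨΨ u y q x q' = trans (cong total (assoc₁ u _ _)) (trans (total-Ψ (u ++ (suc y , q) ∷ []) x q') (cong suc (total-Ψ ((x , q') ∷ u) y q)))

  -- Path independence of the J_{v,τ}, by induction on the degree k and on the number of trailing zeros
  Claim : ℕ → ℕ → Set
  Claim k n = ∀ t u e e' r {T f f'} → WF (u ++ e ∷ e' ∷ r) → total (u ++ e ∷ e' ∷ r) ≡ k → tz (u ++ e ∷ e' ∷ r) ≤ n →
    Edge t e e' T f f' → Intertwines k t u e e' r T f f'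

  -- The cases are given by the last nonzero entry. Behind the pair: Ψ or a commuting move. In the
  -- right place of the pair: after a zero the edge is the definition of `J`, after a nonzero entry
  -- `ΨΨ-step` or `braid-right` applies. It cannot be in the left place, since an edge never starts
  -- from a larger value followed by a smaller one. Before the pair: the pair is a tie of zeros, and
  -- a commuting move or `braid-left` applies. With no nonzero entry, `base-edge`.
  claim-step : ∀ k n → (∀ k' → k' < k → ∀ n → Claim k' n) → (∀ n' → n' < n → Claim k n') → Claim k n
  claim-step k n k↓ n↓ t u e e' r w tot le ed with splitZ r
  claim-step zero n k↓ n↓ t u e e' _ w tot le ed | last r₁ x q {r₀} z = ⊥-elim (total-∈ (Memₚ.∈-++⁺ʳ u (there (there (∈-mid r₁ {(suc x , q)} {r₀})))) tot)
  claim-step (suc k) n k↓ n↓ t u e e' _ {T} {f} {f'} w tot le ed | last r₁ x q {[]} [] = Ψ-step k t u e e' r₁ x q {T} {f} {f'} (len w)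
    (k↓ k (ℕₚ.n<1+n k) (tz ((x , q) ∷ u ++ e ∷ e' ∷ r₁)) t ((x , q) ∷ u) e e' r₁ (wf-unΨ (u ++ e ∷ e' ∷ r₁) (wf-subst (assoc₂ u e e' r₁ _) w))
      (ℕₚ.suc-injective (trans (sym (total-Ψ (u ++ e ∷ e' ∷ r₁) x q)) (trans (cong total (sym (assoc₂ u e e' r₁ _))) tot))) ℕₚ.≤-refl ed)
  claim-step (suc k) n k↓ n↓ t u e e' _ {T} {f} {f'} w tot le ed | last r₁ x q {e₀ ∷ r₀} (z₀ ∷ z) with subst (ℕ._≤ n) (tz-split (u ++ e ∷ e' ∷ r₁) x q (assoc₂ u e e' r₁ _) (z₀ ∷ z)) le
  ... | s≤s {n = n'} le' = commute-right k t u e e' r₁ x q e₀ r₀ {T} {f} {f'} (len w) (z₀ ∷ z)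
      (λ { refl → edge-z₀ ed (apart-from u ap (there (Memₚ.∈-++⁺ʳ r₁ (there (here refl))))) (apart-from₂ u ap (Memₚ.∈-++⁺ʳ r₁ (there (here refl))))
                , edge-z₀ ed (apart-from u ap (there (∈-mid r₁))) (apart-from₂ u ap (∈-mid r₁)) })
      (n↓ n' (ℕₚ.n<1+n n') t u e e' (r₁ ++ e₀ ∷ (suc x , q) ∷ r₀)
        (wf-subst (sym (assoc₂ u e e' r₁ _)) (wf-swap (u ++ e ∷ e' ∷ r₁) r₀ (ne-IsZ {e₀} z₀ ∘ sym) (wf-subst (assoc₂ u e e' r₁ _) w)))
        (trans (cong total (assoc₂ u e e' r₁ _)) (trans (total-swap (u ++ e ∷ e' ∷ r₁) e₀ (suc x , q) r₀) (trans (cong total (sym (assoc₂ u e e' r₁ _))) tot)))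
        (subst (ℕ._≤ n') (sym (tz-split ((u ++ e ∷ e' ∷ r₁) ++ e₀ ∷ []) x q (trans (assoc₂ u e e' r₁ _) (assoc₁ (u ++ e ∷ e' ∷ r₁) e₀ _)) z)) le') ed)
    where
    ap : AllPairs Apart (u ++ e ∷ e' ∷ (r₁ ++ (suc x , q) ∷ e₀ ∷ r₀))
    ap = LabOK-apart _ (lab w)
  claim-step zero n k↓ n↓ t u e (suc x , q') r w tot le ed | zeros z = ⊥-elim (total-∈ (Memₚ.∈-++⁺ʳ u (there (here refl))) tot)
  claim-step (suc k) n k↓ n↓ t u (zero , q) (suc x , q') r w tot le (up lt) | zeros z = ≐-sym (≡⇒≐ (J-move k t u x q' (zero , q) r (refl ∷ z)))
  claim-step (suc zero) n k↓ n↓ t u (suc y , q) (suc x , q') [] w tot le ed | zeros z with trans (sym (total-ΨΨ u y q x q')) tot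
  ... | ()
  claim-step (suc (suc k)) n k↓ n↓ t u (suc y , q) (suc x , q') [] {T} w tot le ed | zeros z with edge-suc ed
  ... | a , b , a' , b' , refl , refl , ed' = ΨΨ-step k t u y q x q' {T} {a} {b} {a'} {b'} (len w)
      (k↓ k (ℕₚ.≤-trans (ℕₚ.n<1+n k) (ℕₚ.n≤1+n _)) (tz ((y , q) ∷ (x , q') ∷ u)) t [] (y , q) (x , q') u (wf-unΨ ((x , q') ∷ u) (wf-unΨ (u ++ (suc y , q) ∷ []) (wf-subst (assoc₁ u _ _) w)))
        (ℕₚ.suc-injective (ℕₚ.suc-injective (trans (sym (total-ΨΨ u y q x q')) tot))) ℕₚ.≤-refl ed')
  claim-step (suc k) n k↓ n↓ t u (suc y , q) (suc x , q') (e₀ ∷ r) {T} w tot le ed | zeros (z₀ ∷ z)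
    with subst (ℕ._≤ n) (tz-split (u ++ (suc y , q) ∷ []) x q' (assoc₁ u _ _) (z₀ ∷ z)) le | edge-suc ed
  ... | s≤s {n = n'} le' | a , b , a' , b' , refl , refl , ed' =
      braid-right k t u y q x q' e₀ r {T} {a} {b} {a'} {b'} (len w) (z₀ ∷ z) ed hz
        (n↓ n' (ℕₚ.n<1+n n') t u e₀ Y (X' ∷ r) wfY totY (subst (ℕ._≤ n') (sym (tz-split (u ++ e₀ ∷ Y ∷ []) x q' (sym (Listₚ.++-assoc u _ _)) z)) le') (up-z z₀))
        (n↓ n' (ℕₚ.n<1+n n') t (u ++ e₀ ∷ []) Y X' r (wf-subst (assoc₁ u e₀ _) wfY) (trans (cong total (sym (assoc₁ u e₀ _))) totY)
          (subst (ℕ._≤ n') (sym (tz-split ((u ++ e₀ ∷ []) ++ Y ∷ []) x q' (sym (Listₚ.++-assoc (u ++ e₀ ∷ []) _ _)) z)) le') ed)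
        (target T ed hz)
    where
    Y X' : Ent
    Y = suc y , q
    X' = suc x , q'
    ap : AllPairs Apart (u ++ Y ∷ X' ∷ e₀ ∷ r)
    ap = LabOK-apart _ (lab w)
    hz : ∀ {t'} → T ≡ just t' → zE t' e₀ ≡ zE t e₀
    hz refl = edge-z₀ ed (apart-from u ap (there (here refl))) (apart-from₂ u ap (here refl))
    rot : ∀ {A B : Ent} → WF (u ++ A ∷ B ∷ e₀ ∷ r) → proj₁ A ≢ 0 → proj₁ B ≢ 0 → WF (u ++ e₀ ∷ A ∷ B ∷ r)
    rot {A} {B} wV nA nB = wf-swap u (B ∷ r) (λ h → nA (trans h z₀))
      (wf-subst (sym (assoc₁ u A _)) (wf-swap (u ++ A ∷ []) r (λ h → nB (trans h z₀)) (wf-subst (assoc₁ u A _) wV)))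
    rot-total : ∀ (A B : Ent) → total (u ++ e₀ ∷ A ∷ B ∷ r) ≡ total (u ++ A ∷ B ∷ e₀ ∷ r)
    rot-total A B = trans (total-swap u e₀ A (B ∷ r)) (trans (cong total (assoc₁ u A _)) (trans (total-swap (u ++ A ∷ []) e₀ B r) (cong total (sym (assoc₁ u A _)))))
    wfY : WF (u ++ e₀ ∷ Y ∷ X' ∷ r)
    wfY = rot w (λ ()) (λ ())
    totY : total (u ++ e₀ ∷ Y ∷ X' ∷ r) ≡ suc k
    totY = trans (rot-total Y X') tot
    up-z : IsZ e₀ → ∀ {t x q} → Edge t e₀ (suc x , q) (just t) (suc x , q) e₀
    up-z refl = up (s≤s z≤n)
    target : ∀ T → Edge t Y X' T (suc a , b) (suc a' , b') → (∀ {t'} → T ≡ just t' → zE t' e₀ ≡ zE t e₀) →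
      S (length u) (gapK (zE t e₀) (zE t X')) (J? (suc k) T (u ++ e₀ ∷ (suc a , b) ∷ (suc a' , b') ∷ r)) ≐ J? (suc k) T (u ++ (suc a , b) ∷ e₀ ∷ (suc a' , b') ∷ r)
    target nothing ed _ = S-zero _ _
    target (just t') ed hz = ≐-trans (≡⇒≐ (cong₂ (λ z₁ z₂ → S (length u) (gapK z₁ z₂) (J (suc k) t' (u ++ e₀ ∷ (suc a , b) ∷ (suc a' , b') ∷ r))) (sym (hz refl)) (sym (edge-z₁ ed))))
      (n↓ n' (ℕₚ.n<1+n n') t' u e₀ (suc a , b) ((suc a' , b') ∷ r) (rot (edge-wf ed u (e₀ ∷ r) w) (λ ()) (λ ())) (trans (rot-total _ _) (trans (edge-total ed u (e₀ ∷ r)) tot))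
        (subst (ℕ._≤ n') (sym (tz-split (u ++ e₀ ∷ (suc a , b) ∷ []) a' b' (sym (Listₚ.++-assoc u _ _)) z)) le') (up-z z₀))
  claim-step k n k↓ n↓ t u (y , q) (zero , q') r w tot le (up ()) | zeros z
  claim-step k n k↓ n↓ t u (zero , q) (zero , _) r {T} w tot le (tie tg) | zeros z with splitZ u
  ... | zeros zu = ≐-trans (≡⇒≐ (cong (S (length u) _) (J-zeros k t zV))) (≐-trans (≡⇒≐ (cong (λ n → S n (gapK (zE t (0 , q)) (zE t (0 , suc q))) (base t)) (sym q≡))) (base-edge 0 tg zV))
    where
    zV : Zeros (u ++ (zero , q) ∷ (zero , suc q) ∷ r)
    zV = Allₚ.++⁺ zu (refl ∷ refl ∷ z)
    q≡ : q ≡ length u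
    q≡ = LabOK-zeros u ((zero , suc q) ∷ r) (refl ∷ z) (lab w)
  claim-step zero n k↓ n↓ t _ (zero , q) (zero , _) r w tot le (tie tg) | zeros z | last u₁ x qx {u₀} zu = ⊥-elim (total-∈ (Memₚ.∈-++⁺ˡ (∈-mid u₁ {(suc x , qx)} {u₀})) tot)
  claim-step (suc k) n k↓ n↓ t _ (zero , q) (zero , _) r {T} w tot le (tie tg) | zeros z | last u₁ x qx {[]} []
    with subst (ℕ._≤ n) (tz-split u₁ x qx (sym (assoc₁ u₁ _ _)) (refl ∷ refl ∷ z)) le
  ... | s≤s {n = n'} le' = braid-left k t u₁ x qx (zero , q) (zero , suc q) r {T} {zero , q} {zero , suc q} (len w) (refl ∷ refl ∷ z) (refl ∷ refl ∷ z) (tie tg)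
      (λ { refl → edge-z₀ {t} {zero , q} {zero , suc q} (tie tg) (apX (here refl) ∘ sym) (apX (there (here refl)) ∘ sym) })
      (n↓ n' (ℕₚ.n<1+n n') t u₁ (zero , q) (zero , suc q) ((suc x , qx) ∷ r)
        (wf-subst (sym (assoc₁ u₁ (zero , q) _)) (wf-swap (u₁ ++ (zero , q) ∷ []) r (λ ()) (wf-subst (assoc₁ u₁ (zero , q) _) (wf-swap u₁ ((zero , suc q) ∷ r) (λ ()) (wf-subst (sym (assoc₁ u₁ _ _)) w)))))
        (trans (cong total (assoc₁ u₁ (zero , q) _)) (trans (total-swap (u₁ ++ (zero , q) ∷ []) (zero , suc q) (suc x , qx) r) (trans (cong total (sym (assoc₁ u₁ (zero , q) _))) (trans (total-swap u₁ (zero , q) (suc x , qx) ((zero , suc q) ∷ r)) (trans (cong total (assoc₁ u₁ _ _)) tot)))))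
        (subst (ℕ._≤ n') (sym (tz-split (u₁ ++ (zero , q) ∷ (zero , suc q) ∷ []) x qx (sym (Listₚ.++-assoc u₁ _ _)) z)) (ℕₚ.≤-trans (ℕₚ.n≤1+n _) le')) (tie tg))
    where
    apX : ∀ {g} → g ∈ (zero , q) ∷ (zero , suc q) ∷ r → Apart (suc x , qx) g
    apX = apart-from u₁ (subst (AllPairs Apart) (sym (assoc₁ u₁ _ _)) (LabOK-apart _ (lab w)))
  claim-step (suc k) n k↓ n↓ t _ (zero , q) (zero , _) r {T} w tot le (tie tg) | zeros z | last u₁ x qx {e₀ ∷ u₀} (z₀ ∷ zu)
    with subst (ℕ._≤ n) (tz-split u₁ x qx (Listₚ.++-assoc u₁ _ _) (z₀ ∷ Allₚ.++⁺ zu (refl ∷ refl ∷ z))) le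
  ... | s≤s {n = n'} le' = commute-left k t u₁ x qx e₀ u₀ (zero , q) (zero , suc q) r {T} {zero , q} {zero , suc q} (len w) (z₀ ∷ Allₚ.++⁺ zu (refl ∷ refl ∷ z)) (z₀ ∷ Allₚ.++⁺ zu (refl ∷ refl ∷ z))
      (λ { refl → edge-z₀ {t} {zero , q} {zero , suc q} (tie tg) (ap₀ (∈-mid u₀) ∘ sym) (ap₀ (Memₚ.∈-++⁺ʳ u₀ (there (here refl))) ∘ sym)
                , edge-z₀ {t} {zero , q} {zero , suc q} (tie tg) (apX (there (∈-mid u₀)) ∘ sym) (apX (there (Memₚ.∈-++⁺ʳ u₀ (there (here refl)))) ∘ sym) })
      (n↓ n' (ℕₚ.n<1+n n') t (u₁ ++ e₀ ∷ (suc x , qx) ∷ u₀) (zero , q) (zero , suc q) r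
        (wf-subst (sym (Listₚ.++-assoc u₁ _ _)) (wf-swap u₁ _ (ne-IsZ {e₀} z₀ ∘ sym) (wf-subst (Listₚ.++-assoc u₁ _ _) w)))
        (trans (cong total (Listₚ.++-assoc u₁ _ _)) (trans (total-swap u₁ e₀ (suc x , qx) _) (trans (cong total (sym (Listₚ.++-assoc u₁ _ _))) tot)))
        (subst (ℕ._≤ n') (sym (tz-split (u₁ ++ e₀ ∷ []) x qx (trans (Listₚ.++-assoc u₁ _ _) (assoc₁ u₁ e₀ _)) (Allₚ.++⁺ zu (refl ∷ refl ∷ z)))) le') (tie tg))
    where
    V' : List Ent
    V' = u₁ ++ (suc x , qx) ∷ e₀ ∷ (u₀ ++ (zero , q) ∷ (zero , suc q) ∷ r)
    apV : AllPairs Apart V'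
    apV = subst (AllPairs Apart) (Listₚ.++-assoc u₁ _ _) (LabOK-apart _ (lab w))
    apX : ∀ {g} → g ∈ e₀ ∷ (u₀ ++ (zero , q) ∷ (zero , suc q) ∷ r) → Apart (suc x , qx) g
    apX = apart-from u₁ apV
    ap₀ : ∀ {g} → g ∈ u₀ ++ (zero , q) ∷ (zero , suc q) ∷ r → Apart e₀ g
    ap₀ = apart-from₂ u₁ apV

  claim : ∀ k n → Acc _<_ k → Acc _<_ n → Claim k n
  claim k n (acc k↓) (acc n↓) = claim-step k n (λ k' lt n' → claim k' n' (k↓ lt) (<-wellFounded n')) (λ n' lt → claim k n' (acc k↓) (n↓ lt))

  intertwine : ∀ k t u e e' r {T f f'} → WF (u ++ e ∷ e' ∷ r) → total (u ++ e ∷ e' ∷ r) ≡ k → Edge t e e' T f f' → Intertwines k t u e e' r T f f'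
  intertwine k t u e e' r w tot ed = claim k (tz (u ++ e ∷ e' ∷ r)) (<-wellFounded _) (<-wellFounded _) t u e e' r w tot ℕₚ.≤-refl ed

-- Sorting by adjacent exchanges

module Sorting {A : Set} (bad : A → A → Bool) (asym : ∀ {x y} → bad x y ≡ true → bad y x ≡ false) where

  hits : A → List A → ℕ
  hits x [] = 0
  hits x (y ∷ ys) = ind (bad x y) + hits x ys

  inversions : List A → ℕ
  inversions [] = 0
  inversions (x ∷ xs) = hits x xs + inversions xs

  hits-swap : ∀ c u x y r → hits c (u ++ x ∷ y ∷ r) ≡ hits c (u ++ y ∷ x ∷ r)
  hits-swap c [] x y r = exch (ind (bad c x)) (ind (bad c y)) _
  hits-swap c (a ∷ u) x y r = cong (ind (bad c a) ℕ.+_) (hits-swap c u x y r)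

  inversions-swap : ∀ u {x y} r → bad x y ≡ true → suc (inversions (u ++ y ∷ x ∷ r)) ≡ inversions (u ++ x ∷ y ∷ r)
  inversions-swap [] {x} {y} r b rewrite b | asym b = cong suc (exch (hits y r) (hits x r) (inversions r))
  inversions-swap (a ∷ u) {x} {y} r b = trans (sym (ℕₚ.+-suc (hits a (u ++ y ∷ x ∷ r)) _)) (cong₂ _+_ (hits-swap a u y x r) (inversions-swap u r b))

  Good : A → A → Set
  Good x y = bad x y ≡ false

  find : ∀ xs → (∃[ u ] ∃[ x ] ∃[ y ] ∃[ r ] (xs ≡ u ++ x ∷ y ∷ r × bad x y ≡ true)) ⊎ Linked Good xs
  find [] = inj₂ []
  find (x ∷ []) = inj₂ [-]
  find (x ∷ y ∷ r) with find (y ∷ r) | bad x y in e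
  ... | _ | true = inj₁ ([] , x , y , r , refl , e)
  ... | inj₁ (u , a , b , s , eq , h) | false = inj₁ (x ∷ u , a , b , s , cong (x ∷_) eq , h)
  ... | inj₂ l | false = inj₂ (e ∷ l)

  -- Exchanging a bad pair removes exactly one inversion. The same induction sorts exponents, rows
  -- inside a block of equal exponents, words of tableaux, and rearrangements of T.
  sort-induction : (P : List A → Set) → (∀ xs → Linked Good xs → P xs) →
    (∀ u x y r → bad x y ≡ true → P (u ++ y ∷ x ∷ r) → P (u ++ x ∷ y ∷ r)) → ∀ xs → P xs
  sort-induction P base step xs = go xs (<-wellFounded (inversions xs))
    where
    go : ∀ xs → Acc _<_ (inversions xs) → P xs
    go xs (acc h) with find xs
    ... | inj₂ l = base xs l
    ... | inj₁ (u , x , y , r , refl , b) = step u x y r b (go _ (h (ℕₚ.≤-reflexive (inversions-swap u r b))))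

-- Fillings read along a tableau

Σ< : ℕ → (ℕ → ℕ) → ℕ
Σ< zero g = 0
Σ< (suc n) g = g 0 + Σ< n (g ∘ suc)

Σ<-cong : ∀ n {g h} → (∀ i → i < n → g i ≡ h i) → Σ< n g ≡ Σ< n h
Σ<-cong zero e = refl
Σ<-cong (suc n) e = cong₂ _+_ (e 0 (s≤s z≤n)) (Σ<-cong n (λ i lt → e (suc i) (s≤s lt)))

Σ<-last : ∀ n g → Σ< (suc n) g ≡ Σ< n g + g n
Σ<-last zero g = ℕₚ.+-comm (g 0) 0
Σ<-last (suc n) g = trans (cong (g 0 ℕ.+_) (Σ<-last n (g ∘ suc))) (sym (ℕₚ.+-assoc (g 0) _ _))

Σ<-update : ∀ n {g h} x d → x < n → (∀ i → i ≢ x → h i ≡ g i) → h x ≡ g x + d → Σ< n h ≡ Σ< n g + d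
Σ<-update (suc n) {g} {h} zero d lt e ex = trans (cong₂ _+_ ex (Σ<-cong n (λ i _ → e (suc i) (λ ())))) (trans (ℕₚ.+-assoc (g 0) d _) (trans (cong (g 0 ℕ.+_) (ℕₚ.+-comm d _)) (sym (ℕₚ.+-assoc (g 0) _ d))))
Σ<-update (suc n) {g} {h} (suc x) d (s≤s lt) e ex = trans (cong₂ _+_ (e 0 (λ ())) (Σ<-update n x d lt (λ i ne → e (suc i) (ne ∘ ℕₚ.suc-injective)) ex)) (sym (ℕₚ.+-assoc (g 0) _ d))

sum-++ : ∀ xs ys → sum (xs ++ ys) ≡ sum xs + sum ys
sum-++ [] ys = refl
sum-++ (x ∷ xs) ys = trans (cong (x ℕ.+_) (sum-++ xs ys)) (sym (ℕₚ.+-assoc x _ _))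

sum-concat-applyUpTo : ∀ (h : ℕ → List ℕ) (f : ℕ → ℕ) n → sum (concatMap h (map suc (applyUpTo f n))) ≡ Σ< n (λ i → sum (h (suc (f i))))
sum-concat-applyUpTo h f zero = refl
sum-concat-applyUpTo h f (suc n) = trans (sum-++ (h (suc (f 0))) _) (cong (sum (h (suc (f 0))) ℕ.+_) (sum-concat-applyUpTo h (f ∘ suc) n))

sum-map-applyUpTo : ∀ (g : ℕ → ℕ) (f : ℕ → ℕ) n → sum (map g (map suc (applyUpTo f n))) ≡ Σ< n (λ i → g (suc (f i)))
sum-map-applyUpTo g f zero = refl
sum-map-applyUpTo g f (suc n) = cong (g (suc (f 0)) ℕ.+_) (sum-map-applyUpTo g (f ∘ suc) n)

-- The values of T at the boxes of the entries 1, ..., N in this order. A pair (τ, v) belongs to H_T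
-- exactly when v⁺ is this list.
LT : Filling → List ℕ → List ℕ
LT T [] = []
LT T (x ∷ r) = T (suc x) (suc (count x r)) ∷ LT T r

degFilling-Σ : ∀ lam T → degFilling lam T ≡ Σ< (length lam) (λ i → Σ< (idx0 lam i) (λ j → T (suc i) (suc j)))
degFilling-Σ lam T = trans (sum-concat-applyUpTo (λ r → map (T r) (oneTo (at lam r))) id (length lam))
  (Σ<-cong (length lam) (λ i _ → sum-map-applyUpTo (T (suc i)) id (idx0 lam i)))

sum-LT : ∀ T l t → Lat l t → sum (LT T t) ≡ Σ< l (λ i → Σ< (count i t) (λ j → T (suc i) (suc j)))
sum-LT T l [] lt = sym (zero-Σ l)
  where
  zero-Σ : ∀ n → Σ< n (λ i → 0) ≡ 0
  zero-Σ zero = refl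
  zero-Σ (suc n) = zero-Σ n
sum-LT T l (x ∷ r) (xl , _ , lt) = sym (trans (Σ<-update l x (T (suc x) (suc (count x r))) xl
    (λ i ne → cong (λ c → Σ< c (λ j → T (suc i) (suc j))) (count-diff r ne))
    (trans (cong (λ c → Σ< c (λ j → T (suc x) (suc j))) (count-same x r)) (Σ<-last (count x r) (λ j → T (suc x) (suc j)))))
  (trans (cong (ℕ._+ _) (sym (sum-LT T l r lt))) (ℕₚ.+-comm (sum (LT T r)) _)))

sum-LT-valid : ∀ T {lam t} → Valid lam t → sum (LT T t) ≡ degFilling lam T
sum-LT-valid T {lam} {t} v = trans (sum-LT T (length lam) t (lattice v))
  (trans (Σ<-cong (length lam) (λ i lt → cong (λ c → Σ< c (λ j → T (suc i) (suc j))) (shape v i lt))) (sym (degFilling-Σ lam T)))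

_≥′_ : ℕ → ℕ → Set
x ≥′ y = y ≤ x

Desc : List ℕ → Set
Desc = AllPairs _≥′_

-- Different boxes that can be added to the same partition carry different values of T. They lie in
-- different rows, which settles T₁, and in different columns, which settles T_det.
Separates : Filling → Set
Separates T = ∀ {l x y r} → Lat l (x ∷ r) → Lat l (y ∷ r) → T (suc x) (suc (count x r)) ≡ T (suc y) (suc (count y r)) → x ≡ y

separates-T1 : Separates T1
separates-T1 _ _ e = e

separates-Tdet : Separates Tdet
separates-Tdet {l} {x} {y} {r} (_ , sx , lt) (_ , sy , _) e with ℕₚ.<-cmp x y
... | tri≈ _ eq _ = eq
... | tri< x<y _ _ = ⊥-elim (ℕₚ.<⇒≢ (Step-count r lt x<y sy) (sym e))
... | tri> _ _ y<x = ⊥-elim (ℕₚ.<⇒≢ (Step-count r lt y<x sx) e)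

earliest : ∀ y u → count y u ≢ 0 → ∃[ a ] ∃[ b ] (u ≡ a ++ y ∷ b × count y b ≡ 0)
earliest y [] ne = ⊥-elim (ne refl)
earliest y (x ∷ u) ne with count y u ℕ.≟ 0
... | no ne' = let (a , b , e , z) = earliest y u ne' in x ∷ a , b , cong (x ∷_) e , z
... | yes z with y ℕ.≟ x
... | yes refl = [] , u , refl , z
... | no y≢x = ⊥-elim (ne (trans (count-diff u y≢x) z))

LT-label-≥ : ∀ T y x u r → y ≢ x → count y u ≢ 0 → Desc (LT T (u ++ x ∷ r)) → T (suc x) (suc (count x r)) ≤ T (suc y) (suc (count y r))
LT-label-≥ T y x u r y≢x ne ds with earliest y u ne
... | a , b , refl , z = subst (λ c → T (suc x) (suc (count x r)) ≤ T (suc y) (suc c)) (trans (count-++ y b (x ∷ r)) (trans (cong (ℕ._+ count y (x ∷ r)) z) (count-diff r y≢x)))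
    (go a ds)
  where
  mem : ∀ b → T (suc x) (suc (count x r)) ∈ LT T (b ++ x ∷ r)
  mem [] = here refl
  mem (_ ∷ b) = there (mem b)
  go : ∀ a → Desc (LT T ((a ++ y ∷ b) ++ x ∷ r)) → T (suc x) (suc (count x r)) ≤ T (suc y) (suc (count y (b ++ x ∷ r)))
  go [] (h ∷ _) = All.lookup h (mem b)
  go (_ ∷ a) (_ ∷ h) = go a h

-- Compare the tableaux from the entry N downwards. At the first difference, the box chosen by one
-- tableau is still to be filled in the other, by a smaller entry and hence with a label at least as
-- large. So both boxes have the same label, and `Separates` makes them equal.
tableau-unique : ∀ {T lam t t'} → Separates T → Valid lam t → Valid lam t' → Desc (LT T t) → Desc (LT T t') → t ≡ t'
tableau-unique {T} {lam} {t} {t'} sep v v' d d' = trans (sym (Listₚ.++-identityʳ t)) (trans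
    (go (length t) t t' [] refl (trans (size v') (sym (size v))) (subst (Valid lam) (sym (Listₚ.++-identityʳ t)) v) (subst (Valid lam) (sym (Listₚ.++-identityʳ t')) v')
      (subst (Desc ∘ LT T) (sym (Listₚ.++-identityʳ t)) d) (subst (Desc ∘ LT T) (sym (Listₚ.++-identityʳ t')) d'))
    (Listₚ.++-identityʳ t'))
  where
  occurs : ∀ {u u' x y r} → Valid lam (u ++ x ∷ r) → Valid lam (u' ++ y ∷ r) → y ≢ x → count y u ≢ 0
  occurs {u} {u'} {x} {y} {r} v v' y≢x z = ℕₚ.m≢1+n+m (count y r) {count y u'} (trans (sym (trans (count-++ y u (x ∷ r)) (cong₂ _+_ z (count-diff r y≢x))))
    (trans (trans (shape v y yl) (sym (shape v' y yl))) (trans (count-++ y u' (y ∷ r)) (trans (cong (count y u' ℕ.+_) (count-same y r)) (ℕₚ.+-suc (count y u') (count y r))))))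
    where
    yl : y < length lam
    yl = proj₁ (Lat-drop u' (lattice v'))
  go : ∀ n u u' r → length u ≡ n → length u' ≡ n → Valid lam (u ++ r) → Valid lam (u' ++ r) → Desc (LT T (u ++ r)) → Desc (LT T (u' ++ r)) → u ++ r ≡ u' ++ r
  go zero [] [] r _ _ _ _ _ _ = refl
  go (suc n) u u' r l l' v v' d d' with initLast u | initLast u'
  ... | [] | _ = ⊥-elim (ℕₚ.0≢1+n l)
  ... | _ ∷ʳ′ _ | [] = ⊥-elim (ℕₚ.0≢1+n l')
  ... | ū ∷ʳ′ x | ū' ∷ʳ′ y rewrite Listₚ.++-assoc ū (x ∷ []) r | Listₚ.++-assoc ū' (y ∷ []) r with x ℕ.≟ y
  ... | yes refl = go n ū ū' (x ∷ r) (ℕₚ.suc-injective (trans (sym (trans (Listₚ.length-++ ū) (ℕₚ.+-comm (length ū) 1))) l)) (ℕₚ.suc-injective (trans (sym (trans (Listₚ.length-++ ū') (ℕₚ.+-comm (length ū') 1))) l')) v v' d d'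
  ... | no x≢y = ⊥-elim (x≢y (sep (Lat-drop ū (lattice v)) (Lat-drop ū' (lattice v'))
       (ℕₚ.≤-antisym (LT-label-≥ T y x ū r (x≢y ∘ sym) (occurs v v' (x≢y ∘ sym)) d) (LT-label-≥ T x y ū' r x≢y (occurs v' v x≢y) d'))))

-- Symmetric and antisymmetric elements of small degree

Pairs : Set
Pairs = List (ℕ × ℕ)

exps lets : Pairs → List ℕ
exps = map proj₁
lets = map proj₂

pairUp : List ℕ → List ℕ → Pairs
pairUp (a ∷ m) (x ∷ t) = (a , x) ∷ pairUp m t
pairUp _ _ = []

exps-pairUp : ∀ m t → length m ≡ length t → exps (pairUp m t) ≡ m
exps-pairUp [] [] e = refl
exps-pairUp (a ∷ m) (x ∷ t) e = cong (a ∷_) (exps-pairUp m t (ℕₚ.suc-injective e))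

lets-pairUp : ∀ m t → length m ≡ length t → lets (pairUp m t) ≡ t
lets-pairUp [] [] e = refl
lets-pairUp (a ∷ m) (x ∷ t) e = cong (x ∷_) (lets-pairUp m t (ℕₚ.suc-injective e))

Bounds : Filling → Pairs → Set
Bounds T [] = ⊤
Bounds T ((a , x) ∷ ys) = T (suc x) (suc (count x (lets ys))) ≤ a × Bounds T ys

bounds-sum : ∀ T xs → Bounds T xs → sum (LT T (lets xs)) ≤ sum (exps xs)
bounds-sum T [] b = z≤n
bounds-sum T ((a , x) ∷ ys) (h , b) = ℕₚ.+-mono-≤ h (bounds-sum T ys b)

bounds-tight : ∀ T xs → Bounds T xs → sum (LT T (lets xs)) ≡ sum (exps xs) → LT T (lets xs) ≡ exps xs
bounds-tight T [] b e = refl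
bounds-tight T ((a , x) ∷ ys) (h , b) e with ℕₚ.m≤n⇒m<n∨m≡n h
... | inj₁ lt = ⊥-elim (ℕₚ.<⇒≢ (ℕₚ.+-mono-<-≤ lt (bounds-sum T ys b)) e)
... | inj₂ eq = cong₂ _∷_ eq (bounds-tight T ys b (ℕₚ.+-cancelˡ-≡ a _ _ (trans (cong (ℕ._+ sum (LT T (lets ys))) (sym eq)) e)))

count-∈ : ∀ {A : Set} (f : A → ℕ) x (ys : List A) → count x (map f ys) ≢ 0 → ∃[ y ] (y ∈ ys × f y ≡ x)
count-∈ f x [] ne = ⊥-elim (ne refl)
count-∈ f x (y ∷ ys) ne with x ℕ.≟ f y
... | yes e = y , here refl , sym e
... | no n = let (z , m , e) = count-∈ f x ys (ne ∘ trans (count-diff (map f ys) n)) in z , there m , e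

-- Exponents decrease weakly, so everything between two equal exponents shares that exponent and the
-- relation passes along the chain.
block : ∀ {R : ℕ → ℕ → Set} → (∀ {x y z} → R x y → R y z → R x z) →
  ∀ {a x} ys → Desc (exps ((a , x) ∷ ys)) → Linked (λ p q → proj₁ p ≡ proj₁ q → R (proj₂ p) (proj₂ q)) ((a , x) ∷ ys) →
  ∀ {b y} → (b , y) ∈ ys → a ≡ b → R x y
block tr ((c , z) ∷ ys) ds (h ∷ l) (here refl) refl = h refl
block tr {a} ((c , z) ∷ ys) ((hc ∷ ha) ∷ ds@(hb ∷ _)) (h ∷ l) {b} (there m) refl = tr (h a≡c) (block tr ys ds l m (sym a≡c))
  where
  a≡c : a ≡ c
  a≡c = ℕₚ.≤-antisym (All.lookup hb (Memₚ.∈-map⁺ proj₁ m)) hc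

Increasing Decreasing : ℕ × ℕ → ℕ × ℕ → Set
Increasing p q = proj₁ p ≡ proj₁ q → proj₂ p ≤ proj₂ q
Decreasing p q = proj₁ p ≡ proj₁ q → proj₂ q < proj₂ p

Desc-head : ∀ {a x ys b y} → Desc (exps ((a , x) ∷ ys)) → (b , y) ∈ ys → b ≤ a
Desc-head (h ∷ _) m = All.lookup h (Memₚ.∈-map⁺ proj₁ m)

tail-Linked : ∀ {A : Set} {R : A → A → Set} {x xs} → Linked R (x ∷ xs) → Linked R xs
tail-Linked [-] = []
tail-Linked (_ ∷ l) = l

-- A box in row x + 1 needs a larger entry in row x, which has exponent at least x by induction. Its
-- exponent is at most that of the box; if they were equal, both would lie in one block with the row
-- index going down.
bounds-T1 : ∀ {l} xs → Lat l (lets xs) → Desc (exps xs) → Linked Increasing xs → Bounds T1 xs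
bounds-T1 [] _ _ _ = tt
bounds-T1 ((a , x) ∷ ys) (xl , st , lt) ds@(_ ∷ ds') lk = bd x st lk , rest
  where
  rest : Bounds T1 ys
  rest = bounds-T1 ys lt ds' (tail-Linked lk)
  look : ∀ {b y} zs → Bounds T1 zs → (b , y) ∈ zs → y ≤ b
  look (_ ∷ zs) (h , _) (here refl) = h
  look (_ ∷ zs) (_ , h) (there m) = look zs h m
  bd : ∀ x → Step (lets ys) x → Linked Increasing ((a , x) ∷ ys) → x ≤ a
  bd zero _ _ = z≤n
  bd (suc x) st lk with count-∈ proj₂ x ys (λ z → ℕₚ.<⇒≱ st (ℕₚ.≤-trans (ℕₚ.≤-reflexive z) z≤n))
  ... | (b , _) , m , refl with ℕₚ.m≤n⇒m<n∨m≡n (Desc-head {a} {x} ds m)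
  ... | inj₁ b<a = ℕₚ.≤-trans (s≤s (look ys rest m)) b<a
  ... | inj₂ refl = ⊥-elim (ℕₚ.<⇒≱ (ℕₚ.n<1+n x) (block ℕₚ.≤-trans ys ds lk m refl))

-- The comparison is with the previous box of the same row, one column to the left. Rows decrease
-- strictly inside a block, so a row does not occur there twice and the exponent must grow.
bounds-Tdet : ∀ {l} xs → Lat l (lets xs) → Desc (exps xs) → Linked Decreasing xs → Bounds Tdet xs
bounds-Tdet [] _ _ _ = tt
bounds-Tdet ((a , x) ∷ ys) (xl , st , lt) ds@(_ ∷ ds') lk = bd (count x (lets ys)) refl , rest
  where
  rest : Bounds Tdet ys
  rest = bounds-Tdet ys lt ds' (tail-Linked lk)
  look : ∀ {c} zs → Bounds Tdet zs → count x (lets zs) ≡ suc c → ∃[ b ] ((b , x) ∈ zs × c ≤ b)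
  look [] _ ()
  look ((b , z) ∷ zs) (h , hs) e with x ℕ.≟ z
  ... | yes refl = b , here refl , subst (ℕ._≤ b) (ℕₚ.suc-injective (trans (sym (count-same x (lets zs))) e)) h
  ... | no ne = let (b , m , le) = look zs hs (trans (sym (count-diff (lets zs) ne)) e) in b , there m , le
  bd : ∀ c → count x (lets ys) ≡ c → count x (lets ys) ≤ a
  bd zero e = ℕₚ.≤-trans (ℕₚ.≤-reflexive e) z≤n
  bd (suc c) e with look ys rest e
  ... | b , m , le with ℕₚ.m≤n⇒m<n∨m≡n (Desc-head {a} {x} ds m)
  ... | inj₁ b<a = ℕₚ.≤-trans (ℕₚ.≤-reflexive e) (ℕₚ.≤-trans (s≤s le) b<a)
  ... | inj₂ refl = ⊥-elim (ℕₚ.<-irrefl refl (block (λ p q → ℕₚ.<-trans q p) ys ds lk m refl))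

≡ᵇ⇒≡ : ∀ {x y} → (x ≡ᵇ y) ≡ true → x ≡ y
≡ᵇ⇒≡ {x} {y} e = ℕₚ.≡ᵇ⇒≡ x y (subst T (sym e) tt)

∧-true : ∀ {a b} → (a ∧ b) ≡ true → a ≡ true × b ≡ true
∧-true {true} {true} refl = refl , refl

∧-falseʳ : ∀ {a b} → (a ∧ b) ≡ false → a ≡ true → b ≡ false
∧-falseʳ {true} e refl = e

<ᵇ-asym : ∀ {x y} → (x <ᵇ y) ≡ true → (y <ᵇ x) ≡ false
<ᵇ-asym {x} {y} e = <ᵇ-false (ℕₚ.<⇒≤ (<ᵇ⇒< {x} {y} e))

<ᵇ-false⇒ : ∀ {x y} → (x <ᵇ y) ≡ false → y ≤ x
<ᵇ-false⇒ {x} {y} e with x ℕ.<? y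
... | no h = ℕₚ.≮⇒≥ h
... | yes lt with trans (sym e) (<ᵇ-true lt)
... | ()

bad₊ bad₋ : ℕ × ℕ → ℕ × ℕ → Bool
bad₊ (a , x) (b , y) = (a ≡ᵇ b) ∧ (y <ᵇ x)
bad₋ (a , x) (b , y) = (a ≡ᵇ b) ∧ (x <ᵇ y)

bad₊-asym : ∀ {p q} → bad₊ p q ≡ true → bad₊ q p ≡ false
bad₊-asym {a , x} {b , y} e with ∧-true {a ≡ᵇ b} e
... | e₁ , e₂ with b ≡ᵇ a
... | true = <ᵇ-asym {y} {x} e₂
... | false = refl

bad₋-asym : ∀ {p q} → bad₋ p q ≡ true → bad₋ q p ≡ false
bad₋-asym {a , x} {b , y} e with ∧-true {a ≡ᵇ b} e
... | e₁ , e₂ with b ≡ᵇ a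
... | true = <ᵇ-asym {x} {y} e₂
... | false = refl

module SortDesc = Sorting (λ x y → x <ᵇ y) (λ {x} {y} → <ᵇ-asym {x} {y})
module Sort₊ = Sorting bad₊ (λ {p} {q} → bad₊-asym {p} {q})
module Sort₋ = Sorting bad₋ (λ {p} {q} → bad₋-asym {p} {q})

Linked-map : ∀ {A : Set} {R Q : A → A → Set} → (∀ {x y} → R x y → Q x y) → ∀ {xs} → Linked R xs → Linked Q xs
Linked-map f [] = []
Linked-map f [-] = [-]
Linked-map f (h ∷ l) = f h ∷ Linked-map f l

split-Linked : ∀ {A : Set} {R Q : A → A → Set} (dec : ∀ x y → R x y ⊎ Q x y) xs →
  Linked Q xs ⊎ (∃[ u ] ∃[ x ] ∃[ y ] ∃[ r ] (xs ≡ u ++ x ∷ y ∷ r × R x y))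
split-Linked dec [] = inj₁ []
split-Linked dec (x ∷ []) = inj₁ [-]
split-Linked dec (x ∷ y ∷ r) with dec x y | split-Linked dec (y ∷ r)
... | inj₁ h | _ = inj₂ ([] , x , y , r , refl , h)
... | inj₂ h | inj₁ l = inj₁ (h ∷ l)
... | inj₂ h | inj₂ (u , a , b , s , e , k) = inj₂ (x ∷ u , a , b , s , cong (x ∷_) e , k)

module Vanishing (lam : List ℕ) where
  open Polynomials lam

  Equivariant : K → Fun → Set
  Equivariant ε f = ∀ p → suc p < N → T̂ p f ≐ ε · f

  -- Isolates the step in which the two signs differ: which tableaux can carry a nonzero coefficient
  -- at a decreasing exponent. Everything after it treats both signs at once.
  Reduces : K → Filling → Set
  Reduces ε T = ∀ f → Equivariant ε f →
    ∀ xs → OfLen (exps xs) → Valid lam (lets xs) → Desc (exps xs) →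
    (∀ ys → exps ys ≡ exps xs → Valid lam (lets ys) → Bounds T ys → f (exps ys) (lets ys) ≈ 0f) → f (exps xs) (lets xs) ≈ 0f

  β≉1 : ∀ {d} → d ≢ ℤ.+ 0 → d ≢ ℤ.+ 1 → 1f ⊖ᶠ β d ≉ 0f
  β≉1 {d} n0 n1 e = n1 (ℤₚ.i-j≡0⇒i≡j d (ℤ.+ 1) (fromZ≈0 (≈-trans (fromZ-sub d (ℤ.+ 1)) (≈⇒⊖ᶠ-zero (≈-trans (≈-sym (KRing.*-identityʳ _))
    (≈-trans (⊛-congˡ (⊖ᶠ-zero⇒≈ e)) (≈-trans (inv-right (fromZ≉0 n0)) (≈-sym fromZ-1))))))))

  β≉-1 : ∀ {d} → d ≢ ℤ.+ 0 → d ≢ -[1+ 0 ] → 1f ⊕ β d ≉ 0f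
  β≉-1 {d} n0 n1 e = β≉1 {ℤ.- d} (λ h → n0 (trans (sym (ℤₚ.neg-involutive d)) (cong (ℤ.-_) h))) (λ h → n1 (trans (sym (ℤₚ.neg-involutive d)) (cong (ℤ.-_) h)))
    (≈-trans (⊕-congˡ (≈-trans (⊝-cong (β-neg n0)) (KS.solve 1 (λ b → KS.:- (KS.:- b) KS.:= b) ≈-refl (β d)))) e)

  private
    pos<N : ∀ {A : Set} (f : A → ℕ) u x y r → length (map f (u ++ x ∷ y ∷ r)) ≡ N → suc (length (map f u)) < N
    pos<N f u x y r l = subst₂ _<_ (cong suc (sym (Listₚ.length-map f u))) (trans (sym (Listₚ.length-map f (u ++ x ∷ y ∷ r))) l)
      (subst (suc (suc (length u)) ℕ.≤_) (trans (trans (cong suc (sym (ℕₚ.+-suc (length u) (length r)))) (sym (ℕₚ.+-suc (length u) (suc (length r))))) (sym (Listₚ.length-++ u))) (s≤s (s≤s (ℕₚ.m≤m+n _ _))))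

    -- At two equal exponents the transposition fixes the monomial, so equivariance becomes a
    -- relation between the coefficients of one tableau and its exchange.
    at-tie : ∀ {ε f} → Equivariant ε f → ∀ u a x y r → OfLen (exps (u ++ (a , x) ∷ (a , y) ∷ r)) → Valid lam (lets (u ++ (a , x) ∷ (a , y) ∷ r)) →
      let m = exps (u ++ (a , x) ∷ (a , y) ∷ r) ; d = ctAt x (y ∷ lets r) ℤ.- ctAt y (lets r) in
      β d ⊛ f m (lets (u ++ (a , x) ∷ (a , y) ∷ r)) ⊕ κ d ⊛ f m (lets (u ++ (a , y) ∷ (a , x) ∷ r)) ≈ ε ⊛ f m (lets (u ++ (a , x) ∷ (a , y) ∷ r))
    at-tie {ε} {f} eq u a x y r l v = ≈-trans (≡⇒≈ (sym (cong₂ _⊕_ (cong₂ _⊛_ (cong β d≡) (cong (λ z → f z (lets (u ++ (a , x) ∷ (a , y) ∷ r))) m≡)) (cong₂ _⊛_ (cong κ d≡) (cong₂ f m≡ t≡))))) (on (eq (length (lets u)) lt) l v)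
      where
      lt : suc (length (lets u)) < N
      lt = pos<N proj₂ u (a , x) (a , y) r (size v)
      len≡ : length (lets u) ≡ length (exps u)
      len≡ = trans (Listₚ.length-map proj₂ u) (sym (Listₚ.length-map proj₁ u))
      lets-++ : ∀ p q → lets (u ++ p ∷ q ∷ r) ≡ lets u ++ proj₂ p ∷ proj₂ q ∷ lets r
      lets-++ p q = Listₚ.map-++ proj₂ u _
      d≡ : dd (length (lets u)) (lets (u ++ (a , x) ∷ (a , y) ∷ r)) ≡ ctAt x (y ∷ lets r) ℤ.- ctAt y (lets r)
      d≡ = trans (cong (dd (length (lets u))) (lets-++ _ _)) (dd-split (lets u) x y (lets r))
      m≡ : swap0 (exps (u ++ (a , x) ∷ (a , y) ∷ r)) (length (lets u)) ≡ exps (u ++ (a , x) ∷ (a , y) ∷ r)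
      m≡ = trans (cong₂ swap0 (Listₚ.map-++ proj₁ u _) len≡) (trans (swap0-split (exps u) a a (exps r)) (sym (Listₚ.map-++ proj₁ u _)))
      t≡ : swap0 (lets (u ++ (a , x) ∷ (a , y) ∷ r)) (length (lets u)) ≡ lets (u ++ (a , y) ∷ (a , x) ∷ r)
      t≡ = trans (cong (λ z → swap0 z (length (lets u))) (lets-++ _ _)) (trans (swap0-split (lets u) x y (lets r)) (sym (lets-++ _ _)))

    adj-at : ∀ u a x y r → Valid lam (lets (u ++ (a , x) ∷ (a , y) ∷ r)) → Adj (length lam) x y (lets r)
    adj-at u a x y r v = adj (length lam) x y (lets r) (Lat-drop (lets u) (subst (Lat (length lam)) (Listₚ.map-++ proj₂ u _) (lattice v)))

    valid-at : ∀ u a x y r → Valid lam (lets (u ++ (a , x) ∷ (a , y) ∷ r)) → Lat (length lam) (y ∷ x ∷ lets r) → Valid lam (lets (u ++ (a , y) ∷ (a , x) ∷ r))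
    valid-at u a x y r v lt = subst (Valid lam) (sym (Listₚ.map-++ proj₂ u _)) (swap-valid (lets u) x y (lets r) (subst (Valid lam) (Listₚ.map-++ proj₂ u _) v) lt)

    exps-swap : ∀ u a x y r → exps (u ++ (a , y) ∷ (a , x) ∷ r) ≡ exps (u ++ (a , x) ∷ (a , y) ∷ r)
    exps-swap u a x y r = trans (Listₚ.map-++ proj₁ u _) (sym (Listₚ.map-++ proj₁ u _))

    double-zero : ∀ {x} → x ⊕ x ≈ 0f → x ≈ 0f
    double-zero {x} e = ⊛-cancelˡ 2≉0 (≈-trans (KRing.distribʳ x 1f 1f) (≈-trans (⊕-cong (KRing.*-identityˡ x) (KRing.*-identityˡ x)) e))

  -- Rows are sorted to be increasing inside each block. A bad pair in one column has b = -1 and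
  -- satisfies -f = f, so f = 0. A bad pair at distance -2 or less gives (1 - b) f(t) = κ f(t′) with
  -- b ≠ 1, so f(t) vanishes together with the coefficient of the exchanged tableau.
  reduces₊ : Reduces 1f T1
  reduces₊ f eq xs = Sort₊.sort-induction P base step xs
    where
    P : Pairs → Set
    P xs = OfLen (exps xs) → Valid lam (lets xs) → Desc (exps xs) →
      (∀ ys → exps ys ≡ exps xs → Valid lam (lets ys) → Bounds T1 ys → f (exps ys) (lets ys) ≈ 0f) → f (exps xs) (lets xs) ≈ 0f
    base : ∀ xs → Linked Sort₊.Good xs → P xs
    base xs lk l v ds h = h xs refl v (bounds-T1 xs (lattice v) ds (Linked-map (λ {p} {q} g e → good p q g e) lk))
      where
      good : ∀ p q → bad₊ p q ≡ false → Increasing p q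
      good (a , x) (b , y) g refl = <ᵇ-false⇒ {y} {x} (∧-falseʳ g (≡ᵇ-refl a))
    step : ∀ u p q r → bad₊ p q ≡ true → P (u ++ q ∷ p ∷ r) → P (u ++ p ∷ q ∷ r)
    step u (a , x) (b , y) r bd ih l v ds h with ∧-true {a ≡ᵇ b} bd
    ... | e₁ , e₂ with ≡ᵇ⇒≡ {a} {b} e₁
    ... | refl with adj-at u a x y r v | at-tie eq u a x y r l v
    ... | row refl _ | _ = ⊥-elim (ℕₚ.<-irrefl refl (<ᵇ⇒< {y} {x} e₂))
    ... | fall k x<y _ _ | _ = ⊥-elim (ℕₚ.<-asym x<y (<ᵇ⇒< {y} {x} e₂))
    ... | col _ _ d | tie rewrite d = double-zero (≈-trans (⊕-congʳ (≈-trans (≈-sym (KRing.*-identityˡ _)) (≈-trans (≈-sym tie) (⊕-cong (⊛-congʳ β--1) (KRing.zeroˡ _)))))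
          (KS.solve 2 (λ o x → (KS.:- o KS.:* x KS.:+ KS.con (ℤ.+ 0)) KS.:+ x KS.:= (KS.con (ℤ.+ 1) KS.:- o) KS.:* x) ≈-refl 1f (f _ _) ⟨≈⟩ ⊛-zeroˡ (≈⇒⊖ᶠ-zero (KRing.+-identityʳ 1f))))
      where _⟨≈⟩_ : ∀ {x y z} → x ≈ y → y ≈ z → x ≈ z
            _⟨≈⟩_ = ≈-trans
    ... | rise k y<x d lt | tie rewrite d = ⊛-cancelˡ (β≉1 { -[1+ suc k ]} (λ ()) (λ ()))
          (≈-trans (KS.solve 3 (λ o b x → (o KS.:- b) KS.:* x KS.:= o KS.:* x KS.:- b KS.:* x) ≈-refl 1f (β -[1+ suc k ]) (f _ _))
          (≈⇒⊖ᶠ-zero (≈-trans (≈-sym tie) (≈-trans (⊕-congˡ (⊛-zeroʳ swapped)) (KRing.+-identityʳ _)))))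
      where
      swapped : f (exps (u ++ (a , x) ∷ (a , y) ∷ r)) (lets (u ++ (a , y) ∷ (a , x) ∷ r)) ≈ 0f
      swapped = subst (λ m → f m (lets (u ++ (a , y) ∷ (a , x) ∷ r)) ≈ 0f) (exps-swap u a x y r)
        (ih (subst OfLen (sym (exps-swap u a x y r)) l) (valid-at u a x y r v lt) (subst Desc (sym (exps-swap u a x y r)) ds) (λ ys e → h ys (trans e (exps-swap u a x y r))))

  -- The mirror image: rows are sorted to be decreasing, with 1 + b in place of 1 - b. A repeated
  -- row, meaning two neighbours in a row with equal exponents, has b = 1 and gives f = -f; this
  -- makes the decrease strict.
  reduces₋ : Reduces (⊝ 1f) Tdet
  reduces₋ f eq xs = Sort₋.sort-induction P base step xs
    where
    P : Pairs → Set
    P xs = OfLen (exps xs) → Valid lam (lets xs) → Desc (exps xs) →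
      (∀ ys → exps ys ≡ exps xs → Valid lam (lets ys) → Bounds Tdet ys → f (exps ys) (lets ys) ≈ 0f) → f (exps xs) (lets xs) ≈ 0f
    repeated? : ∀ (p q : ℕ × ℕ) → p ≡ q ⊎ p ≢ q
    repeated? (a , x) (b , y) with a ℕ.≟ b | x ℕ.≟ y
    ... | yes refl | yes refl = inj₁ refl
    ... | no n | _ = inj₂ (n ∘ cong proj₁)
    ... | _ | no n = inj₂ (n ∘ cong proj₂)
    base : ∀ xs → Linked Sort₋.Good xs → P xs
    base xs lk l v ds h with split-Linked repeated? xs
    ... | inj₁ ne = h xs refl v (bounds-Tdet xs (lattice v) ds (both lk ne))
      where
      good : ∀ p q → bad₋ p q ≡ false → p ≢ q → Decreasing p q
      good (a , x) (b , y) g n refl = ℕₚ.≤∧≢⇒< (<ᵇ-false⇒ {x} {y} (∧-falseʳ g (≡ᵇ-refl a))) (λ e → n (cong (a ,_) (sym e)))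
      both : ∀ {xs} → Linked Sort₋.Good xs → Linked _≢_ xs → Linked Decreasing xs
      both [] [] = []
      both [-] [-] = [-]
      both (g ∷ l) (n ∷ l') = good _ _ g n ∷ both l l'
    ... | inj₂ (u , (a , x) , _ , r , refl , refl) with adj-at u a x x r v | at-tie eq u a x x r l v
    ... | fall k x<x _ _ | _ = ⊥-elim (ℕₚ.<-irrefl refl x<x)
    ... | rise k x<x _ _ | _ = ⊥-elim (ℕₚ.<-irrefl refl x<x)
    ... | col () _ _ | _
    ... | row _ d | tie rewrite d = double-zero (≈-trans (⊕-congʳ (≈-trans (≈-sym (KRing.*-identityˡ _)) (≈-trans (⊛-congʳ (≈-sym β-1)) (≈-trans (≈-sym (KRing.+-identityʳ _)) (≈-trans (⊕-congˡ (≈-sym (KRing.zeroˡ _))) tie)))))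
          (≈-trans (⊕-congˡ (≈-sym (KRing.*-identityˡ _))) (KS.solve 2 (λ o x → (KS.:- o) KS.:* x KS.:+ o KS.:* x KS.:= KS.con (ℤ.+ 0)) ≈-refl 1f (f _ _))))
    step : ∀ u p q r → bad₋ p q ≡ true → P (u ++ q ∷ p ∷ r) → P (u ++ p ∷ q ∷ r)
    step u (a , x) (b , y) r bd ih l v ds h with ∧-true {a ≡ᵇ b} bd
    ... | e₁ , e₂ with ≡ᵇ⇒≡ {a} {b} e₁
    ... | refl with adj-at u a x y r v | at-tie eq u a x y r l v
    ... | row refl _ | _ = ⊥-elim (ℕₚ.<-irrefl refl (<ᵇ⇒< {x} {y} e₂))
    ... | col refl _ _ | _ = ⊥-elim (ℕₚ.<-asym (ℕₚ.n<1+n y) (<ᵇ⇒< {x} {y} e₂))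
    ... | rise k y<x _ _ | _ = ⊥-elim (ℕₚ.<-asym y<x (<ᵇ⇒< {x} {y} e₂))
    ... | fall k x<y d lt | tie rewrite d = ⊛-cancelˡ (β≉-1 {ℤ.+ suc (suc k)} (λ ()) (λ ()))
          (≈-trans (KS.solve 3 (λ o b x → (o KS.:+ b) KS.:* x KS.:= b KS.:* x KS.:- (KS.:- o) KS.:* x) ≈-refl 1f (β (ℤ.+ suc (suc k))) (f _ _))
          (≈⇒⊖ᶠ-zero (≈-trans (≈-sym (≈-trans (⊕-congˡ (⊛-zeroʳ swapped)) (KRing.+-identityʳ _))) tie)))
      where
      swapped : f (exps (u ++ (a , x) ∷ (a , y) ∷ r)) (lets (u ++ (a , y) ∷ (a , x) ∷ r)) ≈ 0f
      swapped = subst (λ m → f m (lets (u ++ (a , y) ∷ (a , x) ∷ r)) ≈ 0f) (exps-swap u a x y r)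
        (ih (subst OfLen (sym (exps-swap u a x y r)) l) (valid-at u a x y r v lt) (subst Desc (sym (exps-swap u a x y r)) ds) (λ ys e → h ys (trans e (exps-swap u a x y r))))

  module _ {ε : K} {T : Filling} (ε² : ε ⊛ ε ≈ 1f) (red : Reduces ε T) (sep : Separates T) (f : Fun) (eq : Equivariant ε f) where

    vanish-desc : (∀ m t → OfLen m → Valid lam t → Desc m → f m t ≈ 0f) → f ≐ 𝟎
    vanish-desc h = pointwise λ {m} {t} l v → SortDesc.sort-induction P base step m l v
      where
      P : List ℕ → Set
      P m = OfLen m → ∀ {t} → Valid lam t → f m t ≈ 0f
      base : ∀ m → Linked SortDesc.Good m → P m
      base m lk l v = h m _ l v (Linked⇒AllPairs (λ p q → ℕₚ.≤-trans q p) (Linked-map (λ {x} {y} → <ᵇ-false⇒ {x} {y}) lk))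
      step : ∀ u x y r → (x <ᵇ y) ≡ true → P (u ++ y ∷ x ∷ r) → P (u ++ x ∷ y ∷ r)
      step u x y r _ ih l {t} v = ⊛-cancelˡ ε≉0 (≈-trans (≈-sym (on (eq p lt) l v)) (⊕-zero
          (⊛-zeroʳ (ih' v)) (≈-trans (κ-cong v lt λ v' _ _ → ih' v') (KRing.zeroʳ _))))
        where
        p : ℕ
        p = length u
        lt : suc p < N
        lt = subst₂ _<_ (cong suc (Listₚ.length-map id u)) refl (pos<N id u x y r (trans (Listₚ.length-map id (u ++ x ∷ y ∷ r)) (getLen l)))
        ε≉0 : ε ≉ 0f
        ε≉0 e = 1≉0 (≈-trans (≈-sym ε²) (⊛-zeroˡ e))
        ih' : ∀ {t} → Valid lam t → f (swap0 (u ++ x ∷ y ∷ r) p) t ≈ 0f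
        ih' {t} v = ≈-trans (≡⇒≈ (cong (λ z → f z t) (swap0-split u x y r))) (ih (ofLen (trans (trans (Listₚ.length-++ u) (sym (Listₚ.length-++ u))) (getLen l))) v)

    vanish-pairs : (∀ ys → OfLen (exps ys) → Valid lam (lets ys) → Desc (exps ys) → Bounds T ys → f (exps ys) (lets ys) ≈ 0f) → f ≐ 𝟎
    vanish-pairs h = vanish-desc λ m t l v ds →
      let le = trans (getLen l) (sym (size v)) ; em = exps-pairUp m t le ; et = lets-pairUp m t le in
      subst₂ (λ a b → f a b ≈ 0f) em et (red f eq (pairUp m t) (subst OfLen (sym em) l) (subst (Valid lam) (sym et) v) (subst Desc (sym em) ds)
        (λ ys e v' b → h ys (subst OfLen (sym (trans e em)) l) v' (subst Desc (sym (trans e em)) ds) b))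

    module _ {d : ℕ} (hom : ∀ m t → OfLen m → Valid lam t → sum m ≢ d → f m t ≈ 0f) where

      vanish-below : d < degFilling lam T → f ≐ 𝟎
      vanish-below lt = vanish-pairs λ ys l v ds b → hom _ _ l v
        λ e → ℕₚ.<⇒≱ lt (subst₂ _≤_ (sum-LT-valid T v) e (bounds-sum T ys b))

      -- The lower bounds already sum to the degree, so each is an equality: the exponents are the
      -- labels of T, and `tableau-unique` leaves only `t`.
      vanish-at : d ≡ degFilling lam T → ∀ {t} → Valid lam t → Desc (LT T t) → f (LT T t) t ≈ 0f → f ≐ 𝟎
      vanish-at refl {t} v ds z = vanish-pairs λ ys l v' ds' b → case ys l v' ds' b (sum (exps ys) ℕ.≟ d)
        where
        case : ∀ ys → OfLen (exps ys) → Valid lam (lets ys) → Desc (exps ys) → Bounds T ys → Dec (sum (exps ys) ≡ d) → f (exps ys) (lets ys) ≈ 0f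
        case ys l v' ds' b (no ne) = hom _ _ l v' ne
        case ys l v' ds' b (yes e) = subst₂ (λ a s → f a s ≈ 0f) (trans (cong (LT T) t≡) LT≡) t≡ z
          where
          LT≡ : LT T (lets ys) ≡ exps ys
          LT≡ = bounds-tight T ys b (trans (sum-LT-valid T v') (sym e))
          t≡ : t ≡ lets ys
          t≡ = tableau-unique {T} sep v v' ds (subst Desc (sym LT≡) ds')

-- Words and reversed words

idx0-mid : ∀ u x r → idx0 (u ++ x ∷ r) (length u) ≡ x
idx0-mid [] x r = refl
idx0-mid (_ ∷ u) x r = idx0-mid u x r

take-mid : ∀ {A : Set} (u : List A) x r → take (suc (length u)) (u ++ x ∷ r) ≡ u ++ x ∷ []
take-mid [] x r = refl
take-mid (a ∷ u) x r = cong (a ∷_) (take-mid u x r)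

reverse-mid : ∀ {A : Set} (u : List A) x r → reverse (u ++ x ∷ r) ≡ reverse r ++ x ∷ reverse u
reverse-mid u x r = trans (Listₚ.reverse-++ u (x ∷ r)) (trans (cong (_++ reverse u) (Listₚ.unfold-reverse x r)) (Listₚ.++-assoc (reverse r) (x ∷ []) (reverse u)))

reverse-mid₂ : ∀ {A : Set} (u : List A) x y r → reverse (u ++ x ∷ y ∷ r) ≡ reverse r ++ y ∷ x ∷ reverse u
reverse-mid₂ u x y r = trans (reverse-mid u x (y ∷ r)) (trans (cong (_++ x ∷ reverse u) (Listₚ.unfold-reverse y r)) (Listₚ.++-assoc (reverse r) (y ∷ []) (x ∷ reverse u)))

count-reverse : ∀ x r → count x (reverse r) ≡ count x r
count-reverse x [] = refl
count-reverse x (y ∷ r) = trans (cong (count x) (Listₚ.unfold-reverse y r)) (trans (count-++ x (reverse r) (y ∷ [])) (trans (ℕₚ.+-comm (count x (reverse r)) _) (trans (cong (count x (y ∷ []) ℕ.+_) (count-reverse x r)) (sym (count-∷ x y r)))))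

entry-position : ∀ {A : Set} (u : List A) x r → length (reverse (u ++ x ∷ r)) ∸ suc (length u) ≡ length (reverse r)
entry-position u x r = trans (cong (_∸ suc (length u)) (trans (Listₚ.length-reverse (u ++ x ∷ r)) (trans (Listₚ.length-++ u) (ℕₚ.+-suc (length u) (length r)))))
  (trans (ℕₚ.m+n∸m≡n (suc (length u)) (length r)) (sym (Listₚ.length-reverse r)))

rowOf-reverse : ∀ u x r → rowOf (reverse (u ++ x ∷ r)) (suc (length u)) ≡ suc x
rowOf-reverse u x r = cong suc (trans (cong (idx0 (reverse (u ++ x ∷ r))) (entry-position u x r)) (trans (cong (λ w → idx0 w (length (reverse r))) (reverse-mid u x r)) (idx0-mid (reverse r) x (reverse u))))

colOf-reverse : ∀ u x r → colOf (reverse (u ++ x ∷ r)) (suc (length u)) ≡ suc (count x r)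
colOf-reverse u x r = trans (cong₂ count (ℕₚ.suc-injective (rowOf-reverse u x r))
    (trans (cong (λ n → take (suc n) (reverse (u ++ x ∷ r))) (entry-position u x r)) (trans (cong (take (suc (length (reverse r)))) (reverse-mid u x r)) (take-mid (reverse r) x (reverse u)))))
  (trans (count-++ x (reverse r) (x ∷ [])) (trans (cong₂ _+_ (count-reverse x r) (count-same x [])) (ℕₚ.+-comm (count x r) 1)))

CT-reverse-split : ∀ u x r → CT (reverse (u ++ x ∷ r)) (suc (length u)) ≡ ctAt x r
CT-reverse-split u x r = trans (cong₂ (λ c s → ℤ.+ c ℤ.- ℤ.+ s) (colOf-reverse u x r) (rowOf-reverse u x r))
  (trans (ℤₚ.m-n≡m⊖n (suc (count x r)) (suc x)) (trans (ℤₚ.[1+m]⊖[1+n]≡m⊖n (count x r) x) (sym (ℤₚ.m-n≡m⊖n (count x r) x))))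

CT-reverse : ∀ t p → p < length t → CT (reverse t) (suc p) ≡ ct t p
CT-reverse t p lt with split₁ t p lt
... | u , x , r , refl , refl = trans (CT-reverse-split u x r) (sym (ct-split u x r))

swapEntries-reverse : ∀ t p → suc p < length t → swapEntries (reverse t) (suc p) ≡ reverse (swap0 t p)
swapEntries-reverse t p lt with split₂ t p lt
... | u , x , y , r , refl , refl = trans (cong (swap0 (reverse (u ++ x ∷ y ∷ r))) (trans (cong (_∸ 1) (entry-position u x (y ∷ r))) (trans (cong (_∸ 1) (Listₚ.length-reverse (y ∷ r))) (sym (Listₚ.length-reverse r)))))
      (trans (cong (λ w → swap0 w (length (reverse r))) (reverse-mid₂ u x y r)) (trans (swap0-split (reverse r) y x (reverse u))
      (sym (trans (cong reverse (swap0-split u x y r)) (reverse-mid₂ u y x r)))))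

idx0-incAt0-same : ∀ mu x → x < length mu → idx0 (incAt0 mu x) x ≡ suc (idx0 mu x)
idx0-incAt0-same (a ∷ mu) zero lt = refl
idx0-incAt0-same (a ∷ mu) (suc x) (s≤s lt) = idx0-incAt0-same mu x lt

idx0-incAt0-diff : ∀ mu x y → y ≢ x → idx0 (incAt0 mu x) y ≡ idx0 mu y
idx0-incAt0-diff [] x y ne = refl
idx0-incAt0-diff (a ∷ mu) zero zero ne = ⊥-elim (ne refl)
idx0-incAt0-diff (a ∷ mu) zero (suc y) ne = refl
idx0-incAt0-diff (a ∷ mu) (suc x) zero ne = refl
idx0-incAt0-diff (a ∷ mu) (suc x) (suc y) ne = idx0-incAt0-diff mu x y (ne ∘ cong suc)

length-incAt0 : ∀ mu x → length (incAt0 mu x) ≡ length mu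
length-incAt0 [] x = refl
length-incAt0 (a ∷ mu) zero = refl
length-incAt0 (a ∷ mu) (suc x) = cong suc (length-incAt0 mu x)

sum-incAt0 : ∀ mu x → x < length mu → sum (incAt0 mu x) ≡ suc (sum mu)
sum-incAt0 (a ∷ mu) zero lt = refl
sum-incAt0 (a ∷ mu) (suc x) (s≤s lt) = trans (cong (a ℕ.+_) (sum-incAt0 mu x lt)) (ℕₚ.+-suc a (sum mu))

idx0-ext : ∀ mu nu → length mu ≡ length nu → (∀ x → x < length nu → idx0 mu x ≡ idx0 nu x) → mu ≡ nu
idx0-ext [] [] e h = refl
idx0-ext (a ∷ mu) (b ∷ nu) e h = cong₂ _∷_ (h 0 (s≤s z≤n)) (idx0-ext mu nu (ℕₚ.suc-injective e) (λ x lt → h (suc x) (s≤s lt)))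

idx0-replicate : ∀ n x → idx0 (replicate n 0) x ≡ 0
idx0-replicate zero x = refl
idx0-replicate (suc n) zero = refl
idx0-replicate (suc n) (suc x) = idx0-replicate n x

-- The invariant of `validFrom`: its argument `mu` is the list of letter counts of the part already
-- read, which `r` holds in reversed order.
record Tracks (lam mu r : List ℕ) : Set where
  field
    tlen : length mu ≡ length lam
    tidx : ∀ x → x < length lam → idx0 mu x ≡ count x r
open Tracks public

tracks-inc : ∀ {lam mu r x} → Tracks lam mu r → x < length lam → Tracks lam (incAt0 mu x) (x ∷ r)
tlen (tracks-inc {mu = mu} {x = x} tr lt) = trans (length-incAt0 mu x) (tlen tr)
tidx (tracks-inc {lam} {mu} {r} {x} tr lt) y yl with y ℕ.≟ x
... | yes refl = trans (idx0-incAt0-same mu x (subst (x ℕ.<_) (sym (tlen tr)) lt)) (trans (cong suc (tidx tr x lt)) (sym (count-same x r)))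
... | no ne = trans (idx0-incAt0-diff mu x y ne) (trans (tidx tr y yl) (sym (count-diff r ne)))

∨-true : ∀ {a b} → (a ∨ b) ≡ true → a ≡ true ⊎ b ≡ true
∨-true {true} e = inj₁ refl
∨-true {false} e = inj₂ e

stepOK-Step : ∀ {lam mu r} x → Tracks lam mu r → x < length lam → ((x ≡ᵇ 0) ∨ (idx0 mu x <ᵇ idx0 mu (x ∸ 1))) ≡ true → Step r x
stepOK-Step zero tr lt e = tt
stepOK-Step {lam} {mu} (suc x) tr lt e = subst₂ _<_ (tidx tr (suc x) lt) (tidx tr x (ℕₚ.<-trans (ℕₚ.n<1+n x) lt)) (<ᵇ⇒< {idx0 mu (suc x)} {idx0 mu x} e)

Step-stepOK : ∀ {lam mu r} x → Tracks lam mu r → x < length lam → Step r x → ((x ≡ᵇ 0) ∨ (idx0 mu x <ᵇ idx0 mu (x ∸ 1))) ≡ true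
Step-stepOK zero tr lt e = refl
Step-stepOK {lam} {mu} (suc x) tr lt st = <ᵇ-true (subst₂ _<_ (sym (tidx tr (suc x) lt)) (sym (tidx tr x (ℕₚ.<-trans (ℕₚ.n<1+n x) lt))) st)

validFrom-sound : ∀ lam mu r w → Tracks lam mu r → Lat (length lam) r → validFrom lam mu w ≡ true →
  Lat (length lam) (w ʳ++ r) × Tracks lam lam (w ʳ++ r) × length w + sum mu ≡ sum lam
validFrom-sound lam mu r [] tr lt e with eqL⇒≡ {mu} {lam} e
... | refl = lt , tr , refl
validFrom-sound lam mu r (x ∷ w) tr lt e =
  let (e₁ , e₂) = ∧-true {stepOK lam mu x} e
      (xl , e₃) = ∧-true {x <ᵇ length lam} e₁
      (_ , e₄) = ∧-true {idx0 mu x <ᵇ idx0 lam x} e₃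
      xl' = <ᵇ⇒< {x} xl
      (a , b , c) = validFrom-sound lam (incAt0 mu x) (x ∷ r) w (tracks-inc tr xl') (xl' , stepOK-Step x tr xl' e₄ , lt) e₂
  in a , b , trans (sym (ℕₚ.+-suc (length w) (sum mu))) (trans (cong (length w ℕ.+_) (sym (sum-incAt0 mu x (subst (x ℕ.<_) (sym (tlen tr)) xl')))) c)

validFrom-complete : ∀ lam mu r w → Tracks lam mu r → Lat (length lam) (w ʳ++ r) → Tracks lam lam (w ʳ++ r) → validFrom lam mu w ≡ true
validFrom-complete lam mu r [] tr lt fin = trans (cong (eqL mu) (sym mu≡)) (eqL-refl mu)
  where
  mu≡ : mu ≡ lam
  mu≡ = idx0-ext mu lam (tlen tr) (λ x xl → trans (tidx tr x xl) (sym (tidx fin x xl)))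
validFrom-complete lam mu r (x ∷ w) tr lt fin = cong₂ _∧_
    (cong₂ _∧_ (<ᵇ-true xl) (cong₂ _∧_ (<ᵇ-true below) (Step-stepOK x tr xl (proj₁ (proj₂ lx)))))
    (validFrom-complete lam (incAt0 mu x) (x ∷ r) w (tracks-inc tr xl) lt fin)
  where
  lx : Lat (length lam) (x ∷ r)
  lx = Lat-drop (reverse w) (subst (Lat (length lam)) (Listₚ.ʳ++-defn w) lt)
  xl : x < length lam
  xl = proj₁ lx
  below : idx0 mu x < idx0 lam x
  below = subst₂ _<_ (sym (tidx tr x xl)) (sym (trans (tidx fin x xl) (trans (cong (count x) (Listₚ.ʳ++-defn w)) (count-++ x (reverse w) (x ∷ r)))))
    (ℕₚ.<-≤-trans (ℕₚ.≤-reflexive (sym (count-same x r))) (ℕₚ.m≤n+m _ (count x (reverse w))))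

tracks-start : ∀ lam → Tracks lam (replicate (length lam) 0) []
tlen (tracks-start lam) = Listₚ.length-replicate (length lam)
tidx (tracks-start lam) x xl = idx0-replicate (length lam) x

sum-replicate-0 : ∀ n → sum (replicate n 0) ≡ 0
sum-replicate-0 zero = refl
sum-replicate-0 (suc n) = sum-replicate-0 n

isRST⇒Valid : ∀ lam w → isRST lam w ≡ true → Valid lam (reverse w)
isRST⇒Valid lam w e = let (a , b , c) = validFrom-sound lam (replicate (length lam) 0) [] w (tracks-start lam) tt e in
  valid a (λ x xl → sym (tidx b x xl)) (trans (Listₚ.length-reverse w) (trans (sym (ℕₚ.+-identityʳ (length w))) (trans (cong (length w ℕ.+_) (sym (sum-replicate-0 (length lam)))) c)))

Valid⇒isRST : ∀ lam w → Valid lam (reverse w) → isRST lam w ≡ true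
Valid⇒isRST lam w v = validFrom-complete lam (replicate (length lam) 0) [] w (tracks-start lam) (lattice v) (record { tlen = refl ; tidx = λ x xl → sym (shape v x xl) })

-- Elements of M_λ as coefficient functions

if-true : ∀ {A : Set} {b} {x y : A} → b ≡ true → (if b then x else y) ≡ x
if-true refl = refl

if-false : ∀ {A : Set} {b} {x y : A} → b ≡ false → (if b then x else y) ≡ y
if-false refl = refl

term-at : Term → List ℕ → List ℕ → K
term-at t m w = if eqL (expo t) m ∧ eqL (tab t) w then coef t else 0f

coeffAt : M → List ℕ → List ℕ → K
coeffAt [] m w = 0f
coeffAt (t ∷ P) m w = term-at t m w ⊕ coeffAt P m w

coeffM≈ : ∀ P m w → coeffM P m w ≈ coeffAt P m w
coeffM≈ [] m w = ≡⇒≈ 0f-def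
coeffM≈ (t ∷ P) m w with eqL (expo t) m ∧ eqL (tab t) w
... | true = ≈-trans (≡⇒≈ (⊕-def (coef t) (coeffM P m w))) (⊕-congˡ (coeffM≈ P m w))
... | false = ≈-trans (coeffM≈ P m w) (≈-sym (KRing.+-identityˡ _))

term-at-hit : ∀ c e w → term-at (term c e w) e w ≡ c
term-at-hit c e w rewrite eqL-refl e | eqL-refl w = refl

term-at-miss₁ : ∀ c {e m} w w' → e ≢ m → term-at (term c e w) m w' ≡ 0f
term-at-miss₁ c w w' ne rewrite eqL-≢ ne = refl

term-at-miss₂ : ∀ c e m {w w'} → w ≢ w' → term-at (term c e w) m w' ≡ 0f
term-at-miss₂ c e m ne with eqL e m
... | true rewrite eqL-≢ ne = refl
... | false = refl

coeffAt-++ : ∀ P Q m w → coeffAt (P ++ Q) m w ≈ coeffAt P m w ⊕ coeffAt Q m w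
coeffAt-++ [] Q m w = ≈-sym (KRing.+-identityˡ _)
coeffAt-++ (t ∷ P) Q m w = ≈-trans (⊕-congˡ (coeffAt-++ P Q m w)) (≈-sym (KRing.+-assoc _ _ _))

coeffAt-scaleM : ∀ c P m w → coeffAt (scaleM c P) m w ≈ c ⊛ coeffAt P m w
coeffAt-scaleM c [] m w = ≈-sym (KRing.zeroʳ c)
coeffAt-scaleM c (t ∷ P) m w = ≈-trans (⊕-cong h (coeffAt-scaleM c P m w)) (≈-sym (KRing.distribˡ c _ _))
  where
  h : term-at (term (c *K coef t) (expo t) (tab t)) m w ≈ c ⊛ term-at t m w
  h with eqL (expo t) m ∧ eqL (tab t) w
  ... | true = ≡⇒≈ (⊛-def c (coef t))
  ... | false = ≈-sym (KRing.zeroʳ c)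

sum-swap0 : ∀ m p → sum (swap0 m p) ≡ sum m
sum-swap0 [] p = refl
sum-swap0 (x ∷ []) zero = refl
sum-swap0 (x ∷ y ∷ m) zero = exch y x (sum m)
sum-swap0 (x ∷ m) (suc p) = trans (cong sum (swap0-∷ x m p)) (cong (x ℕ.+_) (sum-swap0 m p))

∣∣≡ᵇ1-false : ∀ {d k} → d ≡ ℤ.+ suc (suc k) ⊎ d ≡ -[1+ suc k ] → (ℤ.∣ d ∣ ≡ᵇ 1) ≡ false
∣∣≡ᵇ1-false (inj₁ refl) = refl
∣∣≡ᵇ1-false (inj₂ refl) = refl

oneTo-snoc : ∀ n → oneTo (suc n) ≡ oneTo n ++ suc n ∷ []
oneTo-snoc n = trans (cong (map suc) (sym (Listₚ.upTo-∷ʳ n))) (Listₚ.map-++ suc (upTo n) (n ∷ []))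

module Bridge (lam : List ℕ) where
  open Intertwining lam public

  fn : M → Fun
  fn P m t = coeffAt P m (reverse t)

  record InDeg (k : ℕ) (t : Term) : Set where
    constructor inDeg
    field
      exp-len : length (expo t) ≡ N
      exp-sum : sum (expo t) ≡ k
      tab-ok  : Valid lam (reverse (tab t))
  open InDeg public

  InD : ℕ → M → Set
  InD k = All (InDeg k)

  data Action (w : List ℕ) (p : ℕ) : Set where
    fixes : (dd p (reverse w) ≡ ℤ.+ 1 ⊎ dd p (reverse w) ≡ -[1+ 0 ]) → actTab w (suc p) ≡ (invK (fromℤ (dd p (reverse w))) , w) ∷ [] → Action w p
    moves : ∀ c → c ≈ κ (dd p (swap0 (reverse w) p)) → Valid lam (swap0 (reverse w) p) → dd p (swap0 (reverse w) p) ≡ ℤ.- dd p (reverse w) →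
            actTab w (suc p) ≡ (invK (fromℤ (dd p (reverse w))) , w) ∷ (c , reverse (swap0 (reverse w) p)) ∷ [] → Action w p

  action : ∀ w p → Valid lam (reverse w) → suc p < N → Action w p
  action w p v lt with place {p = p} v lt'
    where
    lt' : suc p < length (reverse w)
    lt' = subst (suc p ℕ.<_) (sym (size v)) lt
  ... | pl = go pl
    where
    s : List ℕ
    s = reverse w
    lt' : suc p < length s
    lt' = subst (suc p ℕ.<_) (sym (size v)) lt
    ww : reverse s ≡ w
    ww = Listₚ.reverse-involutive w
    d≡ : CT w (suc p) ℤ.- CT w (suc (suc p)) ≡ dd p s
    d≡ = cong₂ ℤ._-_ (trans (cong (λ z → CT z (suc p)) (sym ww)) (CT-reverse s p (ℕₚ.<-trans (ℕₚ.n<1+n p) lt')))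
                     (trans (cong (λ z → CT z (suc (suc p))) (sym ww)) (CT-reverse s (suc p) lt'))
    sw≡ : swapEntries w (suc p) ≡ reverse (swap0 s p)
    sw≡ = trans (cong (λ z → swapEntries z (suc p)) (sym ww)) (swapEntries-reverse s p lt')
    gen : ℤ → List ℕ → List (K × List ℕ)
    gen d w' = let b = invK (fromℤ d) in if (ℤ.∣ d ∣ ≡ᵇ 1) then ((b , w) ∷ []) else if (ℤ.+ 2 ℤ.≤ᵇ d) then ((b , w) ∷ (1K , w') ∷ []) else ((b , w) ∷ ((1K -K (b *K b)) , w') ∷ [])
    act≡ : actTab w (suc p) ≡ gen (dd p s) (reverse (swap0 s p))
    act≡ = cong₂ gen d≡ sw≡
    go : Place lam p s → Action w p
    go (same-row d) = fixes (inj₁ d) (trans act≡ (if-true (cong (λ z → ℤ.∣ z ∣ ≡ᵇ 1) d)))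
    go (same-col d) = fixes (inj₂ d) (trans act≡ (if-true (cong (λ z → ℤ.∣ z ∣ ≡ᵇ 1) d)))
    go (exchange k (inj₁ d) v' c c') = moves 1K (≈-trans (≡⇒≈ 1f-def) (≡⇒≈ (sym (cong κ (trans dd' (cong (ℤ.-_) d)))))) v' dd'
      (trans act≡ (trans (if-false (∣∣≡ᵇ1-false (inj₁ d))) (if-true (cong (ℤ.+ 2 ℤ.≤ᵇ_) d))))
      where
      dd' : dd p (swap0 s p) ≡ ℤ.- dd p s
      dd' = dd-exchange {s} {p} c c'
    go (exchange k (inj₂ d) v' c c') = moves _ (≈-trans (≡⇒≈ unf) (≈-trans (⊖ᶠ-cong ≈-refl sq) (≡⇒≈ (sym (cong κ (trans dd' (cong (ℤ.-_) d))))))) v' dd'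
      (trans act≡ (trans (if-false (∣∣≡ᵇ1-false (inj₂ d))) (if-false (cong (ℤ.+ 2 ℤ.≤ᵇ_) d))))
      where
      dd' : dd p (swap0 s p) ≡ ℤ.- dd p s
      dd' = dd-exchange {s} {p} c c'
      b : K
      b = invK (fromℤ (dd p s))
      b≡ : b ≡ β (dd p s)
      b≡ = trans (inv-def _) (cong inv (fromZ-def (dd p s)))
      unf : 1K -K (b *K b) ≡ 1f ⊖ᶠ β (dd p s) ⊛ β (dd p s)
      unf = trans (⊕-def 1K (-K (b *K b))) (cong₂ _⊕_ 1f-def (trans (⊝-def (b *K b)) (cong (⊝_) (trans (⊛-def b b) (cong₂ _⊛_ b≡ b≡)))))
      sq : β (dd p s) ⊛ β (dd p s) ≈ β (ℤ.+ suc (suc k)) ⊛ β (ℤ.+ suc (suc k))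
      sq = ≈-trans (≈-sym (β-sq-neg {dd p s} (dd≢0 v lt))) (≡⇒≈ (cong (λ z → β z ⊛ β z) (cong (ℤ.-_) d)))

  private
    act-term : Term → ℕ → M
    act-term t p = map (λ qw → term (coef t *K proj₁ qw) (swapV (expo t) (suc p)) (proj₂ qw)) (actTab (tab t) (suc p))

    inv≡ : ∀ d → invK (fromℤ d) ≡ β d
    inv≡ d = trans (inv-def _) (cong inv (fromZ-def d))

    reverse-≢ : ∀ (w s : List ℕ) → reverse w ≢ s → w ≢ reverse s
    reverse-≢ w s ne e = ne (trans (cong reverse e) (Listₚ.reverse-involutive s))

    -- `actTab` lists the image of one tableau, whereas `T̂` collects the preimages of one tableau.
    -- The two agree because the coefficient listed for the exchange is `κ` at the distance of that
    -- exchange.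
    act-term-fn : ∀ {t p} → Valid lam (reverse (tab t)) → suc p < N → ∀ m s → Valid lam s →
      coeffAt (act-term t p) m (reverse s) ≈ T̂ p (λ m s → term-at t m (reverse s)) m s
    act-term-fn {term c e w} {p} ok lt m s vs with Listₚ.≡-dec ℕ._≟_ (swap0 e p) m
    ... | no ne = ≈-trans (allmiss (actTab w (suc p))) (≈-sym (⊕-zero (⊛-zeroʳ (≡⇒≈ (term-at-miss₁ c w _ ne'))) (⊛-zeroʳ (≡⇒≈ (term-at-miss₁ c w _ ne')))))
      where
      ne' : e ≢ swap0 m p
      ne' h = ne (trans (cong (λ z → swap0 z p) h) (swap0-invol m p))
      allmiss : ∀ qs → coeffAt (map (λ qw → term (c *K proj₁ qw) (swap0 e p) (proj₂ qw)) qs) m (reverse s) ≈ 0f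
      allmiss [] = ≈-refl
      allmiss (q ∷ qs) = ⊕-zero (≡⇒≈ (term-at-miss₁ (c *K proj₁ q) (proj₂ q) (reverse s) ne)) (allmiss qs)
    ... | yes refl = go (action w p ok lt) (Listₚ.≡-dec ℕ._≟_ (reverse w) s) (Listₚ.≡-dec ℕ._≟_ (swap0 (reverse w) p) s)
      where
      r : List ℕ
      r = reverse w
      rr : reverse r ≡ w
      rr = Listₚ.reverse-involutive w
      LHS : List (K × List ℕ) → K
      LHS qs = coeffAt (map (λ qw → term (c *K proj₁ qw) (swap0 e p) (proj₂ qw)) qs) (swap0 e p) (reverse s)
      G : List ℕ → List ℕ → K
      G m s = term-at (term c e w) m (reverse s)
      mm : swap0 (swap0 e p) p ≡ e
      mm = swap0-invol e p
      hit : r ≡ s → G (swap0 (swap0 e p) p) s ≡ c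
      hit h = trans (cong₂ (λ a b → term-at (term c e w) a b) mm (trans (cong reverse (sym h)) rr)) (term-at-hit c e w)
      hit' : swap0 r p ≡ s → G (swap0 (swap0 e p) p) (swap0 s p) ≡ c
      hit' h = trans (cong₂ (λ a b → term-at (term c e w) a b) mm (trans (cong reverse (trans (cong (λ z → swap0 z p) (sym h)) (swap0-invol r p))) rr)) (term-at-hit c e w)
      miss : r ≢ s → ∀ m → G m s ≡ 0f
      miss ne m = term-at-miss₂ c e m {w} {reverse s} (reverse-≢ w s ne)
      miss' : swap0 r p ≢ s → ∀ m → G m (swap0 s p) ≡ 0f
      miss' ne m = term-at-miss₂ c e m {w} {reverse (swap0 s p)} (reverse-≢ w (swap0 s p) (λ h → ne (trans (cong (λ z → swap0 z p) h) (swap0-invol s p))))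
      first : ∀ {d} → dd p r ≡ d → Dec (r ≡ s) → term-at (term (c *K invK (fromℤ (dd p r))) (swap0 e p) w) (swap0 e p) (reverse s) ≈ β (dd p s) ⊛ G (swap0 (swap0 e p) p) s
      first _ (yes refl) = ≈-trans (≡⇒≈ (trans (cong (term-at (term (c *K invK (fromℤ (dd p r))) (swap0 e p) w) (swap0 e p)) rr) (term-at-hit (c *K invK (fromℤ (dd p r))) (swap0 e p) w))) (≈-trans (≡⇒≈ (trans (⊛-def c _) (cong (c ⊛_) (inv≡ (dd p r)))))
         (≈-trans (KRing.*-comm _ _) (⊛-congˡ (≡⇒≈ (sym (hit refl))))))
      first _ (no ne) = ≈-trans (≡⇒≈ (term-at-miss₂ (c *K invK (fromℤ (dd p r))) (swap0 e p) (swap0 e p) {w} {reverse s} (reverse-≢ w s ne))) (≈-sym (⊛-zeroʳ (≡⇒≈ (miss ne _))))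
      second : ∀ {b} → b ≈ κ (dd p (swap0 r p)) → Dec (swap0 r p ≡ s) → term-at (term (c *K b) (swap0 e p) (reverse (swap0 r p))) (swap0 e p) (reverse s) ≈ κ (dd p s) ⊛ G (swap0 (swap0 e p) p) (swap0 s p)
      second {b} eb (yes refl) = ≈-trans (≡⇒≈ (term-at-hit (c *K b) (swap0 e p) (reverse (swap0 r p)))) (≈-trans (≡⇒≈ (⊛-def c b)) (≈-trans (⊛-congˡ eb) (≈-trans (KRing.*-comm _ _) (⊛-congˡ (≡⇒≈ (sym (hit' refl)))))))
      second {b} eb (no ne) = ≈-trans (≡⇒≈ (term-at-miss₂ (c *K b) (swap0 e p) (swap0 e p) {reverse (swap0 r p)} {reverse s} (λ h → ne (Listₚ.reverse-injective h)))) (≈-sym (⊛-zeroʳ (≡⇒≈ (miss' ne _))))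
      frozen : dd p r ≡ ℤ.+ 1 ⊎ dd p r ≡ -[1+ 0 ] → Dec (swap0 r p ≡ s) → 0f ≈ κ (dd p s) ⊛ G (swap0 (swap0 e p) p) (swap0 s p)
      frozen d (no ne) = ≈-sym (⊛-zeroʳ (≡⇒≈ (miss' ne _)))
      -- The list for `r` has no second term here, so `κ` must vanish at `s`. A genuine exchange at
      -- `s` would give `r` a distance of absolute value at least 2.
      frozen d (yes refl) with place {p = p} vs (subst (suc p ℕ.<_) (sym (size vs)) lt)
      ... | same-row d' = ≈-sym (⊛-zeroˡ (≡⇒≈ (κ-null (inj₁ d'))))
      ... | same-col d' = ≈-sym (⊛-zeroˡ (≡⇒≈ (κ-null (inj₂ d'))))
      ... | exchange j d' _ x x' = ⊥-elim (clash d (subst (λ z → dd p z ≡ ℤ.- dd p (swap0 r p)) (swap0-invol r p) (dd-exchange {swap0 r p} {p} x x')) d')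
        where
        clash : ∀ {a b} → a ≡ ℤ.+ 1 ⊎ a ≡ -[1+ 0 ] → a ≡ ℤ.- b → b ≡ ℤ.+ (suc (suc j)) ⊎ b ≡ -[1+ suc j ] → ⊥
        clash (inj₁ refl) () (inj₁ refl)
        clash (inj₁ refl) () (inj₂ refl)
        clash (inj₂ refl) () (inj₁ refl)
        clash (inj₂ refl) () (inj₂ refl)
      go : Action w p → Dec (r ≡ s) → Dec (swap0 r p ≡ s) → LHS (actTab w (suc p)) ≈ T̂ p G (swap0 e p) s
      go (fixes d act) D D' = ≈-trans (≡⇒≈ (cong LHS act)) (⊕-cong (first refl D) (frozen d D'))
      go (moves b eb _ _ act) D D' = ≈-trans (≡⇒≈ (cong LHS act)) (⊕-cong (first refl D) (≈-trans (KRing.+-identityʳ _) (second eb D')))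

  Tabs : M → Set
  Tabs = All (λ t → Valid lam (reverse (tab t)))

  InD⇒Tabs : ∀ {k P} → InD k P → Tabs P
  InD⇒Tabs = All.map tab-ok

  actS-fn : ∀ {P p} → Tabs P → suc p < N → fn (actS (suc p) P) ≐ T̂ p (fn P)
  actS-fn {P = []} [] lt = ≐-sym (T-zero _)
  actS-fn {P = t ∷ P} {p} (ok ∷ oks) lt = pointwise λ {m} {s} l v →
    ≈-trans (coeffAt-++ (act-term t p) (actS (suc p) P) m (reverse s))
    (≈-trans (⊕-cong (act-term-fn {t} {p} ok lt m s v) (on (actS-fn oks lt) l v))
      (KS.solve 6 (λ b k x y z w → (b KS.:* x KS.:+ k KS.:* y) KS.:+ (b KS.:* z KS.:+ k KS.:* w) KS.:= b KS.:* (x KS.:+ z) KS.:+ k KS.:* (y KS.:+ w)) ≈-refl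
        (β (dd p s)) (κ (dd p s)) (term-at t (swap0 m p) (reverse s)) (term-at t (swap0 m p) (reverse (swap0 s p))) (fn P (swap0 m p) s) (fn P (swap0 m p) (swap0 s p))))

  actS-InD : ∀ {k P p} → InD k P → suc p < N → InD k (actS (suc p) P)
  actS-InD {P = []} [] lt = []
  actS-InD {k} {P = t ∷ P} {p} (ok ∷ oks) lt = Allₚ.++⁺ (go (action (tab t) p (tab-ok ok) lt)) (actS-InD oks lt)
    where
    mk : ∀ c w → Valid lam (reverse w) → InDeg k (term c (swap0 (expo t) p) w)
    mk c w v = inDeg (trans (length-swap0 (expo t) p) (exp-len ok)) (trans (sum-swap0 (expo t) p) (exp-sum ok)) v
    go : Action (tab t) p → InD k (act-term t p)
    go (fixes _ act) rewrite act = mk _ _ (tab-ok ok) ∷ []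
    go (moves c _ v _ act) rewrite act = mk _ _ (tab-ok ok) ∷ mk _ _ (subst (Valid lam) (sym (Listₚ.reverse-involutive _)) v) ∷ []

  scaleM-InD : ∀ {k} c {P} → InD k P → InD k (scaleM c P)
  scaleM-InD c [] = []
  scaleM-InD c (ok ∷ oks) = inDeg (exp-len ok) (exp-sum ok) (tab-ok ok) ∷ scaleM-InD c oks

  fn-++ : ∀ P Q → fn (P ++ Q) ≐ fn P ⊞ fn Q
  fn-++ P Q = pointwise λ {m} {t} _ _ → coeffAt-++ P Q m (reverse t)

  fn-scaleM : ∀ c P → fn (scaleM c P) ≐ c · fn P
  fn-scaleM c P = pointwise λ {m} {t} _ _ → coeffAt-scaleM c P m (reverse t)

  rotate : ℕ → M → M
  rotate n P = foldl (λ acc j → actS j acc) P (oneTo n)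

  rotate-suc : ∀ n P → rotate (suc n) P ≡ actS (suc n) (rotate n P)
  rotate-suc n P = trans (cong (foldl (λ acc j → actS j acc) P) (oneTo-snoc n)) (Listₚ.foldl-++ (λ acc j → actS j acc) P (oneTo n) (suc n ∷ []))

  rotate-InD : ∀ {k P} n → InD k P → n < N → InD k (rotate n P)
  rotate-InD zero ok lt = ok
  rotate-InD {P = P} (suc n) ok lt = subst (InD _) (sym (rotate-suc n P)) (actS-InD (rotate-InD n ok (ℕₚ.<-trans (ℕₚ.n<1+n n) lt)) lt)

  rotate-fn : ∀ {k P} n → InD k P → n < N → fn (rotate n P) ≐ θ n (fn P)
  rotate-fn zero ok lt = ≐-refl
  rotate-fn {P = P} (suc n) ok lt = ≐-trans (≡⇒≐ (cong fn (rotate-suc n P))) (≐-trans (actS-fn (InD⇒Tabs (rotate-InD n ok n<N)) lt) (T-cong lt (rotate-fn n ok n<N)))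
    where
    n<N : n < N
    n<N = ℕₚ.<-trans (ℕₚ.n<1+n n) lt

  decAt-incAt0 : ∀ e j → j < length e → decAt (incAt0 e j) j ≡ just e
  decAt-incAt0 (x ∷ e) zero lt = refl
  decAt-incAt0 (x ∷ e) (suc j) (s≤s lt) = trans (decAt-∷ x (incAt0 e j) j) (cong (mapMaybe (x ∷_)) (decAt-incAt0 e j lt))

  incAt0-decAt : ∀ m j {e} → decAt m j ≡ just e → incAt0 e j ≡ m
  incAt0-decAt (suc x ∷ m) zero refl = refl
  incAt0-decAt (x ∷ m) (suc j) h rewrite decAt-∷ x m j with decAt m j in eq
  incAt0-decAt (x ∷ m) (suc j) refl | just e = cong (x ∷_) (incAt0-decAt m j eq)

  raise : ℕ → Term → Term
  raise j t = term (coef t) (incAt0 (expo t) j) (tab t)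

  raise-fn : ∀ {k P j} → InD k P → j < N → fn (map (raise j) P) ≐ X j (fn P)
  raise-fn {P = []} {j} [] lt = ≐-sym (X-zero j)
  raise-fn {P = t ∷ P} {j} (ok ∷ oks) lt = pointwise λ {m} {s} l v → ≈-trans (⊕-cong (one m s) (on (raise-fn {P = P} oks lt) l v)) (add m s)
    where
    g : Fun
    g m s = term-at t m (reverse s)
    one : ∀ m s → term-at (raise j t) m (reverse s) ≈ X j g m s
    one m s with decAt m j in eq
    ... | nothing = ≡⇒≈ (term-at-miss₁ (coef t) {incAt0 (expo t) j} {m} (tab t) (reverse s) (λ h → contr (trans (sym eq) (trans (cong (λ z → decAt z j) (sym h)) (decAt-incAt0 (expo t) j (subst (j ℕ.<_) (sym (exp-len ok)) lt))))))
      where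
      contr : ∀ {A : Set} {x : A} → nothing ≡ just x → ⊥
      contr ()
    ... | just m' with Listₚ.≡-dec ℕ._≟_ (expo t) m'
    ... | yes refl = ≡⇒≈ (cong (λ b → if b ∧ eqL (tab t) (reverse s) then coef t else 0f) (trans (cong (eqL (incAt0 (expo t) j)) (sym (incAt0-decAt m j eq))) (eqL-refl (incAt0 (expo t) j))))
    ... | no ne = ≈-trans (≡⇒≈ (term-at-miss₁ (coef t) {incAt0 (expo t) j} {m} (tab t) (reverse s) (λ h → ne (just-inj (trans (sym (decAt-incAt0 (expo t) j (subst (j ℕ.<_) (sym (exp-len ok)) lt))) (trans (cong (λ z → decAt z j) h) eq)))))) ≈-refl
      where
      just-inj : ∀ {A : Set} {x y : A} → just x ≡ just y → x ≡ y
      just-inj refl = refl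
    add : ∀ m s → X j g m s ⊕ X j (fn P) m s ≈ X j (fn (t ∷ P)) m s
    add m s with decAt m j
    ... | nothing = KRing.+-identityʳ _
    ... | just _ = ≈-refl

  PsiM-fn : ∀ {k P n} → N ≡ suc n → InD k P → fn (PsiM N P) ≐ Ψ (fn P)
  PsiM-fn {k} {P} {n} eqN ok = ≐-trans (raise-fn (rotate-InD (N ∸ 1) ok lt) lt) (X-cong (rotate-fn (N ∸ 1) ok lt))
    where
    lt : N ∸ 1 < N
    lt = subst (λ z → z ∸ 1 ℕ.< z) (sym eqN) (ℕₚ.n<1+n n)

  PsiM-InD : ∀ {k P n} → N ≡ suc n → InD k P → InD (suc k) (PsiM N P)
  PsiM-InD {k} {P} {n} eqN ok = Allₚ.map⁺ (All.map raised (rotate-InD (N ∸ 1) ok lt))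
    where
    lt : N ∸ 1 < N
    lt = subst (λ z → z ∸ 1 ℕ.< z) (sym eqN) (ℕₚ.n<1+n n)
    raised : ∀ {t} → InDeg k t → InDeg (suc k) (raise (N ∸ 1) t)
    raised {t} ok = inDeg (trans (length-incAt0 (expo t) (N ∸ 1)) (exp-len ok)) (trans (sum-incAt0 (expo t) (N ∸ 1) (subst (N ∸ 1 ℕ.<_) (sym (exp-len ok)) lt)) (cong suc (exp-sum ok))) (tab-ok ok)

-- Ranks of the entries of a composition, compared with `sigma` and `zeta`

labelAux : List ℕ → List ℕ → List Ent
labelAux pre [] = []
labelAux pre (x ∷ r) = (x , gec x pre + gtc x r) ∷ labelAux (x ∷ pre) r

label : List ℕ → List Ent
label = labelAux []

vals-labelAux : ∀ pre v → vals (labelAux pre v) ≡ v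
vals-labelAux pre [] = refl
vals-labelAux pre (x ∷ r) = cong (x ∷_) (vals-labelAux (x ∷ pre) r)

LabOK-labelAux : ∀ pre v → LabOK pre (labelAux pre v)
LabOK-labelAux pre [] = tt
LabOK-labelAux pre (x ∷ r) = cong (λ s → gec x pre + gtc x s) (sym (vals-labelAux (x ∷ pre) r)) , LabOK-labelAux (x ∷ pre) r

LabOK-unique : ∀ pre V → LabOK pre V → labelAux pre (vals V) ≡ V
LabOK-unique pre [] _ = refl
LabOK-unique pre ((x , q) ∷ V) (e , h) = cong₂ _∷_ (cong (x ,_) (sym e)) (LabOK-unique (x ∷ pre) V h)

label-vals : ∀ v → vals (label v) ≡ v
label-vals = vals-labelAux []

LabOK-label : ∀ v → LabOK [] (label v)
LabOK-label = LabOK-labelAux []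

length-label : ∀ v → length (label v) ≡ length v
length-label v = trans (sym (Listₚ.length-map proj₁ (label v))) (cong length (label-vals v))

total-label : ∀ v → total (label v) ≡ sum v
total-label v = cong sum (label-vals v)

LabOK-at : ∀ {pre} U {x q} R → LabOK pre (U ++ (x , q) ∷ R) → q ≡ (gec x pre + gec x (vals U)) + gtc x (vals R)
LabOK-at {pre} [] {x} R (e , _) = trans e (cong (ℕ._+ gtc x (vals R)) (sym (ℕₚ.+-identityʳ (gec x pre))))
LabOK-at {pre} ((y , _) ∷ U) {x} R (_ , h) = trans (LabOK-at U R h) (cong (ℕ._+ gtc x (vals R)) (trans (ℕₚ.+-assoc (ind (x ≤ᵇ y)) _ _) (exch (ind (x ≤ᵇ y)) (gec x pre) _)))

label-split : ∀ u x r → ∃[ U ] ∃[ q ] ∃[ R ] (label (u ++ x ∷ r) ≡ U ++ (x , q) ∷ R × vals U ≡ u × vals R ≡ r)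
label-split u x r = go (label (u ++ x ∷ r)) u (label-vals (u ++ x ∷ r))
  where
  go : ∀ V u → vals V ≡ u ++ x ∷ r → ∃[ U ] ∃[ q ] ∃[ R ] (V ≡ U ++ (x , q) ∷ R × vals U ≡ u × vals R ≡ r)
  go ((y , q) ∷ V) [] refl = [] , q , V , refl , refl , refl
  go (e ∷ V) (y ∷ u) h with go V u (Listₚ.∷-injectiveʳ h)
  ... | U , q , R , refl , refl , refl = e ∷ U , q , R , refl , cong (_∷ vals U) (Listₚ.∷-injectiveˡ h) , refl

label-split₂ : ∀ u y z r → ∃[ U ] ∃[ q ] ∃[ q' ] ∃[ R ] (label (u ++ y ∷ z ∷ r) ≡ U ++ (y , q) ∷ (z , q') ∷ R × vals U ≡ u × vals R ≡ r)
label-split₂ u y z r with label-split u y (z ∷ r)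
... | U , q , (z' , q') ∷ R , e , e' , refl = U , q , q' , R , e , e' , refl

label-LabOK : ∀ {V v} → LabOK [] V → vals V ≡ v → label v ≡ V
label-LabOK {V} h refl = LabOK-unique [] V h

label-swap : ∀ {u y z r U q q' R} → label (u ++ y ∷ z ∷ r) ≡ U ++ (y , q) ∷ (z , q') ∷ R → vals U ≡ u → vals R ≡ r → y ≢ z →
  label (u ++ z ∷ y ∷ r) ≡ U ++ (z , q') ∷ (y , q) ∷ R
label-swap {u} {y} {z} {r} {U} {q} {q'} {R} e refl refl ne =
  label-LabOK (LabOK-swap U R ne (subst (LabOK []) e (LabOK-label (u ++ y ∷ z ∷ r)))) (vals-++ U _)

label-Ψ : ∀ x w → ∃[ q ] ∃[ W ] (label (x ∷ w) ≡ (x , q) ∷ W × label (w ++ suc x ∷ []) ≡ W ++ (suc x , q) ∷ [])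
label-Ψ x w with label-split w (suc x) []
... | W , q , [] , e , refl , refl = q , W , label-LabOK (LabOK-unΨ W (subst (LabOK []) e (LabOK-label (w ++ suc x ∷ [])))) refl , e

length-filter-gt : ∀ x v → length (filterᵇ (λ y → x <ᵇ y) v) ≡ gtc x v
length-filter-gt x [] = refl
length-filter-gt x (y ∷ v) with x <ᵇ y
... | true = cong suc (length-filter-gt x v)
... | false = length-filter-gt x v

gec-gtc-count : ∀ x u → gec x u ≡ gtc x u + count x u
gec-gtc-count x [] = refl
gec-gtc-count x (y ∷ u) = trans (cong₂ _+_ (one x y) (gec-gtc-count x u)) (trans (arith (ind (x <ᵇ y)) (count x (y ∷ [])) (gtc x u) (count x u)) (cong (ind (x <ᵇ y) + gtc x u ℕ.+_) (sym (count-∷ x y u))))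
  where
  arith : ∀ a b c d → (a + b) + (c + d) ≡ (a + c) + (b + d)
  arith = solve-∀
  one : ∀ x y → ind (x ≤ᵇ y) ≡ ind (x <ᵇ y) + count x (y ∷ [])
  one x y with ℕₚ.<-cmp x y
  ... | tri< lt ne _ rewrite ≤ᵇ-true (ℕₚ.<⇒≤ lt) | <ᵇ-true lt | ≡ᵇ-≢ ne = refl
  ... | tri≈ _ refl _ rewrite ≤ᵇ-true (ℕₚ.≤-refl {x}) | <ᵇ-false (ℕₚ.≤-refl {x}) | ≡ᵇ-refl x = refl
  ... | tri> _ ne gt rewrite ≤ᵇ-false gt | <ᵇ-false (ℕₚ.<⇒≤ gt) | ≡ᵇ-≢ ne = refl

take-length : ∀ {A : Set} (u r : List A) → take (length u) (u ++ r) ≡ u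
take-length [] r = refl
take-length (x ∷ u) r = cong (x ∷_) (take-length u r)

sigma-label : ∀ {v U x q R} → label v ≡ U ++ (x , q) ∷ R → sigma v (suc (length U)) ≡ suc q
sigma-label {v} {U} {x} {q} {R} e = cong suc (trans (cong₂ _+_
    (trans (cong (λ a → length (filterᵇ (λ y → a <ᵇ y) v)) at≡) (trans (length-filter-gt x v) (trans (cong (gtc x) v≡) (trans (gtc-++ x (vals U) _) (cong (λ b → gtc x (vals U) + (ind b + gtc x (vals R))) (<ᵇ-false (ℕₚ.≤-refl {x})))))))
    (cong₂ count at≡ (trans (cong (take (length U)) v≡) (trans (cong (λ n → take n (vals U ++ x ∷ vals R)) len≡) (take-length (vals U) _)))))
  (trans (arith (gtc x (vals U)) (gtc x (vals R)) (count x (vals U))) (sym (trans (LabOK-at U R (subst (LabOK []) e (LabOK-label v))) (cong (ℕ._+ gtc x (vals R)) (gec-gtc-count x (vals U)))))))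
  where
  arith : ∀ a b c → (a + b) + c ≡ (a + c) + b
  arith = solve-∀
  v≡ : v ≡ vals U ++ x ∷ vals R
  v≡ = trans (sym (label-vals v)) (trans (cong vals e) (vals-++ U _))
  len≡ : length U ≡ length (vals U)
  len≡ = sym (Listₚ.length-map proj₁ U)
  at≡ : idx0 v (length U) ≡ x
  at≡ = trans (cong₂ idx0 v≡ len≡) (idx0-mid (vals U) x (vals R))

at-label : ∀ {v U x q R} → label v ≡ U ++ (x , q) ∷ R → at v (suc (length U)) ≡ x
at-label {v} {U} {x} {q} {R} e = trans (cong₂ idx0 (trans (sym (label-vals v)) (trans (cong vals e) (vals-++ U _))) (sym (Listₚ.length-map proj₁ U))) (idx0-mid (vals U) x (vals R))

label-range : ∀ {v U x q R} → label v ≡ U ++ (x , q) ∷ R → q < length v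
label-range {v} {U} {x} {q} {R} e = subst (q ℕ.<_) (cong length (label-vals v))
  (ℕₚ.≤-trans (proj₂ (All.lookup (LabOK-range (label v) (LabOK-label v)) (subst ((x , q) ∈_) (sym e) (Memₚ.∈-++⁺ʳ U (here refl))))) (gec≤length x (vals (label v))))

shift-label : ∀ {v U e e' R} → label v ≡ U ++ e ∷ e' ∷ R → label v ≡ (U ++ e ∷ []) ++ e' ∷ R
shift-label {U = U} {e} h = trans h (sym (Listₚ.++-assoc U (e ∷ []) _))

length-∷ʳ : ∀ {A : Set} (U : List A) e → length (U ++ e ∷ []) ≡ suc (length U)
length-∷ʳ U e = trans (Listₚ.length-++ U) (ℕₚ.+-comm (length U) 1)

CT-label : ∀ w q → q < length w → CT w (suc q) ≡ ct (reverse w) q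
CT-label w q lt = trans (cong (λ z → CT z (suc q)) (sym (Listₚ.reverse-involutive w))) (CT-reverse (reverse w) q (subst (q ℕ.<_) (sym (Listₚ.length-reverse w)) lt))

zeta-label : ∀ {w v U x q R} → length w ≡ length v → label v ≡ U ++ (x , q) ∷ R → zeta w v (suc (length U)) ≡ zE (reverse w) (x , q)
zeta-label {w} {v} {U} {x} {q} {R} l e = trans (⊕-def (αK *K fromℕ (at v (suc (length U)))) (fromℤ (CT w (sigma v (suc (length U)))))) (cong₂ _⊕_
    (trans (⊛-def αK (fromℕ (at v (suc (length U))))) (cong₂ _⊛_ αf-def (trans (cong fromℕ (at-label e)) (fromZ-def (ℤ.+ x)))))
    (trans (cong fromℤ (trans (cong (CT w) (sigma-label e)) (CT-label w q (subst (q ℕ.<_) (sym l) (label-range {U = U} e))))) (fromZ-def (ct (reverse w) q))))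

zeta-label′ : ∀ {w v U e x q R} → length w ≡ length v → label v ≡ U ++ e ∷ (x , q) ∷ R → zeta w v (suc (suc (length U))) ≡ zE (reverse w) (x , q)
zeta-label′ {w} {v} {U} {e} l h = trans (cong (zeta w v ∘ suc) (sym (length-∷ʳ U e))) (zeta-label {w} {v} {U ++ e ∷ []} l (shift-label h))

at-label′ : ∀ {v U e x q R} → label v ≡ U ++ e ∷ (x , q) ∷ R → at v (suc (suc (length U))) ≡ x
at-label′ {v} {U} {e} h = trans (cong (idx0 v) (sym (length-∷ʳ U e))) (at-label {v} {U ++ e ∷ []} (shift-label h))

gap-def : ∀ x y → invK (x -K y) ≡ inv (x ⊖ᶠ y)
gap-def x y = trans (inv-def (x -K y)) (cong inv (trans (⊕-def x (-K y)) (cong (x ⊕_) (⊝-def y))))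

≤ᵇ⇒≤ℤ : ∀ d → (ℤ.+ 2 ℤ.≤ᵇ d) ≡ true → ∃[ k ] d ≡ ℤ.+ suc (suc k)
≤ᵇ⇒≤ℤ (ℤ.+ suc (suc k)) e = k , refl
≤ᵇ⇒≤ℤ (ℤ.+ zero) ()
≤ᵇ⇒≤ℤ (ℤ.+ suc zero) ()

-- The edges computed by `edge` as intertwining relations

module Edges (lam : List ℕ) where
  open Bridge lam public

  Ĵ : List ℕ → List ℕ → Fun
  Ĵ w v = J (sum v) (reverse w) (label v)

  wf-label : ∀ {v} → length v ≡ N → WF (label v)
  wf-label {v} l = wf (trans (length-label v) l) (LabOK-label v)

  Ĵ-Ψ : ∀ w v → length v ≡ N → ∀ {n} → N ≡ suc n → Ĵ w (vPsi v) ≡ Ψ (Ĵ w v)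
  Ĵ-Ψ w [] l eqN = ⊥-elim (ℕₚ.0≢1+n (trans l eqN))
  Ĵ-Ψ w (x ∷ v) l eqN with label-Ψ x v
  ... | q , W , e , e' = trans (cong₂ (λ k V → J k (reverse w) V) s≡ e') (trans (J-Ψ (x + sum v) (reverse w) W x q) (cong (λ V → Ψ (J (x + sum v) (reverse w) V)) (sym e)))
    where
    s≡ : sum (v ++ suc x ∷ []) ≡ suc (x + sum v)
    s≡ = trans (sum-++ v (suc x ∷ [])) (trans (ℕₚ.+-comm (sum v) _) (cong (λ z → suc z + sum v) (ℕₚ.+-identityʳ x)))

  target-of : ∀ {t q} → Valid lam t → suc q < N → ∀ {k} → dd q t ≡ ℤ.+ suc (suc k) → Target t q (just (swap0 t q))
  target-of {t} {q} v lt {k} e with place {p = q} v (subst (suc q ℕ.<_) (sym (size v)) lt)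
  ... | same-row d = ⊥-elim (contr (trans (sym d) e))
    where
    contr : ℤ.+ 1 ≢ ℤ.+ suc (suc k)
    contr ()
  ... | same-col d = ⊥-elim (contr (trans (sym d) e))
    where
    contr : -[1+ 0 ] ≢ ℤ.+ suc (suc k)
    contr ()
  ... | exchange j _ v' c c' = flip k lt e v' c c'

  record Good (k : ℕ) (key : Key) : Set where
    constructor good
    field
      word-ok : Valid lam (reverse (proj₁ key))
      comp-len : length (proj₂ key) ≡ N
      comp-sum : sum (proj₂ key) ≡ k
  open Good public

  word-len : ∀ {k w v} → Good k (w , v) → length w ≡ length v
  word-len {k} {w} g = trans (sym (Listₚ.length-reverse w)) (trans (size (word-ok g)) (sym (comp-len g)))

  data EdgeView (w v : List ℕ) (p : ℕ) : Set where
    rises : ∀ u y z r → v ≡ u ++ y ∷ z ∷ r → length u ≡ p → y < z → edge (w , v) (suc p) ≡ just (w , u ++ z ∷ y ∷ r) → EdgeView w v p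
    flips : ∀ u y r q → v ≡ u ++ y ∷ y ∷ r → length u ≡ p → ∃[ U ] ∃[ R ] (label v ≡ U ++ (y , q) ∷ (y , suc q) ∷ R × vals U ≡ u × vals R ≡ r) → suc q < N →
            (∃[ k ] dd q (reverse w) ≡ ℤ.+ suc (suc k)) → edge (w , v) (suc p) ≡ just (reverse (swap0 (reverse w) q) , v) → EdgeView w v p
    none  : edge (w , v) (suc p) ≡ nothing → EdgeView w v p

  dd-label : ∀ w q → suc q < length w → CT w (suc q) ℤ.- CT w (suc (suc q)) ≡ dd q (reverse w)
  dd-label w q lt = cong₂ ℤ._-_ (CT-label w q (ℕₚ.<-trans (ℕₚ.n<1+n q) lt)) (CT-label w (suc q) lt)

  swapEntries-label : ∀ w q → suc q < length w → swapEntries w (suc q) ≡ reverse (swap0 (reverse w) q)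
  swapEntries-label w q lt = trans (cong (λ z → swapEntries z (suc q)) (sym (Listₚ.reverse-involutive w))) (swapEntries-reverse (reverse w) q (subst (suc q ℕ.<_) (sym (Listₚ.length-reverse w)) lt))

  label-tie : ∀ {v U y q q' R} → label v ≡ U ++ (y , q) ∷ (y , q') ∷ R → q' ≡ suc q
  label-tie {v} {U} {R = R} e with LabOK-drop U (subst (LabOK []) e (LabOK-label v))
  ... | _ , h = LabOK-equal R h

  edgeView : ∀ {k} w v p → Good k (w , v) → suc p < N → EdgeView w v p
  edgeView w v p g lt with split₂ v p (subst (suc p ℕ.<_) (sym (comp-len g)) lt)
  ... | u , y , z , r , refl , refl with label-split₂ u y z r
  ... | U , q , q' , R , e , refl , refl = go (ℕₚ.<-cmp y z)
    where
    V : List ℕ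
    V = vals U ++ y ∷ z ∷ vals R
    a₁ : at V (suc (length (vals U))) ≡ y
    a₁ = idx0-mid (vals U) y (z ∷ vals R)
    a₂ : at V (suc (suc (length (vals U)))) ≡ z
    a₂ = trans (cong (λ n → at V (suc (suc n))) (Listₚ.length-map proj₁ U)) (at-label′ e)
    σ₁ : sigma V (suc (length (vals U))) ≡ suc q
    σ₁ = trans (cong (sigma V ∘ suc) (Listₚ.length-map proj₁ U)) (sigma-label e)
    gen : ℕ → ℕ → ℕ → Maybe Key
    gen a b s = if (a <ᵇ b) then just (w , swapV V (suc (length (vals U)))) else if (a ≡ᵇ b) ∧ (ℤ.+ 2 ℤ.≤ᵇ (CT w s ℤ.- CT w (suc s))) then just (swapEntries w s , V) else nothing
    edge≡ : edge (w , V) (suc (length (vals U))) ≡ gen y z (suc q)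
    edge≡ = trans (cong₂ (λ a b → gen a b (sigma V (suc (length (vals U))))) a₁ a₂) (cong (gen y z) σ₁)
    go : Tri (y < z) (y ≡ z) (z < y) → EdgeView w V (length (vals U))
    go (tri< y<z _ _) = rises (vals U) y z (vals R) refl refl y<z (trans edge≡ (trans (if-true (<ᵇ-true y<z)) (cong (λ s → just (w , s)) (swap0-split (vals U) y z (vals R)))))
    go (tri> _ ne z<y) = none (trans edge≡ (trans (if-false (<ᵇ-false (ℕₚ.<⇒≤ z<y))) (if-false (cong (λ b → b ∧ (ℤ.+ 2 ℤ.≤ᵇ (CT w (suc q) ℤ.- CT w (suc (suc q))))) (≡ᵇ-≢ ne)))))
    go (tri≈ _ refl _) = tie' (ℤ.+ 2 ℤ.≤ᵇ dd q (reverse w)) refl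
      where
      q'≡ : q' ≡ suc q
      q'≡ = label-tie {U = U} e
      sq : suc q < length V
      sq = subst (ℕ._< length V) q'≡ (label-range {U = U ++ (y , q) ∷ []} (shift-label {U = U} e))
      sq' : suc q < length w
      sq' = subst (suc q ℕ.<_) (sym (word-len g)) sq
      edge₂ : edge (w , V) (suc (length (vals U))) ≡ (if ℤ.+ 2 ℤ.≤ᵇ dd q (reverse w) then just (reverse (swap0 (reverse w) q) , V) else nothing)
      edge₂ = trans edge≡ (trans (if-false (<ᵇ-false (ℕₚ.≤-refl {y}))) (trans (cong (λ b → if b ∧ (ℤ.+ 2 ℤ.≤ᵇ (CT w (suc q) ℤ.- CT w (suc (suc q)))) then just (swapEntries w (suc q) , V) else nothing) (≡ᵇ-refl y))
        (cong₂ (λ d s → if ℤ.+ 2 ℤ.≤ᵇ d then just (s , V) else nothing) (dd-label w q sq') (swapEntries-label w q sq'))))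
      tie' : ∀ b → (ℤ.+ 2 ℤ.≤ᵇ dd q (reverse w)) ≡ b → EdgeView w V (length (vals U))
      tie' true h = flips (vals U) y (vals R) q refl refl (U , R , trans e (cong (λ s → U ++ (y , q) ∷ (y , s) ∷ R) q'≡) , refl , refl) (subst (suc q ℕ.<_) (comp-len g) sq) (≤ᵇ⇒≤ℤ _ h) (trans edge₂ (if-true h))
      tie' false h = none (trans edge₂ (if-false h))

  opaque
    gapAt : List ℕ → List ℕ → ℕ → K
    gapAt w v i = invK (zeta w v (suc i) -K zeta w v i)

    gapAt-def : ∀ w v i → invK (zeta w v (suc i) -K zeta w v i) ≡ gapAt w v i
    gapAt-def w v i = refl

    Jstep-def : ∀ u i → Jstep u i ≡ actS i (vJ u) ++ scaleM (gapAt (vw u) (vv u) i) (vJ u)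
    Jstep-def u i = refl

  gapAt-label : ∀ {w v U x q y q' R} → length w ≡ length v → label v ≡ U ++ (x , q) ∷ (y , q') ∷ R →
    gapAt w v (suc (length U)) ≡ gapK (zE (reverse w) (x , q)) (zE (reverse w) (y , q'))
  gapAt-label {w} {v} {U} l e = trans (sym (gapAt-def w v (suc (length U)))) (trans (gap-def (zeta w v (suc (suc (length U)))) (zeta w v (suc (length U))))
    (cong₂ (λ a b → inv (a ⊖ᶠ b)) (zeta-label′ {w} l e) (zeta-label {w} l e)))

  Ĵ-rise : ∀ {k w} u y z r → Good k (w , u ++ y ∷ z ∷ r) → y < z →
    S (length u) (gapAt w (u ++ y ∷ z ∷ r) (suc (length u))) (Ĵ w (u ++ y ∷ z ∷ r)) ≐ Ĵ w (u ++ z ∷ y ∷ r)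
  Ĵ-rise {k} {w} u y z r g y<z with label-split₂ u y z r
  ... | U , q , q' , R , e , refl , refl =
    ≐-trans (≡⇒≐ (trans (cong₂ (λ n c → S n c (Ĵ w v)) (Listₚ.length-map proj₁ U) gap≡) (cong (λ V → S (length U) (gapK (zE t (y , q)) (zE t (z , q'))) (J (sum v) t V)) e)))
    (≐-trans (intertwine (sum v) t U (y , q) (z , q') R (wf-subst e (wf-label (comp-len g))) (trans (cong total (sym e)) (total-label v)) (up y<z))
    (≡⇒≐ (cong₂ (λ k V → J k t V) sum≡ (sym (label-swap {U = U} e refl refl (ℕₚ.<⇒≢ y<z))))))
    where
    v : List ℕ
    v = vals U ++ y ∷ z ∷ vals R
    t : List ℕ
    t = reverse w
    gap≡ : gapAt w v (suc (length (vals U))) ≡ gapK (zE t (y , q)) (zE t (z , q'))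
    gap≡ = trans (cong (λ n → gapAt w v (suc n)) (Listₚ.length-map proj₁ U)) (gapAt-label {w} {v} {U} (word-len g) e)
    sum≡ : sum v ≡ sum (vals U ++ z ∷ y ∷ vals R)
    sum≡ = trans (sum-++ (vals U) _) (trans (cong (sum (vals U) ℕ.+_) (exch y z (sum (vals R)))) (sym (sum-++ (vals U) _)))

  Ĵ-tie : ∀ {k w} u y r q {T} → Good k (w , u ++ y ∷ y ∷ r) → (∃[ U ] ∃[ R ] (label (u ++ y ∷ y ∷ r) ≡ U ++ (y , q) ∷ (y , suc q) ∷ R × vals U ≡ u × vals R ≡ r)) →
    Target (reverse w) q T → S (length u) (gapAt w (u ++ y ∷ y ∷ r) (suc (length u))) (Ĵ w (u ++ y ∷ y ∷ r)) ≐ J? (sum (u ++ y ∷ y ∷ r)) T (label (u ++ y ∷ y ∷ r))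
  Ĵ-tie {k} {w} _ y _ q {T} g (U , R , e , refl , refl) tg =
    ≐-trans (≡⇒≐ (trans (cong₂ (λ n c → S n c (Ĵ w v)) (Listₚ.length-map proj₁ U) gap≡) (cong (λ V → S (length U) (gapK (zE t (y , q)) (zE t (y , suc q))) (J (sum v) t V)) e)))
    (≐-trans (intertwine (sum v) t U (y , q) (y , suc q) R (wf-subst e (wf-label (comp-len g))) (trans (cong total (sym e)) (total-label v)) (tie tg))
    (J?-cong (sum v) T (sym e)))
    where
    v : List ℕ
    v = vals U ++ y ∷ y ∷ vals R
    t : List ℕ
    t = reverse w
    gap≡ : gapAt w v (suc (length (vals U))) ≡ gapK (zE t (y , q)) (zE t (y , suc q))
    gap≡ = trans (cong (λ n → gapAt w v (suc n)) (Listₚ.length-map proj₁ U)) (gapAt-label {w} {v} {U} (word-len g) e)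

  edge-sound : ∀ {k w v p key} → Good k (w , v) → suc p < N → edge (w , v) (suc p) ≡ just key →
    Good k key × S p (gapAt w v (suc p)) (Ĵ w v) ≐ Ĵ (proj₁ key) (proj₂ key)
  edge-sound {k} {w} {v} {p} g lt h with edgeView w v p g lt
  ... | none e with trans (sym e) h
  ...   | ()
  edge-sound {k} {w} {v} {p} g lt h | rises u y z r refl refl y<z e with trans (sym e) h
  ... | refl = good (word-ok g) (trans (trans (Listₚ.length-++ u) (sym (Listₚ.length-++ u))) (comp-len g)) (trans (sum-swap u z y r) (comp-sum g)) , Ĵ-rise u y z r g y<z
    where
    sum-swap : ∀ u y z r → sum (u ++ y ∷ z ∷ r) ≡ sum (u ++ z ∷ y ∷ r)
    sum-swap u y z r = trans (sum-++ u _) (trans (cong (sum u ℕ.+_) (exch y z (sum r))) (sym (sum-++ u _)))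
  edge-sound {k} {w} {v} {p} g lt h | flips u y r q refl refl lab sq (j , d) e with trans (sym e) h
  ... | refl with target-of (word-ok g) sq d
  ... | tg@(flip _ _ _ v' _ _) = good (subst (Valid lam) (sym rr) v') (comp-len g) (comp-sum g) ,
      ≐-trans (Ĵ-tie u y r q g lab tg) (≡⇒≐ (cong (λ t → J (sum (u ++ y ∷ y ∷ r)) t (label (u ++ y ∷ y ∷ r))) (sym rr)))
    where
    rr : reverse (reverse (swap0 (reverse w) q)) ≡ swap0 (reverse w) q
    rr = Listₚ.reverse-involutive _

-- Correctness of the search for vertices

eqKey⇒≡ : ∀ {k k' : Key} → eqKey k k' ≡ true → k ≡ k'
eqKey⇒≡ {w , v} {w' , v'} e with ∧-true {eqL w w'} e
... | e₁ , e₂ = cong₂ _,_ (eqL⇒≡ {w} e₁) (eqL⇒≡ {v} e₂)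

eqKey-refl : ∀ k → eqKey k k ≡ true
eqKey-refl (w , v) = cong₂ _∧_ (eqL-refl w) (eqL-refl v)

HasKey : Key → List Vtx → Set
HasKey k = Any (λ u → vkey u ≡ k)

memKey-true : ∀ k vs → memKey k vs ≡ true → HasKey k vs
memKey-true k (u ∷ vs) e with ∨-true {eqKey (vkey u) k} e
... | inj₁ h = here (eqKey⇒≡ {vkey u} h)
... | inj₂ h = there (memKey-true k vs h)

memKey-false : ∀ k vs → memKey k vs ≡ false → All (λ u → vkey u ≢ k) vs
memKey-false k [] e = []
memKey-false k (u ∷ vs) e with eqKey (vkey u) k in h
... | false = (λ { refl → contr (trans (sym h) (eqKey-refl (vkey u))) }) ∷ memKey-false k vs e
  where
  contr : false ≢ true
  contr ()

DistinctKeys : List Vtx → Set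
DistinctKeys = AllPairs (λ u u' → vkey u ≢ vkey u')

AllPairs-snoc : ∀ {A : Set} {R : A → A → Set} {xs x} → AllPairs R xs → All (λ y → R y x) xs → AllPairs R (xs ++ x ∷ [])
AllPairs-snoc [] [] = [] ∷ []
AllPairs-snoc (h ∷ hs) (r ∷ rs) = Allₚ.++⁺ h (r ∷ []) ∷ AllPairs-snoc hs rs

Extends : List Vtx → List Vtx → Set
Extends vs vs' = ∃[ ex ] vs' ≡ vs ++ ex

extends-refl : ∀ {vs} → Extends vs vs
extends-refl = [] , sym (Listₚ.++-identityʳ _)

extends-trans : ∀ {a b c} → Extends a b → Extends b c → Extends a c
extends-trans {a} (x , refl) (y , refl) = x ++ y , Listₚ.++-assoc a x y

extends-HasKey : ∀ {k vs vs'} → Extends vs vs' → HasKey k vs → HasKey k vs'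
extends-HasKey (x , refl) h = Anyₚ.++⁺ˡ h

tryAdd-nothing : ∀ u ac i → edge (vkey u) i ≡ nothing → tryAdd u ac i ≡ ac
tryAdd-nothing u ac i e with edge (vkey u) i
tryAdd-nothing u ac i refl | nothing = refl

-- a record, so that the large normal form of Jstep u i stays out of the types
record IsJstep (u : Vtx) (i : ℕ) (P : M) : Set where
  constructor isJstep
  field Jstep-eq : P ≡ Jstep u i
open IsJstep public

tryAdd-just : ∀ u ac i {k} → edge (vkey u) i ≡ just k → ∃[ P ] (IsJstep u i P × tryAdd u ac i ≡ (if memKey k ac then ac else ac ++ (vtx k P ∷ [])))
tryAdd-just u ac i e with edge (vkey u) i
tryAdd-just u ac i refl | just k = Jstep u i , isJstep refl , refl

∈-oneTo : ∀ {n i} → i ∈ oneTo n → ∃[ p ] (i ≡ suc p × p < n)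
∈-oneTo {n} m with Memₚ.∈-map⁻ suc m
... | p , pm , e = p , e , Memₚ.∈-upTo⁻ pm

oneTo-∈ : ∀ {n p} → p < n → suc p ∈ oneTo n
oneTo-∈ lt = Memₚ.∈-map⁺ suc (Memₚ.∈-upTo⁺ lt)

unique-length : ∀ {A : Set} {xs : List A} (ys : List A) → AllPairs _≢_ xs → (∀ {x} → x ∈ xs → x ∈ ys) → length xs ≤ length ys
unique-length {xs = []} ys u h = z≤n
unique-length {xs = x ∷ xs} ys (ne ∷ u) h with Memₚ.∈-∃++ (h (here refl))
... | as , bs , refl = ℕₚ.≤-trans (s≤s (unique-length (as ++ bs) u sub)) (ℕₚ.≤-reflexive (trans (cong suc (Listₚ.length-++ as)) (trans (sym (ℕₚ.+-suc (length as) (length bs))) (sym (Listₚ.length-++ as)))))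
  where
  sub : ∀ {y} → y ∈ xs → y ∈ as ++ bs
  sub {y} m with Memₚ.∈-++⁻ as (h (there m))
  ... | inj₁ a = Memₚ.∈-++⁺ˡ a
  ... | inj₂ (here refl) = ⊥-elim (All.lookup ne m refl)
  ... | inj₂ (there b) = Memₚ.∈-++⁺ʳ as b

N<pow : ∀ k n → n < suc (suc k) ^ n
N<pow k zero = s≤s z≤n
N<pow k (suc n) = ℕₚ.≤-trans (s≤s (N<pow k n)) (ℕₚ.≤-trans (ℕₚ.+-monoˡ-≤ (suc (suc k) ^ n) (ℕₚ.≤-trans (s≤s z≤n) (N<pow k n))) (ℕₚ.+-monoʳ-≤ (suc (suc k) ^ n) (ℕₚ.m≤m+n (suc (suc k) ^ n) _)))

module Search (lam : List ℕ) where
  open Edges lam public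

  record VOK (k : ℕ) (u : Vtx) : Set where
    constructor vok
    field
      key-ok : Good k (vkey u)
      J-in   : InD k (vJ u)
      J-fn   : fn (vJ u) ≐ Ĵ (vw u) (vv u)
  open VOK public

  Jstep-ok : ∀ {k u p key P} → VOK k u → suc p < N → edge (vkey u) (suc p) ≡ just key → IsJstep u (suc p) P → VOK k (vtx key P)
  Jstep-ok {k} {u} {p} {key} {P} ok lt h isj = vok (proj₁ es) (subst (InD k) (sym P≡) (Allₚ.++⁺ (actS-InD (J-in ok) lt) (scaleM-InD c (J-in ok))))
    (≐-trans (≡⇒≐ (cong fn P≡)) (≐-trans (fn-++ (actS (suc p) (vJ u)) (scaleM c (vJ u))) (≐-trans (⊞-cong (≐-trans (actS-fn (InD⇒Tabs (J-in ok)) lt) (T-cong lt (J-fn ok)))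
       (≐-trans (fn-scaleM c (vJ u)) (·-cong ≈-refl (J-fn ok)))) (proj₂ es))))
    where
    es : Good k key × S p (gapAt (vw u) (vv u) (suc p)) (Ĵ (vw u) (vv u)) ≐ Ĵ (proj₁ key) (proj₂ key)
    es = edge-sound {v = vv u} (key-ok ok) lt h
    c : K
    c = gapAt (vw u) (vv u) (suc p)
    P≡ : P ≡ actS (suc p) (vJ u) ++ scaleM c (vJ u)
    P≡ = trans (Jstep-eq isj) (Jstep-def u (suc p))

  record LOK (k : ℕ) (vs : List Vtx) : Set where
    constructor lok
    field
      all-ok   : All (VOK k) vs
      distinct : DistinctKeys vs
  open LOK public

  record Progress (k : ℕ) (ac ac' : List Vtx) (E : Key → Set) : Set where
    constructor progress
    field
      p-ok  : LOK k ac'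
      p-ext : Extends ac ac'
      p-has : ∀ {key} → E key → HasKey key ac'
  open Progress public

  tryAdd-ok : ∀ {k u ac p} → VOK k u → suc p < N → LOK k ac → Progress k ac (tryAdd u ac (suc p)) (λ key → edge (vkey u) (suc p) ≡ just key)
  tryAdd-ok {k} {u} {ac} {p} ok lt a = go (edge (vkey u) (suc p)) refl
    where
    Goal : List Vtx → Set
    Goal ac' = Progress k ac ac' (λ key → edge (vkey u) (suc p) ≡ just key)
    just-inj : ∀ {A : Set} {x y : A} → just x ≡ just y → x ≡ y
    just-inj refl = refl
    go : ∀ e → edge (vkey u) (suc p) ≡ e → Goal (tryAdd u ac (suc p))
    go nothing e = subst Goal (sym (tryAdd-nothing u ac (suc p) e)) (progress a extends-refl (λ h → contr (trans (sym e) h)))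
      where
      contr : ∀ {A : Set} {x : A} {P : Set} → nothing ≡ just x → P
      contr ()
    go (just key) e = let (P , isj , eq) = tryAdd-just u ac (suc p) e in subst Goal (sym eq) (mem P isj (memKey key ac) refl)
      where
      mem : ∀ P → IsJstep u (suc p) P → ∀ b → memKey key ac ≡ b → Goal (if memKey key ac then ac else ac ++ (vtx key P ∷ []))
      mem P isj true m = subst Goal (sym (if-true m)) (progress a extends-refl (λ h → subst (λ z → HasKey z ac) (just-inj (trans (sym e) h)) (memKey-true key ac m)))
      mem P isj false m = subst Goal (sym (if-false m)) (progress
        (lok (Allₚ.++⁺ (all-ok a) (Jstep-ok ok lt e isj ∷ [])) (AllPairs-snoc (distinct a) (memKey-false key ac m)))
        (_ , refl) (λ h → Anyₚ.++⁺ʳ ac (here (just-inj (trans (sym e) h)))))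

  tryAll-ok : ∀ {k u ac} is → (∀ {i} → i ∈ is → ∃[ p ] (i ≡ suc p × suc p < N)) → VOK k u → LOK k ac →
    Progress k ac (foldl (tryAdd u) ac is) (λ key → ∃[ i ] (i ∈ is × edge (vkey u) i ≡ just key))
  tryAll-ok [] h ok a = progress a extends-refl (λ { (_ , () , _) })
  tryAll-ok {k} {u} {ac} (i ∷ is) h ok a with h (here refl)
  ... | p , refl , lt with tryAdd-ok ok lt a
  ... | pr with tryAll-ok is (h ∘ there) ok (p-ok pr)
  ... | pr' = progress (p-ok pr') (extends-trans (p-ext pr) (p-ext pr')) λ
        { (_ , here refl , e) → extends-HasKey (p-ext pr') (p-has pr e) ; (j , there m , e) → p-has pr' (j , m , e) }

  steps : List ℕ
  steps = oneTo (N ∸ 1)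

  steps-< : ∀ {i} → i ∈ steps → ∃[ p ] (i ≡ suc p × suc p < N)
  steps-< {i} m with ∈-oneTo m
  ... | p , e , lt = p , e , lem N lt
    where
    lem : ∀ n → p < n ∸ 1 → suc p < n
    lem (suc n) h = s≤s h

  <-steps : ∀ {p} → suc p < N → suc p ∈ steps
  <-steps {p} lt = oneTo-∈ (lem N lt)
    where
    lem : ∀ n → suc p < n → p < n ∸ 1
    lem (suc n) (s≤s h) = h

  OutOf : List Vtx → Key → Set
  OutOf us key' = ∃[ u ] ∃[ i ] (u ∈ us × i ∈ steps × edge (vkey u) i ≡ just key')

  round-ok : ∀ {k ac} us → All (VOK k) us → LOK k ac →
    Progress k ac (foldl (λ ac u → foldl (tryAdd u) ac steps) ac us) (OutOf us)
  round-ok [] [] a = progress a extends-refl (λ { (_ , _ , () , _) })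
  round-ok {k} {ac} (u ∷ us) (ok ∷ oks) a with tryAll-ok steps steps-< ok a
  ... | pr with round-ok us oks (p-ok pr)
  ... | pr' = progress (p-ok pr') (extends-trans (p-ext pr) (p-ext pr')) λ
        { (_ , i , here refl , m , e) → extends-HasKey (p-ext pr') (p-has pr (i , m , e)) ; (u' , i , there um , m , e) → p-has pr' (u' , i , um , m , e) }

  closeRound-ok : ∀ {k vs} → LOK k vs → Progress k vs (closeRound N vs) (OutOf vs)
  closeRound-ok {vs = vs} a = round-ok vs (all-ok a) a

  closeFuel-ok : ∀ {k vs} n → LOK k vs → LOK k (closeFuel N n vs) × Extends vs (closeFuel N n vs)
  closeFuel-ok zero a = a , extends-refl
  closeFuel-ok (suc n) a with closeRound-ok a
  ... | pr with closeFuel-ok n (p-ok pr)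
  ... | a' , ext = a' , extends-trans (p-ext pr) ext

  Closed : List Vtx → Set
  Closed vs = ∀ {key} → OutOf vs key → HasKey key vs

  closeFuel-fix : ∀ n {vs} → closeRound N vs ≡ vs → closeFuel N n vs ≡ vs
  closeFuel-fix zero e = refl
  closeFuel-fix (suc n) e = trans (cong (closeFuel N n) e) (closeFuel-fix n e)

  -- A round that adds nothing certifies closure and is repeated without change; any other round
  -- adds at least one vertex. The second alternative is refuted later by counting the possible
  -- vertices.
  closeFuel-closed : ∀ {k vs} n → LOK k vs → Closed (closeFuel N n vs) ⊎ n + length vs ≤ length (closeFuel N n vs)
  closeFuel-closed zero a = inj₂ ℕₚ.≤-refl
  closeFuel-closed {k} {vs} (suc n) a with closeRound-ok a
  ... | pr with p-ext pr
  ... | [] , e = inj₁ (subst Closed (sym (closeFuel-fix (suc n) e')) (λ {key} o → subst (HasKey key) e' (p-has pr o)))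
    where
    e' : closeRound N vs ≡ vs
    e' = trans e (Listₚ.++-identityʳ vs)
  ... | x ∷ xs , e with closeFuel-closed n (p-ok pr)
  ... | inj₁ c = inj₁ c
  ... | inj₂ le = inj₂ (ℕₚ.≤-trans (ℕₚ.≤-trans (ℕₚ.≤-reflexive (sym (ℕₚ.+-suc n (length vs)))) (ℕₚ.+-monoʳ-≤ n grow)) le)
    where
    grow : suc (length vs) ≤ length (closeRound N vs)
    grow = subst (suc (length vs) ℕ.≤_) (sym (trans (cong length e) (trans (Listₚ.length-++ vs) (ℕₚ.+-suc (length vs) (length xs))))) (s≤s (ℕₚ.m≤m+n _ _))

  data Path : ℕ → Key → Key → Set where
    done : ∀ {key} → Path 0 key key
    step : ∀ {n key key' key'' p} → suc p < N → edge key (suc p) ≡ just key' → Path n key' key'' → Path (suc n) key key''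

  path-snoc : ∀ {n a b c p} → Path n a b → suc p < N → edge b (suc p) ≡ just c → Path (suc n) a c
  path-snoc done lt e = step lt e done
  path-snoc (step lt' e' p) lt e = step lt' e' (path-snoc p lt e)

  -- Each round follows all edges once, so a path of length `m` is covered by `m` rounds. In
  -- positive degree the vertices needed lie at the end of short explicit paths, and no count of all
  -- vertices is required.
  closeFuel-path : ∀ {k vs} n m {a b} → LOK k vs → m ≤ n → Path m a b → HasKey a vs → HasKey b (closeFuel N n vs)
  closeFuel-path n zero lk le done h = extends-HasKey (proj₂ (closeFuel-ok n lk)) h
  closeFuel-path (suc n) (suc m) lk (s≤s le) (step {p = p} lt e path) h with closeRound-ok lk
  ... | pr = closeFuel-path n m (p-ok pr) le path (p-has pr (out e h))
    where
    out : ∀ {a b vs} → edge a (suc p) ≡ just b → HasKey a vs → OutOf vs b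
    out e (here refl) = _ , suc p , here refl , <-steps lt , e
    out e (there h) with out e h
    ... | u , i , um , im , e' = u , i , there um , im , e'

zero-sum : ∀ v → sum v ≡ 0 → v ≡ replicate (length v) 0
zero-sum [] e = refl
zero-sum (zero ∷ v) e = cong (0 ∷_) (zero-sum v e)

last-nonzero : ∀ v → sum v ≢ 0 → ∃[ w ] ∃[ x ] ∃[ j ] v ≡ w ++ suc x ∷ replicate j 0
last-nonzero [] ne = ⊥-elim (ne refl)
last-nonzero (a ∷ v) ne with sum v ℕ.≟ 0
... | no ne' = let (w , x , j , e) = last-nonzero v ne' in a ∷ w , x , j , cong (a ∷_) e
... | yes z with a
... | zero = ⊥-elim (ne z)
... | suc x = [] , x , length v , cong (suc x ∷_) (zero-sum v z)

label-zeros : ∀ v → All (_≡ 0) v → Zeros (label v)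
label-zeros v = go [] v
  where
  go : ∀ pre v → All (_≡ 0) v → Zeros (labelAux pre v)
  go pre [] [] = []
  go pre (x ∷ v) (e ∷ es) = e ∷ go (x ∷ pre) v es

replicate-all : ∀ n → All (_≡ 0) (replicate n 0)
replicate-all zero = []
replicate-all (suc n) = refl ∷ replicate-all n

vPsi-length : ∀ v → length (vPsi v) ≡ length v
vPsi-length [] = refl
vPsi-length (x ∷ v) = trans (Listₚ.length-++ v) (ℕₚ.+-comm (length v) 1)

vPsi-sum : ∀ x v → sum (vPsi (x ∷ v)) ≡ suc (sum (x ∷ v))
vPsi-sum x v = trans (sum-++ v (suc x ∷ [])) (trans (ℕₚ.+-comm (sum v) _) (cong (λ z → suc z + sum v) (ℕₚ.+-identityʳ x)))

vPsi-injective : ∀ v v' → length v ≡ length v' → vPsi v ≡ vPsi v' → v ≡ v'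
vPsi-injective [] [] _ _ = refl
vPsi-injective (x ∷ v) (x' ∷ v') _ e with Listₚ.∷ʳ-injective v v' e
... | refl , refl = refl

AllPairs-map : ∀ {A B : Set} {R : A → A → Set} {Q : B → B → Set} {P : A → Set} (f : A → B) → (∀ {x y} → P x → P y → R x y → Q (f x) (f y)) →
  ∀ {xs} → All P xs → AllPairs R xs → AllPairs Q (map f xs)
AllPairs-map f h [] [] = []
AllPairs-map {A} {R = R} {Q} {P} f h {x ∷ xs} (p ∷ ps) (r ∷ rs) = Allₚ.map⁺ (zip ps r) ∷ AllPairs-map f h ps rs
  where
  zip : ∀ {ys} → All P ys → All (R x) ys → All (λ y → Q (f x) (f y)) ys
  zip [] [] = []
  zip (p' ∷ ps) (r' ∷ rs) = h p p' r' ∷ zip ps rs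

∈-allWords : ∀ l w → All (ℕ._< l) w → w ∈ allWords l (length w)
∈-allWords l [] [] = here refl
∈-allWords l (x ∷ w) (lt ∷ lts) = Memₚ.∈-concatMap⁺ (λ r → map (r ∷_) (allWords l (length w))) (Any.map (λ { refl → Memₚ.∈-map⁺ (x ∷_) (∈-allWords l w lts) }) (Memₚ.∈-upTo⁺ lt))

Lat-letters : ∀ {l} t → Lat l t → All (ℕ._< l) t
Lat-letters [] _ = []
Lat-letters (x ∷ t) (lt , _ , h) = lt ∷ Lat-letters t h

∈-rsts : ∀ lam w → Valid lam (reverse w) → w ∈ rsts lam
∈-rsts lam w v = Memₚ.∈-filter⁺ (Data.Bool.T? ∘ isRST lam)
  (subst (λ n → w ∈ allWords (length lam) n) (trans (sym (Listₚ.length-reverse w)) (size v)) (∈-allWords (length lam) w (All.tabulate (λ m → All.lookup (Lat-letters (reverse w) (lattice v)) (Anyₚ.reverse⁺ m)))))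
  (subst T (sym (Valid⇒isRST lam w v)) tt)

find-key : ∀ {k vs} → HasKey k vs → ∃[ u ] (u ∈ vs × vkey u ≡ k)
find-key (here e) = _ , here refl , e
find-key (there h) = let (u , m , e) = find-key h in u , there m , e

-- The vertices of each degree

module Levels (lam : List ℕ) (τ-valid : Valid lam (reverse (tauLam lam))) where
  open Search lam public

  private
    τ : List ℕ
    τ = tauLam lam
    zs : List ℕ
    zs = replicate N 0

  start : Vtx
  start = vtx (τ , zs) (term 1K zs τ ∷ [])

  Ĵ-zero : ∀ w → Ĵ w zs ≡ base (reverse w)
  Ĵ-zero w = J-zeros (sum zs) (reverse w) (label-zeros zs (replicate-all N))

  start-ok : VOK 0 start
  start-ok = vok (good τ-valid (Listₚ.length-replicate N) (sum-replicate-0 N))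
    (inDeg (Listₚ.length-replicate N) (sum-replicate-0 N) τ-valid ∷ [])
    (≐-trans (pointwise λ {m} {s} l v → ≈-trans (KRing.+-identityʳ _) (cases m s (Listₚ.≡-dec ℕ._≟_ m zs) (Listₚ.≡-dec ℕ._≟_ s (reverse τ)))) (≡⇒≐ (sym (Ĵ-zero τ))))
    where
    cases : ∀ m s → Dec (m ≡ zs) → Dec (s ≡ reverse τ) → term-at (term 1K zs τ) m (reverse s) ≈ base (reverse τ) m s
    cases m s (no ne) _ = ≈-trans (≡⇒≈ (term-at-miss₁ 1K {zs} {m} τ (reverse s) (ne ∘ sym))) (≡⇒≈ (sym (base-m (reverse τ) s ne)))
    cases m s (yes refl) (no ne) = ≈-trans (≡⇒≈ (term-at-miss₂ 1K zs zs {τ} {reverse s} (λ h → ne (trans (sym (Listₚ.reverse-involutive s)) (cong reverse (sym h)))))) (≡⇒≈ (sym (base-s (reverse τ) zs ne)))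
    cases m s (yes refl) (yes refl) = ≈-trans (≡⇒≈ (trans (cong (term-at (term 1K zs τ) zs) (Listₚ.reverse-involutive τ)) (term-at-hit 1K zs τ))) (≈-trans (≡⇒≈ 1f-def) (≡⇒≈ (sym (base-1 (reverse τ) refl))))

  Ψ-vtx : Vtx → Vtx
  Ψ-vtx u = vtx (vw u , vPsi (vv u)) (PsiM N (vJ u))

  Ψ-good : ∀ {k w v n} → N ≡ suc n → Good k (w , v) → Good (suc k) (w , vPsi v)
  Ψ-good {v = []} eqN g = ⊥-elim (ℕₚ.0≢1+n (trans (comp-len g) eqN))
  Ψ-good {v = x ∷ v} eqN g = good (word-ok g) (trans (vPsi-length (x ∷ v)) (comp-len g)) (trans (vPsi-sum x v) (cong suc (comp-sum g)))

  Ψ-vtx-ok : ∀ {k n} → N ≡ suc n → ∀ {u} → VOK k u → VOK (suc k) (Ψ-vtx u)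
  Ψ-vtx-ok {k} eqN {u} ok = vok (Ψ-good eqN (key-ok ok)) (PsiM-InD eqN (J-in ok))
    (≐-trans (PsiM-fn eqN (J-in ok)) (≐-trans (Ψ-cong eqN (J-fn ok)) (≡⇒≐ (sym (Ĵ-Ψ (vw u) (vv u) (comp-len (key-ok ok)) eqN)))))

  Ψ-LOK : ∀ {k n vs} → N ≡ suc n → LOK k vs → LOK (suc k) (map Ψ-vtx vs)
  Ψ-LOK eqN a = lok (Allₚ.map⁺ (All.map (Ψ-vtx-ok eqN) (all-ok a)))
    (AllPairs-map Ψ-vtx (λ {x} {y} p q ne e → ne (cong₂ _,_ (cong proj₁ e) (vPsi-injective (vv x) (vv y) (trans (comp-len (key-ok p)) (sym (comp-len (key-ok q)))) (cong proj₂ e)))) (all-ok a) (distinct a))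

  start-LOK : LOK 0 (start ∷ [])
  start-LOK = lok (start-ok ∷ []) ([] ∷ [])

  level-ok : ∀ k → k ≡ 0 ⊎ ∃[ n ] N ≡ suc n → LOK k (level lam k)
  level-ok zero _ = proj₁ (closeFuel-ok (length (rsts lam)) start-LOK)
  level-ok (suc k) (inj₂ (n , eqN)) = proj₁ (closeFuel-ok (length (rsts lam) * (suc (suc k) ^ N)) (Ψ-LOK eqN (level-ok k (inj₂ (n , eqN)))))

  start-key : HasKey (τ , zs) (level lam 0)
  start-key = extends-HasKey (proj₂ (closeFuel-ok (length (rsts lam)) start-LOK)) (here refl)

  -- In degree 0 the composition is zero, so distinct keys are distinct tableaux. The fuel is the
  -- number of tableaux; were the list not closed, it would contain more vertices than that.
  level0-closed : Closed (level lam 0)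
  level0-closed with closeFuel-closed (length (rsts lam)) start-LOK
  ... | inj₁ c = c
  ... | inj₂ le = ⊥-elim (ℕₚ.<⇒≱ (ℕₚ.n<1+n (length (rsts lam))) (ℕₚ.≤-trans (ℕₚ.≤-reflexive (ℕₚ.+-comm 1 (length (rsts lam)))) (ℕₚ.≤-trans le bound)))
    where
    lk : LOK 0 (level lam 0)
    lk = level-ok 0 (inj₁ refl)
    zero-comp : ∀ {u} → VOK 0 u → vv u ≡ zs
    zero-comp {u} ok = trans (zero-sum (vv u) (comp-sum (key-ok ok))) (cong (λ n → replicate n 0) (comp-len (key-ok ok)))
    bound : length (level lam 0) ≤ length (rsts lam)
    bound = subst (ℕ._≤ length (rsts lam)) (Listₚ.length-map vw (level lam 0)) (unique-length (rsts lam)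
      (AllPairs-map vw (λ p q ne e → ne (cong₂ _,_ e (trans (zero-comp p) (sym (zero-comp q))))) (all-ok lk) (distinct lk))
      (λ m → let (u , um , e) = Memₚ.∈-map⁻ vw m in subst (_∈ rsts lam) (sym e) (∈-rsts lam (vw u) (word-ok (key-ok (All.lookup (all-ok lk) um))))))

  word-at-0 : ∀ {w v} → HasKey (w , v) (level lam 0) → Valid lam (reverse w)
  word-at-0 h with find-key h
  ... | u , um , refl = word-ok (key-ok (All.lookup (all-ok (level-ok 0 (inj₁ refl))) um))

  -- The s_i-edges sort the word of a tableau, so the row-by-row tableau is reached from τ_λ
  sorted-reached : ∃[ t ] (Valid lam t × Desc t × HasKey (reverse t , zs) (level lam 0))
  sorted-reached = SortDesc.sort-induction P basis swap-step (reverse τ) (subst (λ w → HasKey (w , zs) (level lam 0)) (sym (Listₚ.reverse-involutive τ)) start-key)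
    where
    P : List ℕ → Set
    P t = HasKey (reverse t , zs) (level lam 0) → ∃[ t' ] (Valid lam t' × Desc t' × HasKey (reverse t' , zs) (level lam 0))
    basis : ∀ t → Linked SortDesc.Good t → P t
    basis t lk h = t , subst (Valid lam) (Listₚ.reverse-involutive t) (word-at-0 h) , Linked⇒AllPairs (λ p q → ℕₚ.≤-trans q p) (Linked-map (λ {x} {y} → <ᵇ-false⇒ {x} {y}) lk) , h
    swap-step : ∀ u x y r → (x <ᵇ y) ≡ true → P (u ++ y ∷ x ∷ r) → P (u ++ x ∷ y ∷ r)
    swap-step u x y r b ih h = ih (level0-closed (out (find-key h)))
      where
      t : List ℕ
      t = u ++ x ∷ y ∷ r
      v : Valid lam t
      v = subst (Valid lam) (Listₚ.reverse-involutive t) (word-at-0 h)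
      p : ℕ
      p = length u
      lt : suc p < N
      lt = subst (suc p ℕ.<_) (size v) (subst (suc p ℕ.<_) (sym (Listₚ.length-++ u)) (subst (suc (suc p) ℕ.≤_) (trans (cong suc (sym (ℕₚ.+-suc p (length r)))) (sym (ℕₚ.+-suc p (suc (length r))))) (s≤s (s≤s (ℕₚ.m≤m+n _ _)))))
      g : Good 0 (reverse t , zs)
      g = good (subst (Valid lam) (sym (Listₚ.reverse-involutive t)) v) (Listₚ.length-replicate N) (sum-replicate-0 N)
      dfall : ∃[ k ] dd p t ≡ ℤ.+ suc (suc k)
      dfall with adj (length lam) x y r (Lat-drop u (lattice v))
      ... | row refl _ = ⊥-elim (ℕₚ.<-irrefl refl (<ᵇ⇒< {x} {y} b))
      ... | col refl _ _ = ⊥-elim (ℕₚ.<-asym (ℕₚ.n<1+n y) (<ᵇ⇒< {x} {y} b))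
      ... | rise k y<x _ _ = ⊥-elim (ℕₚ.<-asym y<x (<ᵇ⇒< {x} {y} b))
      ... | fall k _ e _ = k , trans (dd-split u x y r) e
      all-zero : ∀ {u' a b' s} → zs ≡ u' ++ a ∷ b' ∷ s → a ≡ 0 × b' ≡ 0
      all-zero {u'} e with Allₚ.++⁻ʳ u' (subst (All (_≡ 0)) e (replicate-all N))
      ... | p ∷ q ∷ _ = p , q
      the-edge : EdgeView (reverse t) zs p → edge (reverse t , zs) (suc p) ≡ just (reverse (u ++ y ∷ x ∷ r) , zs)
      the-edge (rises u' a b' s e l a<b _) = ⊥-elim (ℕₚ.<⇒≢ a<b (let (p , q) = all-zero {u'} e in trans p (sym q)))
      the-edge (flips u' a s q e l (U , R , el , refl , refl) sq _ ed) = trans ed (cong (λ w → just (w , zs)) (cong reverse (trans (cong₂ swap0 (Listₚ.reverse-involutive t) q≡) (swap0-split u x y r))))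
        where
        a≡0 : a ≡ 0
        a≡0 = proj₁ (all-zero {vals U} e)
        zR : Zeros ((a , suc q) ∷ R)
        zR = Allₚ.++⁻ʳ (U ++ (a , q) ∷ []) (subst Zeros (trans el (sym (Listₚ.++-assoc U _ _))) (label-zeros zs (replicate-all N)))
        q≡ : q ≡ p
        q≡ = trans (LabOK-zeros U ((a , suc q) ∷ R) zR (subst (λ z → LabOK [] (U ++ (z , q) ∷ (a , suc q) ∷ R)) a≡0 (subst (LabOK []) el (LabOK-label zs)))) (trans (sym (Listₚ.length-map proj₁ U)) l)
      -- In the zero composition the rank at position p is p itself, so `x < y` yields an axial
      -- distance of at least 2 at the ranks involved, and the edge exists.
      the-edge (none e) = ⊥-elim (no-none (split₂ zs p (subst (suc p ℕ.<_) (sym (Listₚ.length-replicate N)) lt)))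
        where
        no-none : ∃[ u' ] ∃[ a ] ∃[ b' ] ∃[ s ] (zs ≡ u' ++ a ∷ b' ∷ s × length u' ≡ p) → ⊥
        no-none (u' , a , b' , s , eq , l) = contr (trans (sym e) (edge-exists eq l))
          where
          contr : ∀ {A : Set} {x : A} → nothing ≡ just x → ⊥
          contr ()
          edge-exists : zs ≡ u' ++ a ∷ b' ∷ s → length u' ≡ p → edge (reverse t , zs) (suc p) ≡ just (swapEntries (reverse t) (sigma zs (suc p)) , zs)
          edge-exists eq _ with label-split₂ u' a b' s
          ... | U , q , q' , R , el , vU , vR = trans (if-false at<) (if-true (cong₂ _∧_ at≡ gt2))
            where
            el' : label zs ≡ U ++ (a , q) ∷ (b' , q') ∷ R
            el' = trans (cong label eq) el
            lU : length U ≡ p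
            lU = trans (sym (Listₚ.length-map proj₁ U)) (trans (cong length vU) l)
            at₁ : at zs (suc p) ≡ 0
            at₁ = idx0-replicate N p
            at₂ : at zs (suc (suc p)) ≡ 0
            at₂ = idx0-replicate N (suc p)
            at< : (at zs (suc p) <ᵇ at zs (suc (suc p))) ≡ false
            at< = cong₂ _<ᵇ_ at₁ at₂
            at≡ : (at zs (suc p) ≡ᵇ at zs (suc (suc p))) ≡ true
            at≡ = cong₂ _≡ᵇ_ at₁ at₂
            a≡0 : a ≡ 0
            a≡0 = proj₁ (all-zero {u'} eq)
            zR : Zeros ((b' , q') ∷ R)
            zR = Allₚ.++⁻ʳ (U ++ (a , q) ∷ []) (subst Zeros (trans el' (sym (Listₚ.++-assoc U _ _))) (label-zeros zs (replicate-all N)))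
            q≡ : q ≡ p
            q≡ = trans (LabOK-zeros U ((b' , q') ∷ R) zR (subst (λ z → LabOK [] (U ++ (z , q) ∷ (b' , q') ∷ R)) a≡0 (subst (LabOK []) el' (LabOK-label zs)))) lU
            σ≡ : sigma zs (suc p) ≡ suc p
            σ≡ = trans (cong (sigma zs ∘ suc) (sym lU)) (trans (sigma-label el') (cong suc q≡))
            gt2 : (ℤ.+ 2 ℤ.≤ᵇ (CT (reverse t) (sigma zs (suc p)) ℤ.- CT (reverse t) (suc (sigma zs (suc p))))) ≡ true
            gt2 = cong (ℤ.+ 2 ℤ.≤ᵇ_) (trans (cong (λ s → CT (reverse t) s ℤ.- CT (reverse t) (suc s)) σ≡) (trans (dd-label (reverse t) p (subst (suc p ℕ.<_) (sym (trans (Listₚ.length-reverse t) (size v))) lt)) (trans (cong (dd p) (Listₚ.reverse-involutive t)) (proj₂ dfall))))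
      out : ∃[ w ] (w ∈ level lam 0 × vkey w ≡ (reverse t , zs)) → OutOf (level lam 0) (reverse (u ++ y ∷ x ∷ r) , zs)
      out (w , wm , e) = w , suc p , wm , <-steps lt , trans (cong (λ k → edge k (suc p)) e) (the-edge (edgeView (reverse t) zs p g lt))

  move-path : ∀ w x → Valid lam (reverse w) → ∀ j a i → length (a ++ replicate j 0 ++ suc x ∷ replicate i 0) ≡ N →
    Path j (w , a ++ replicate j 0 ++ suc x ∷ replicate i 0) (w , a ++ suc x ∷ replicate (j + i) 0)
  move-path w x vw' zero a i l = done
  move-path w x vw' (suc j) a i l = path-snoc (subst₂ (λ b c → Path j (w , b) (w , c)) (Listₚ.++-assoc a (0 ∷ []) _) (Listₚ.++-assoc a (0 ∷ []) _) (move-path w x vw' j (a ++ 0 ∷ []) i (trans (cong length (Listₚ.++-assoc a (0 ∷ []) _)) l))) lt ed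
    where
    v : List ℕ
    v = a ++ 0 ∷ suc x ∷ replicate (j + i) 0
    lv : length v ≡ N
    lv = trans (Listₚ.length-++ a) (trans (cong (λ z → length a + suc z) (trans (cong suc (Listₚ.length-replicate (j + i))) (trans (sym (ℕₚ.+-suc j i)) (sym (trans (Listₚ.length-++ (replicate j 0)) (cong₂ (λ b c → b + suc c) (Listₚ.length-replicate j) (Listₚ.length-replicate i))))))) (trans (sym (Listₚ.length-++ a)) l))
    lt : suc (length a) < N
    lt = subst (suc (length a) ℕ.<_) lv (subst (suc (length a) ℕ.<_) (sym (Listₚ.length-++ a)) (subst (suc (suc (length a)) ℕ.≤_) (trans (cong suc (sym (ℕₚ.+-suc (length a) (length (replicate (j + i) 0))))) (sym (ℕₚ.+-suc (length a) (suc (length (replicate (j + i) 0)))))) (s≤s (s≤s (ℕₚ.m≤m+n _ _)))))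
    ed : edge (w , v) (suc (length a)) ≡ just (w , a ++ suc x ∷ replicate (suc j + i) 0)
    ed = trans (if-true (cong₂ _<ᵇ_ (idx0-mid a 0 _) (at₂ a))) (cong (λ s → just (w , s)) (swap0-split a 0 (suc x) (replicate (j + i) 0)))
      where
      at₂ : ∀ a → idx0 (a ++ 0 ∷ suc x ∷ replicate (j + i) 0) (suc (length a)) ≡ suc x
      at₂ [] = refl
      at₂ (_ ∷ a) = at₂ a

  -- Follows the path chosen for `J`: undo the Ψ that created the last nonzero entry, then move this
  -- entry left past the zeros behind it.
  complete : ∀ {w} → HasKey (w , zs) (level lam 0) → ∀ k v → length v ≡ N → sum v ≡ k → HasKey (w , v) (level lam k)
  complete {w} h zero v l s = subst (λ z → HasKey (w , z) (level lam 0)) (sym (trans (zero-sum v s) (cong (λ n → replicate n 0) l))) h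
  complete {w} h (suc k) v l s with last-nonzero v (λ z → ℕₚ.0≢1+n (trans (sym z) s))
  ... | a , x , j , refl = subst (λ z → HasKey (w , a ++ suc x ∷ replicate z 0) (level lam (suc k))) (ℕₚ.+-identityʳ j)
        (closeFuel-path (length (rsts lam) * (suc (suc k) ^ N)) j (Ψ-LOK eqN (level-ok k (inj₂ (_ , eqN)))) fuel (move-path w x (word-at-0 h) j a 0 len') (has-Ψ prev))
    where
    len' : length (a ++ replicate j 0 ++ suc x ∷ []) ≡ N
    len' = trans (Listₚ.length-++ a) (trans (cong (length a ℕ.+_) (trans (Listₚ.length-++ (replicate j 0)) (ℕₚ.+-comm (length (replicate j 0)) 1))) (trans (sym (Listₚ.length-++ a)) l))
    eqN : N ≡ suc (length (a ++ replicate j 0))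
    eqN = trans (sym len') (trans (cong length (sym (Listₚ.++-assoc a (replicate j 0) _))) (trans (Listₚ.length-++ (a ++ replicate j 0)) (ℕₚ.+-comm _ 1)))
    prev : HasKey (w , x ∷ a ++ replicate j 0) (level lam k)
    prev = complete h k (x ∷ a ++ replicate j 0) (sym eqN) (ℕₚ.suc-injective (trans (trans (cong suc (trans (cong (x ℕ.+_) (sum-++ a (replicate j 0))) (exch x (sum a) _))) (trans (sym (ℕₚ.+-suc (sum a) _)) (sym (sum-++ a (suc x ∷ replicate j 0))))) s))
    has-Ψ : HasKey (w , x ∷ a ++ replicate j 0) (level lam k) → HasKey (w , a ++ replicate j 0 ++ suc x ∷ []) (map Ψ-vtx (level lam k))
    has-Ψ h = Anyₚ.map⁺ (Any.map (λ { {u} refl → cong (w ,_) (Listₚ.++-assoc a (replicate j 0) _) }) h)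
    -- The number j of zeros is less than N, hence less than (k + 2)^N, and at least one tableau
    -- exists, namely `w`.
    fuel : j ≤ length (rsts lam) * (suc (suc k) ^ N)
    fuel = ℕₚ.≤-trans (ℕₚ.≤-trans (ℕₚ.≤-trans (ℕₚ.≤-reflexive (sym (Listₚ.length-replicate j))) (ℕₚ.≤-trans (ℕₚ.m≤n+m _ (length a)) (ℕₚ.≤-trans (ℕₚ.≤-reflexive (sym (Listₚ.length-++ a))) (ℕₚ.≤-trans (ℕₚ.n≤1+n _) (ℕₚ.≤-reflexive (sym eqN)))))) (ℕₚ.<⇒≤ (N<pow k N)))
      (ℕₚ.≤-trans (ℕₚ.≤-reflexive (sym (ℕₚ.+-identityʳ _))) (ℕₚ.*-monoˡ-≤ (suc (suc k) ^ N) (nonempty (∈-rsts lam w (word-at-0 h)))))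
      where
      nonempty : ∀ {A : Set} {x : A} {xs} → x ∈ xs → 1 ≤ length xs
      nonempty (here _) = s≤s z≤n
      nonempty (there _) = s≤s z≤n

-- Leading terms at α = ∞

rotv : ℕ → List ℕ → List ℕ
rotv zero v = v
rotv (suc n) v = swap0 (rotv n v) n

rotv-split : ∀ n x a c → length a ≡ n → rotv n (x ∷ a ++ c) ≡ a ++ x ∷ c
rotv-split zero x [] c refl = refl
rotv-split (suc n) x a c l with initLast a
... | [] = ⊥-elim (ℕₚ.0≢1+n l)
... | a' ∷ʳ′ b = trans (cong (λ z → swap0 (rotv n (x ∷ z)) n) (Listₚ.++-assoc a' (b ∷ []) c))
      (trans (cong (λ z → swap0 z n) (rotv-split n x a' (b ∷ c) l')) (trans (cong (swap0 (a' ++ x ∷ b ∷ c)) (sym l')) (trans (swap0-split a' x b c) (sym (Listₚ.++-assoc a' (b ∷ []) (x ∷ c))))))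
  where
  l' : length a' ≡ n
  l' = ℕₚ.suc-injective (trans (sym (trans (Listₚ.length-++ a') (ℕₚ.+-comm (length a') 1))) l)

incAt0-last : ∀ w x → incAt0 (w ++ x ∷ []) (length w) ≡ w ++ suc x ∷ []
incAt0-last [] x = refl
incAt0-last (a ∷ w) x = cong (a ∷_) (incAt0-last w x)

Val-zero : ∀ {k x} → x ≈ 0f → Val k x
Val-zero {k} e = Val-resp (≈-sym e) (Val-0 {k})

Val-β : ∀ d → Val 1 (β d)
Val-β d = Val-inv-fromZ d

Val-κ : ∀ d → Val 1 (κ d)
Val-κ -[1+ suc n ] = Val-1
Val-κ -[1+ zero ] = Val-0 {1}
Val-κ (ℤ.+ suc zero) = Val-0 {1}
Val-κ (ℤ.+ zero) = Val-⊕ {1} Val-1 (Val-⊝ {1} (Val-⊛ {1} (Val-β _) (Val-β _)))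
Val-κ (ℤ.+ suc (suc n)) = Val-⊕ {1} Val-1 (Val-⊝ {1} (Val-⊛ {1} (Val-β _) (Val-β _)))

-- At α = ∞ the function J_{v,τ} degenerates to x^v ⊗ t for a nonzero t ∈ V_λ
module Leading (lam : List ℕ) where
  open Graph lam public

  record Lead (v : List ℕ) (f : Fun) : Set where
    constructor lead
    field
      regular  : ∀ m {s} → Valid lam s → Val 1 (f m s)
      small    : ∀ {m s} → m ≢ v → Valid lam s → Val 0 (f m s)
      nonsmall : ¬ (∀ {s} → Valid lam s → Val 0 (f v s))
  open Lead public

  Val-κ-swap : ∀ {k p s} {f : Fun} {m : List ℕ} → suc p < N → Valid lam s → (∀ {s} → Valid lam s → Val k (f m s)) → Val k (κ (dd p s) ⊛ f m (swap0 s p))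
  Val-κ-swap {k} {p} {s} {f} {m} lt v h with place {p = p} v (subst (suc p ℕ.<_) (sym (size v)) lt)
  ... | same-row d = Val-zero {k} (⊛-zeroˡ (≡⇒≈ (κ-null (inj₁ d))))
  ... | same-col d = Val-zero {k} (⊛-zeroˡ (≡⇒≈ (κ-null (inj₂ d))))
  ... | exchange _ _ v' _ _ = Val-⊛ {k} (Val-κ (dd p s)) (h v')

  Val-T : ∀ {k p s f m} → suc p < N → Valid lam s → (∀ {s} → Valid lam s → Val k (f (swap0 m p) s)) → Val k (T̂ p f m s)
  Val-T {k} {p} {s} {f} {m} lt v h = Val-⊕ {k} (Val-⊛ {k} (Val-β (dd p s)) (h v)) (Val-κ-swap {k} {p} {s} {f} {swap0 m p} lt v h)

  lead-base : ∀ {t} → Valid lam t → Lead (replicate N 0) (base t)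
  lead-base {t} vt = lead reg (λ {m} {s} ne v → Val-zero {0} (≡⇒≈ (base-m t s ne))) (λ h → ¬Val0-1 (subst (Val 0) (base-1 t refl) (h vt)))
    where
    reg : ∀ m {s} → Valid lam s → Val 1 (base t m s)
    reg m {s} v with eqL m (replicate N 0) ∧ eqL s t
    ... | true = Val-1
    ... | false = Val-0 {1}

  -- The coefficients of s ⊗ s do not involve α, so regularity and smallness pass through it. Not
  -- being small survives because `T̂ p` is its own inverse.
  lead-T : ∀ {p v f} → suc p < N → length v ≡ N → Lead v f → Lead (swap0 v p) (T̂ p f)
  lead-T {p} {v} {f} lt l ld = lead (λ m vs → Val-T {1} {p} {f = f} {m} lt vs (λ vs' → regular ld (swap0 m p) vs'))
    (λ {m} ne vs → Val-T {0} {p} {f = f} {m} lt vs (λ vs' → small ld (λ e → ne (trans (sym (swap0-invol m p)) (cong (λ z → swap0 z p) e))) vs'))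
    (λ h → nonsmall ld (λ {s} vs → Val-resp {0} (on (T-invol f lt) (ofLen l) vs) (Val-T {0} {p} {f = T̂ p f} {v} lt vs h)))

  lead-S : ∀ {p δ v f} → suc p < N → length v ≡ N → Val 0 δ → Lead v f → Lead (swap0 v p) (S p δ f)
  lead-S {p} {δ} {v} {f} lt l vδ ld = lead (λ m vs → Val-⊕ {1} (regular lT m vs) (Val-⊛ {1} (Val-weaken vδ) (regular ld m vs)))
    (λ {m} {s} ne vs → Val-⊕ {0} (small lT ne vs) (δf m vs))
    (λ h → nonsmall lT (λ {s} vs → Val-resp {0} (KS.solve 2 (λ a b → (a KS.:+ b) KS.:+ KS.:- b KS.:= a) ≈-refl (T̂ p f (swap0 v p) s) (δ ⊛ f (swap0 v p) s)) (Val-⊕ {0} (h vs) (Val-⊝ {0} (δf (swap0 v p) vs)))))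
    where
    lT : Lead (swap0 v p) (T̂ p f)
    lT = lead-T lt l ld
    δf : ∀ m {s} → Valid lam s → Val 0 (δ ⊛ f m s)
    δf m {s} vs = Val-resp {0} (KRing.*-comm (f m s) δ) (Val-⊛ {0} (regular ld m vs) vδ)

  length-rotv : ∀ n v → length (rotv n v) ≡ length v
  length-rotv zero v = refl
  length-rotv (suc n) v = trans (length-swap0 (rotv n v) n) (length-rotv n v)

  lead-θ : ∀ {v f} n → n < N → length v ≡ N → Lead v f → Lead (rotv n v) (θ n f)
  lead-θ zero lt l ld = ld
  lead-θ {v} (suc n) lt l ld = lead-T lt (trans (length-rotv n v) l) (lead-θ n (ℕₚ.<-trans (ℕₚ.n<1+n n) lt) l ld)

  incAt0-dec : ∀ m j {e} → decAt m j ≡ just e → incAt0 e j ≡ m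
  incAt0-dec (suc x ∷ m) zero refl = refl
  incAt0-dec (x ∷ m) (suc j) h rewrite decAt-∷ x m j with decAt m j in eq
  incAt0-dec (x ∷ m) (suc j) refl | just e = cong (x ∷_) (incAt0-dec m j eq)

  lead-X : ∀ {j v f} → decAt (incAt0 v j) j ≡ just v → Lead v f → Lead (incAt0 v j) (X j f)
  lead-X {j} {v} {f} dv ld = lead reg sm (λ h → nonsmall ld (λ {s} vs → subst (Val 0) (cong (λ M → orZero (mapMaybe (λ m' → f m' s) M)) dv) (h vs)))
    where
    reg : ∀ m {s} → Valid lam s → Val 1 (X j f m s)
    reg m vs with decAt m j
    ... | just m' = regular ld m' vs
    ... | nothing = Val-0 {1}
    sm : ∀ {m s} → m ≢ incAt0 v j → Valid lam s → Val 0 (X j f m s)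
    sm {m} ne vs with decAt m j in eq
    ... | just m' = small ld (λ e → ne (trans (sym (incAt0-dec m j eq)) (cong (λ z → incAt0 z j) e))) vs
    ... | nothing = Val-0 {0}

  decAt-last : ∀ w x → decAt (w ++ suc x ∷ []) (length w) ≡ just (w ++ x ∷ [])
  decAt-last [] x = refl
  decAt-last (a ∷ w) x = trans (decAt-∷ a (w ++ suc x ∷ []) (length w)) (cong (mapMaybe (a ∷_)) (decAt-last w x))

  lead-Ψ : ∀ {x w f} → suc (length w) ≡ N → Lead (x ∷ w) f → Lead (w ++ suc x ∷ []) (Ψ f)
  lead-Ψ {x} {w} {f} l ld = subst (Lead (w ++ suc x ∷ [])) (sym (Ψ-unfold (sym l) f)) (subst (λ v → Lead v (X n (θ n f))) (incAt0-last w x)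
    (lead-X (trans (cong (λ z → decAt z n) (incAt0-last w x)) (decAt-last w x)) (subst (λ v → Lead v (θ n f)) rot≡ (lead-θ n (subst (n ℕ.<_) l (ℕₚ.n<1+n n)) l ld))))
    where
    n : ℕ
    n = length w
    rot≡ : rotv n (x ∷ w) ≡ w ++ x ∷ []
    rot≡ = trans (cong (λ z → rotv n (x ∷ z)) (sym (Listₚ.++-identityʳ w))) (rotv-split n x w [] refl)

  Val-gap : ∀ t x y q q' → x ≢ y → Val 0 (gapK (zE t (x , q)) (zE t (y , q')))
  Val-gap t x y q q' ne = Val-resp {0} (inv-cong (≈-trans (≡⇒≈ (lin-def _ _)) (≈-sym (zE-diff t x q y q'))))
    (Val-inv-lin (ct t q' ℤ.- ct t q) (λ e → ne (sym (ℤₚ.+-injective (ℤₚ.i-j≡0⇒i≡j (ℤ.+ y) (ℤ.+ x) e)))))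

  vals-zeros : ∀ {V} → Zeros V → vals V ≡ replicate (length V) 0
  vals-zeros [] = refl
  vals-zeros (refl ∷ z) = cong (0 ∷_) (vals-zeros z)

  -- The chosen path moves nonzero entries past zeros only, so each parameter is the inverse of αn +
  -- c with n ≠ 0. It vanishes at infinity and leaves the leading term of s ⊗ s unchanged.
  lead-J : ∀ k {t} V → Valid lam t → total V ≡ k → length V ≡ N → Lead (vals V) (J k t V)
  lead-Jmove : ∀ k {t} w x q r → Valid lam t → Zeros r → total (w ++ (suc x , q) ∷ r) ≡ suc k → length (w ++ (suc x , q) ∷ r) ≡ N →
    Lead (vals (w ++ (suc x , q) ∷ r)) (Jmove k t w (x , q) r)
  lead-J k {t} V vt tot l with splitZ V
  ... | zeros z = subst₂ Lead (sym (trans (vals-zeros z) (cong (λ n → replicate n 0) l))) (sym (J-zeros k t z)) (lead-base vt)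
  lead-J zero {t} _ vt tot l | last w x q {r} z = ⊥-elim (nz w tot)
    where
    nz : ∀ w → total (w ++ (suc x , q) ∷ r) ≢ 0
    nz w h = ℕₚ.0≢1+n (sym (trans (sym (trans (total-++ w _) (ℕₚ.+-suc (total w) _))) h))
  lead-J (suc k) {t} _ vt tot l | last w x q {r} z = subst (Lead _) (sym (cong (Jsplit k t) (splitz-++ w z))) (lead-Jmove k w x q r vt z tot l)
  lead-Jmove k {t} w x q [] vt z tot l = subst (λ v → Lead v (Ψ (J k t ((x , q) ∷ w)))) (sym (vals-++ w _))
    (lead-Ψ (trans (cong suc (Listₚ.length-map proj₁ w)) l') (lead-J k ((x , q) ∷ w) vt (ℕₚ.suc-injective (trans (sym (total-Ψ w x q)) tot)) l'))
    where
    l' : suc (length w) ≡ N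
    l' = trans (sym (trans (Listₚ.length-++ w) (ℕₚ.+-comm (length w) 1))) l
  lead-Jmove k {t} w x q (e₀ ∷ r) vt (z₀ ∷ z) tot l = subst (λ v → Lead v (Jmove k t w (x , q) (e₀ ∷ r))) sw≡
    (lead-S lt lv (gap-small e₀ z₀) (lead-Jmove k (w ++ e₀ ∷ []) x q r vt z (trans (cong total (Listₚ.++-assoc w _ _)) (trans (total-swap w e₀ (suc x , q) r) tot)) (trans (cong length (Listₚ.++-assoc w _ _)) (trans (trans (Listₚ.length-++ w) (sym (Listₚ.length-++ w))) l))))
    where
    lt : suc (length w) < N
    lt = subst (suc (length w) ℕ.<_) l (subst (suc (length w) ℕ.<_) (sym (Listₚ.length-++ w)) (subst (suc (suc (length w)) ℕ.≤_) (trans (cong suc (sym (ℕₚ.+-suc (length w) (length r)))) (sym (ℕₚ.+-suc (length w) (suc (length r))))) (s≤s (s≤s (ℕₚ.m≤m+n _ _)))))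
    V' : List Ent
    V' = (w ++ e₀ ∷ []) ++ (suc x , q) ∷ r
    lv : length (vals V') ≡ N
    lv = trans (Listₚ.length-map proj₁ V') (trans (cong length (Listₚ.++-assoc w _ _)) (trans (trans (Listₚ.length-++ w) (sym (Listₚ.length-++ w))) l))
    gap-small : ∀ e₀ → IsZ e₀ → Val 0 (gapK (zE t e₀) (zE t (suc x , q)))
    gap-small (zero , q₀) refl = Val-gap t 0 (suc x) q₀ q (λ ())
    sw≡ : swap0 (vals V') (length w) ≡ vals (w ++ (suc x , q) ∷ e₀ ∷ r)
    sw≡ = trans (cong₂ swap0 (trans (cong vals (Listₚ.++-assoc w (e₀ ∷ []) ((suc x , q) ∷ r))) (vals-++ w _)) (sym (Listₚ.length-map proj₁ w))) (trans (swap0-split (vals w) (proj₁ e₀) (suc x) (vals r)) (sym (vals-++ w _)))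

-- The coefficients of J_T (ε = 1) and J'_T (ε = −1): a product over the inversions of v

module Weights (ε : K) (ε² : ε ⊛ ε ≈ 1f) (Val-ε : Val 1 ε)
  (ε-lin : ∀ n c → n ≢ ℤ.+ 0 → ∃[ n' ] ∃[ c' ] (n' ≢ ℤ.+ 0 × 1f ⊕ ε ⊛ lin n c ≈ lin n' c')) where

  -- With δ = ζ[i] - ζ[i+1] at the source of an edge between different values, ε = 1 gives the
  -- factor of 𝓔. For ε = -1 it is the factor of 𝓕: there ζ is taken at the target, where the
  -- difference is -δ, and -(-δ)/(1 - δ) = δ/(1 - δ).
  hh : K → K
  hh δ = δ ⊛ inv (1f ⊕ ε ⊛ δ)

  record Slope (δ : K) : Set where
    constructor slope
    field
      δ≉0   : δ ≉ 0f
      den≉0 : 1f ⊕ ε ⊛ δ ≉ 0f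
      Val-i : Val 0 (inv (1f ⊕ ε ⊛ δ))
  open Slope public

  slope-zE : ∀ t {x y} q q' → x ≢ y → Slope (zE t (y , q') ⊖ᶠ zE t (x , q))
  slope-zE t {x} {y} q q' ne = let (n' , c' , nz , e) = ε-lin n c nz₀ in
    slope (zE-apart-val t q q' ne) (λ h → lin≉0 c' nz (≈-trans (≈-sym e) (≈-trans (⊕-congˡ (⊛-congˡ (≈-sym d≈))) h)))
      (Val-resp {0} (inv-cong (≈-trans (≈-sym e) (⊕-congˡ (⊛-congˡ (≈-sym d≈))))) (Val-inv-lin c' nz))
    where
    n c : ℤ
    n = ℤ.+ y ℤ.- ℤ.+ x
    c = ct t q' ℤ.- ct t q
    nz₀ : n ≢ ℤ.+ 0
    nz₀ e = ne (sym (ℤₚ.+-injective (ℤₚ.i-j≡0⇒i≡j (ℤ.+ y) (ℤ.+ x) e)))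
    d≈ : zE t (y , q') ⊖ᶠ zE t (x , q) ≈ lin n c
    d≈ = ≈-trans (zE-diff t x q y q') (≡⇒≈ (sym (lin-def n c)))

  hh≉0 : ∀ {δ} → Slope δ → hh δ ≉ 0f
  hh≉0 s = ⊛-nonzero (δ≉0 s) (inv-nonzero (den≉0 s))

  -- Written this way, `hh δ` is visibly regular at infinity: although δ has a pole there, the
  -- inverse on the left vanishes.
  hh-alt : ∀ {δ} → Slope δ → 1f ⊖ᶠ inv (1f ⊕ ε ⊛ δ) ≈ ε ⊛ hh δ
  hh-alt {δ} s = ≈-trans (⊕-congʳ (≈-sym (inv-right (den≉0 s)))) (≈-trans (⊕-congˡ (⊝-cong (≈-sym (KRing.*-identityˡ _))))
    (KS.solve 4 (λ o e d i → (o KS.:+ e KS.:* d) KS.:* i KS.:+ KS.:- (o KS.:* i) KS.:= e KS.:* (d KS.:* i)) ≈-refl 1f ε δ (inv (1f ⊕ ε ⊛ δ))))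

  Val-hh : ∀ {δ} → Slope δ → Val 1 (hh δ)
  Val-hh {δ} s = Val-resp {1} (≈-trans (⊛-congˡ (hh-alt s)) (≈-trans (≈-sym (KRing.*-assoc ε ε _)) (≈-trans (⊛-congʳ ε²) (KRing.*-identityˡ _))))
    (Val-⊛ {1} Val-ε (Val-⊕ {1} Val-1 (Val-⊝ {1} (Val-weaken (Val-i s)))))

  module _ (t : List ℕ) where

    pairW : Ent → Ent → K
    pairW e e' = if proj₁ e' <ᵇ proj₁ e then hh (zE t e' ⊖ᶠ zE t e) else 1f

    rowW : Ent → List Ent → K
    rowW e [] = 1f
    rowW e (e' ∷ V) = pairW e e' ⊛ rowW e V

    weight : List Ent → K
    weight [] = 1f
    weight (e ∷ V) = rowW e V ⊛ weight V

    rowW-swap : ∀ e u a b r → rowW e (u ++ a ∷ b ∷ r) ≈ rowW e (u ++ b ∷ a ∷ r)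
    rowW-swap e [] a b r = KS.solve 3 (λ x y z → x KS.:* (y KS.:* z) KS.:= y KS.:* (x KS.:* z)) ≈-refl (pairW e a) (pairW e b) (rowW e r)
    rowW-swap e (c ∷ u) a b r = ⊛-congˡ (rowW-swap e u a b r)

    -- Ranks travel with the values, so the exchange creates one inversion and leaves the factors of
    -- all other pairs as they are.
    weight-swap : ∀ u e e' r → proj₁ e < proj₁ e' → weight (u ++ e' ∷ e ∷ r) ≈ hh (zE t e ⊖ᶠ zE t e') ⊛ weight (u ++ e ∷ e' ∷ r)
    weight-swap [] e e' r lt rewrite <ᵇ-true lt | <ᵇ-false (ℕₚ.<⇒≤ lt) =
      ≈-trans (KS.solve 4 (λ h x y w → (h KS.:* x) KS.:* (y KS.:* w) KS.:= h KS.:* (y KS.:* (x KS.:* w))) ≈-refl (hh (zE t e ⊖ᶠ zE t e')) (rowW e' r) (rowW e r) (weight r))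
        (⊛-congˡ (⊛-congʳ (≈-sym (KRing.*-identityˡ _))))
    weight-swap (c ∷ u) e e' r lt = ≈-trans (⊛-cong (rowW-swap c u e' e r) (weight-swap u e e' r lt))
      (KS.solve 3 (λ a h w → a KS.:* (h KS.:* w) KS.:= h KS.:* (a KS.:* w)) ≈-refl (rowW c (u ++ e ∷ e' ∷ r)) (hh (zE t e ⊖ᶠ zE t e')) (weight (u ++ e ∷ e' ∷ r)))

    pairW-nonzero : ∀ e e' → pairW e e' ≉ 0f
    pairW-nonzero (x , q) (y , q') with y <ᵇ x in h
    ... | true = hh≉0 (slope-zE t q q' (ℕₚ.<⇒≢ (<ᵇ⇒< {y} {x} h) ∘ sym))
    ... | false = 1≉0

    Val-pairW : ∀ e e' → Val 1 (pairW e e')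
    Val-pairW (x , q) (y , q') with y <ᵇ x in h
    ... | true = Val-hh (slope-zE t q q' (ℕₚ.<⇒≢ (<ᵇ⇒< {y} {x} h) ∘ sym))
    ... | false = Val-1

    rowW-nonzero : ∀ e V → rowW e V ≉ 0f
    rowW-nonzero e [] = 1≉0
    rowW-nonzero e (e' ∷ V) = ⊛-nonzero (pairW-nonzero e e') (rowW-nonzero e V)

    weight-nonzero : ∀ V → weight V ≉ 0f
    weight-nonzero [] = 1≉0
    weight-nonzero (e ∷ V) = ⊛-nonzero (rowW-nonzero e V) (weight-nonzero V)

    Val-rowW : ∀ e V → Val 1 (rowW e V)
    Val-rowW e [] = Val-1
    Val-rowW e (e' ∷ V) = Val-⊛ {1} (Val-pairW e e') (Val-rowW e V)

    Val-weight : ∀ V → Val 1 (weight V)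
    Val-weight [] = Val-1
    Val-weight (e ∷ V) = Val-⊛ {1} (Val-rowW e V) (Val-weight V)

    weight-increasing : ∀ V → AllPairs _≤_ (vals V) → weight V ≈ 1f
    weight-increasing [] _ = ≈-refl
    weight-increasing (e ∷ V) (h ∷ hs) = ≈-trans (⊛-cong (row-one V h) (weight-increasing V hs)) (KRing.*-identityˡ 1f)
      where
      row-one : ∀ V → All (proj₁ e ≤_) (vals V) → rowW e V ≈ 1f
      row-one [] _ = ≈-refl
      row-one (e' ∷ V) (le ∷ les) = ≈-trans (⊛-cong (≡⇒≈ (if-false (<ᵇ-false le))) (row-one V les)) (KRing.*-identityˡ 1f)

  -- T(e J + e' J') = ε (e J + e' J') when e' = h e and J' = T J + g J, with a = J, b = T J at a point
  pair-identity : ∀ {δ g e e' a b} → Slope δ → g ⊛ δ ≈ ⊝ 1f → e' ≈ hh δ ⊛ e →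
    (e ⊛ b ⊖ᶠ ε ⊛ (e ⊛ a)) ⊕ (e' ⊛ (a ⊕ g ⊛ b) ⊖ᶠ ε ⊛ (e' ⊛ (b ⊕ g ⊛ a))) ≈ 0f
  pair-identity {δ} {g} {e} {e'} {a} {b} s gδ e'≈ = ≈-trans (⊕-congˡ (⊖ᶠ-cong (⊛-congʳ e'≈) (⊛-congˡ (⊛-congʳ e'≈))))
    (≈-trans (KS.solve 8 (λ e h g a b E i o →
        (e KS.:* b KS.:- E KS.:* (e KS.:* a)) KS.:+ ((h KS.:* e) KS.:* (a KS.:+ g KS.:* b) KS.:- E KS.:* ((h KS.:* e) KS.:* (b KS.:+ g KS.:* a)))
        KS.:= (e KS.:* (b KS.:- E KS.:* a)) KS.:* (h KS.:* g KS.:- KS.:- i) KS.:+ ((e KS.:* (b KS.:- E KS.:* a)) KS.:* ((o KS.:- i) KS.:- E KS.:* h)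
           KS.:+ ((e KS.:* (b KS.:- E KS.:* a) KS.:- (o KS.:* (e KS.:* (b KS.:- E KS.:* a)))) KS.:+ (o KS.:- E KS.:* E) KS.:* (h KS.:* (e KS.:* a))
             KS.:+ ((h KS.:* (e KS.:* a)) KS.:- o KS.:* (h KS.:* (e KS.:* a)))))) ≈-refl e h g a b ε i 1f)
    (⊕-zero (⊛-zeroʳ (≈⇒⊖ᶠ-zero hg)) (⊕-zero (⊛-zeroʳ (≈⇒⊖ᶠ-zero (hh-alt s))) (⊕-zero (⊕-zero (≈⇒⊖ᶠ-zero (≈-sym (KRing.*-identityˡ _))) (⊛-zeroˡ (≈⇒⊖ᶠ-zero (≈-sym ε²)))) (≈⇒⊖ᶠ-zero (≈-sym (KRing.*-identityˡ _)))))))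
    where
    i h : K
    i = inv (1f ⊕ ε ⊛ δ)
    h = hh δ
    hg : h ⊛ g ≈ ⊝ i
    hg = ≈-trans (KS.solve 3 (λ d i g → (d KS.:* i) KS.:* g KS.:= (g KS.:* d) KS.:* i) ≈-refl δ i g) (≈-trans (⊛-congʳ gδ) (≈-trans (KS.solve 2 (λ o i → (KS.:- o) KS.:* i KS.:= KS.:- (o KS.:* i)) ≈-refl 1f i) (⊝-cong (KRing.*-identityˡ i))))

-- Decreasing rearrangement

insertDesc-count : ∀ c x s → count c (insertDesc x s) ≡ count c (x ∷ s)
insertDesc-count c x [] = refl
insertDesc-count c x (y ∷ s) with y ≤ᵇ x
... | true = refl
... | false = trans (count-++-cong c (y ∷ []) (insertDesc-count c x s)) (count-swap c y x s)

vplus-count : ∀ c v → count c (vplus v) ≡ count c v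
vplus-count c [] = refl
vplus-count c (x ∷ v) = trans (insertDesc-count c x (vplus v)) (count-++-cong c (x ∷ []) (vplus-count c v))

insertDesc-length : ∀ x s → length (insertDesc x s) ≡ suc (length s)
insertDesc-length x [] = refl
insertDesc-length x (y ∷ s) with y ≤ᵇ x
... | true = refl
... | false = cong suc (insertDesc-length x s)

vplus-length : ∀ v → length (vplus v) ≡ length v
vplus-length [] = refl
vplus-length (x ∷ v) = trans (insertDesc-length x (vplus v)) (cong suc (vplus-length v))

insertDesc-sum : ∀ x s → sum (insertDesc x s) ≡ x + sum s
insertDesc-sum x [] = refl
insertDesc-sum x (y ∷ s) with y ≤ᵇ x
... | true = refl
... | false = trans (cong (y ℕ.+_) (insertDesc-sum x s)) (exch y x (sum s))

vplus-sum : ∀ v → sum (vplus v) ≡ sum v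
vplus-sum [] = refl
vplus-sum (x ∷ v) = trans (insertDesc-sum x (vplus v)) (cong (x ℕ.+_) (vplus-sum v))

insertDesc-gtc : ∀ c x s → gtc c (insertDesc x s) ≡ gtc c (x ∷ s)
insertDesc-gtc c x [] = refl
insertDesc-gtc c x (y ∷ s) with y ≤ᵇ x
... | true = refl
... | false = trans (cong (ind (c <ᵇ y) ℕ.+_) (insertDesc-gtc c x s)) (exch (ind (c <ᵇ y)) (ind (c <ᵇ x)) (gtc c s))

vplus-gtc : ∀ c v → gtc c (vplus v) ≡ gtc c v
vplus-gtc c [] = refl
vplus-gtc c (x ∷ v) = trans (insertDesc-gtc c x (vplus v)) (cong (ind (c <ᵇ x) ℕ.+_) (vplus-gtc c v))

vplus-gec : ∀ c v → gec c (vplus v) ≡ gec c v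
vplus-gec zero v = trans (gec-zero (vplus v)) (trans (vplus-length v) (sym (gec-zero v)))
vplus-gec (suc c) v = trans (gec-suc c (vplus v)) (trans (vplus-gtc c v) (sym (gec-suc c v)))

≤ᵇ-true⇒ : ∀ {x y} → (x ≤ᵇ y) ≡ true → x ≤ y
≤ᵇ-true⇒ {x} {y} e = ℕₚ.≤ᵇ⇒≤ x y (subst T (sym e) tt)

≤ᵇ-false⇒ : ∀ {x y} → (x ≤ᵇ y) ≡ false → y < x
≤ᵇ-false⇒ {x} {y} e with x ℕ.≤? y
... | no h = ℕₚ.≰⇒> h
... | yes le with trans (sym e) (≤ᵇ-true le)
... | ()

insertDesc-All : ∀ {P : ℕ → Set} x s → P x → All P s → All P (insertDesc x s)
insertDesc-All x [] p [] = p ∷ []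
insertDesc-All x (y ∷ s) p (q ∷ qs) with y ≤ᵇ x
... | true = p ∷ q ∷ qs
... | false = q ∷ insertDesc-All x s p qs

insertDesc-Desc : ∀ x s → Desc s → Desc (insertDesc x s)
insertDesc-Desc x [] [] = [] ∷ []
insertDesc-Desc x (y ∷ s) (h ∷ hs) with y ≤ᵇ x in e
... | true = (≤ᵇ-true⇒ {y} {x} e ∷ All.map (λ le → ℕₚ.≤-trans le (≤ᵇ-true⇒ {y} {x} e)) h) ∷ h ∷ hs
... | false = insertDesc-All x s (ℕₚ.<⇒≤ (≤ᵇ-false⇒ {y} {x} e)) h ∷ insertDesc-Desc x s hs

vplus-Desc : ∀ v → Desc (vplus v)
vplus-Desc [] = []
vplus-Desc (x ∷ v) = insertDesc-Desc x (vplus v) (vplus-Desc v)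

Ordered-unique : ∀ {R : ℕ → ℕ → Set} → (∀ {x y} → R x y → R y x → x ≡ y) → ∀ {a b} → AllPairs R a → AllPairs R b → (∀ c → count c a ≡ count c b) → a ≡ b
Ordered-unique anti {[]} {[]} _ _ _ = refl
Ordered-unique anti {[]} {y ∷ b} _ _ h = ⊥-elim (ℕₚ.0≢1+n (trans (h y) (count-same y b)))
Ordered-unique anti {x ∷ a} {[]} _ _ h = ⊥-elim (ℕₚ.0≢1+n (sym (trans (sym (count-same x a)) (h x))))
Ordered-unique {R} anti {x ∷ a} {y ∷ b} (ha ∷ as) (hb ∷ bs) h = cong₂ _∷_ x≡y (Ordered-unique anti as bs tails)
  where
  occurs : ∀ {z c cs} → count z (c ∷ cs) ≢ 0 → z ≡ c ⊎ z ∈ cs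
  occurs {z} {c} {cs} ne with z ℕ.≟ c
  ... | yes e = inj₁ e
  ... | no n with count-∈ id z cs (λ e → ne (trans (count-diff cs n) (trans (cong (count z) (sym (Listₚ.map-id cs))) e)))
  ... | w , m , refl = inj₂ m
  x≡y : x ≡ y
  x≡y with occurs {x} {y} {b} (λ e → ℕₚ.0≢1+n (trans (sym e) (trans (sym (h x)) (count-same x a)))) | occurs {y} {x} {a} (λ e → ℕₚ.0≢1+n (trans (sym e) (trans (h y) (count-same y b))))
  ... | inj₁ e | _ = e
  ... | _ | inj₁ e = sym e
  ... | inj₂ m | inj₂ m' = anti (All.lookup ha m') (All.lookup hb m)
  tails : ∀ c → count c a ≡ count c b
  tails c with trans (sym (count-∷ c x a)) (trans (h c) (trans (cong (λ z → count c (z ∷ b)) (sym x≡y)) (count-∷ c x b)))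
  ... | e = ℕₚ.+-cancelˡ-≡ (count c (x ∷ [])) _ _ e

Desc-unique : ∀ {a b} → Desc a → Desc b → (∀ c → count c a ≡ count c b) → a ≡ b
Desc-unique = Ordered-unique (λ p q → ℕₚ.≤-antisym q p)

vplus-cong : ∀ {v v'} → (∀ c → count c v ≡ count c v') → vplus v ≡ vplus v'
vplus-cong {v} {v'} h = Desc-unique (vplus-Desc v) (vplus-Desc v') (λ c → trans (vplus-count c v) (trans (h c) (sym (vplus-count c v'))))

vplus-Desc-id : ∀ {v} → Desc v → vplus v ≡ v
vplus-Desc-id {v} d = Desc-unique (vplus-Desc v) d (λ c → vplus-count c v)

-- In a decreasing list the copies of `x` fill the interval from the number of larger to the number
-- of larger or equal entries. This identifies v[i] with the entry of v⁺ at the rank of i.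
Desc-rank : ∀ {x n} s → Desc s → gtc x s ≤ n → n < gec x s → idx0 s n ≡ x
Desc-rank [] d lo ()
Desc-rank {x} {n} (y ∷ s) (h ∷ d) lo hi with ℕₚ.<-cmp x y
Desc-rank {x} {zero} (y ∷ s) (h ∷ d) lo hi | tri< lt _ _ rewrite <ᵇ-true lt = ⊥-elim (ℕₚ.<⇒≱ lo z≤n)
Desc-rank {x} {suc n} (y ∷ s) (h ∷ d) lo hi | tri< lt _ _ rewrite <ᵇ-true lt | ≤ᵇ-true (ℕₚ.<⇒≤ lt) = Desc-rank s d (ℕₚ.≤-pred lo) (ℕₚ.≤-pred hi)
Desc-rank {x} {zero} (y ∷ s) (h ∷ d) lo hi | tri≈ _ e _ = sym e
Desc-rank {x} {suc n} (y ∷ s) (h ∷ d) lo hi | tri≈ _ refl _ rewrite <ᵇ-false (ℕₚ.≤-refl {x}) | ≤ᵇ-true (ℕₚ.≤-refl {x}) = Desc-rank s d (ℕₚ.≤-trans (ℕₚ.≤-reflexive (none s h)) z≤n) (ℕₚ.≤-pred hi)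
  where
  none : ∀ s → All (x ≥′_) s → gtc x s ≡ 0
  none [] [] = refl
  none (z ∷ s) (le ∷ les) rewrite <ᵇ-false le = none s les
Desc-rank {x} {n} (y ∷ s) (h ∷ d) lo hi | tri> _ _ gt = ⊥-elim (ℕₚ.<⇒≱ hi (ℕₚ.≤-trans (ℕₚ.≤-reflexive (none (y ∷ s) (gt ∷ All.map (λ le → ℕₚ.≤-<-trans le gt) h))) z≤n))
  where
  none : ∀ s → All (ℕ._< x) s → gec x s ≡ 0
  none [] [] = refl
  none (z ∷ s) (lt ∷ lts) rewrite ≤ᵇ-false lt = none s lts

length-LT : ∀ T t → length (LT T t) ≡ length t
length-LT T [] = refl
length-LT T (x ∷ t) = cong suc (length-LT T t)

idx0-LT : ∀ T u x r → idx0 (LT T (u ++ x ∷ r)) (length u) ≡ T (suc x) (suc (count x r))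
idx0-LT T [] x r = refl
idx0-LT T (_ ∷ u) x r = idx0-LT T u x r

idx0-LT-reverse : ∀ T t p → p < length t → T (rowOf (reverse t) (suc p)) (colOf (reverse t) (suc p)) ≡ idx0 (LT T t) p
idx0-LT-reverse T t p lt with split₁ t p lt
... | u , x , r , refl , refl = trans (cong₂ T (rowOf-reverse u x r) (colOf-reverse u x r)) (sym (idx0-LT T u x r))

foldr-∧⇒ : ∀ {A : Set} (g : A → Bool) xs → foldr (λ i b → g i ∧ b) true xs ≡ true → ∀ {x} → x ∈ xs → g x ≡ true
foldr-∧⇒ g (x ∷ xs) e (here refl) = proj₁ (∧-true {g x} e)
foldr-∧⇒ g (x ∷ xs) e (there m) = foldr-∧⇒ g xs (proj₂ (∧-true {g x} e)) m

⇒foldr-∧ : ∀ {A : Set} (g : A → Bool) xs → (∀ {x} → x ∈ xs → g x ≡ true) → foldr (λ i b → g i ∧ b) true xs ≡ true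
⇒foldr-∧ g [] h = refl
⇒foldr-∧ g (x ∷ xs) h = cong₂ _∧_ (h (here refl)) (⇒foldr-∧ g xs (h ∘ there))

labelOK⇒ : ∀ T w v → length w ≡ length v → labelOK T (w , v) ≡ true → vplus v ≡ LT T (reverse w)
labelOK⇒ T w v l e = idx0-ext (vplus v) (LT T (reverse w)) (trans (vplus-length v) (trans (sym l) (sym lw)))
  (λ p lt → trans (≡ᵇ⇒≡ {idx0 (vplus v) p} (foldr-∧⇒ (λ i → at (vplus v) i ≡ᵇ T (rowOf w i) (colOf w i)) (oneTo (length w)) e (oneTo-∈ (subst (p ℕ.<_) lw lt))))
    (trans (cong (λ z → T (rowOf z (suc p)) (colOf z (suc p))) (sym (Listₚ.reverse-involutive w))) (idx0-LT-reverse T (reverse w) p (subst (p ℕ.<_) (length-LT T (reverse w)) lt))))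
  where
  lw : length (LT T (reverse w)) ≡ length w
  lw = trans (length-LT T (reverse w)) (Listₚ.length-reverse w)

⇒labelOK : ∀ T w v → vplus v ≡ LT T (reverse w) → labelOK T (w , v) ≡ true
⇒labelOK T w v e = ⇒foldr-∧ (λ i → at (vplus v) i ≡ᵇ T (rowOf w i) (colOf w i)) (oneTo (length w)) go
  where
  go : ∀ {i} → i ∈ oneTo (length w) → (at (vplus v) i ≡ᵇ T (rowOf w i) (colOf w i)) ≡ true
  go m with ∈-oneTo m
  ... | p , refl , lt = trans (cong₂ _≡ᵇ_ (cong (λ s → idx0 s p) e) (trans (cong (λ z → T (rowOf z (suc p)) (colOf z (suc p))) (sym (Listₚ.reverse-involutive w))) (idx0-LT-reverse T (reverse w) p (subst (p ℕ.<_) (sym (Listₚ.length-reverse w)) lt)))) (≡ᵇ-refl (idx0 (LT T (reverse w)) p))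

-- Propagation of the coefficients along the edges

edgeTo⇒ : ∀ k i k' → edgeTo k i k' ≡ true → edge k i ≡ just k'
edgeTo⇒ k i k' e with edge k i
... | just k'' = cong just (eqKey⇒≡ {k''} e)

⇒edgeTo : ∀ k i k' → edge k i ≡ just k' → edgeTo k i k' ≡ true
⇒edgeTo k i k' e with edge k i
⇒edgeTo k i k' refl | just .k' = eqKey-refl k'

Assoc : Set
Assoc = List (Vtx × K)

Covers : Assoc → Key → Set
Covers ac k = Any (λ p → vkey (proj₁ p) ≡ k) ac

lookupVal⇒ : ∀ k ac {e} → lookupVal k ac ≡ just e → ∃[ u ] ((u , e) ∈ ac × vkey u ≡ k)
lookupVal⇒ k (p ∷ ac) h with eqKey (vkey (proj₁ p)) k in eq
lookupVal⇒ k (p ∷ ac) refl | true = proj₁ p , here refl , eqKey⇒≡ {vkey (proj₁ p)} eq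
lookupVal⇒ k (p ∷ ac) h | false with lookupVal⇒ k ac h
... | u , m , e = u , there m , e

Covers⇒lookup : ∀ {k ac} → Covers ac k → ∃[ e ] lookupVal k ac ≡ just e
Covers⇒lookup {k} {p ∷ ac} c with eqKey (vkey (proj₁ p)) k in eq
Covers⇒lookup {k} {p ∷ ac} c | true = proj₂ p , refl
Covers⇒lookup {k} {p ∷ ac} (here refl) | false with trans (sym eq) (eqKey-refl (vkey (proj₁ p)))
... | ()
Covers⇒lookup {k} {p ∷ ac} (there c) | false = Covers⇒lookup c

lookup-nothing : ∀ k ac → lookupVal k ac ≡ nothing → All (λ p → vkey (proj₁ p) ≢ k) ac
lookup-nothing k [] h = []
lookup-nothing k (p ∷ ac) h with eqKey (vkey (proj₁ p)) k in eq
lookup-nothing k (p ∷ ac) () | true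
lookup-nothing k (p ∷ ac) h | false = (λ { refl → contr (trans (sym eq) (eqKey-refl (vkey (proj₁ p)))) }) ∷ lookup-nothing k ac h
  where
  contr : false ≢ true
  contr ()

firstJust⇒ : ∀ {A : Set} (xs : List (Maybe A)) {e} → firstJust xs ≡ just e → just e ∈ xs
firstJust⇒ (just x ∷ xs) refl = here refl
firstJust⇒ (nothing ∷ xs) h = there (firstJust⇒ xs h)

⇒firstJust : ∀ {A : Set} {xs : List (Maybe A)} {e} → just e ∈ xs → ∃[ e' ] firstJust xs ≡ just e'
⇒firstJust {xs = just x ∷ xs} m = x , refl
⇒firstJust {xs = nothing ∷ xs} (there m) = ⇒firstJust m

-- names for the local functions of findVal and propRound, recovered by unification
module LocalNames (N : ℕ) (f : Factor) (hv : List Vtx) where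

  private
    capture₂ : ∀ {ac t} {F G : Vtx → ℕ → Maybe K} → findVal N f hv ac t ≡ firstJust (concatMap (λ u → concatMap (λ i → F u i ∷ G u i ∷ []) (oneTo (N ∸ 1))) hv) →
      (Vtx → ℕ → Maybe K) × (Vtx → ℕ → Maybe K)
    capture₂ {F = F} {G} _ = F , G

    captureS : ∀ {ac} {g : Assoc → Vtx → Assoc} → propRound N f hv ac ≡ foldl g ac hv → Assoc → Vtx → Assoc
    captureS {g = g} _ = g

  fwdOf bwdOf : Assoc → Vtx → Vtx → ℕ → Maybe K
  fwdOf ac t = proj₁ (capture₂ {ac} {t} (refl {x = findVal N f hv ac t}))
  bwdOf ac t = proj₂ (capture₂ {ac} {t} (refl {x = findVal N f hv ac t}))

  stepOf : Assoc → Assoc → Vtx → Assoc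
  stepOf ac = captureS {ac} (refl {x = propRound N f hv ac})

  fwd⇒ : ∀ ac t u i {e} → fwdOf ac t u i ≡ just e → ∃[ e' ] (edgeTo (vkey u) i (vkey t) ≡ true × lookupVal (vkey u) ac ≡ just e' × e ≡ f u i t *K e')
  fwd⇒ ac t u i h with edgeTo (vkey u) i (vkey t) | lookupVal (vkey u) ac
  fwd⇒ ac t u i refl | true | just e' = e' , refl , refl , refl

  bwd⇒ : ∀ ac t u i {e} → bwdOf ac t u i ≡ just e → ∃[ e' ] (edgeTo (vkey t) i (vkey u) ≡ true × lookupVal (vkey u) ac ≡ just e' × e ≡ invK (f t i u) *K e')
  bwd⇒ ac t u i h with edgeTo (vkey t) i (vkey u) | lookupVal (vkey u) ac
  bwd⇒ ac t u i refl | true | just e' = e' , refl , refl , refl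

  ⇒fwd : ∀ ac t u i {e} → edgeTo (vkey u) i (vkey t) ≡ true → lookupVal (vkey u) ac ≡ just e → ∃[ e' ] fwdOf ac t u i ≡ just e'
  ⇒fwd ac t u i h h' with edgeTo (vkey u) i (vkey t) | lookupVal (vkey u) ac
  ⇒fwd ac t u i refl refl | true | just e = _ , refl

  ⇒bwd : ∀ ac t u i {e} → edgeTo (vkey t) i (vkey u) ≡ true → lookupVal (vkey u) ac ≡ just e → ∃[ e' ] bwdOf ac t u i ≡ just e'
  ⇒bwd ac t u i h h' with edgeTo (vkey t) i (vkey u) | lookupVal (vkey u) ac
  ⇒bwd ac t u i refl refl | true | just e = _ , refl

  Neighbour : Vtx → Vtx → Set
  Neighbour t u = ∃[ i ] (i ∈ oneTo (N ∸ 1) × (edgeTo (vkey u) i (vkey t) ≡ true ⊎ edgeTo (vkey t) i (vkey u) ≡ true))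

  private
    options : Assoc → Vtx → Vtx → List (Maybe K)
    options ac t u = concatMap (λ i → fwdOf ac t u i ∷ bwdOf ac t u i ∷ []) (oneTo (N ∸ 1))

  findVal⇒ : ∀ ac t {e} → findVal N f hv ac t ≡ just e → ∃[ u ] ∃[ i ] (u ∈ hv × i ∈ oneTo (N ∸ 1) × (fwdOf ac t u i ≡ just e ⊎ bwdOf ac t u i ≡ just e))
  findVal⇒ ac t {e} h with find-concat (options ac t) hv (firstJust⇒ _ h)
    where
    find-concat : ∀ {A B : Set} (g : A → List B) xs {y} → y ∈ concatMap g xs → ∃[ x ] (x ∈ xs × y ∈ g x)
    find-concat g (x ∷ xs) m with Memₚ.∈-++⁻ (g x) m
    ... | inj₁ m' = x , here refl , m'
    ... | inj₂ m' = let (x' , xm , ym) = find-concat g xs m' in x' , there xm , ym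
  ... | u , um , m with find-inner (oneTo (N ∸ 1)) m
    where
    find-inner : ∀ is → just e ∈ concatMap (λ i → fwdOf ac t u i ∷ bwdOf ac t u i ∷ []) is → ∃[ i ] (i ∈ is × (fwdOf ac t u i ≡ just e ⊎ bwdOf ac t u i ≡ just e))
    find-inner (i ∷ is) (here e) = i , here refl , inj₁ (sym e)
    find-inner (i ∷ is) (there (here e)) = i , here refl , inj₂ (sym e)
    find-inner (i ∷ is) (there (there m)) = let (j , jm , h) = find-inner is m in j , there jm , h
  ... | i , im , h' = u , i , um , im , h'

  ⇒findVal : ∀ ac t u → u ∈ hv → Neighbour t u → Covers ac (vkey u) → ∃[ e ] findVal N f hv ac t ≡ just e
  ⇒findVal ac t u um (i , im , ed) c with Covers⇒lookup c
  ... | e , le = ⇒firstJust (proj₂ (member (opt ed)))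
    where
    opt : edgeTo (vkey u) i (vkey t) ≡ true ⊎ edgeTo (vkey t) i (vkey u) ≡ true → ∃[ e' ] (fwdOf ac t u i ≡ just e' ⊎ bwdOf ac t u i ≡ just e')
    opt (inj₁ h) = let (e' , q) = ⇒fwd ac t u i h le in e' , inj₁ q
    opt (inj₂ h) = let (e' , q) = ⇒bwd ac t u i h le in e' , inj₂ q
    ∈-concatMap : ∀ {A B : Set} (g : A → List B) {xs x y} → x ∈ xs → y ∈ g x → y ∈ concatMap g xs
    ∈-concatMap g {x ∷ xs} (here refl) m = Memₚ.∈-++⁺ˡ m
    ∈-concatMap g {x ∷ xs} (there xm) m = Memₚ.∈-++⁺ʳ (g x) (∈-concatMap g xm m)
    member : ∃[ e' ] (fwdOf ac t u i ≡ just e' ⊎ bwdOf ac t u i ≡ just e') → ∃[ e' ] (just e' ∈ concatMap (options ac t) hv)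
    member (e' , inj₁ q) = e' , ∈-concatMap (options ac t) um (∈-concatMap (λ i → fwdOf ac t u i ∷ bwdOf ac t u i ∷ []) im (here (sym q)))
    member (e' , inj₂ q) = e' , ∈-concatMap (options ac t) um (∈-concatMap (λ i → fwdOf ac t u i ∷ bwdOf ac t u i ∷ []) im (there (here (sym q))))

  data StepView (ac₀ ac : Assoc) (t : Vtx) : Set where
    known : ∀ {e} → lookupVal (vkey t) ac ≡ just e → stepOf ac₀ ac t ≡ ac → StepView ac₀ ac t
    added : ∀ {e} → lookupVal (vkey t) ac ≡ nothing → findVal N f hv ac t ≡ just e → stepOf ac₀ ac t ≡ ac ++ ((t , e) ∷ []) → StepView ac₀ ac t
    stuck : findVal N f hv ac t ≡ nothing → stepOf ac₀ ac t ≡ ac → StepView ac₀ ac t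

  stepView : ∀ ac₀ ac t → StepView ac₀ ac t
  stepView ac₀ ac t = go (lookupVal (vkey t) ac) refl (findVal N f hv ac t) refl
    where
    s-just : ∀ {e} → lookupVal (vkey t) ac ≡ just e → stepOf ac₀ ac t ≡ ac
    s-just h with lookupVal (vkey t) ac
    s-just refl | just _ = refl
    s-add : ∀ {e} → lookupVal (vkey t) ac ≡ nothing → findVal N f hv ac t ≡ just e → stepOf ac₀ ac t ≡ ac ++ ((t , e) ∷ [])
    s-add h h' with lookupVal (vkey t) ac
    s-add refl h' | nothing with findVal N f hv ac t
    s-add refl refl | nothing | just e = refl
    s-not : lookupVal (vkey t) ac ≡ nothing → findVal N f hv ac t ≡ nothing → stepOf ac₀ ac t ≡ ac
    s-not h h' with lookupVal (vkey t) ac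
    s-not refl h' | nothing with findVal N f hv ac t
    s-not refl refl | nothing | nothing = refl
    go : ∀ l → lookupVal (vkey t) ac ≡ l → ∀ r → findVal N f hv ac t ≡ r → StepView ac₀ ac t
    go (just e) h r h' = known h (s-just h)
    go nothing h (just e) h' = added h h' (s-add h h')
    go nothing h nothing h' = stuck h' (s-not h h')

module SortAsc = Sorting (λ x y → y <ᵇ x) (λ {x} {y} → <ᵇ-asym {y} {x})

idx0-mid₂ : ∀ a y z b → idx0 (a ++ y ∷ z ∷ b) (suc (length a)) ≡ z
idx0-mid₂ [] y z b = refl
idx0-mid₂ (_ ∷ a) y z b = idx0-mid₂ a y z b

rise-edge : ∀ w a y z b → y < z → edge (w , a ++ y ∷ z ∷ b) (suc (length a)) ≡ just (w , a ++ z ∷ y ∷ b)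
rise-edge w a y z b lt = trans (if-true (trans (cong₂ _<ᵇ_ (idx0-mid a y (z ∷ b)) (idx0-mid₂ a y z b)) (<ᵇ-true lt))) (cong (λ s → just (w , s)) (swap0-split a y z b))

anyL-false : ∀ {A : Set} (g : A → Bool) xs → (∀ {x} → x ∈ xs → g x ≡ false) → anyL g xs ≡ false
anyL-false g [] h = refl
anyL-false g (x ∷ xs) h = cong₂ _∨_ (h (here refl)) (anyL-false g xs (h ∘ there))

sourceOf-just : ∀ N hs hv {s} → s ∈ hs → (∀ {u i} → u ∈ hv → i ∈ oneTo (N ∸ 1) → edgeTo (vkey u) i (vkey s) ≡ false) →
  ∃[ s' ] (s' ∈ hs × foldr (λ s r → if anyL (λ u → anyL (λ i → edgeTo (vkey u) i (vkey s)) (oneTo (N ∸ 1))) hv then r else just s) nothing hs ≡ just s')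
sourceOf-just N (s ∷ hs) hv (here refl) h = s , here refl , if-false (anyL-false _ hv (λ um → anyL-false _ (oneTo (N ∸ 1)) (λ im → h um im)))
sourceOf-just N (s₀ ∷ hs) hv (there m) h with sourceOf-just N hs hv m h
... | s' , m' , e with anyL (λ u → anyL (λ i → edgeTo (vkey u) i (vkey s₀)) (oneTo (N ∸ 1))) hv
... | true = s' , there m' , e
... | false = s₀ , here refl , refl

coeffs-just : ∀ lam f T {s} → sourceOf (sum lam) (HT lam T) ≡ just s → coeffs lam f T ≡ propFuel (sum lam) f (HT lam T) (length (HT lam T)) ((s , 1K) ∷ [])
coeffs-just lam f T e with sourceOf (sum lam) (HT lam T)
coeffs-just lam f T refl | just s = refl

pos-in : ∀ {A : Set} (a : List A) y z b {n} → length (a ++ y ∷ z ∷ b) ≡ n → suc (length a) < n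
pos-in a y z b l = subst (suc (length a) ℕ.<_) l (subst (suc (length a) ℕ.<_) (sym (Listₚ.length-++ a)) (subst (suc (suc (length a)) ℕ.≤_) (trans (cong suc (sym (ℕₚ.+-suc (length a) (length b)))) (sym (ℕₚ.+-suc (length a) (suc (length b))))) (s≤s (s≤s (ℕₚ.m≤m+n _ _)))))

-- Sums over the rearrangements of T

Σv : (List ℕ → K) → List (List ℕ) → K
Σv g [] = 0f
Σv g (v ∷ vs) = g v ⊕ Σv g vs

Σv-split : ∀ g as x bs → Σv g (as ++ x ∷ bs) ≈ g x ⊕ Σv g (as ++ bs)
Σv-split g [] x bs = ≈-refl
Σv-split g (a ∷ as) x bs = ≈-trans (⊕-congˡ (Σv-split g as x bs)) (KS.solve 3 (λ a x s → a KS.:+ (x KS.:+ s) KS.:= x KS.:+ (a KS.:+ s)) ≈-refl (g a) (g x) (Σv g (as ++ bs)))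

Σv-unique : ∀ g {xs} ys → AllPairs _≢_ xs → AllPairs _≢_ ys → (∀ {x} → x ∈ xs → x ∈ ys) → (∀ {x} → x ∈ ys → x ∈ xs) → Σv g xs ≈ Σv g ys
Σv-unique g {[]} [] _ _ _ _ = ≈-refl
Σv-unique g {[]} (y ∷ ys) _ _ _ h with h (here refl)
... | ()
Σv-unique g {x ∷ xs} ys (nx ∷ ux) uy h h' with Memₚ.∈-∃++ (h (here refl))
... | as , bs , refl = ≈-trans (⊕-congˡ (Σv-unique g (as ++ bs) ux (drop-mid as uy) sub sup)) (≈-sym (Σv-split g as x bs))
  where
  drop-mid : ∀ {A : Set} {R : A → A → Set} as {x bs} → AllPairs R (as ++ x ∷ bs) → AllPairs R (as ++ bs)
  drop-mid [] (_ ∷ u) = u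
  drop-mid (a ∷ as) (r ∷ u) = rm as r ∷ drop-mid as u
    where
    rm : ∀ {P : _ → Set} as {x bs} → All P (as ++ x ∷ bs) → All P (as ++ bs)
    rm [] (_ ∷ p) = p
    rm (a ∷ as) (p ∷ ps) = p ∷ rm as ps
  sub : ∀ {y} → y ∈ xs → y ∈ as ++ bs
  sub {y} m with Memₚ.∈-++⁻ as (h (there m))
  ... | inj₁ a = Memₚ.∈-++⁺ˡ a
  ... | inj₂ (here refl) = ⊥-elim (All.lookup nx m refl)
  ... | inj₂ (there b) = Memₚ.∈-++⁺ʳ as b
  x∉ : ∀ as {y} → y ∈ as ++ bs → AllPairs _≢_ (as ++ x ∷ bs) → y ≢ x
  x∉ [] m (r ∷ _) e = All.lookup r m (sym e)
  x∉ (a ∷ as) (here refl) (r ∷ _) e = All.lookup r (Memₚ.∈-++⁺ʳ as (here refl)) e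
  x∉ (a ∷ as) (there m) (_ ∷ u) e = x∉ as m u e
  sup : ∀ {y} → y ∈ as ++ bs → y ∈ xs
  sup {y} m with h' (wk m)
    where
    wk : y ∈ as ++ bs → y ∈ as ++ x ∷ bs
    wk m with Memₚ.∈-++⁻ as m
    ... | inj₁ a = Memₚ.∈-++⁺ˡ a
    ... | inj₂ b = Memₚ.∈-++⁺ʳ as (there b)
  ... | here e = ⊥-elim (x∉ as m uy e)
  ... | there m' = m'

Σv-map : ∀ g (s : List ℕ → List ℕ) xs → Σv g (map s xs) ≡ Σv (g ∘ s) xs
Σv-map g s [] = refl
Σv-map g s (x ∷ xs) = cong (g (s x) ⊕_) (Σv-map g s xs)

Σv-neg : ∀ g h {xs} → (∀ {x} → x ∈ xs → h x ≈ ⊝ g x) → Σv h xs ≈ ⊝ Σv g xs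
Σv-neg g h {[]} e = ≈-sym (⊝-zero ≈-refl)
Σv-neg g h {x ∷ xs} e = ≈-trans (⊕-cong (e (here refl)) (Σv-neg g h (e ∘ there))) (KS.solve 2 (λ a b → (KS.:- a) KS.:+ (KS.:- b) KS.:= KS.:- (a KS.:+ b)) ≈-refl (g x) (Σv g xs))

-- Reindexing by the involution shows that the sum equals its negative, and 2 is invertible. Fixed
-- points of `s` need no separate treatment.
Σv-odd : ∀ g s {xs} → AllPairs _≢_ xs → (∀ v → s (s v) ≡ v) → (∀ {x} → x ∈ xs → s x ∈ xs) → (∀ {x} → x ∈ xs → g (s x) ≈ ⊝ g x) → Σv g xs ≈ 0f
Σv-odd g s {xs} u invol st odd = ⊛-cancelˡ 2≉0 (≈-trans (KRing.distribʳ _ 1f 1f) (≈-trans (⊕-cong (KRing.*-identityˡ _) (KRing.*-identityˡ _))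
    (≈-trans (⊕-congʳ neg) (KRing.-‿inverseˡ _))))
  where
  u' : AllPairs _≢_ (map s xs)
  u' = AllPairsₚ.map⁺ (Data.List.Relation.Unary.AllPairs.map (λ {x} {y} ne e → ne (trans (sym (invol x)) (trans (cong s e) (invol y)))) u)
  neg : Σv g xs ≈ ⊝ Σv g xs
  neg = ≈-trans (Σv-unique g (map s xs) u u' (λ {x} m → subst (_∈ map s xs) (invol x) (Memₚ.∈-map⁺ s (st m)))
      (λ m → let (z , zm , e) = Memₚ.∈-map⁻ s m in subst (_∈ xs) (sym e) (st zm)))
    (≈-trans (≡⇒≈ (Σv-map g s xs)) (Σv-neg g (g ∘ s) odd))

-- The component H_T and the (anti)symmetry of its sum

-- `sgn` is the axial distance of consecutive entries with equal labels: 1 in a row for T₁, -1 in a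
-- column for T_det. The equation `β sgn ≈ ε` ties the shape of the filling to the sign of the
-- invariance.
module Component (lam : List ℕ) (τ-valid : Valid lam (reverse (tauLam lam))) (T : Filling) (f : Factor)
  (ε : K) (ε² : ε ⊛ ε ≈ 1f) (Val-ε : Val 1 ε)
  (ε-lin : ∀ n c → n ≢ ℤ.+ 0 → ∃[ n' ] ∃[ c' ] (n' ≢ ℤ.+ 0 × 1f ⊕ ε ⊛ lin n c ≈ lin n' c'))
  (sep : Separates T) (t : List ℕ) (t-valid : Valid lam t) (t-desc : Desc (LT T t))
  (t-key : HasKey (reverse t , replicate (sum lam) 0) (level lam 0))
  (sgn : ℤ) (sgn-unit : sgn ≡ ℤ.+ 1 ⊎ sgn ≡ -[1+ 0 ]) (β-sgn : β sgn ≈ ε)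
  (tie-dd : ∀ q → suc q < sum lam → idx0 (LT T t) q ≡ idx0 (LT T t) (suc q) → dd q t ≡ sgn) where

  open Levels lam τ-valid
  open Weights ε ε² Val-ε ε-lin
  module Ld = Leading lam

  w₀ L : List ℕ
  w₀ = reverse t
  L = LT T t

  D : ℕ
  D = degFilling lam T

  hv : List Vtx
  hv = HT lam T

  rev-w₀ : reverse w₀ ≡ t
  rev-w₀ = Listₚ.reverse-involutive t

  record Orb (v : List ℕ) : Set where
    constructor orb
    field orb-eq : vplus v ≡ L
  open Orb public

  orb-len : ∀ {v} → Orb v → length v ≡ N
  orb-len {v} o = trans (sym (vplus-length v)) (trans (cong length (orb-eq o)) (trans (length-LT T t) (size t-valid)))

  orb-sum : ∀ {v} → Orb v → sum v ≡ D
  orb-sum {v} o = trans (sym (vplus-sum v)) (trans (cong sum (orb-eq o)) (sum-LT-valid T t-valid))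

  orb-good : ∀ {v} → Orb v → Good D (w₀ , v)
  orb-good o = good (subst (Valid lam) (sym rev-w₀) t-valid) (orb-len o) (orb-sum o)

  orb-swap : ∀ {v} p → Orb v → Orb (swap0 v p)
  orb-swap {v} p o = orb (trans (vplus-cong {swap0 v p} {v} (λ c → count-swap0 c v p)) (orb-eq o))

  orb-swap-split : ∀ a y z b → Orb (a ++ y ∷ z ∷ b) → Orb (a ++ z ∷ y ∷ b)
  orb-swap-split a y z b o = subst Orb (swap0-split a y z b) (orb-swap (length a) o)

  level-D : LOK D (level lam D)
  level-D = level-ok D (case N refl)
    where
    case : ∀ n → N ≡ n → D ≡ 0 ⊎ ∃[ n ] N ≡ suc n
    case (suc n) e = inj₂ (n , e)
    case zero e = inj₁ (trans (sym (sum-LT-valid T t-valid)) (cong sum (nil L (trans (length-LT T t) (trans (size t-valid) e)))))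
      where
      nil : ∀ (xs : List ℕ) → length xs ≡ 0 → xs ≡ []
      nil [] _ = refl

  record InHT (u : Vtx) : Set where
    constructor inHT
    field
      ht-ok   : VOK D u
      ht-word : vw u ≡ w₀
      ht-orb  : Orb (vv u)
  open InHT public

  -- The labels of T along the tableau of a vertex equal v⁺, which is decreasing, so
  -- `tableau-unique` identifies the tableau with `t`.
  hv⇒ : ∀ {u} → u ∈ hv → InHT u
  hv⇒ {u} m with Memₚ.∈-filter⁻ (Data.Bool.T? ∘ (λ u → labelOK T (vkey u))) {xs = level lam D} m
  ... | um , lab = inHT ok word (orb (trans vp (cong (λ s → LT T s) rw)))
    where
    ok : VOK D u
    ok = All.lookup (all-ok level-D) um
    T⇒≡ : ∀ {b} → Data.Bool.T b → b ≡ true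
    T⇒≡ {true} _ = refl
    vp : vplus (vv u) ≡ LT T (reverse (vw u))
    vp = labelOK⇒ T (vw u) (vv u) (word-len (key-ok ok)) (T⇒≡ lab)
    rw : reverse (vw u) ≡ t
    rw = tableau-unique {T} sep (word-ok (key-ok ok)) t-valid (subst Desc vp (vplus-Desc (vv u))) t-desc
    word : vw u ≡ w₀
    word = trans (sym (Listₚ.reverse-involutive (vw u))) (cong reverse rw)

  key-eq : ∀ {u} → InHT u → vkey u ≡ (w₀ , vv u)
  key-eq h = cong (_, _) (ht-word h)

  orb⇒hv : ∀ {v} → Orb v → ∃[ u ] (u ∈ hv × vkey u ≡ (w₀ , v))
  orb⇒hv {v} o with find-key (complete t-key D v (orb-len o) (orb-sum o))
  ... | u , um , e = u , Memₚ.∈-filter⁺ (Data.Bool.T? ∘ (λ u → labelOK T (vkey u))) um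
        (subst Data.Bool.T (sym (trans (cong (labelOK T) e) (⇒labelOK T w₀ v (trans (orb-eq o) (cong (LT T) (sym rev-w₀)))))) tt) , e

  tie-label : ∀ {v U y q R} → Orb v → label v ≡ U ++ (y , q) ∷ (y , suc q) ∷ R → dd q t ≡ sgn
  tie-label {v} {U} {y} {q} {R} o e = tie-dd q (subst (suc q ℕ.<_) (orb-len o) (label-range {U = U ++ (y , q) ∷ []} (shift-label {U = U} e)))
    (trans (rank (Memₚ.∈-++⁺ʳ U (here refl))) (sym (rank (Memₚ.∈-++⁺ʳ U (there (here refl))))))
    where
    rank : ∀ {x q} → (x , q) ∈ U ++ (y , _) ∷ (y , _) ∷ R → idx0 L q ≡ x
    rank {x} {q} m = let (lo , hi) = All.lookup (LabOK-range (label v) (LabOK-label v)) (subst ((x , q) ∈_) (sym e) m) in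
      trans (cong (λ s → idx0 s q) (sym (orb-eq o))) (Desc-rank (vplus v) (vplus-Desc v)
        (subst (ℕ._≤ q) (trans (cong (gtc x) (label-vals v)) (sym (vplus-gtc x v))) lo)
        (subst (q ℕ.<_) (trans (cong (gec x) (label-vals v)) (sym (vplus-gec x v))) hi))

  Jv : List ℕ → Fun
  Jv v = Ĵ w₀ v

  wt : List ℕ → K
  wt v = weight t (label v)

  -- Equal entries of v sit in neighbouring boxes of `t`, so the edge leads to ∅ and J (s ⊗ s + g) =
  -- 0. Here g is minus the inverse of the axial distance, that is -ε.
  J-tie : ∀ a y b → Orb (a ++ y ∷ y ∷ b) → T̂ (length a) (Jv (a ++ y ∷ y ∷ b)) ≐ ε · Jv (a ++ y ∷ y ∷ b)
  J-tie a y b o with label-split₂ a y y b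
  ... | U , q , q' , R , e , refl , refl with label-tie {U = U} e
  ... | refl = pointwise λ {m} {s} l v → ≈-trans (KS.solve 3 (λ x g j → x KS.:= (x KS.:+ g KS.:* j) KS.:+ (KS.:- g) KS.:* j) ≈-refl (T̂ p J₀ m s) g (J₀ m s))
      (≈-trans (⊕-cong (on null-eq l v) (⊛-congʳ g≈)) (KRing.+-identityˡ _))
    where
    p : ℕ
    p = length (vals U)
    vv₀ : List ℕ
    vv₀ = vals U ++ y ∷ y ∷ vals R
    J₀ : Fun
    J₀ = Jv vv₀
    g : K
    g = gapAt w₀ vv₀ (suc p)
    d≡ : dd q (reverse w₀) ≡ sgn
    d≡ = trans (cong (dd q) rev-w₀) (tie-label {U = U} o e)
    unit : dd q (reverse w₀) ≡ ℤ.+ 1 ⊎ dd q (reverse w₀) ≡ -[1+ 0 ]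
    unit = Data.Sum.map (trans d≡) (trans d≡) sgn-unit
    tg : Target (reverse w₀) q nothing
    tg = null (subst (suc q ℕ.<_) (orb-len o) (label-range {U = U ++ (y , q) ∷ []} (shift-label {U = U} e))) unit
    null-eq : S p g J₀ ≐ 𝟎
    null-eq = Ĵ-tie (vals U) y (vals R) q (orb-good o) (U , R , e , refl , refl) tg
    g≈ : ⊝ g ≈ ε
    g≈ = ≈-trans (⊝-cong (≈-trans (≡⇒≈ (trans (cong (λ n → gapAt w₀ vv₀ (suc n)) (Listₚ.length-map proj₁ U)) (gapAt-label {w₀} {vv₀} {U} (word-len (orb-good o)) e))) (gapK-dd (reverse w₀) q y (Target-dd tg))))
      (≈-trans (KS.solve 1 (λ b → KS.:- (KS.:- b) KS.:= b) ≈-refl (β (dd q (reverse w₀)))) (≈-trans (≡⇒≈ (cong β d≡)) β-sgn))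

  -- What the pair at a rising edge needs, with δ kept abstract. `δ-def` recovers its formula from
  -- any labelled splitting, for comparison with the factor computed along the edge.
  record RiseData (a : List ℕ) (y z : ℕ) (b : List ℕ) : Set where
    constructor riseData
    field
      δ     : K
      δ-ok  : Slope δ
      wt≈   : wt (a ++ z ∷ y ∷ b) ≈ hh δ ⊛ wt (a ++ y ∷ z ∷ b)
      g     : K
      g-δ   : g ⊛ δ ≈ ⊝ 1f
      J≐    : S (length a) g (Jv (a ++ y ∷ z ∷ b)) ≐ Jv (a ++ z ∷ y ∷ b)
      δ-def : ∀ {U q q' R} → label (a ++ y ∷ z ∷ b) ≡ U ++ (y , q) ∷ (z , q') ∷ R → vals U ≡ a → δ ≡ zE t (y , q) ⊖ᶠ zE t (z , q')
  open RiseData public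

  rise-data : ∀ a y z b → Orb (a ++ y ∷ z ∷ b) → y < z → RiseData a y z b
  rise-data a y z b o y<z with label-split₂ a y z b
  ... | U , q , q' , R , e , refl , refl = riseData δ₀ sl
      (≈-trans (≡⇒≈ (cong (weight t) (label-swap {U = U} e refl refl (ℕₚ.<⇒≢ y<z)))) (≈-trans (weight-swap t U (y , q) (z , q') R y<z) (⊛-congˡ (≡⇒≈ (cong (weight t) (sym e))))))
      (gapAt w₀ v (suc (length (vals U)))) g-δ₀ (Ĵ-rise (vals U) y z (vals R) (orb-good o) y<z) (λ {U'} {q₁} {q₂} {R'} e' vU' → same U' q₁ q₂ R' (trans (sym e) e') (trans (sym (Listₚ.length-map proj₁ U)) (trans (cong length (sym vU')) (Listₚ.length-map proj₁ U'))))
    where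
    v : List ℕ
    v = vals U ++ y ∷ z ∷ vals R
    δ₀ : K
    δ₀ = zE t (y , q) ⊖ᶠ zE t (z , q')
    sl : Slope δ₀
    sl = slope-zE t q' q (ℕₚ.<⇒≢ y<z ∘ sym)
    g₀≡ : gapAt w₀ v (suc (length (vals U))) ≡ gapK (zE t (y , q)) (zE t (z , q'))
    g₀≡ = trans (cong (λ n → gapAt w₀ v (suc n)) (Listₚ.length-map proj₁ U)) (trans (gapAt-label {w₀} {v} {U} (word-len (orb-good o)) e) (cong₂ gapK (cong (λ s → zE s (y , q)) rev-w₀) (cong (λ s → zE s (z , q')) rev-w₀)))
    g-δ₀ : gapAt w₀ v (suc (length (vals U))) ⊛ δ₀ ≈ ⊝ 1f
    g-δ₀ = ≈-trans (⊛-congʳ (≡⇒≈ g₀≡)) (≈-trans (KS.solve 3 (λ i a b → i KS.:* (a KS.:- b) KS.:= KS.:- (i KS.:* (b KS.:- a))) ≈-refl (gapK (zE t (y , q)) (zE t (z , q'))) (zE t (y , q)) (zE t (z , q')))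
      (⊝-cong (inv-left (zE-apart-val t q q' (ℕₚ.<⇒≢ y<z)))))
    same : ∀ U' q₁ q₂ R' → U ++ (y , q) ∷ (z , q') ∷ R ≡ U' ++ (y , q₁) ∷ (z , q₂) ∷ R' → length U ≡ length U' → δ₀ ≡ zE t (y , q₁) ⊖ᶠ zE t (z , q₂)
    same U' q₁ q₂ R' h l with go U U' h l
      where
      go : ∀ U U' → U ++ (y , q) ∷ (z , q') ∷ R ≡ U' ++ (y , q₁) ∷ (z , q₂) ∷ R' → length U ≡ length U' → q ≡ q₁ × q' ≡ q₂
      go [] [] h l = cong proj₂ (Listₚ.∷-injectiveˡ h) , cong proj₂ (Listₚ.∷-injectiveˡ (Listₚ.∷-injectiveʳ h))
      go (_ ∷ U) (_ ∷ U') h l = go U U' (Listₚ.∷-injectiveʳ h) (ℕₚ.suc-injective l)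
    ... | refl , refl = refl

  F : List ℕ → Fun
  F v = wt v · Jv v

  T-scale : ∀ p c g → T̂ p (c · g) ≐ c · T̂ p g
  T-scale p c g = pointwise λ {m} {s} l v → KS.solve 5 (λ b k c x y → b KS.:* (c KS.:* x) KS.:+ k KS.:* (c KS.:* y) KS.:= c KS.:* (b KS.:* x KS.:+ k KS.:* y)) ≈-refl
    (β (dd p s)) (κ (dd p s)) c (g (swap0 m p) s) (g (swap0 m p) (swap0 s p))

  -- The failure of one summand to be ε-invariant. It changes sign when the entries of v at
  -- positions p and p + 1 are exchanged, so the failures cancel over all rearrangements.
  defect : ℕ → List ℕ → List ℕ → List ℕ → K
  defect p m s v = T̂ p (F v) m s ⊖ᶠ ε ⊛ F v m s

  module _ {p : ℕ} (lt : suc p < N) {m s : List ℕ} (l : OfLen m) (vs : Valid lam s) where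

    defect-rise : ∀ a y z b → length a ≡ p → Orb (a ++ y ∷ z ∷ b) → y < z → defect p m s (a ++ y ∷ z ∷ b) ⊕ defect p m s (a ++ z ∷ y ∷ b) ≈ 0f
    defect-rise a y z b refl o y<z = ≈-trans (⊕-cong
        (⊖ᶠ-cong (on (T-scale p (wt v) (Jv v)) l vs) ≈-refl)
        (⊖ᶠ-cong (≈-trans (on (T-scale p (wt v') (Jv v')) l vs) (⊛-congˡ (≈-trans (on (T-cong lt (≐-sym (J≐ rd))) l vs) (≈-trans (on (T-linear p (T̂ p (Jv v)) (g rd) (Jv v)) l vs) (⊕-congʳ (on (T-invol (Jv v) lt) l vs))))))
          (⊛-congˡ (⊛-congˡ (on (≐-sym (J≐ rd)) l vs)))))
      (pair-identity (δ-ok rd) (g-δ rd) (wt≈ rd))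
      where
      v v' : List ℕ
      v = a ++ y ∷ z ∷ b
      v' = a ++ z ∷ y ∷ b
      rd : RiseData a y z b
      rd = rise-data a y z b o y<z

    opp : ∀ {x y} → x ⊕ y ≈ 0f → y ≈ ⊝ x
    opp {x} {y} e = ≈-trans (KS.solve 2 (λ x y → y KS.:= (x KS.:+ y) KS.:+ KS.:- x) ≈-refl x y) (≈-trans (⊕-congʳ e) (KRing.+-identityˡ _))

    defect-odd : ∀ {v} → Orb v → defect p m s (swap0 v p) ≈ ⊝ defect p m s v
    defect-odd {v} o with split₂ v p (subst (suc p ℕ.<_) (sym (orb-len o)) lt)
    ... | a , y , z , b , refl , refl = ≈-trans (≡⇒≈ (cong (defect p m s) (swap0-split a y z b))) (cmp (ℕₚ.<-cmp y z))
      where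
      cmp : Tri (y < z) (y ≡ z) (z < y) → defect p m s (a ++ z ∷ y ∷ b) ≈ ⊝ defect p m s (a ++ y ∷ z ∷ b)
      cmp (tri< y<z _ _) = opp (defect-rise a y z b refl o y<z)
      cmp (tri> _ _ z<y) = opp (≈-trans (KRing.+-comm _ _) (defect-rise a z y b refl (orb-swap-split a y z b o) z<y))
      cmp (tri≈ _ refl _) = ≈-trans zero-defect (≈-sym (⊝-zero zero-defect))
        where
        zero-defect : defect p m s (a ++ y ∷ y ∷ b) ≈ 0f
        zero-defect = ≈⇒⊖ᶠ-zero (≈-trans (on (T-scale p (wt (a ++ y ∷ y ∷ b)) (Jv (a ++ y ∷ y ∷ b))) l vs) (≈-trans (⊛-congˡ (on (J-tie a y b o) l vs))
          (KS.solve 3 (λ w e j → w KS.:* (e KS.:* j) KS.:= e KS.:* (w KS.:* j)) ≈-refl (wt (a ++ y ∷ y ∷ b)) ε (Jv (a ++ y ∷ y ∷ b) m s))))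

  sumF : List (List ℕ) → Fun
  sumF vs m s = Σv (λ v → F v m s) vs

  Enumerates : List (List ℕ) → Set
  Enumerates vs = AllPairs _≢_ vs × (∀ {v} → v ∈ vs → Orb v) × (∀ {v} → Orb v → v ∈ vs)

  sumF-equivariant : ∀ {vs} → Enumerates vs → ∀ p → suc p < N → T̂ p (sumF vs) ≐ ε · sumF vs
  sumF-equivariant {vs} (u , o , c) p lt = pointwise λ {m} {s} l v → ⊖ᶠ-zero⇒≈ (≈-trans (collect m s vs)
      (Σv-odd (defect p m s) (λ v → swap0 v p) u (λ v → swap0-invol v p) (λ xm → c (orb-swap p (o xm))) (λ xm → defect-odd lt l v (o xm))))
    where
    collect : ∀ m s vs → T̂ p (sumF vs) m s ⊖ᶠ ε ⊛ sumF vs m s ≈ Σv (defect p m s) vs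
    collect m s [] = ≈⇒⊖ᶠ-zero (≈-trans (⊕-zero (KRing.zeroʳ _) (KRing.zeroʳ _)) (≈-sym (KRing.zeroʳ ε)))
    collect m s (v ∷ vs) = ≈-trans (KS.solve 8 (λ b k e x y x' y' z → ((b KS.:* (x KS.:+ y) KS.:+ k KS.:* (x' KS.:+ y')) KS.:- z) KS.:= ((b KS.:* x KS.:+ k KS.:* x') KS.:+ (b KS.:* y KS.:+ k KS.:* y')) KS.:- z) ≈-refl
        (β (dd p s)) (κ (dd p s)) ε (F v (swap0 m p) s) (sumF vs (swap0 m p) s) (F v (swap0 m p) (swap0 s p)) (sumF vs (swap0 m p) (swap0 s p)) (ε ⊛ (F v m s ⊕ sumF vs m s)))
      (≈-trans (KS.solve 5 (λ a b e x y → (a KS.:+ b) KS.:- e KS.:* (x KS.:+ y) KS.:= (a KS.:- e KS.:* x) KS.:+ (b KS.:- e KS.:* y)) ≈-refl (T̂ p (F v) m s) (T̂ p (sumF vs) m s) ε (F v m s) (sumF vs m s))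
      (⊕-congˡ (collect m s vs)))

  lead-Jv : ∀ {v} → Orb v → Ld.Lead v (Jv v)
  lead-Jv {v} o = subst (λ x → Ld.Lead x (Jv v)) (label-vals v) (Ld.lead-J (sum v) (label v) (subst (Valid lam) (sym rev-w₀) t-valid) (total-label v) (trans (length-label v) (orb-len o)))

  Σv-small : ∀ {m s} a → m ≡ a → Valid lam s → ∀ vs → (∀ {v} → v ∈ vs → Orb v × v ≢ a) → Val 0 (Σv (λ v → F v m s) vs)
  Σv-small a e vs [] h = Val-0 {0}
  Σv-small {m} {s} a refl vs (v ∷ xs) h = Val-⊕ {0} (Val-⊛ {0} (Val-weight t (label v)) (Ld.small (lead-Jv (proj₁ (h (here refl)))) (proj₂ (h (here refl)) ∘ sym) vs)) (Σv-small a refl vs xs (h ∘ there))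

  -- Only the coefficients at the monomial x^a matter. All summands other than that of `a` are small
  -- there at infinity, and the weight of `a` is 1, so a vanishing sum would make the leading part
  -- of `Jv a` small.
  sumF-nonzero : ∀ {vs a} → Enumerates vs → Orb a → AllPairs _≤_ a → ¬ (sumF vs ≐ 𝟎)
  sumF-nonzero {vs} {a} (u , o , c) oa inc z with Memₚ.∈-∃++ (c oa)
  ... | as , bs , refl = Ld.nonsmall (lead-Jv oa) λ {s} v → Val-resp {0} (one s) (Val-⊕ {0} (Val-resp {0} (≈-trans (≈-sym (on z (ofLen (orb-len oa)) v)) (Σv-split (λ v → F v a s) as a bs)) (Val-0 {0}))
        (Val-⊝ {0} (Σv-small {a} {s} a refl v (as ++ bs) others)))
    where
    one : ∀ s → (F a a s ⊕ Σv (λ v → F v a s) (as ++ bs)) ⊕ ⊝ Σv (λ v → F v a s) (as ++ bs) ≈ Jv a a s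
    one s = ≈-trans (KS.solve 2 (λ x y → (x KS.:+ y) KS.:+ KS.:- y KS.:= x) ≈-refl (F a a s) (Σv (λ v → F v a s) (as ++ bs)))
      (≈-trans (⊛-congʳ (weight-increasing t (label a) (subst (AllPairs _≤_) (sym (label-vals a)) inc))) (KRing.*-identityˡ _))
    others : ∀ {v} → v ∈ as ++ bs → Orb v × v ≢ a
    others {v} m = o (wk (Memₚ.∈-++⁻ as m)) , ne as u m
      where
      wk : v ∈ as ⊎ v ∈ bs → v ∈ as ++ a ∷ bs
      wk (inj₁ x) = Memₚ.∈-++⁺ˡ x
      wk (inj₂ x) = Memₚ.∈-++⁺ʳ as (there x)
      ne : ∀ as → AllPairs _≢_ (as ++ a ∷ bs) → ∀ {v} → v ∈ as ++ bs → v ≢ a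
      ne [] (r ∷ _) m e = All.lookup r m (sym e)
      ne (x ∷ as) (r ∷ _) (here refl) e = All.lookup r (Memₚ.∈-++⁺ʳ as (here refl)) e
      ne (x ∷ as) (_ ∷ u) (there m) e = ne as u m e

  descend : (P : List ℕ → Set) → (∀ a y z b → y < z → Orb (a ++ y ∷ z ∷ b) → P (a ++ z ∷ y ∷ b) → P (a ++ y ∷ z ∷ b)) →
    ∀ v → Orb v → P v → ∃[ a ] (Orb a × AllPairs _≤_ a × P a)
  descend P down v = SortAsc.sort-induction (λ v → Orb v → P v → ∃[ a ] (Orb a × AllPairs _≤_ a × P a))
    (λ v lk o p → v , o , Linked⇒AllPairs ℕₚ.≤-trans (Linked-map (λ {x} {y} → <ᵇ-false⇒ {y} {x}) lk) , p)
    (λ u x y r b ih o p → ih (orb-swap-split u x y r o) (down u y x r (<ᵇ⇒< {y} {x} b) (orb-swap-split u x y r o) p)) v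

  ascend : (P : List ℕ → Set) → (∀ a y z b → y < z → Orb (a ++ y ∷ z ∷ b) → P (a ++ y ∷ z ∷ b) → P (a ++ z ∷ y ∷ b)) →
    ∀ {a} → Orb a → AllPairs _≤_ a → P a → ∀ v → Orb v → P v
  ascend P up' {a} oa inc pa = SortAsc.sort-induction (λ v → Orb v → P v)
    (λ v lk o → subst P (Ordered-unique ℕₚ.≤-antisym inc (Linked⇒AllPairs ℕₚ.≤-trans (Linked-map (λ {x} {y} → <ᵇ-false⇒ {y} {x}) lk))
        (λ c → trans (sym (vplus-count c a)) (trans (cong (count c) (trans (orb-eq oa) (sym (orb-eq o)))) (vplus-count c v)))) pa)
    (λ u x y r b ih o → up' u y x r (<ᵇ⇒< {y} {x} b) (orb-swap-split u x y r o) (ih (orb-swap-split u x y r o)))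

  orb-L : Orb L
  orb-L = orb (vplus-Desc-id t-desc)

  bottom : ∃[ a ] (Orb a × AllPairs _≤_ a)
  bottom = let (a , o , inc , _) = descend (λ _ → ⊤) (λ _ _ _ _ _ _ _ → tt) L orb-L tt in a , o , inc

  just-injective : ∀ {A : Set} {x y : A} → just x ≡ just y → x ≡ y
  just-injective refl = refl

  sgn-small : ∀ k → sgn ≢ ℤ.+ suc (suc k)
  sgn-small k e = go sgn-unit
    where
    go : sgn ≡ ℤ.+ 1 ⊎ sgn ≡ -[1+ 0 ] → ⊥
    go (inj₁ h) with trans (sym h) e
    ... | ()
    go (inj₂ h) with trans (sym h) e
    ... | ()

  data HTEdge (v v' : List ℕ) (p : ℕ) : Set where
    ht-rise : ∀ a y z b → v ≡ a ++ y ∷ z ∷ b → v' ≡ a ++ z ∷ y ∷ b → length a ≡ p → y < z → HTEdge v v' p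

  -- An edge at equal entries would need an axial distance of at least 2, but equal labels are at
  -- distance `sgn`. So only edges between different values remain, and the tableau is constant.
  ht-edge : ∀ {v key p} → Orb v → suc p < N → edge (w₀ , v) (suc p) ≡ just key → HTEdge v (proj₂ key) p × proj₁ key ≡ w₀
  ht-edge {v} {key} {p} o lt h = go (edgeView w₀ v p (orb-good o) lt)
    where
    contr : ∀ {A : Set} {x : A} {P : Set} → nothing ≡ just x → P
    contr ()
    go : EdgeView w₀ v p → HTEdge v (proj₂ key) p × proj₁ key ≡ w₀
    go (rises a y z b e l y<z ed) = ht-rise a y z b e (cong proj₂ k≡) l y<z , cong proj₁ k≡
      where
      k≡ : key ≡ (w₀ , a ++ z ∷ y ∷ b)
      k≡ = just-injective (trans (sym h) ed)
    go (flips a y b q e l (U , R , el , _) sq (k , d) ed) = ⊥-elim (sgn-small k (trans (sym (tie-label {U = U} o el)) (trans (cong (dd q) (sym rev-w₀)) d)))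
    go (none ed) = contr (trans (sym ed) h)

  module Coefficients (factor-spec : ∀ {u u' : Vtx} a y z b → vkey u ≡ (w₀ , a ++ y ∷ z ∷ b) → vkey u' ≡ (w₀ , a ++ z ∷ y ∷ b) →
    (o : Orb (a ++ y ∷ z ∷ b)) (lt : y < z) → f u (suc (length a)) u' ≈ hh (δ (rise-data a y z b o lt))) where

    open LocalNames N f hv

    value-step : ∀ {u u' i} → u ∈ hv → u' ∈ hv → i ∈ steps → edge (vkey u) i ≡ just (vkey u') →
      (wt (vv u') ≈ f u i u' ⊛ wt (vv u)) × f u i u' ≉ 0f
    value-step {u} {u'} {i} um um' im h = go (steps-< im)
      where
      hu : InHT u
      hu = hv⇒ um
      go : ∃[ p ] (i ≡ suc p × suc p < N) → (wt (vv u') ≈ f u i u' ⊛ wt (vv u)) × f u i u' ≉ 0f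
      go (p , refl , lt) = go' (proj₁ (ht-edge (ht-orb hu) lt (trans (cong (λ k → edge k (suc p)) (sym (key-eq hu))) h)))
        where
        go' : HTEdge (vv u) (vv u') p → (wt (vv u') ≈ f u (suc p) u' ⊛ wt (vv u)) × f u (suc p) u' ≉ 0f
        go' (ht-rise a y z b e e' l y<z) =
            ≈-trans (≡⇒≈ (cong wt e')) (≈-trans (wt≈ rd) (⊛-cong (≈-sym f≈) (≡⇒≈ (cong wt (sym e))))) ,
            (λ z → hh≉0 (δ-ok rd) (≈-trans (≈-sym f≈) z))
          where
          o : Orb (a ++ y ∷ z ∷ b)
          o = subst Orb e (ht-orb hu)
          rd : RiseData a y z b
          rd = rise-data a y z b o y<z
          f≈ : f u (suc p) u' ≈ hh (δ rd)
          f≈ = ≈-trans (≡⇒≈ (cong (λ n → f u (suc n) u') (sym l))) (factor-spec a y z b (trans (key-eq hu) (cong (w₀ ,_) e)) (trans (key-eq (hv⇒ um')) (cong (w₀ ,_) e')) o y<z)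

    -- The propagation starts with 1 at whichever source the search returns. Comparing its values
    -- with `wt` only up to a common constant avoids identifying that source with the increasing
    -- rearrangement.
    record AOK (c : K) (ac : Assoc) : Set where
      constructor aok
      field
        a-all  : All (λ p → proj₁ p ∈ hv × proj₂ p ≈ c ⊛ wt (vv (proj₁ p))) ac
        a-dist : AllPairs (λ p q → vkey (proj₁ p) ≢ vkey (proj₁ q)) ac
    open AOK

    findVal-ok : ∀ {c ac t' e} → AOK c ac → t' ∈ hv → findVal N f hv ac t' ≡ just e → e ≈ c ⊛ wt (vv t')
    findVal-ok {c} {ac} {t'} {e} a tm h = go (findVal⇒ ac t' h)
      where
      known-val : ∀ {u e'} → lookupVal (vkey u) ac ≡ just e' → e' ≈ c ⊛ wt (vv u)
      known-val {u} {e'} h with lookupVal⇒ (vkey u) ac h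
      ... | u₀ , m , k = ≈-trans (proj₂ (All.lookup (a-all a) m)) (≡⇒≈ (cong (λ k → c ⊛ wt (proj₂ k)) k))
      go : ∃[ u ] ∃[ i ] (u ∈ hv × i ∈ oneTo (N ∸ 1) × (fwdOf ac t' u i ≡ just e ⊎ bwdOf ac t' u i ≡ just e)) → e ≈ c ⊛ wt (vv t')
      go (u , i , um , im , inj₁ h) = fw (fwd⇒ ac t' u i h)
        where
        fw : ∃[ e' ] (edgeTo (vkey u) i (vkey t') ≡ true × lookupVal (vkey u) ac ≡ just e' × e ≡ f u i t' *K e') → e ≈ c ⊛ wt (vv t')
        fw (e' , ed , lk , eq) = ≈-trans (≡⇒≈ (trans eq (⊛-def (f u i t') e'))) (≈-trans (⊛-congˡ (known-val {u} lk)) (≈-trans (KS.solve 3 (λ f c w → f KS.:* (c KS.:* w) KS.:= c KS.:* (f KS.:* w)) ≈-refl (f u i t') c (wt (vv u)))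
          (⊛-congˡ (≈-sym (proj₁ (value-step um tm im (edgeTo⇒ (vkey u) i (vkey t') ed)))))))
      go (u , i , um , im , inj₂ h) = bw (bwd⇒ ac t' u i h)
        where
        bw : ∃[ e' ] (edgeTo (vkey t') i (vkey u) ≡ true × lookupVal (vkey u) ac ≡ just e' × e ≡ invK (f t' i u) *K e') → e ≈ c ⊛ wt (vv t')
        bw (e' , ed , lk , eq) = ≈-trans (≡⇒≈ (trans eq (trans (⊛-def (invK (f t' i u)) e') (cong (_⊛ e') (inv-def (f t' i u)))))) (≈-trans (⊛-congˡ (≈-trans (known-val {u} lk) (⊛-congˡ (proj₁ vs))))
          (≈-trans (KS.solve 4 (λ i f c w → i KS.:* (c KS.:* (f KS.:* w)) KS.:= (i KS.:* f) KS.:* (c KS.:* w)) ≈-refl (inv (f t' i u)) (f t' i u) c (wt (vv t'))) (≈-trans (⊛-congʳ (inv-left (proj₂ vs))) (KRing.*-identityˡ _))))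
          where
          vs : (wt (vv u) ≈ f t' i u ⊛ wt (vv t')) × f t' i u ≉ 0f
          vs = value-step tm um im (edgeTo⇒ (vkey t') i (vkey u) ed)

    Reachable : Assoc → Vtx → Set
    Reachable ac t' = ∃[ u ] (u ∈ hv × Neighbour t' u × Covers ac (vkey u))

    covers-++ : ∀ {ac k} ex → Covers ac k → Covers (ac ++ ex) k
    covers-++ ex c = Anyₚ.++⁺ˡ c

    record RoundOK (c : K) (ac r : Assoc) (ts : List Vtx) : Set where
      constructor roundOK
      field
        r-ok  : AOK c r
        r-ext : ∃[ ex ] r ≡ ac ++ ex
        r-cov : ∀ {t'} → t' ∈ ts → Reachable ac t' → Covers r (vkey t')
    open RoundOK

    step-ok : ∀ {c} ac₀ {ac t'} → AOK c ac → t' ∈ hv → RoundOK c ac (stepOf ac₀ ac t') (t' ∷ [])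
    step-ok {c} ac₀ {ac} {t'} a tm = go (stepView ac₀ ac t')
      where
      Goal : Assoc → Set
      Goal r = RoundOK c ac r (t' ∷ [])
      go : StepView ac₀ ac t' → Goal (stepOf ac₀ ac t')
      go (known h e) = subst Goal (sym e) (roundOK a ([] , sym (Listₚ.++-identityʳ ac)) (λ { (here refl) _ → let (u , m , k) = lookupVal⇒ (vkey t') ac h in Any.map (λ { refl → k }) m }))
      go (added {e'} h h' e) = subst Goal (sym e) (roundOK (aok (Allₚ.++⁺ (a-all a) ((tm , findVal-ok a tm h') ∷ [])) (AllPairs-snoc (a-dist a) (lookup-nothing (vkey t') ac h)))
        (_ , refl) (λ { (here refl) _ → Anyₚ.++⁺ʳ ac (here refl) }))
      go (stuck h e) = subst Goal (sym e) (roundOK a ([] , sym (Listₚ.++-identityʳ ac)) (λ { (here refl) (u , um , nb , cv) → ⊥-elim (contr (trans (sym h) (proj₂ (⇒findVal ac t' u um nb cv)))) }))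
        where
        contr : ∀ {A : Set} {x : A} → nothing ≡ just x → ⊥
        contr ()

    fold-ok : ∀ {c} ac₀ {ac} ts → (∀ {t'} → t' ∈ ts → t' ∈ hv) → AOK c ac → RoundOK c ac (foldl (stepOf ac₀) ac ts) ts
    fold-ok ac₀ {ac} [] sub a = roundOK a ([] , sym (Listₚ.++-identityʳ ac)) (λ ())
    fold-ok {c} ac₀ {ac} (t' ∷ ts) sub a = combine (step-ok ac₀ a (sub (here refl)))
      where
      combine : RoundOK c ac (stepOf ac₀ ac t') (t' ∷ []) → RoundOK c ac (foldl (stepOf ac₀) ac (t' ∷ ts)) (t' ∷ ts)
      combine s with fold-ok ac₀ ts (sub ∘ there) (r-ok s) | r-ext s
      ... | s' | ex , e with r-ext s'
      ... | ex' , e' = roundOK (r-ok s') (ex ++ ex' , trans e' (trans (cong (_++ ex') e) (Listₚ.++-assoc ac ex ex')))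
            (λ { (here refl) rc → subst (λ z → Covers z (vkey t')) (sym e') (covers-++ ex' (r-cov s (here refl) rc))
               ; (there m) (u , um , nb , cv) → r-cov s' m (u , um , nb , subst (λ z → Covers z (vkey u)) (sym e) (covers-++ ex cv)) })

    propRound-ok : ∀ {c ac} → AOK c ac → RoundOK c ac (propRound N f hv ac) hv
    propRound-ok {c} {ac} a = fold-ok ac hv id a

    Stable : Assoc → Set
    Stable ac = ∀ {t'} → t' ∈ hv → Reachable ac t' → Covers ac (vkey t')

    propFuel-fix : ∀ n {ac} → propRound N f hv ac ≡ ac → propFuel N f hv n ac ≡ ac
    propFuel-fix zero e = refl
    propFuel-fix (suc n) e = trans (cong (propFuel N f hv n) e) (propFuel-fix n e)

    propFuel-ok : ∀ {c ac} n → AOK c ac → AOK c (propFuel N f hv n ac) × (∃[ ex ] propFuel N f hv n ac ≡ ac ++ ex) × (Stable (propFuel N f hv n ac) ⊎ n + length ac ≤ length (propFuel N f hv n ac))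
    propFuel-ok {c} {ac} zero a = a , ([] , sym (Listₚ.++-identityʳ ac)) , inj₂ ℕₚ.≤-refl
    propFuel-ok {c} {ac} (suc n) a = go (propRound-ok a)
      where
      Goal : Set
      Goal = AOK c (propFuel N f hv (suc n) ac) × (∃[ ex ] propFuel N f hv (suc n) ac ≡ ac ++ ex) × (Stable (propFuel N f hv (suc n) ac) ⊎ suc n + length ac ≤ length (propFuel N f hv (suc n) ac))
      grow : ∀ {x xs r} → r ≡ ac ++ x ∷ xs → suc (length ac) ≤ length r
      grow {x} {xs} e = subst (suc (length ac) ℕ.≤_) (sym (trans (cong length e) (trans (Listₚ.length-++ ac) (ℕₚ.+-suc (length ac) (length xs))))) (s≤s (ℕₚ.m≤m+n _ _))
      go : RoundOK c ac (propRound N f hv ac) hv → Goal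
      go s = go' (propFuel-ok n (r-ok s)) (r-ext s)
        where
        go' : AOK c (propFuel N f hv n (propRound N f hv ac)) × (∃[ ex ] propFuel N f hv n (propRound N f hv ac) ≡ propRound N f hv ac ++ ex) × (Stable (propFuel N f hv n (propRound N f hv ac)) ⊎ n + length (propRound N f hv ac) ≤ length (propFuel N f hv n (propRound N f hv ac))) →
          (∃[ ex ] propRound N f hv ac ≡ ac ++ ex) → Goal
        go' (a' , (ex' , e') , alt) (ex , e) = a' , (ex ++ ex' , trans e' (trans (cong (_++ ex') e) (Listₚ.++-assoc ac ex ex'))) , final ex e alt
          where
          final : ∀ ex → propRound N f hv ac ≡ ac ++ ex → _ → Stable (propFuel N f hv (suc n) ac) ⊎ suc n + length ac ≤ length (propFuel N f hv (suc n) ac)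
          final [] e alt = inj₁ (subst Stable (sym (propFuel-fix (suc n) fix)) (λ {t'} m rc → subst (λ z → Covers z (vkey t')) fix (r-cov s m rc)))
            where
            fix : propRound N f hv ac ≡ ac
            fix = trans e (Listₚ.++-identityʳ ac)
          final (x ∷ xs) e (inj₁ st) = inj₁ st
          final (x ∷ xs) e (inj₂ le) = inj₂ (ℕₚ.≤-trans (ℕₚ.≤-trans (ℕₚ.≤-reflexive (sym (ℕₚ.+-suc n (length ac)))) (ℕₚ.+-monoʳ-≤ n (grow e))) le)

    -- The target of an edge of H_T has a larger entry directly before a smaller one, so no edge
    -- enters the vertex of the increasing rearrangement.
    source-exists : ∃[ s ] (s ∈ hv × sourceOf N hv ≡ just s)
    source-exists = go bottom
      where
      go : ∃[ a ] (Orb a × AllPairs _≤_ a) → ∃[ s ] (s ∈ hv × sourceOf N hv ≡ just s)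
      go (a , o , inc) = go' (orb⇒hv o)
        where
        go' : ∃[ u ] (u ∈ hv × vkey u ≡ (w₀ , a)) → ∃[ s ] (s ∈ hv × sourceOf N hv ≡ just s)
        go' (s₀ , sm , k) = sourceOf-just N hv hv sm no-in
          where
          no-edge : ∀ {u i} → u ∈ hv → ∃[ p ] (i ≡ suc p × suc p < N) → edge (vkey u) i ≡ just (vkey s₀) → ⊥
          no-edge {u} um (p , refl , lt) h = bad' (proj₁ (ht-edge (ht-orb (hv⇒ um)) lt (trans (cong (λ k → edge k (suc p)) (sym (key-eq (hv⇒ um)))) (trans h (cong just k)))))
            where
            bad' : HTEdge (vv u) a p → ⊥
            bad' (ht-rise a' y z b _ refl _ y<z) = ℕₚ.<⇒≱ y<z (apart-from a' inc (here refl))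
          no-in : ∀ {u i} → u ∈ hv → i ∈ oneTo (N ∸ 1) → edgeTo (vkey u) i (vkey s₀) ≡ false
          no-in {u} {i} um im with edgeTo (vkey u) i (vkey s₀) in eq
          ... | false = refl
          ... | true = ⊥-elim (no-edge um (steps-< im) (edgeTo⇒ (vkey u) i (vkey s₀) eq))

    s₀ : Vtx
    s₀ = proj₁ source-exists

    c₀ : K
    c₀ = inv (wt (vv s₀))

    c₀≉0 : c₀ ≉ 0f
    c₀≉0 = inv-nonzero (weight-nonzero t (label (vv s₀)))

    cs : Assoc
    cs = propFuel N f hv (length hv) ((s₀ , 1K) ∷ [])

    coeffs≡ : coeffs lam f T ≡ cs
    coeffs≡ = coeffs-just lam f T (proj₂ (proj₂ source-exists))

    start-aok : AOK c₀ ((s₀ , 1K) ∷ [])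
    start-aok = aok ((proj₁ (proj₂ source-exists) , ≈-trans (≡⇒≈ 1f-def) (≈-sym (inv-left (weight-nonzero t (label (vv s₀)))))) ∷ []) ([] ∷ [])

    cs-ok : AOK c₀ cs
    cs-ok = proj₁ (propFuel-ok (length hv) start-aok)

    cs-stable : Stable cs
    cs-stable = go (proj₂ (proj₂ (propFuel-ok (length hv) start-aok)))
      where
      keys : ∀ {ac} → AOK c₀ ac → length ac ≤ length hv
      keys {ac} a = subst₂ ℕ._≤_ (Listₚ.length-map (vkey ∘ proj₁) ac) (Listₚ.length-map vkey hv)
        (unique-length (map vkey hv) (AllPairsₚ.map⁺ (a-dist a)) (λ m → let (p , pm , e) = Memₚ.∈-map⁻ (vkey ∘ proj₁) m in subst (_∈ map vkey hv) (sym e) (Memₚ.∈-map⁺ vkey (proj₁ (All.lookup (a-all a) pm)))))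
      go : Stable cs ⊎ length hv + 1 ≤ length cs → Stable cs
      go (inj₁ st) = st
      go (inj₂ le) = ⊥-elim (ℕₚ.<⇒≱ (ℕₚ.≤-trans (ℕₚ.≤-reflexive (ℕₚ.+-comm 1 (length hv))) le) (keys cs-ok))

    -- Coverage spreads along edges in both directions: backwards from the source to the increasing
    -- rearrangement, then forwards from there to any `v`.
    covered : ∀ v → Orb v → Covers cs (w₀ , v)
    covered v o = go (descend C down (vv s₀) (ht-orb hs) base-cov)
      where
      C : List ℕ → Set
      C v = Covers cs (w₀ , v)
      hs : InHT s₀
      hs = hv⇒ (proj₁ (proj₂ source-exists))
      base-cov : C (vv s₀)
      base-cov = subst (λ z → Covers z (w₀ , vv s₀)) (sym (proj₂ (proj₁ (proj₂ (propFuel-ok (length hv) start-aok))))) (here (key-eq hs))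
      nbr : ∀ a y z b → y < z → Orb (a ++ y ∷ z ∷ b) → ∃[ i ] (i ∈ oneTo (N ∸ 1) × edgeTo (w₀ , a ++ y ∷ z ∷ b) i (w₀ , a ++ z ∷ y ∷ b) ≡ true)
      nbr a y z b y<z o = suc (length a) , <-steps (pos-in a y z b (orb-len o)) , ⇒edgeTo (w₀ , a ++ y ∷ z ∷ b) (suc (length a)) (w₀ , a ++ z ∷ y ∷ b) (rise-edge w₀ a y z b y<z)
      move-cov : ∀ {v v'} → Orb v → Orb v' → (∃[ i ] (i ∈ oneTo (N ∸ 1) × (edgeTo (w₀ , v') i (w₀ , v) ≡ true ⊎ edgeTo (w₀ , v) i (w₀ , v') ≡ true))) → C v' → C v
      move-cov {v} {v'} ov ov' (i , im , ed) cv = go' (orb⇒hv ov) (orb⇒hv ov')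
        where
        go' : ∃[ u ] (u ∈ hv × vkey u ≡ (w₀ , v)) → ∃[ u ] (u ∈ hv × vkey u ≡ (w₀ , v')) → C v
        go' (u , um , k) (u' , um' , k') = subst (Covers cs) k (cs-stable um (u' , um' ,
          (i , im , subst₂ (λ x y → edgeTo y i x ≡ true ⊎ edgeTo x i y ≡ true) (sym k) (sym k') ed) , subst (Covers cs) (sym k') cv))
      down : ∀ a y z b → y < z → Orb (a ++ y ∷ z ∷ b) → C (a ++ z ∷ y ∷ b) → C (a ++ y ∷ z ∷ b)
      down a y z b y<z o cv = let (i , im , e) = nbr a y z b y<z o in move-cov o (orb-swap-split a y z b o) (i , im , inj₂ e) cv
      up' : ∀ a y z b → y < z → Orb (a ++ y ∷ z ∷ b) → C (a ++ y ∷ z ∷ b) → C (a ++ z ∷ y ∷ b)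
      up' a y z b y<z o cv = let (i , im , e) = nbr a y z b y<z o in move-cov (orb-swap-split a y z b o) o (i , im , inj₁ e) cv
      go : ∃[ a ] (Orb a × AllPairs _≤_ a × C a) → C v
      go (a , oa , inc , ca) = ascend C up' oa inc ca v o

    vs : List (List ℕ)
    vs = map (vv ∘ proj₁) cs

    vs-enumerates : Enumerates vs
    vs-enumerates = AllPairs-map (vv ∘ proj₁) (λ {x} {y} p q ne e → ne (trans (key-eq (hv⇒ (proj₁ p))) (trans (cong (w₀ ,_) e) (sym (key-eq (hv⇒ (proj₁ q))))))) (a-all cs-ok) (a-dist cs-ok)
      , (λ m → let (p , pm , e) = Memₚ.∈-map⁻ (vv ∘ proj₁) m in subst Orb (sym e) (ht-orb (hv⇒ (proj₁ (All.lookup (a-all cs-ok) pm)))))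
      , (λ {v} o → in-vs (covered v o))
      where
      in-vs : ∀ {v ac} → Covers ac (w₀ , v) → v ∈ map (vv ∘ proj₁) ac
      in-vs (here e) = here (sym (cong proj₂ e))
      in-vs (there m) = there (in-vs m)

    J-expand : ∀ {ac} → All (λ p → proj₁ p ∈ hv × proj₂ p ≈ c₀ ⊛ wt (vv (proj₁ p))) ac →
      fn (concatMap (λ p → scaleM (proj₂ p) (vJ (proj₁ p))) ac) ≐ c₀ · sumF (map (vv ∘ proj₁) ac)
    J-expand {[]} [] = pointwise λ _ _ → ≈-sym (KRing.zeroʳ c₀)
    J-expand {(u , e) ∷ ac} ((um , e≈) ∷ h) = ≐-trans (fn-++ (scaleM e (vJ u)) (concatMap (λ p → scaleM (proj₂ p) (vJ (proj₁ p))) ac)) (pointwise λ {m} {s} l v →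
      ≈-trans (⊕-cong (≈-trans (on (fn-scaleM e (vJ u)) l v) (⊛-cong e≈ (≈-trans (on (J-fn (ht-ok hu)) l v) (≡⇒≈ (cong (λ w → Ĵ w (vv u) m s) (ht-word hu)))))) (on (J-expand h) l v))
        (KS.solve 4 (λ c w j r → (c KS.:* w) KS.:* j KS.:+ c KS.:* r KS.:= c KS.:* (w KS.:* j KS.:+ r)) ≈-refl c₀ (wt (vv u)) (Jv (vv u) m s) (sumF (map (vv ∘ proj₁) ac) m s)))
      where
      hu : InHT u
      hu = hv⇒ um

    JT-InD : InD D (JTwith lam f T)
    JT-InD = subst (λ z → InD D (concatMap (λ p → scaleM (proj₂ p) (vJ (proj₁ p))) z)) (sym coeffs≡) (go (a-all cs-ok))
      where
      go : ∀ {ac} → All (λ p → proj₁ p ∈ hv × proj₂ p ≈ c₀ ⊛ wt (vv (proj₁ p))) ac → InD D (concatMap (λ p → scaleM (proj₂ p) (vJ (proj₁ p))) ac)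
      go [] = []
      go {(u , e) ∷ ac} ((um , _) ∷ h) = Allₚ.++⁺ (scaleM-InD e (J-in (ht-ok (hv⇒ um)))) (go h)

    JT-fn : fn (JTwith lam f T) ≐ c₀ · sumF vs
    JT-fn = ≐-trans (≡⇒≐ (cong (λ z → fn (concatMap (λ p → scaleM (proj₂ p) (vJ (proj₁ p))) z)) coeffs≡)) (J-expand (a-all cs-ok))

    JT-equivariant : ∀ p → suc p < N → T̂ p (fn (JTwith lam f T)) ≐ ε · fn (JTwith lam f T)
    JT-equivariant p lt = ≐-trans (T-cong lt JT-fn) (≐-trans (T-scale p c₀ (sumF vs)) (≐-trans (·-cong ≈-refl (sumF-equivariant vs-enumerates p lt))
      (pointwise λ {m} {s} l v → ≈-trans (KS.solve 3 (λ c e x → c KS.:* (e KS.:* x) KS.:= e KS.:* (c KS.:* x)) ≈-refl c₀ ε (sumF vs m s)) (⊛-congˡ (≈-sym (on JT-fn l v))))))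

    JT-nonzero : ¬ (fn (JTwith lam f T) ≐ 𝟎)
    JT-nonzero z = let (a , o , inc) = bottom in sumF-nonzero vs-enumerates o inc
      (pointwise λ {m} {s} l v → ⊛-cancelˡ c₀≉0 (≈-trans (≈-sym (on JT-fn l v)) (on z l v)))

-- The tableau τ_λ

column columns : List ℕ → ℕ → ℕ → List ℕ
column lam c k = filterᵇ (λ r → c ≤ᵇ idx0 lam r) (upTo k)
columns lam l c = concatMap (λ c → column lam c l) (oneTo c)

column-suc : ∀ lam c k → column lam c (suc k) ≡ column lam c k ++ (if c ≤ᵇ idx0 lam k then k ∷ [] else [])
column-suc lam c k = trans (cong (filterᵇ (λ r → c ≤ᵇ idx0 lam r)) (sym (Listₚ.upTo-∷ʳ k))) (trans (Listₚ.filter-++ (Data.Bool.T? ∘ (λ r → c ≤ᵇ idx0 lam r)) (upTo k) (k ∷ []))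
  (cong (column lam c k ++_) last-cell))
  where
  last-cell : filterᵇ (λ r → c ≤ᵇ idx0 lam r) (k ∷ []) ≡ (if c ≤ᵇ idx0 lam k then k ∷ [] else [])
  last-cell with c ≤ᵇ idx0 lam k
  ... | true = refl
  ... | false = refl

columns-suc : ∀ lam l c → columns lam l (suc c) ≡ columns lam l c ++ column lam (suc c) l
columns-suc lam l c = trans (cong (concatMap (λ c → column lam c l)) (oneTo-snoc c)) (trans (Listₚ.concatMap-++ (λ c → column lam c l) (oneTo c) (suc c ∷ []))
  (cong (columns lam l c ++_) (Listₚ.++-identityʳ (column lam (suc c) l))))

partition-mono : ∀ lam → IsPartition lam → ∀ r → idx0 lam (suc r) ≤ idx0 lam r
partition-mono [] _ r = z≤n
partition-mono (a ∷ []) _ r = z≤n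
partition-mono (a ∷ b ∷ lam) (_ ∷ ps , le , h) zero = le
partition-mono (a ∷ b ∷ lam) (_ ∷ ps , le , h) (suc r) = partition-mono (b ∷ lam) (ps , h) r

partition-≤ : ∀ lam → IsPartition lam → ∀ r → idx0 lam r ≤ idx0 lam 0
partition-≤ lam pt zero = ℕₚ.≤-refl
partition-≤ lam pt (suc r) = ℕₚ.≤-trans (partition-mono lam pt r) (partition-≤ lam pt r)

-- The cells of the columns 1, …, c and of the first k rows of column c + 1.
record Filled (lam : List ℕ) (c k : ℕ) (t : List ℕ) : Set where
  constructor filled
  field
    f-lattice : Lat (length lam) t
    f-done    : ∀ r → r < k → count r t ≡ idx0 lam r ℕ.⊓ suc c
    f-todo    : ∀ r → k ≤ r → count r t ≡ idx0 lam r ℕ.⊓ c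
    f-bound   : All (_≤ c) (LT Tdet t)
    f-desc    : Desc (LT Tdet t)
open Filled

module _ {lam : List ℕ} (pt : IsPartition lam) where

  filled-cell : ∀ {c k t} → k < length lam → Filled lam c k t → Filled lam c (suc k) (reverse (if suc c ≤ᵇ idx0 lam k then k ∷ [] else []) ++ t)
  filled-cell {c} {k} {t} kl f with suc c ℕ.≤? idx0 lam k
  ... | no nle rewrite ≤ᵇ-false (ℕₚ.≰⇒> nle) = filled (f-lattice f) closed (λ r lt → f-todo f r (ℕₚ.<⇒≤ lt)) (f-bound f) (f-desc f)
    where
    closed : ∀ r → r < suc k → count r t ≡ idx0 lam r ℕ.⊓ suc c
    closed r (s≤s le) with ℕₚ.m≤n⇒m<n∨m≡n le
    ... | inj₁ lt = f-done f r lt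
    ... | inj₂ refl = trans (f-todo f r ℕₚ.≤-refl) (trans (ℕₚ.m≤n⇒m⊓n≡m (ℕₚ.≤-pred (ℕₚ.≰⇒> nle))) (sym (ℕₚ.m≤n⇒m⊓n≡m (ℕₚ.<⇒≤ (ℕₚ.≰⇒> nle)))))
  ... | yes le rewrite ≤ᵇ-true le = filled (kl , step-at k refl , f-lattice f) closed
      (λ r lt → trans (count-diff t (ℕₚ.<⇒≢ lt ∘ sym)) (f-todo f r (ℕₚ.<⇒≤ lt)))
      (ℕₚ.≤-reflexive height ∷ f-bound f) (All.map (λ {x} h → subst (x ℕ.≤_) (sym height) h) (f-bound f) ∷ f-desc f)
    where
    height : count k t ≡ c
    height = trans (f-todo f k ℕₚ.≤-refl) (ℕₚ.m≥n⇒m⊓n≡n (ℕₚ.≤-trans (ℕₚ.n≤1+n c) le))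
    step-at : ∀ j → j ≡ k → Step t j
    step-at zero _ = tt
    step-at (suc j) refl = subst₂ _<_ (sym height) (sym (trans (f-done f j (ℕₚ.n<1+n j)) (ℕₚ.m≥n⇒m⊓n≡n (ℕₚ.≤-trans le (partition-mono lam pt j))))) (ℕₚ.n<1+n c)
    closed : ∀ r → r < suc k → count r (k ∷ t) ≡ idx0 lam r ℕ.⊓ suc c
    closed r (s≤s le') with ℕₚ.m≤n⇒m<n∨m≡n le'
    ... | inj₁ lt = trans (count-diff t (ℕₚ.<⇒≢ lt)) (f-done f r lt)
    ... | inj₂ refl = trans (count-same r t) (trans (cong suc height) (sym (ℕₚ.m≥n⇒m⊓n≡n le)))

  filled-column : ∀ {c t} k → k ≤ length lam → Filled lam c 0 t → Filled lam c k (reverse (column lam (suc c) k) ++ t)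
  filled-column zero le f = f
  filled-column {c} {t} (suc k) le f = subst (Filled lam c (suc k)) (trans (sym (Listₚ.++-assoc (reverse cell) (reverse (column lam (suc c) k)) t))
      (cong (_++ t) (trans (sym (Listₚ.reverse-++ (column lam (suc c) k) cell)) (cong reverse (sym (column-suc lam (suc c) k))))))
    (filled-cell le (filled-column k (ℕₚ.<⇒≤ le) f))
    where
    cell : List ℕ
    cell = if suc c ≤ᵇ idx0 lam k then k ∷ [] else []

  beyond : ∀ (mu : List ℕ) r → length mu ≤ r → idx0 mu r ≡ 0
  beyond [] r le = refl
  beyond (_ ∷ mu) (suc r) (s≤s le) = beyond mu r le

  filled-columns : ∀ c → Filled lam c 0 (reverse (columns lam (length lam) c))
  filled-columns zero = filled tt (λ _ ()) (λ r _ → sym (ℕₚ.⊓-zeroʳ (idx0 lam r))) [] []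
  filled-columns (suc c) = subst (Filled lam (suc c) 0) (trans (sym (Listₚ.reverse-++ (columns lam (length lam) c) (column lam (suc c) (length lam)))) (cong reverse (sym (columns-suc lam (length lam) c))))
      (next (filled-column (length lam) ℕₚ.≤-refl (filled-columns c)))
    where
    next : ∀ {t} → Filled lam c (length lam) t → Filled lam (suc c) 0 t
    next f = filled (f-lattice f) (λ _ ()) counts (All.map (λ h → ℕₚ.≤-trans h (ℕₚ.n≤1+n c)) (f-bound f)) (f-desc f)
      where
      counts : ∀ r → 0 ≤ r → _
      counts r _ with suc r ℕ.≤? length lam
      ... | yes lt = f-done f r lt
      ... | no nlt = trans (f-todo f r out) (trans (cong (ℕ._⊓ c) (beyond lam r out)) (sym (cong (ℕ._⊓ suc c) (beyond lam r out))))
        where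
        out : length lam ≤ r
        out = ℕₚ.≤-pred (ℕₚ.≰⇒> nlt)

  private
    tau-filled : Filled lam (idx0 lam 0) 0 (reverse (tauLam lam))
    tau-filled = filled-columns (idx0 lam 0)

  tau-valid : Valid lam (reverse (tauLam lam))
  tau-valid = isRST⇒Valid lam (tauLam lam) (validFrom-complete lam (replicate (length lam) 0) [] (tauLam lam) (tracks-start lam) (f-lattice tau-filled)
    (record { tlen = refl ; tidx = λ r _ → sym (trans (f-todo tau-filled r z≤n) (ℕₚ.m≤n⇒m⊓n≡m (partition-≤ lam pt r))) }))

  -- τ_λ is filled column by column from the entry N downwards, so its column labels decrease along
  -- 1, ..., N. It is therefore the one tableau of the component of T_det.
  tau-desc : Desc (LT Tdet (reverse (tauLam lam)))
  tau-desc = f-desc tau-filled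

-- Equal labels mean neighbouring boxes

idx0-LT′ : ∀ T u x y r → idx0 (LT T (u ++ x ∷ y ∷ r)) (suc (length u)) ≡ T (suc y) (suc (count y r))
idx0-LT′ T [] x y r = refl
idx0-LT′ T (_ ∷ u) x y r = idx0-LT′ T u x y r

LT-T1 : ∀ t → LT T1 t ≡ t
LT-T1 [] = refl
LT-T1 (x ∷ t) = cong (x ∷_) (LT-T1 t)

module _ {lam t : List ℕ} (v : Valid lam t) (q : ℕ) (lt : suc q < sum lam) where

  private
    lt' : suc q < length t
    lt' = subst (suc q ℕ.<_) (sym (size v)) lt

  tie-T1 : idx0 (LT T1 t) q ≡ idx0 (LT T1 t) (suc q) → dd q t ≡ ℤ.+ 1
  tie-T1 h with split₂ t q lt'
  ... | u , x , y , r , refl , refl with trans (sym (idx0-LT T1 u x (y ∷ r))) (trans h (idx0-LT′ T1 u x y r)) | adj (length lam) x y r (Lat-drop u (lattice v))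
  ... | _ | row _ e = trans (dd-split u x y r) e
  ... | refl | col x≡ _ _ = ⊥-elim (ℕₚ.<⇒≢ (ℕₚ.n<1+n x) x≡)
  ... | refl | fall _ x<x _ _ = ⊥-elim (ℕₚ.<-irrefl refl x<x)
  ... | refl | rise _ x<x _ _ = ⊥-elim (ℕₚ.<-irrefl refl x<x)

  -- Of the four relative positions only `col` has equal columns. In `rise` this uses that the
  -- exchanged word is also a lattice word, which forces the higher row to be strictly shorter.
  tie-Tdet : idx0 (LT Tdet t) q ≡ idx0 (LT Tdet t) (suc q) → dd q t ≡ -[1+ 0 ]
  tie-Tdet h with split₂ t q lt'
  ... | u , x , y , r , refl , refl = go (trans (sym (idx0-LT Tdet u x (y ∷ r))) (trans h (idx0-LT′ Tdet u x y r))) (Lat-drop u (lattice v)) (adj (length lam) x y r (Lat-drop u (lattice v)))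
    where
    go : count x (y ∷ r) ≡ count y r → Lat (length lam) (x ∷ y ∷ r) → Adj (length lam) x y r → dd (length u) (u ++ x ∷ y ∷ r) ≡ -[1+ 0 ]
    go _ _ (col _ _ e) = trans (dd-split u x y r) e
    go h _ (row refl _) = ⊥-elim (ℕₚ.<⇒≢ (ℕₚ.n<1+n (count x r)) (sym (trans (sym (count-same x r)) h)))
    go h (_ , _ , _ , sy , lat) (fall _ x<y _ _) = ⊥-elim (ℕₚ.<⇒≢ (ℕₚ.<-≤-trans (Step-count r lat x<y sy) (count-≤-∷ x y r)) (sym h))
    go h _ (rise _ y<x _ (_ , _ , _ , sx , lat)) = ⊥-elim (ℕₚ.<⇒≢ (Step-count r lat y<x sx) (trans (sym (count-diff r (ℕₚ.<⇒≢ y<x ∘ sym))) h))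

-- The two signs and the factors of 𝓔 and 𝓕

ε₊² : 1f ⊛ 1f ≈ 1f
ε₊² = KRing.*-identityʳ 1f

ε₋² : (⊝ 1f) ⊛ (⊝ 1f) ≈ 1f
ε₋² = ≈-trans (KS.solve 1 (λ o → (KS.:- o) KS.:* (KS.:- o) KS.:= o KS.:* o) ≈-refl 1f) ε₊²

ε₊-lin : ∀ n c → n ≢ ℤ.+ 0 → ∃[ n' ] ∃[ c' ] (n' ≢ ℤ.+ 0 × 1f ⊕ 1f ⊛ lin n c ≈ lin n' c')
ε₊-lin n c nz = n , ℤ.+ 1 ℤ.+ c , nz , ≈-trans (⊕-congˡ (≈-trans (KRing.*-identityˡ _) (≡⇒≈ (lin-def n c))))
  (≈-trans (KS.solve 4 (λ o a n c → o KS.:+ (a KS.:* n KS.:+ c) KS.:= a KS.:* n KS.:+ (o KS.:+ c)) ≈-refl 1f αf (fromZ n) (fromZ c))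
  (≈-trans (⊕-congˡ (≈-trans (⊕-congʳ (≈-sym fromZ-1)) (≈-sym (fromZ-+ (ℤ.+ 1) c)))) (≡⇒≈ (sym (lin-def n (ℤ.+ 1 ℤ.+ c))))))

ε₋-lin : ∀ n c → n ≢ ℤ.+ 0 → ∃[ n' ] ∃[ c' ] (n' ≢ ℤ.+ 0 × 1f ⊕ (⊝ 1f) ⊛ lin n c ≈ lin n' c')
ε₋-lin n c nz = ℤ.- n , ℤ.+ 1 ℤ.- c , nz ∘ ℤₚ.neg-injective , ≈-trans (⊕-congˡ (⊛-congˡ (≡⇒≈ (lin-def n c))))
  (≈-trans (KS.solve 4 (λ o a n c → o KS.:+ (KS.:- o) KS.:* (a KS.:* n KS.:+ c) KS.:= (o KS.:* a) KS.:* (KS.:- n) KS.:+ (o KS.:- (o KS.:* c))) ≈-refl 1f αf (fromZ n) (fromZ c))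
  (≈-trans (⊕-cong (⊛-cong (KRing.*-identityˡ _) (≈-sym (fromZ-neg n))) (≈-trans (⊖ᶠ-cong (≈-sym fromZ-1) (KRing.*-identityˡ _)) (≈-sym (fromZ-sub (ℤ.+ 1) c))))
    (≡⇒≈ (sym (lin-def (ℤ.- n) (ℤ.+ 1 ℤ.- c))))))

private
  ratio : K → K → K
  ratio x y = (x ⊖ᶠ y) ⊛ inv ((x ⊖ᶠ y) ⊕ 1f)

ratio-def : ∀ x y → (x -K y) *K invK ((x -K y) +K 1K) ≡ ratio x y
ratio-def x y = trans (⊛-def (x -K y) (invK ((x -K y) +K 1K))) (cong₂ _⊛_ d≡ (trans (inv-def ((x -K y) +K 1K)) (cong inv (trans (⊕-def (x -K y) 1K) (cong₂ _⊕_ d≡ 1f-def)))))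
  where
  d≡ : x -K y ≡ x ⊖ᶠ y
  d≡ = trans (⊕-def x (-K y)) (cong (x ⊕_) (⊝-def y))

zeta-ratio : ∀ {k w v U y q z q' R} → k ≡ (w , v) → length w ≡ length v → label v ≡ U ++ (y , q) ∷ (z , q') ∷ R →
  ratio (zeta (proj₁ k) (proj₂ k) (suc (length U))) (zeta (proj₁ k) (proj₂ k) (suc (suc (length U)))) ≡ ratio (zE (reverse w) (y , q)) (zE (reverse w) (z , q'))
zeta-ratio {w = w} {v} {U} refl l e = cong₂ ratio (zeta-label {w} {v} {U} l e) (zeta-label′ {w} {v} {U} l e)

factorE-label : ∀ {u w v U y q z q' R} u' → vkey u ≡ (w , v) → length w ≡ length v → label v ≡ U ++ (y , q) ∷ (z , q') ∷ R →
  factorE u (suc (length U)) u' ≡ ratio (zE (reverse w) (y , q)) (zE (reverse w) (z , q'))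
factorE-label {u} {w} {v} {U} u' k l e = trans (ratio-def (zeta (vw u) (vv u) (suc (length U))) (zeta (vw u) (vv u) (suc (suc (length U))))) (zeta-ratio {U = U} k l e)

factorF-label : ∀ {u' w v U y q z q' R} u → vkey u' ≡ (w , v) → length w ≡ length v → label v ≡ U ++ (y , q) ∷ (z , q') ∷ R →
  factorF u (suc (length U)) u' ≡ ⊝ ratio (zE (reverse w) (y , q)) (zE (reverse w) (z , q'))
factorF-label {u'} {w} {v} {U} u k l e = trans (⊝-def _) (cong ⊝_ (trans (ratio-def (zeta (vw u') (vv u') (suc (length U))) (zeta (vw u') (vv u') (suc (suc (length U))))) (zeta-ratio {U = U} k l e)))

factorE-swap : ∀ {u w a y z b U q q' R} u' → vkey u ≡ (w , a ++ y ∷ z ∷ b) → length w ≡ length (a ++ y ∷ z ∷ b) →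
  label (a ++ y ∷ z ∷ b) ≡ U ++ (y , q) ∷ (z , q') ∷ R → vals U ≡ a →
  factorE u (suc (length a)) u' ≈ (zE (reverse w) (y , q) ⊖ᶠ zE (reverse w) (z , q')) ⊛ inv (1f ⊕ 1f ⊛ (zE (reverse w) (y , q) ⊖ᶠ zE (reverse w) (z , q')))
factorE-swap {u} {w} {U = U} u' k l e refl = ≈-trans (≡⇒≈ (trans (cong (λ n → factorE u (suc n) u') (Listₚ.length-map proj₁ U)) (factorE-label {u} {U = U} u' k l e)))
  (⊛-congˡ (inv-cong (≈-trans (KRing.+-comm _ 1f) (⊕-congˡ (≈-sym (KRing.*-identityˡ _))))))

-- `factorF` reads ζ at the target, where the two entries have changed places with their ranks.
-- Written with the labels of the source, the sign in front turns the reversed difference back.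
factorF-swap : ∀ {u' w a y z b U q q' R} u → vkey u' ≡ (w , a ++ z ∷ y ∷ b) → length w ≡ length (a ++ z ∷ y ∷ b) → y ≢ z →
  label (a ++ y ∷ z ∷ b) ≡ U ++ (y , q) ∷ (z , q') ∷ R → vals U ≡ a → vals R ≡ b →
  factorF u (suc (length a)) u' ≈ (zE (reverse w) (y , q) ⊖ᶠ zE (reverse w) (z , q')) ⊛ inv (1f ⊕ (⊝ 1f) ⊛ (zE (reverse w) (y , q) ⊖ᶠ zE (reverse w) (z , q')))
factorF-swap {u'} {w} {y = y} {z} {U = U} {q} {q'} u k l ne e refl refl = ≈-trans (≡⇒≈ (trans (cong (λ n → factorF u (suc n) u') (Listₚ.length-map proj₁ U)) (factorF-label {u'} {U = U} u k l (label-swap {U = U} e refl refl ne))))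
  (≈-trans (⊝-cong (⊛-congˡ (inv-cong dn))) (KS.solve 3 (λ x y i → KS.:- ((y KS.:- x) KS.:* i) KS.:= (x KS.:- y) KS.:* i) ≈-refl
    (zE (reverse w) (y , q)) (zE (reverse w) (z , q')) (inv (1f ⊕ (⊝ 1f) ⊛ (zE (reverse w) (y , q) ⊖ᶠ zE (reverse w) (z , q'))))))
  where
  dn : (zE (reverse w) (z , q') ⊖ᶠ zE (reverse w) (y , q)) ⊕ 1f ≈ 1f ⊕ (⊝ 1f) ⊛ (zE (reverse w) (y , q) ⊖ᶠ zE (reverse w) (z , q'))
  dn = ≈-trans (⊕-congʳ (≈-sym (KRing.*-identityˡ _))) (KS.solve 3 (λ o x y → o KS.:* (y KS.:- x) KS.:+ o KS.:= o KS.:+ (KS.:- o) KS.:* (x KS.:- y)) ≈-refl 1f (zE (reverse w) (y , q)) (zE (reverse w) (z , q')))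

-- From coefficient families back to M_λ: the extremal property

module Membership (lam : List ℕ) where
  open Bridge lam public

  coeffAt-absent : ∀ {P} m w → All (λ t → ¬ (expo t ≡ m × tab t ≡ w)) P → coeffAt P m w ≈ 0f
  coeffAt-absent m w [] = ≈-refl
  coeffAt-absent {term c e s ∷ P} m w (ne ∷ h) = ⊕-zero (≡⇒≈ (miss (Listₚ.≡-dec ℕ._≟_ e m) (Listₚ.≡-dec ℕ._≟_ s w))) (coeffAt-absent m w h)
    where
    miss : Dec (e ≡ m) → Dec (s ≡ w) → term-at (term c e s) m w ≡ 0f
    miss (no ne₁) _ = term-at-miss₁ c {e} {m} s w ne₁
    miss (yes _) (no ne₂) = term-at-miss₂ c e m {s} {w} ne₂
    miss (yes e₁) (yes e₂) = ⊥-elim (ne (e₁ , e₂))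

  InM⇒Tabs : ∀ {P} → InM lam P → Tabs P
  InM⇒Tabs = All.map (λ {t} h → isRST⇒Valid lam (tab t) (proj₂ h))

  InD⇒InM : ∀ {k P} → InD k P → InM lam P
  InD⇒InM = All.map (λ {t} h → exp-len h , Valid⇒isRST lam (tab t) (tab-ok h))

  InD⇒Homogeneous : ∀ {k P} → InD k P → Homogeneous k P
  InD⇒Homogeneous {k} {P} h m w ne = ≈⇒≈K {coeffM P m w} {0K} (≈-trans (coeffM≈ P m w) (≈-trans (coeffAt-absent m w (All.map (λ {t} d (e , _) → ne (trans (cong sum (sym e)) (exp-sum d))) h)) (≡⇒≈ (sym 0f-def))))

  Homogeneous⇒ : ∀ {d P} → Homogeneous d P → ∀ m t → OfLen m → Valid lam t → sum m ≢ d → fn P m t ≈ 0f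
  Homogeneous⇒ {d} {P} h m t _ _ ne = ≈-trans (≈-sym (coeffM≈ P m (reverse t))) (≈-trans (≈K⇒≈ {coeffM P m (reverse t)} {0K} (h m (reverse t) ne)) (≡⇒≈ 0f-def))

  ≈M⇒≐ : ∀ {P Q} → P ≈M Q → fn P ≐ fn Q
  ≈M⇒≐ {P} {Q} h = pointwise λ {m} {t} _ _ → ≈-trans (≈-sym (coeffM≈ P m (reverse t))) (≈-trans (≈K⇒≈ {coeffM P m (reverse t)} {coeffM Q m (reverse t)} (h m (reverse t))) (coeffM≈ Q m (reverse t)))

  -- `≈M` also compares at exponents of wrong length and at words that are not tableaux. There
  -- membership in M_λ leaves no terms on either side.
  ≐⇒≈M : ∀ {P Q} → InM lam P → InM lam Q → fn P ≐ fn Q → P ≈M Q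
  ≐⇒≈M {P} {Q} hP hQ e m w = ≈⇒≈K {coeffM P m w} {coeffM Q m w} (≈-trans (coeffM≈ P m w) (≈-trans (go (length m ℕ.≟ N) (isRST lam w Data.Bool.≟ true)) (≈-sym (coeffM≈ Q m w))))
    where
    outside : ¬ (length m ≡ N × isRST lam w ≡ true) → ∀ {P} → InM lam P → coeffAt P m w ≈ 0f
    outside out h = coeffAt-absent m w (All.map (λ { (l , v) (refl , refl) → out (l , v) }) h)
    both : ¬ (length m ≡ N × isRST lam w ≡ true) → coeffAt P m w ≈ coeffAt Q m w
    both out = ≈-trans (outside out hP) (≈-sym (outside out hQ))
    go : Dec (length m ≡ N) → Dec (isRST lam w ≡ true) → coeffAt P m w ≈ coeffAt Q m w
    go (yes l) (yes v) = ≈-trans (≡⇒≈ (cong (coeffAt P m) (sym (Listₚ.reverse-involutive w)))) (≈-trans (on e (ofLen l) (isRST⇒Valid lam w v)) (≡⇒≈ (cong (coeffAt Q m) (Listₚ.reverse-involutive w))))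
    go (no nl) _ = both (nl ∘ proj₁)
    go (yes _) (no nv) = both (nv ∘ proj₂)

  scaleM-InM : ∀ c {P} → InM lam P → InM lam (scaleM c P)
  scaleM-InM c [] = []
  scaleM-InM c (h ∷ hs) = h ∷ scaleM-InM c hs

  fn-negM : ∀ P → fn (negM P) ≐ (⊝ 1f) · fn P
  fn-negM P = ≐-trans (fn-scaleM (-K 1K) P) (·-cong (≡⇒≈ (trans (⊝-def 1K) (cong ⊝_ 1f-def))) ≐-refl)

  fn-one : ∀ P → fn P ≐ 1f · fn P
  fn-one P = pointwise λ _ _ → ≈-sym (KRing.*-identityˡ _)

  open Vanishing lam using (Equivariant; Reduces; vanish-below; vanish-at)

  -- σ is the identity for the symmetric and negM for the antisymmetric elements.
  module _ {ε : K} (σ : M → M) (fn-σ : ∀ P → fn (σ P) ≐ ε · fn P) where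

    Acts : M → Set
    Acts P = ∀ i → 1 ≤ i → i < sum lam → actS i P ≈M σ P

    Acts⇒Equivariant : ∀ {P} → InM lam P → Acts P → Equivariant ε (fn P)
    Acts⇒Equivariant {P} h s p lt = ≐-trans (≐-sym (actS-fn (InM⇒Tabs h) lt)) (≐-trans (≈M⇒≐ {actS (suc p) P} {σ P} (s (suc p) (s≤s z≤n) lt)) (fn-σ P))

    Equivariant⇒Acts : ∀ {k P} → InD k P → InM lam (σ P) → Equivariant ε (fn P) → Acts P
    Equivariant⇒Acts {k} {P} h hσ e (suc p) _ lt = ≐⇒≈M (InD⇒InM (actS-InD h lt)) hσ (≐-trans (actS-fn (InD⇒Tabs h) lt) (≐-trans (e p lt) (≐-sym (fn-σ P))))

    Extremal : M → ℕ → Set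
    Extremal Q d₀ = (∀ d → d < d₀ → ∀ P → InM lam P → Homogeneous d P → Acts P → P ≈M [])
      × InM lam Q × Homogeneous d₀ Q × Acts Q × ¬ (Q ≈M [])
      × (∀ P → InM lam P → Homogeneous d₀ P → Acts P → ∃[ c ] (P ≈M scaleM c Q))

    module _ {T : Filling} (ε² : ε ⊛ ε ≈ 1f) (red : Reduces ε T) (sep : Separates T) {t : List ℕ} (v : Valid lam t) (ds : Desc (LT T t))
      {Q : M} (Q-in : InD (degFilling lam T) Q) (σQ-in : InM lam (σ Q)) (Q-eq : Equivariant ε (fn Q)) (Q-nz : ¬ (fn Q ≐ 𝟎)) where

      extremal : Extremal Q (degFilling lam T)
      extremal = below , Q-inM , InD⇒Homogeneous Q-in , Equivariant⇒Acts Q-in σQ-in Q-eq , (λ z → Q-nz (≈M⇒≐ {Q} {[]} z)) , spanned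
        where
        Q-inM : InM lam Q
        Q-inM = InD⇒InM Q-in
        below : ∀ d → d < degFilling lam T → ∀ P → InM lam P → Homogeneous d P → Acts P → P ≈M []
        below d lt P h hom s = ≐⇒≈M h [] (vanish-below {ε} {T} ε² red sep (fn P) (Acts⇒Equivariant h s) (Homogeneous⇒ {d} {P} hom) lt)
        -- The coefficient of `Q` that determines an element of this degree; it is nonzero, since
        -- otherwise `vanish-at` would kill `Q`.
        q₀ : K
        q₀ = fn Q (LT T t) t
        q₀≉0 : q₀ ≉ 0f
        q₀≉0 z = Q-nz (vanish-at {ε} {T} ε² red sep (fn Q) Q-eq (Homogeneous⇒ {degFilling lam T} {Q} (InD⇒Homogeneous Q-in)) refl v ds z)
        -- P − c Q vanishes at the one coefficient that determines it.
        spanned : ∀ P → InM lam P → Homogeneous (degFilling lam T) P → Acts P → ∃[ c ] (P ≈M scaleM c Q)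
        spanned P h hom s = c , ≐⇒≈M h (scaleM-InM c Q-inM) (≐-trans (pointwise λ {m} {s} l v → ⊖ᶠ-zero⇒≈ (≈-trans (⊕-congˡ (KS.solve 2 (λ c x → KS.:- (c KS.:* x) KS.:= (KS.:- c) KS.:* x) ≈-refl c (fn Q m s))) (on diff-vanishes l v))) (≐-sym (fn-scaleM c Q)))
          where
          c : K
          c = fn P (LT T t) t ⊛ inv q₀
          diff : Fun
          diff = fn P ⊞ (⊝ c) · fn Q
          diff-eq : Equivariant ε diff
          diff-eq p lt = ≐-trans (T-linear p (fn P) (⊝ c) (fn Q)) (pointwise λ {m} {t} l v → ≈-trans (⊕-cong (on (Acts⇒Equivariant h s p lt) l v) (⊛-congˡ (on (Q-eq p lt) l v)))
            (KS.solve 4 (λ e x c y → e KS.:* x KS.:+ c KS.:* (e KS.:* y) KS.:= e KS.:* (x KS.:+ c KS.:* y)) ≈-refl ε (fn P m t) (⊝ c) (fn Q m t)))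
          diff-vanishes : diff ≐ 𝟎
          diff-vanishes = vanish-at {ε} {T} ε² red sep diff diff-eq (λ m t l v ne → ⊕-zero (Homogeneous⇒ {degFilling lam T} {P} hom m t l v ne) (⊛-zeroʳ (Homogeneous⇒ {degFilling lam T} {Q} (InD⇒Homogeneous Q-in) m t l v ne))) refl v ds
            (≈-trans (KS.solve 3 (λ x i q → x KS.:+ (KS.:- (x KS.:* i)) KS.:* q KS.:= x KS.:- x KS.:* (i KS.:* q)) ≈-refl (fn P (LT T t) t) (inv q₀) q₀)
              (≈⇒⊖ᶠ-zero (≈-sym (≈-trans (⊛-congˡ (inv-left q₀≉0)) (KRing.*-identityʳ _)))))

-- The two fillings T₁ and T_det

-- For T₁ the labels are the row indices themselves, so the tableau of the component is the one with
-- decreasing reversed word, and it must first be reached from τ_λ.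
symmetric : ∀ lam → IsPartition lam → ∃[ d₀ ] Membership.Extremal lam {1f} id (Membership.fn-one lam) (JT lam T1) d₀
symmetric lam pt = degFilling lam T1 , (let (t , v , ds , key) = Levels.sorted-reached lam τ-valid in result v (subst Desc (sym (LT-T1 t)) ds) key)
  where
  open Membership lam
  τ-valid : Valid lam (reverse (tauLam lam))
  τ-valid = tau-valid pt
  module _ {t : List ℕ} (v : Valid lam t) (ds : Desc (LT T1 t)) (key : HasKey (reverse t , replicate (sum lam) 0) (level lam 0)) where
    module C = Component lam τ-valid T1 factorE 1f ε₊² Val-1 ε₊-lin separates-T1 t v ds key (ℤ.+ 1) (inj₁ refl) β-1 (tie-T1 v)

    spec : ∀ {u u' : Vtx} a y z b → vkey u ≡ (reverse t , a ++ y ∷ z ∷ b) → vkey u' ≡ (reverse t , a ++ z ∷ y ∷ b) → (o : C.Orb (a ++ y ∷ z ∷ b)) (lt : y < z) →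
      factorE u (suc (length a)) u' ≈ C.δ (C.rise-data a y z b o lt) ⊛ inv (1f ⊕ 1f ⊛ C.δ (C.rise-data a y z b o lt))
    spec {u} {u'} a y z b k k' o lt = go (label-split₂ a y z b)
      where
      D : K
      D = C.δ (C.rise-data a y z b o lt)
      go : ∃[ U ] ∃[ q ] ∃[ q' ] ∃[ R ] (label (a ++ y ∷ z ∷ b) ≡ U ++ (y , q) ∷ (z , q') ∷ R × vals U ≡ a × vals R ≡ b) → factorE u (suc (length a)) u' ≈ D ⊛ inv (1f ⊕ 1f ⊛ D)
      go (U , q , q' , R , e , eU , eR) = ≈-trans (factorE-swap {u} {reverse t} {a} {y} {z} {b} {U} u' k (trans (Listₚ.length-reverse t) (trans (size v) (sym (C.orb-len o)))) e eU)
        (≡⇒≈ (cong (λ d → d ⊛ inv (1f ⊕ 1f ⊛ d)) (trans (cong₂ _⊖ᶠ_ (cong (λ s → zE s (y , q)) C.rev-w₀) (cong (λ s → zE s (z , q')) C.rev-w₀)) (sym (C.δ-def (C.rise-data a y z b o lt) e eU)))))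
    module F = C.Coefficients (λ {u} {u'} → spec {u} {u'})

    result : Extremal {1f} id fn-one (JT lam T1) (degFilling lam T1)
    result = extremal {1f} id fn-one {T1} ε₊² (Vanishing.reduces₊ lam) separates-T1 v ds {JT lam T1} F.JT-InD (InD⇒InM F.JT-InD) F.JT-equivariant F.JT-nonzero

-- For T_det the tableau of the component is τ_λ itself, the starting vertex of the search.
antisymmetric : ∀ lam → IsPartition lam → ∃[ d₀ ] Membership.Extremal lam {(⊝ 1f)} negM (Membership.fn-negM lam) (J'T lam Tdet) d₀
antisymmetric lam pt = degFilling lam Tdet , result τ-valid (tau-desc pt) (subst (λ w → HasKey (w , replicate (sum lam) 0) (level lam 0)) (sym (Listₚ.reverse-involutive (tauLam lam))) (Levels.start-key lam τ-valid))
  where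
  open Membership lam
  τ-valid : Valid lam (reverse (tauLam lam))
  τ-valid = tau-valid pt
  module _ {t : List ℕ} (v : Valid lam t) (ds : Desc (LT Tdet t)) (key : HasKey (reverse t , replicate (sum lam) 0) (level lam 0)) where
    module C = Component lam τ-valid Tdet factorF (⊝ 1f) ε₋² (Val-⊝ {1} Val-1) ε₋-lin separates-Tdet t v ds key -[1+ 0 ] (inj₂ refl) β--1 (tie-Tdet v)

    spec : ∀ {u u' : Vtx} a y z b → vkey u ≡ (reverse t , a ++ y ∷ z ∷ b) → vkey u' ≡ (reverse t , a ++ z ∷ y ∷ b) → (o : C.Orb (a ++ y ∷ z ∷ b)) (lt : y < z) →
      factorF u (suc (length a)) u' ≈ C.δ (C.rise-data a y z b o lt) ⊛ inv (1f ⊕ (⊝ 1f) ⊛ C.δ (C.rise-data a y z b o lt))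
    spec {u} {u'} a y z b k k' o lt = go (label-split₂ a y z b)
      where
      D : K
      D = C.δ (C.rise-data a y z b o lt)
      go : ∃[ U ] ∃[ q ] ∃[ q' ] ∃[ R ] (label (a ++ y ∷ z ∷ b) ≡ U ++ (y , q) ∷ (z , q') ∷ R × vals U ≡ a × vals R ≡ b) → factorF u (suc (length a)) u' ≈ D ⊛ inv (1f ⊕ (⊝ 1f) ⊛ D)
      go (U , q , q' , R , e , eU , eR) = ≈-trans (factorF-swap {u'} {reverse t} {a} {y} {z} {b} {U} u k' (trans (Listₚ.length-reverse t) (trans (size v) (sym (C.orb-len (C.orb-swap-split a y z b o))))) (ℕₚ.<⇒≢ lt) e eU eR)
        (≡⇒≈ (cong (λ d → d ⊛ inv (1f ⊕ (⊝ 1f) ⊛ d)) (trans (cong₂ _⊖ᶠ_ (cong (λ s → zE s (y , q)) C.rev-w₀) (cong (λ s → zE s (z , q')) C.rev-w₀)) (sym (C.δ-def (C.rise-data a y z b o lt) e eU)))))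
    module F = C.Coefficients (λ {u} {u'} → spec {u} {u'})

    result : Extremal {(⊝ 1f)} negM fn-negM (J'T lam Tdet) (degFilling lam Tdet)
    result = extremal {(⊝ 1f)} negM fn-negM {Tdet} ε₋² (Vanishing.reduces₋ lam) separates-Tdet v ds {J'T lam Tdet} F.JT-InD (scaleM-InM (-K 1K) (InD⇒InM F.JT-InD)) F.JT-equivariant F.JT-nonzero

theorem5p22 : ∀ (lam : List ℕ) → IsPartition lam →
    (∃[ d0 ] ((∀ d → d < d0 → ∀ P → InM lam P → Homogeneous d P → Symmetric (sum lam) P → P ≈M [])
    × InM lam (JT lam T1) × Homogeneous d0 (JT lam T1) × Symmetric (sum lam) (JT lam T1)
    × ¬ (JT lam T1 ≈M [])
    × (∀ P → InM lam P → Homogeneous d0 P → Symmetric (sum lam) P → ∃[ c ] (P ≈M scaleM c (JT lam T1)))))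
    × (∃[ d0 ] ((∀ d → d < d0 → ∀ P → InM lam P → Homogeneous d P → Antisymmetric (sum lam) P → P ≈M [])
    × InM lam (J'T lam Tdet) × Homogeneous d0 (J'T lam Tdet) × Antisymmetric (sum lam) (J'T lam Tdet)
    × ¬ (J'T lam Tdet ≈M [])
    × (∀ P → InM lam P → Homogeneous d0 P → Antisymmetric (sum lam) P → ∃[ c ] (P ≈M scaleM c (J'T lam Tdet)))))
theorem5p22 lam pt = symmetric lam pt , antisymmetric lam pt
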